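{- For every real $\gamma$ with $0<\gamma<\frac{1}{2}$, there exists a constant $C(\gamma)$ such that for every real $X>3$, every prime $q$, and every integer $a$ coprime with $q$, one has $$ \left|E(X,q,a)\right| \leq C(\gamma)\left( \frac{X^{\frac13}(\log\log X)^{\frac73}}{(\log X)^{\frac16-\frac{\gamma}{3}}}+\frac{X(\log\log X)^2}{q(\log X)^{\frac{\gamma}{2}}}\right). $$
   Context: Let $\mu$ be the Möbius function, so $\mu^2$ is the indicator function of squarefree positive integers, and let $\varphi$ be Euler's totient function. For real $X>0$, an integer $q\geq 1$ and an integer $a$ coprime to $q$, define $$ E(X,q,a):=\sum_{\substack{n\leq X\\ n\equiv a \pmod q}}\mu^2(n)-\frac{1}{\varphi(q)}\sum_{\substack{n\leq X\\ (n,q)=1}}\mu^2(n), $$ where $n$ runs over positive integers. -}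

module Defs where

open import Axiom.ExcludedMiddle using (ExcludedMiddle)
open import Data.Bool using (if_then_else_)
open import Data.Integer as ℤ using (ℤ; +_)
open import Data.Integer.Divisibility using () renaming (_∣_ to _∣ℤ_)
open import Data.List using (List; upTo; filter; map; length; foldr)
open import Data.List.Membership.Propositional using (_∈_)
open import Data.List.Membership.Propositional.Properties using (∈-filter⁺; ∈-filter⁻; ∈-map⁺; ∈-map⁻; ∈-upTo⁺)
open import Data.List.Relation.Unary.Any using (any?; here; there)
open import Data.Nat as ℕ using (ℕ; zero; suc; z≤n; s≤s)
open import Data.Nat.Coprimality using (coprime?; 1-coprimeTo)
open import Data.Nat.Divisibility using (_∣?_)
import Data.Nat.Properties as ℕ
open import Data.Nat.Primality using (prime?)
open import Data.Product using (∃; _×_; _,_; proj₁; proj₂)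
open import Data.Rational as ℚ using (ℚ; mkℚ; 0ℚ; 1ℚ; ½)
import Data.Integer.Properties as ℤ
import Data.Rational.Properties as ℚ
import Data.Rational.Solver as ℚSolver
import Data.Rational.Unnormalised as ℚᵘ
import Data.Rational.Unnormalised.Properties as ℚᵘ
open import Data.Sum using (inj₁; inj₂)
open import Function using (_∘_)
open import Level using (0ℓ)
open import Relation.Binary.PropositionalEquality using (_≡_; refl; sym; trans; cong; cong₂; subst; subst₂)
open import Relation.Nullary.Negation using (contradiction)
open import Relation.Nullary.Decidable using (Dec; does; yes; no; _×-dec_)

fromℕ : ℕ → ℚ
fromℕ n = + n ℚ./ 1

recip : ℕ → ℚ
recip k = + 1 ℚ./ suc k

-- Total reciprocal on ℚ; it is applied only to sequences that are eventually bounded away from 0, so inv 0ℚ never affects a limit.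
inv : ℚ → ℚ
inv p with p ℚ.≟ 0ℚ
... | yes _  = 0ℚ
... | no p≢0 = (ℚ.1/ p) {{ℚ.≢-nonZero p≢0}}

IsCauchy : (ℕ → ℚ) → Set
IsCauchy x = ∀ ε → 0ℚ ℚ.< ε → ∃ λ N → ∀ m n → N ℕ.≤ m → N ℕ.≤ n → ℚ.∣ x m ℚ.- x n ∣ ℚ.≤ ε

partialSum : (ℕ → ℚ) → ℕ → ℚ
partialSum t zero    = 0ℚ
partialSum t (suc k) = partialSum t k ℚ.+ t k

expTerm : ℚ → ℕ → ℚ
expTerm p zero    = 1ℚ
expTerm p (suc k) = expTerm p k ℚ.* p ℚ.* recip k

oddPower : ℚ → ℕ → ℚ
oddPower p zero    = p
oddPower p (suc k) = oddPower p k ℚ.* (p ℚ.* p)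

artanhTerm : ℚ → ℕ → ℚ
artanhTerm p k = oddPower p k ℚ.* recip (2 ℕ.* k)

module Sequences where

  open import Data.Rational
  open ℚSolver.+-*-Solver using (solve; _:+_; _:*_; _:-_; :-_; _:=_; con)

  *-mono : ∀ {a b c d} → 0ℚ ≤ a → a ≤ b → 0ℚ ≤ c → c ≤ d → a * c ≤ b * d
  *-mono {a} {b} {c} {d} 0≤a a≤b 0≤c c≤d = ℚ.≤-trans
    (ℚ.*-monoʳ-≤-nonNeg c {{nonNegative 0≤c}} a≤b)
    (ℚ.*-monoˡ-≤-nonNeg b {{nonNegative (ℚ.≤-trans 0≤a a≤b)}} c≤d)

  *-nonneg : ∀ {a b} → 0ℚ ≤ a → 0ℚ ≤ b → 0ℚ ≤ a * b
  *-nonneg {a} {b} 0≤a 0≤b =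
    subst (_≤ a * b) (ℚ.*-zeroˡ 0ℚ) (*-mono ℚ.≤-refl 0≤a ℚ.≤-refl 0≤b)

  *-pos : ∀ {a b} → 0ℚ < a → 0ℚ < b → 0ℚ < a * b
  *-pos {a} {b} 0<a 0<b = ℚ.positive⁻¹ (a * b) {{ℚ.pos*pos⇒pos a {{positive 0<a}} b {{positive 0<b}}}}

  +-nonneg : ∀ {a b} → 0ℚ ≤ a → 0ℚ ≤ b → 0ℚ ≤ a + b
  +-nonneg {a} {b} 0≤a 0≤b = subst (_≤ a + b) (ℚ.+-identityˡ 0ℚ) (ℚ.+-mono-≤ 0≤a 0≤b)

  +-pos : ∀ {a b} → 0ℚ < a → 0ℚ ≤ b → 0ℚ < a + b
  +-pos {a} {b} 0<a 0≤b = subst (_< a + b) (ℚ.+-identityˡ 0ℚ) (ℚ.+-mono-<-≤ 0<a 0≤b)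

  cancel : ∀ {a b} c → 0ℚ < c → a * c ≤ b * c → a ≤ b
  cancel c 0<c = ℚ.*-cancelʳ-≤-pos c {{positive 0<c}}

  0≤1 : 0ℚ ≤ 1ℚ
  0≤1 = ℚ.nonNegative⁻¹ 1ℚ

  0<1 : 0ℚ < 1ℚ
  0<1 = ℚ.positive⁻¹ 1ℚ

  0<½ : 0ℚ < ½
  0<½ = ℚ.positive⁻¹ ½

  0≤diff : ∀ {a b} → a ≤ b → 0ℚ ≤ b - a
  0≤diff {a} {b} a≤b = subst (_≤ b - a) (ℚ.+-inverseʳ a) (ℚ.+-monoˡ-≤ (- a) a≤b)

  diff⁻ : ∀ {a b} → 0ℚ ≤ b - a → a ≤ b
  diff⁻ {a} {b} h = subst₂ _≤_ (ℚ.+-identityˡ a)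
    (solve 2 (λ a b → b :- a :+ a := b) refl a b) (ℚ.+-monoˡ-≤ a h)

  p≤∣p∣ : ∀ p → p ≤ ∣ p ∣
  p≤∣p∣ p with ℚ.≤-total 0ℚ p
  ... | inj₁ 0≤p = ℚ.≤-reflexive (sym (ℚ.0≤p⇒∣p∣≡p 0≤p))
  ... | inj₂ p≤0 = ℚ.≤-trans p≤0 (ℚ.0≤∣p∣ p)

  -p≤∣p∣ : ∀ p → - p ≤ ∣ p ∣
  -p≤∣p∣ p = subst (- p ≤_) (ℚ.∣-p∣≡∣p∣ p) (p≤∣p∣ (- p))

  ∣∣≤ : ∀ {p b} → p ≤ b → - p ≤ b → ∣ p ∣ ≤ b
  ∣∣≤ {p} p≤b -p≤b with ℚ.∣p∣≡p∨∣p∣≡-p p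
  ... | inj₁ e = subst (_≤ _) (sym e) p≤b
  ... | inj₂ e = subst (_≤ _) (sym e) -p≤b

  ∣*∣≤ : ∀ {p q a b} → ∣ p ∣ ≤ a → ∣ q ∣ ≤ b → ∣ p * q ∣ ≤ a * b
  ∣*∣≤ {p} {q} h k = subst (_≤ _) (sym (ℚ.∣p*q∣≡∣p∣*∣q∣ p q))
    (*-mono (ℚ.0≤∣p∣ p) h (ℚ.0≤∣p∣ q) k)

  ∣+∣≤ : ∀ {p q a b} → ∣ p ∣ ≤ a → ∣ q ∣ ≤ b → ∣ p + q ∣ ≤ a + b
  ∣+∣≤ {p} {q} h k = ℚ.≤-trans (ℚ.∣p+q∣≤∣p∣+∣q∣ p q) (ℚ.+-mono-≤ h k)

  ∣-∣-sym : ∀ p q → ∣ p - q ∣ ≡ ∣ q - p ∣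
  ∣-∣-sym p q = trans (cong ∣_∣ (solve 2 (λ p q → p :- q := :- (q :- p)) refl p q)) (ℚ.∣-p∣≡∣p∣ (q - p))

  lower : ∀ {p q ε} → ∣ p - q ∣ ≤ ε → q - ε ≤ p
  lower {p} {q} {ε} h = diff⁻ (subst (0ℚ ≤_)
    (solve 3 (λ p q ε → ε :- (q :- p) := p :- (q :- ε)) refl p q ε)
    (0≤diff (ℚ.≤-trans (p≤∣p∣ (q - p)) (subst (_≤ ε) (∣-∣-sym p q) h))))

  toℚᵘ-fromℕ : ∀ n → toℚᵘ (fromℕ n) ℚᵘ.≃ ℚᵘ.mkℚᵘ (+ n) 0
  toℚᵘ-fromℕ n = ℚ.toℚᵘ-fromℚᵘ (ℚᵘ.mkℚᵘ (+ n) 0)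

  fromℕ-mono : ∀ {m n} → m ℕ.≤ n → fromℕ m ≤ fromℕ n
  fromℕ-mono {m} {n} m≤n = ℚ.toℚᵘ-cancel-≤ (ℚᵘ.≤-respʳ-≃ (ℚᵘ.≃-sym (toℚᵘ-fromℕ n))
    (ℚᵘ.≤-respˡ-≃ (ℚᵘ.≃-sym (toℚᵘ-fromℕ m))
      (ℚᵘ.*≤* (ℤ.*-monoʳ-≤-nonNeg (+ 1) (ℤ.+≤+ m≤n)))))

  fromℕ-cancel : ∀ {m n} → fromℕ m ≤ fromℕ n → m ℕ.≤ n
  fromℕ-cancel {m} {n} h with ℚᵘ.≤-respʳ-≃ (toℚᵘ-fromℕ n) (ℚᵘ.≤-respˡ-≃ (toℚᵘ-fromℕ m) (ℚ.toℚᵘ-mono-≤ h))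
  ... | ℚᵘ.*≤* k = ℤ.drop‿+≤+ (ℤ.*-cancelʳ-≤-pos (+ m) (+ n) (+ 1) k)

  fromℕ-+ : ∀ m n → fromℕ (m ℕ.+ n) ≡ fromℕ m + fromℕ n
  fromℕ-+ m n = ℚ.toℚᵘ-injective (ℚᵘ.≃-trans (toℚᵘ-fromℕ (m ℕ.+ n))
    (ℚᵘ.≃-trans (ℚᵘ.*≡* (cong (ℤ._* + 1) (cong₂ ℤ._+_ (sym (ℤ.*-identityʳ (+ m))) (sym (ℤ.*-identityʳ (+ n))))))
    (ℚᵘ.≃-sym (ℚᵘ.≃-trans (ℚ.toℚᵘ-homo-+ (fromℕ m) (fromℕ n))
      (ℚᵘ.+-cong (toℚᵘ-fromℕ m) (toℚᵘ-fromℕ n))))))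

  0≤fromℕ : ∀ n → 0ℚ ≤ fromℕ n
  0≤fromℕ n = fromℕ-mono {0} {n} z≤n

  0<fromℕ : ∀ n → 0ℚ < fromℕ (suc n)
  0<fromℕ n = ℚ.<-≤-trans 0<1 (fromℕ-mono {1} {suc n} (s≤s z≤n))

  archimedean : ∀ p → ∃ λ n → p ≤ fromℕ n
  archimedean p@(mkℚ i d _) = ℤ.∣ i ∣ , ℚ.toℚᵘ-cancel-≤
    (ℚᵘ.≤-respʳ-≃ (ℚᵘ.≃-sym (toℚᵘ-fromℕ ℤ.∣ i ∣)) (ℚᵘ.*≤* bound))
    where
    i≤∣i∣ : ∀ i → i ℤ.≤ + ℤ.∣ i ∣
    i≤∣i∣ (+ n)        = ℤ.≤-refl
    i≤∣i∣ ℤ.-[1+ n ]   = ℤ.-≤+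
    bound : i ℤ.* + 1 ℤ.≤ + ℤ.∣ i ∣ ℤ.* + suc d
    bound = ℤ.≤-trans (ℤ.≤-reflexive (ℤ.*-identityʳ i)) (ℤ.≤-trans (i≤∣i∣ i)
      (subst (+ ℤ.∣ i ∣ ℤ.≤_) (ℤ.pos-* ℤ.∣ i ∣ (suc d)) (ℤ.+≤+ (ℕ.m≤m*n ℤ.∣ i ∣ (suc d)))))

  recip-inverse : ∀ k → recip k * fromℕ (suc k) ≡ 1ℚ
  recip-inverse k = ℚ.toℚᵘ-injective (ℚᵘ.≃-trans (ℚ.toℚᵘ-homo-* (recip k) (fromℕ (suc k)))
    (ℚᵘ.≃-trans (ℚᵘ.*-cong (ℚ.toℚᵘ-fromℚᵘ (ℚᵘ.mkℚᵘ (+ 1) k)) (toℚᵘ-fromℕ (suc k)))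
    (ℚᵘ.*≡* (trans (ℤ.*-identityʳ _) (cong +_ (trans (ℕ.+-identityʳ (suc k))
      (sym (trans (ℕ.+-identityʳ (suc k ℕ.* 1)) (ℕ.*-identityʳ (suc k))))))))))

  0≤recip : ∀ k → 0ℚ ≤ recip k
  0≤recip k = cancel (fromℕ (suc k)) (0<fromℕ k)
    (subst₂ _≤_ (sym (ℚ.*-zeroˡ (fromℕ (suc k)))) (sym (recip-inverse k)) 0≤1)

  recip-bound : ∀ k {a b} → a ≤ b * fromℕ (suc k) → a * recip k ≤ b
  recip-bound k {a} {b} h = subst (a * recip k ≤_)
    (trans (ℚ.*-assoc b (fromℕ (suc k)) (recip k))
      (trans (cong (b *_) (trans (ℚ.*-comm (fromℕ (suc k)) (recip k)) (recip-inverse k))) (ℚ.*-identityʳ b)))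
    (ℚ.*-monoʳ-≤-nonNeg (recip k) {{nonNegative (0≤recip k)}} h)

  recip≤1 : ∀ k → recip k ≤ 1ℚ
  recip≤1 k = subst (_≤ 1ℚ) (ℚ.*-identityˡ (recip k))
    (recip-bound k (subst (1ℚ ≤_) (sym (ℚ.*-identityˡ (fromℕ (suc k)))) (fromℕ-mono {1} {suc k} (s≤s z≤n))))

  inv-inverse : ∀ {p} → 0ℚ < p → p * inv p ≡ 1ℚ
  inv-inverse {p} 0<p with p ℚ.≟ 0ℚ
  ... | yes refl = contradiction 0<p (ℚ.<-irrefl refl)
  ... | no p≢0 = ℚ.*-inverseʳ p {{≢-nonZero p≢0}}

  0<inv : ∀ {p} → 0ℚ < p → 0ℚ < inv p
  0<inv {p} 0<p = ℚ.*-cancelˡ-<-nonNeg p {{nonNegative (ℚ.<⇒≤ 0<p)}}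
    (subst₂ _<_ (sym (ℚ.*-zeroʳ p)) (sym (inv-inverse 0<p)) 0<1)

  halves : ∀ ε → ½ * ε + ½ * ε ≡ ε
  halves = solve 1 (λ ε → con ½ :* ε :+ con ½ :* ε := ε) refl

  bounded : ∀ {x} → IsCauchy x → ∃ λ M → ∃ λ N → 1ℚ ≤ M × (∀ n → N ℕ.≤ n → ∣ x n ∣ ≤ M)
  bounded {x} cx with cx 1ℚ 0<1
  ... | N , h = ∣ x N ∣ + 1ℚ , N
    , subst (_≤ ∣ x N ∣ + 1ℚ) (ℚ.+-identityˡ 1ℚ) (ℚ.+-monoˡ-≤ 1ℚ (ℚ.0≤∣p∣ (x N)))
    , λ n N≤n → subst (_≤ _) (cong ∣_∣ (solve 2 (λ a b → a :+ (b :- a) := b) refl (x N) (x n)))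
        (∣+∣≤ (ℚ.≤-refl {∣ x N ∣}) (h n N N≤n ℕ.≤-refl))

  const-cauchy : ∀ p → IsCauchy (λ _ → p)
  const-cauchy p ε 0<ε = 0 , λ _ _ _ _ → subst (_≤ ε) (sym (cong ∣_∣ (ℚ.+-inverseʳ p))) (ℚ.<⇒≤ 0<ε)

  +-cauchy : ∀ {x y} → IsCauchy x → IsCauchy y → IsCauchy (λ n → x n + y n)
  +-cauchy {x} {y} cx cy ε 0<ε with cx (½ * ε) (*-pos 0<½ 0<ε) | cy (½ * ε) (*-pos 0<½ 0<ε)
  ... | M , h | N , k = M ℕ.⊔ N , λ m n hm hn → subst₂ _≤_
    (cong ∣_∣ (solve 4 (λ a b c d → (a :- b) :+ (c :- d) := (a :+ c) :- (b :+ d)) refl (x m) (x n) (y m) (y n)))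
    (halves ε)
    (∣+∣≤ (h m n (ℕ.m⊔n≤o⇒m≤o M N hm) (ℕ.m⊔n≤o⇒m≤o M N hn)) (k m n (ℕ.m⊔n≤o⇒n≤o M N hm) (ℕ.m⊔n≤o⇒n≤o M N hn)))

  neg-cauchy : ∀ {x} → IsCauchy x → IsCauchy (λ n → - x n)
  neg-cauchy {x} cx ε 0<ε with cx ε 0<ε
  ... | N , h = N , λ m n hm hn → subst (_≤ ε)
    (cong ∣_∣ (solve 2 (λ a b → a :- b := :- b :- :- a) refl (x n) (x m))) (h n m hn hm)

  lipschitz-cauchy : ∀ {x z} δ N₀ → 0ℚ < δ → IsCauchy x
    → (∀ m n → N₀ ℕ.≤ m → N₀ ℕ.≤ n → ∣ z m - z n ∣ ≤ ∣ x m - x n ∣ * δ) → IsCauchy z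
  lipschitz-cauchy {x} {z} δ N₀ 0<δ cx lip ε 0<ε with cx (ε * inv δ) (*-pos 0<ε (0<inv 0<δ))
  ... | N , h = N₀ ℕ.⊔ N , λ m n hm hn → ℚ.≤-trans
    (lip m n (ℕ.m⊔n≤o⇒m≤o N₀ N hm) (ℕ.m⊔n≤o⇒m≤o N₀ N hn))
    (subst (∣ x m - x n ∣ * δ ≤_)
      (trans (ℚ.*-assoc ε (inv δ) δ) (trans (cong (ε *_) (trans (ℚ.*-comm (inv δ) δ) (inv-inverse 0<δ))) (ℚ.*-identityʳ ε)))
      (ℚ.*-monoʳ-≤-nonNeg δ {{nonNegative (ℚ.<⇒≤ 0<δ)}} (h m n (ℕ.m⊔n≤o⇒n≤o N₀ N hm) (ℕ.m⊔n≤o⇒n≤o N₀ N hn))))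

  mul-split : ∀ a b c d → (a - b) * c + (c - d) * b ≡ a * c - b * d
  mul-split = solve 4 (λ a b c d → (a :- b) :* c :+ (c :- d) :* b := a :* c :- b :* d) refl

  undo : ∀ a {C} → 0ℚ < C → a * inv C * C ≡ a
  undo a {C} 0<C = trans (ℚ.*-assoc a (inv C) C)
    (trans (cong (a *_) (trans (ℚ.*-comm (inv C) C) (inv-inverse 0<C))) (ℚ.*-identityʳ a))

  mul-bound : ∀ a b c d {ε A B} → 0ℚ < A → 0ℚ < B
    → ∣ a - b ∣ ≤ ½ * ε * inv B → ∣ c ∣ ≤ B → ∣ c - d ∣ ≤ ½ * ε * inv A → ∣ b ∣ ≤ A
    → ∣ a * c - b * d ∣ ≤ ε
  mul-bound a b c d {ε} {A} {B} 0<A 0<B h₁ h₂ h₃ h₄ = subst₂ _≤_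
    (cong ∣_∣ (mul-split a b c d)) (halves ε)
    (∣+∣≤ {(a - b) * c} {(c - d) * b} {½ * ε} {½ * ε}
      (subst (∣ (a - b) * c ∣ ≤_) (undo (½ * ε) 0<B) (∣*∣≤ {a - b} {c} {½ * ε * inv B} {B} h₁ h₂))
      (subst (∣ (c - d) * b ∣ ≤_) (undo (½ * ε) 0<A) (∣*∣≤ {c - d} {b} {½ * ε * inv A} {A} h₃ h₄)))

  *-cauchy : ∀ {x y} → IsCauchy x → IsCauchy y → IsCauchy (λ n → x n * y n)
  *-cauchy {x} {y} cx cy ε 0<ε = N , λ m n hm hn →
      mul-bound (x m) (x n) (y m) (y n) 0<A 0<B
        (proj₂ cx′ m n (le₃ hm) (le₃ hn)) (proj₂ (proj₂ (proj₂ by)) m (le₂ hm))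
        (proj₂ cy′ m n (le₄ hm) (le₄ hn)) (proj₂ (proj₂ (proj₂ bx)) n (le₁ hn))
    where
    bx = bounded cx
    by = bounded cy
    A = proj₁ bx
    B = proj₁ by
    0<A : 0ℚ < A
    0<A = ℚ.<-≤-trans 0<1 (proj₁ (proj₂ (proj₂ bx)))
    0<B : 0ℚ < B
    0<B = ℚ.<-≤-trans 0<1 (proj₁ (proj₂ (proj₂ by)))
    cx′ = cx (½ * ε * inv B) (*-pos {½ * ε} {inv B} (*-pos {½} {ε} 0<½ 0<ε) (0<inv 0<B))
    cy′ = cy (½ * ε * inv A) (*-pos {½ * ε} {inv A} (*-pos {½} {ε} 0<½ 0<ε) (0<inv 0<A))
    N₁ = proj₁ (proj₂ bx)
    N₂ = proj₁ (proj₂ by)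
    N₃ = proj₁ cx′
    N₄ = proj₁ cy′
    N = (N₁ ℕ.⊔ N₂) ℕ.⊔ (N₃ ℕ.⊔ N₄)
    le₁ : ∀ {m} → N ℕ.≤ m → N₁ ℕ.≤ m
    le₁ h = ℕ.m⊔n≤o⇒m≤o N₁ N₂ (ℕ.m⊔n≤o⇒m≤o (N₁ ℕ.⊔ N₂) (N₃ ℕ.⊔ N₄) h)
    le₂ : ∀ {m} → N ℕ.≤ m → N₂ ℕ.≤ m
    le₂ h = ℕ.m⊔n≤o⇒n≤o N₁ N₂ (ℕ.m⊔n≤o⇒m≤o (N₁ ℕ.⊔ N₂) (N₃ ℕ.⊔ N₄) h)
    le₃ : ∀ {m} → N ℕ.≤ m → N₃ ℕ.≤ m
    le₃ h = ℕ.m⊔n≤o⇒m≤o N₃ N₄ (ℕ.m⊔n≤o⇒n≤o (N₁ ℕ.⊔ N₂) (N₃ ℕ.⊔ N₄) h)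
    le₄ : ∀ {m} → N ℕ.≤ m → N₄ ℕ.≤ m
    le₄ h = ℕ.m⊔n≤o⇒n≤o N₃ N₄ (ℕ.m⊔n≤o⇒n≤o (N₁ ℕ.⊔ N₂) (N₃ ℕ.⊔ N₄) h)

  inv-cauchy : ∀ {x} ε₀ N₀ → 0ℚ < ε₀ → (∀ n → N₀ ℕ.≤ n → ε₀ ≤ x n) → IsCauchy x → IsCauchy (inv ∘ x)
  inv-cauchy {x} ε₀ N₀ 0<ε₀ low cx = lipschitz-cauchy {x} {inv ∘ x} (inv ε₀ * inv ε₀) N₀
      (*-pos (0<inv 0<ε₀) (0<inv 0<ε₀)) cx
      λ m n hm hn → subst (_≤ ∣ x m - x n ∣ * (inv ε₀ * inv ε₀)) (sym (step (x m) (x n) (x-pos m hm) (x-pos n hn)))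
        (ℚ.*-monoˡ-≤-nonNeg ∣ x m - x n ∣ {{ℚ.∣-∣-nonNeg (x m - x n)}}
          (*-mono (ℚ.<⇒≤ (0<inv (x-pos m hm))) (anti m hm) (ℚ.<⇒≤ (0<inv (x-pos n hn))) (anti n hn)))
    where
    x-pos : ∀ n → N₀ ℕ.≤ n → 0ℚ < x n
    x-pos n hn = ℚ.<-≤-trans 0<ε₀ (low n hn)
    anti : ∀ n → N₀ ℕ.≤ n → inv (x n) ≤ inv ε₀
    anti n hn = cancel (ε₀ * x n) (*-pos 0<ε₀ (x-pos n hn)) (subst₂ _≤_
      (sym (trans (solve 3 (λ i e a → i :* (e :* a) := e :* (a :* i)) refl (inv (x n)) ε₀ (x n))
        (trans (cong (ε₀ *_) (inv-inverse (x-pos n hn))) (ℚ.*-identityʳ ε₀))))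
      (sym (trans (solve 3 (λ i e a → i :* (e :* a) := a :* (e :* i)) refl (inv ε₀) ε₀ (x n))
        (trans (cong (x n *_) (inv-inverse 0<ε₀)) (ℚ.*-identityʳ (x n)))))
      (low n hn))
    step : ∀ a b → 0ℚ < a → 0ℚ < b → ∣ inv a - inv b ∣ ≡ ∣ a - b ∣ * (inv a * inv b)
    step a b 0<a 0<b = trans (cong ∣_∣ eq) (trans (ℚ.∣p*q∣≡∣p∣*∣q∣ (b - a) (inv a * inv b))
      (cong₂ _*_ (∣-∣-sym b a) (ℚ.0≤p⇒∣p∣≡p (*-nonneg (ℚ.<⇒≤ (0<inv 0<a)) (ℚ.<⇒≤ (0<inv 0<b))))))
      where
      eq : inv a - inv b ≡ (b - a) * (inv a * inv b)
      eq = trans (cong₂ _-_ (sym (trans (cong (inv a *_) (inv-inverse 0<b)) (ℚ.*-identityʳ (inv a))))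
                            (sym (trans (cong (inv b *_) (inv-inverse 0<a)) (ℚ.*-identityʳ (inv b)))))
        (solve 4 (λ a b i j → i :* (b :* j) :- j :* (a :* i) := (b :- a) :* (i :* j)) refl a b (inv a) (inv b))

  Uniform : (ℕ → ℕ → ℚ) → Set
  Uniform f = ∀ ε → 0ℚ < ε → ∃ λ N → ∀ m n → N ℕ.≤ m → N ℕ.≤ n → ∣ f m n - f N n ∣ ≤ ε

  three-split : ∀ a b c d → (a - b) + ((b - c) + (c - d)) ≡ a - d
  three-split = solve 4 (λ a b c d → (a :- b) :+ ((b :- c) :+ (c :- d)) := a :- d) refl

  diagonal-cauchy : ∀ (f : ℕ → ℕ → ℚ) → (∀ N → IsCauchy (f N)) → Uniform f → IsCauchy (λ n → f n n)
  diagonal-cauchy f cf uf ε 0<ε = N ℕ.⊔ N′ , λ m n hm hn → subst₂ _≤_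
      (cong ∣_∣ (three-split (f m m) (f N m) (f N n) (f n n)))
      (trans (cong (λ z → ½ * ε + z) (halves (½ * ε))) (halves ε))
      (∣+∣≤ {f m m - f N m} {(f N m - f N n) + (f N n - f n n)} {½ * ε} {½ * (½ * ε) + ½ * (½ * ε)}
        (proj₂ u m m (ℕ.m⊔n≤o⇒m≤o N N′ hm) (ℕ.m⊔n≤o⇒m≤o N N′ hm))
        (∣+∣≤ {f N m - f N n} {f N n - f n n} {½ * (½ * ε)} {½ * (½ * ε)}
          (proj₂ c m n (ℕ.m⊔n≤o⇒n≤o N N′ hm) (ℕ.m⊔n≤o⇒n≤o N N′ hn))
          (near n hn)))
    where
    0<½ε : 0ℚ < ½ * ε
    0<½ε = *-pos {½} {ε} 0<½ 0<ε
    0<¼ε : 0ℚ < ½ * (½ * ε)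
    0<¼ε = *-pos {½} {½ * ε} 0<½ 0<½ε
    ¼ε≤½ε : ½ * (½ * ε) ≤ ½ * ε
    ¼ε≤½ε = subst₂ _≤_ (ℚ.+-identityʳ (½ * (½ * ε))) (halves (½ * ε))
      (ℚ.+-monoʳ-≤ (½ * (½ * ε)) (ℚ.<⇒≤ 0<¼ε))
    u′ = uf (½ * (½ * ε)) 0<¼ε
    N = proj₁ u′
    u : ∃ λ (_ : ℕ) → ∀ m n → N ℕ.≤ m → N ℕ.≤ n → ∣ f m n - f N n ∣ ≤ ½ * ε
    u = N , λ m n hm hn → ℚ.≤-trans (proj₂ u′ m n hm hn) ¼ε≤½ε
    c = cf N (½ * (½ * ε)) 0<¼ε
    N′ = proj₁ c
    near : ∀ n → N ℕ.⊔ N′ ℕ.≤ n → ∣ f N n - f n n ∣ ≤ ½ * (½ * ε)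
    near n hn = subst (_≤ ½ * (½ * ε)) (∣-∣-sym (f n n) (f N n))
      (proj₂ u′ n n (ℕ.m⊔n≤o⇒m≤o N N′ hn) (ℕ.m⊔n≤o⇒m≤o N N′ hn))

  power : ℚ → ℕ → ℚ
  power ρ zero    = 1ℚ
  power ρ (suc k) = power ρ k * ρ

  power-+ : ∀ ρ i j → power ρ (i ℕ.+ j) ≡ power ρ j * power ρ i
  power-+ ρ zero    j = sym (ℚ.*-identityʳ (power ρ j))
  power-+ ρ (suc i) j = trans (cong (_* ρ) (power-+ ρ i j)) (ℚ.*-assoc (power ρ j) (power ρ i) ρ)

  power-nonneg : ∀ {ρ} → 0ℚ ≤ ρ → ∀ k → 0ℚ ≤ power ρ k
  power-nonneg 0≤ρ zero    = 0≤1
  power-nonneg {ρ} 0≤ρ (suc k) = *-nonneg {power ρ k} {ρ} (power-nonneg 0≤ρ k) 0≤ρ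

  record Ratio (ρ δ : ℚ) : Set where
    field
      0≤ρ : 0ℚ ≤ ρ
      ρ≤1 : ρ ≤ 1ℚ
      0≤δ : 0ℚ ≤ δ
      geometric : 1ℚ + ρ * δ ≤ δ

  module Geometric {ρ δ : ℚ} (r : Ratio ρ δ) where
    open Ratio r

    decay-step : ∀ a b c d → a * (b - (1ℚ + c * b)) + a * ((1ℚ + d) * (1ℚ - c)) ≡ a * (b + d) - a * c * (b + (1ℚ + d))
    decay-step = solve 4 (λ a b c d →
      a :* (b :- (con 1ℚ :+ c :* b)) :+ a :* ((con 1ℚ :+ d) :* (con 1ℚ :- c))
        := a :* (b :+ d) :- a :* c :* (b :+ (con 1ℚ :+ d))) refl

    decay : ∀ j → power ρ j * (δ + fromℕ j) ≤ δ
    decay zero    = ℚ.≤-reflexive (trans (ℚ.*-identityˡ (δ + 0ℚ)) (ℚ.+-identityʳ δ))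
    decay (suc j) = ℚ.≤-trans (subst (λ z → power ρ j * ρ * (δ + z) ≤ power ρ j * (δ + fromℕ j)) (sym (fromℕ-+ 1 j))
      (diff⁻ (subst (0ℚ ≤_) (decay-step (power ρ j) δ ρ (fromℕ j))
        (+-nonneg {power ρ j * (δ - (1ℚ + ρ * δ))} {power ρ j * ((1ℚ + fromℕ j) * (1ℚ - ρ))}
          (*-nonneg {power ρ j} {δ - (1ℚ + ρ * δ)} (power-nonneg 0≤ρ j) (0≤diff geometric))
          (*-nonneg {power ρ j} {(1ℚ + fromℕ j) * (1ℚ - ρ)} (power-nonneg 0≤ρ j)
            (*-nonneg {1ℚ + fromℕ j} {1ℚ - ρ} (+-nonneg {1ℚ} {fromℕ j} 0≤1 (0≤fromℕ j)) (0≤diff ρ≤1)))))))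
      (decay j)

    tail-step : ∀ B P c → B * P + B * (P * c) * δ ≡ B * P * (1ℚ + c * δ)
    tail-step B P c = solve 4 (λ B P c δ → B :* P :+ B :* (P :* c) :* δ := B :* P :* (con 1ℚ :+ c :* δ)) refl B P c δ

    regroup : ∀ s t b → (s - b) + t ≡ (s + t) - b
    regroup = solve 3 (λ s t b → (s :- b) :+ t := (s :+ t) :- b) refl

    tail : ∀ u b B → 0ℚ ≤ B → (∀ i → ∣ u (i ℕ.+ b) ∣ ≤ B * power ρ i)
      → ∀ i → ∣ partialSum u (i ℕ.+ b) - partialSum u b ∣ + B * power ρ i * δ ≤ B * δ
    tail u b B 0≤B h zero = ℚ.≤-reflexive (trans
      (cong₂ _+_ (cong ∣_∣ (ℚ.+-inverseʳ (partialSum u b))) (cong (_* δ) (ℚ.*-identityʳ B))) (ℚ.+-identityˡ (B * δ)))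
    tail u b B 0≤B h (suc i) = ℚ.≤-trans
      (ℚ.+-monoˡ-≤ (B * (P * ρ) * δ) (subst (λ z → ∣ z ∣ ≤ ∣ D ∣ + B * P) (regroup (partialSum u (i ℕ.+ b)) (u (i ℕ.+ b)) (partialSum u b))
        (∣+∣≤ {D} {u (i ℕ.+ b)} {∣ D ∣} {B * P} ℚ.≤-refl (h i))))
      (ℚ.≤-trans (ℚ.≤-reflexive (trans (ℚ.+-assoc ∣ D ∣ (B * P) (B * (P * ρ) * δ)) (cong (λ z → ∣ D ∣ + z) (tail-step B P ρ))))
      (ℚ.≤-trans (ℚ.+-monoʳ-≤ ∣ D ∣ (ℚ.*-monoˡ-≤-nonNeg (B * P)
          {{nonNegative (*-nonneg {B} {P} 0≤B (power-nonneg 0≤ρ i))}} geometric))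
        (tail u b B 0≤B h i)))
      where
      P = power ρ i
      D = partialSum u (i ℕ.+ b) - partialSum u b

    tail′ : ∀ u b B → 0ℚ ≤ B → (∀ i → ∣ u (i ℕ.+ b) ∣ ≤ B * power ρ i)
      → ∀ m → b ℕ.≤ m → ∣ partialSum u m - partialSum u b ∣ ≤ B * δ
    tail′ u b B 0≤B h m b≤m = subst (λ z → ∣ partialSum u z - partialSum u b ∣ ≤ B * δ) (ℕ.m∸n+n≡m b≤m)
      (ℚ.≤-trans (subst (_≤ D + E) (ℚ.+-identityʳ D) (ℚ.+-monoʳ-≤ D
        (*-nonneg {B * power ρ i} {δ} (*-nonneg {B} {power ρ i} 0≤B (power-nonneg 0≤ρ i)) 0≤δ)))
        (tail u b B 0≤B h i))
      where
      i = m ℕ.∸ b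
      D = ∣ partialSum u (i ℕ.+ b) - partialSum u b ∣
      E = B * power ρ i * δ

    small-left : ∀ A P J → A * δ * (P * J) ≡ A * P * δ * J
    small-left A P J = solve 4 (λ A P J δ → A :* δ :* (P :* J) := A :* P :* δ :* J) refl A P J δ

    small : ∀ A ε → 0ℚ ≤ A → 0ℚ < ε → ∃ λ J → ∀ n → A * power ρ (J ℕ.+ n) * δ ≤ ε
    small A ε 0≤A 0<ε = suc J , λ n → cancel (fromℕ (suc J ℕ.+ n)) (0<fromℕ (J ℕ.+ n))
      (subst (_≤ ε * fromℕ (suc J ℕ.+ n)) (small-left A (power ρ (suc J ℕ.+ n)) (fromℕ (suc J ℕ.+ n)))
        (ℚ.≤-trans (ℚ.*-monoˡ-≤-nonNeg (A * δ) {{nonNegative 0≤Aδ}} (decay₀ (suc J ℕ.+ n)))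
          (ℚ.≤-trans enough (ℚ.*-monoˡ-≤-nonNeg ε {{nonNegative (ℚ.<⇒≤ 0<ε)}}
            (fromℕ-mono {J} {suc J ℕ.+ n} (ℕ.m≤n⇒m≤1+n (ℕ.m≤m+n J n)))))))
      where
      0≤Aδ : 0ℚ ≤ A * δ
      0≤Aδ = *-nonneg {A} {δ} 0≤A 0≤δ
      J = proj₁ (archimedean (A * δ * δ * inv ε))
      enough : A * δ * δ ≤ ε * fromℕ J
      enough = subst₂ _≤_ (undo (A * δ * δ) 0<ε) (ℚ.*-comm (fromℕ J) ε)
        (ℚ.*-monoʳ-≤-nonNeg ε {{nonNegative (ℚ.<⇒≤ 0<ε)}} (proj₂ (archimedean (A * δ * δ * inv ε))))
      decay₀ : ∀ j → power ρ j * fromℕ j ≤ δ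
      decay₀ j = ℚ.≤-trans (ℚ.*-monoˡ-≤-nonNeg (power ρ j) {{nonNegative (power-nonneg 0≤ρ j)}}
        (subst (_≤ δ + fromℕ j) (ℚ.+-identityˡ (fromℕ j)) (ℚ.+-monoˡ-≤ (fromℕ j) 0≤δ))) (decay j)

    series-cauchy : ∀ (t : ℕ → ℕ → ℚ) → (∀ k → IsCauchy (t k)) → ∀ K n₀ A → 0ℚ ≤ A
      → (∀ k n → n₀ ℕ.≤ n → ∣ t (k ℕ.+ K) n ∣ ≤ A * power ρ k)
      → IsCauchy (λ n → partialSum (λ k → t k n) n)
    series-cauchy t ct K n₀ A 0≤A h = diagonal-cauchy (λ m n → partialSum (λ k → t k n) m) partial λ ε 0<ε →
      let J = proj₁ (small A ε 0≤A 0<ε)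
          j = J ℕ.+ n₀
      in j ℕ.+ K , λ m n hm hn → ℚ.≤-trans
        (tail′ (λ k → t k n) (j ℕ.+ K) (A * power ρ j) (*-nonneg {A} {power ρ j} 0≤A (power-nonneg 0≤ρ j))
          (λ i → subst₂ (λ a b → ∣ t a n ∣ ≤ b) (ℕ.+-assoc i j K)
            (trans (cong (A *_) (power-+ ρ i j)) (sym (ℚ.*-assoc A (power ρ j) (power ρ i))))
            (h (i ℕ.+ j) n (ℕ.≤-trans (ℕ.≤-trans (ℕ.m≤n+m n₀ J) (ℕ.m≤m+n j K)) hn)))
          m hm)
        (proj₂ (small A ε 0≤A 0<ε) n₀)
      where
      partial : ∀ N → IsCauchy (λ n → partialSum (λ k → t k n) N)
      partial zero    = const-cauchy 0ℚ
      partial (suc N) = +-cauchy {λ n → partialSum (λ k → t k n) N} {t N} (partial N) (ct N)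

  halving : Ratio ½ (1ℚ + 1ℚ)
  halving = record
    { 0≤ρ = ℚ.<⇒≤ 0<½
    ; ρ≤1 = *≤* (ℤ.+≤+ (s≤s z≤n))
    ; 0≤δ = ℚ.nonNegative⁻¹ (1ℚ + 1ℚ)
    ; geometric = ℚ.≤-refl
    }

  expTerm-cauchy : ∀ {x} → IsCauchy x → ∀ k → IsCauchy (λ n → expTerm (x n) k)
  expTerm-cauchy cx zero    = const-cauchy 1ℚ
  expTerm-cauchy {x} cx (suc k) = *-cauchy {λ n → expTerm (x n) k * x n} {λ _ → recip k}
    (*-cauchy {λ n → expTerm (x n) k} {x} (expTerm-cauchy cx k) cx) (const-cauchy (recip k))

  expTerm-bound : ∀ p m A → ∣ p ∣ ≤ fromℕ m → ∣ expTerm p (m ℕ.+ m) ∣ ≤ A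
    → ∀ k → ∣ expTerm p (k ℕ.+ (m ℕ.+ m)) ∣ ≤ A * power ½ k
  expTerm-bound p m A hp hA zero    = subst (∣ expTerm p (m ℕ.+ m) ∣ ≤_) (sym (ℚ.*-identityʳ A)) hA
  expTerm-bound p m A hp hA (suc k) = subst₂ _≤_
      (cong ∣_∣ (sym (ℚ.*-assoc T p (recip l)))) (ℚ.*-assoc A (power ½ k) ½)
      (∣*∣≤ {T} {p * recip l} {A * power ½ k} {½} (expTerm-bound p m A hp hA k)
        (subst (_≤ ½) (sym (trans (ℚ.∣p*q∣≡∣p∣*∣q∣ p (recip l)) (cong (∣ p ∣ *_) (ℚ.0≤p⇒∣p∣≡p (0≤recip l)))))
          (recip-bound l {∣ p ∣} {½} (ℚ.≤-trans hp
            (subst (_≤ ½ * fromℕ (suc l))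
              (trans (cong (½ *_) (fromℕ-+ m m)) (trans (ℚ.*-distribˡ-+ ½ (fromℕ m) (fromℕ m)) (halves (fromℕ m))))
              (ℚ.*-monoˡ-≤-nonNeg ½ (fromℕ-mono {m ℕ.+ m} {suc l} (ℕ.m≤n⇒m≤1+n (ℕ.m≤n+m (m ℕ.+ m) k)))))))))
    where
    l = k ℕ.+ (m ℕ.+ m)
    T = expTerm p l

  exp-cauchy : ∀ {x} → IsCauchy x → IsCauchy (λ n → partialSum (expTerm (x n)) n)
  exp-cauchy {x} cx = Geometric.series-cauchy halving (λ k n → expTerm (x n) k) (expTerm-cauchy cx)
      (m ℕ.+ m) (N₁ ℕ.⊔ N₂) A (ℚ.≤-trans 0≤1 (proj₁ (proj₂ (proj₂ bt))))
      λ k n hn → expTerm-bound (x n) m A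
        (ℚ.≤-trans (proj₂ (proj₂ (proj₂ bx)) n (ℕ.m⊔n≤o⇒m≤o N₁ N₂ hn)) (proj₂ (archimedean (proj₁ bx))))
        (proj₂ (proj₂ (proj₂ bt)) n (ℕ.m⊔n≤o⇒n≤o N₁ N₂ hn)) k
    where
    bx = bounded cx
    N₁ = proj₁ (proj₂ bx)
    m = proj₁ (archimedean (proj₁ bx))
    bt = bounded (expTerm-cauchy cx (m ℕ.+ m))
    A = proj₁ bt
    N₂ = proj₁ (proj₂ bt)

  partialSum-nonneg : ∀ u → (∀ k → 0ℚ ≤ u k) → ∀ n → 0ℚ ≤ partialSum u n
  partialSum-nonneg u h zero    = ℚ.≤-refl
  partialSum-nonneg u h (suc n) = +-nonneg {partialSum u n} {u n} (partialSum-nonneg u h n) (h n)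

  partialSum-mono : ∀ u → (∀ k → 0ℚ ≤ u k) → ∀ m n → m ℕ.≤ n → partialSum u m ≤ partialSum u n
  partialSum-mono u h m n m≤n = subst (λ z → partialSum u m ≤ partialSum u z) (ℕ.m∸n+n≡m m≤n) (go (n ℕ.∸ m))
    where
    go : ∀ i → partialSum u m ≤ partialSum u (i ℕ.+ m)
    go zero    = ℚ.≤-refl
    go (suc i) = ℚ.≤-trans (go i) (subst (_≤ partialSum u (suc i ℕ.+ m)) (ℚ.+-identityʳ (partialSum u (i ℕ.+ m)))
      (ℚ.+-monoʳ-≤ (partialSum u (i ℕ.+ m)) (h (i ℕ.+ m))))

  expTerm-nonneg : ∀ {p} → 0ℚ ≤ p → ∀ k → 0ℚ ≤ expTerm p k
  expTerm-nonneg 0≤p zero    = 0≤1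
  expTerm-nonneg {p} 0≤p (suc k) = *-nonneg {expTerm p k * p} {recip k}
    (*-nonneg {expTerm p k} {p} (expTerm-nonneg 0≤p k) 0≤p) (0≤recip k)

  1≤exp : ∀ {p} → 0ℚ ≤ p → ∀ n → 1 ℕ.≤ n → 1ℚ ≤ partialSum (expTerm p) n
  1≤exp {p} 0≤p n 1≤n = partialSum-mono (expTerm p) (expTerm-nonneg 0≤p) 1 n 1≤n

  oddPower-cauchy : ∀ {x} → IsCauchy x → ∀ k → IsCauchy (λ n → oddPower (x n) k)
  oddPower-cauchy cx zero    = cx
  oddPower-cauchy {x} cx (suc k) = *-cauchy {λ n → oddPower (x n) k} {λ n → x n * x n}
    (oddPower-cauchy cx k) (*-cauchy {x} {x} cx cx)

  oddPower-bound : ∀ {p ρ δ} → Ratio ρ δ → ∣ p ∣ ≤ ρ → ∀ k → ∣ oddPower p k ∣ ≤ power ρ k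
  oddPower-bound r h zero    = ℚ.≤-trans h (Ratio.ρ≤1 r)
  oddPower-bound {p} {ρ} r h (suc k) = ∣*∣≤ {oddPower p k} {p * p} {power ρ k} {ρ} (oddPower-bound r h k)
    (subst (∣ p * p ∣ ≤_) (ℚ.*-identityʳ ρ) (∣*∣≤ {p} {p} {ρ} {1ℚ} h (ℚ.≤-trans h (Ratio.ρ≤1 r))))

  artanh-cauchy : ∀ {x ρ δ} → Ratio ρ δ → ∀ N → (∀ n → N ℕ.≤ n → ∣ x n ∣ ≤ ρ) → IsCauchy x
    → IsCauchy (λ n → partialSum (artanhTerm (x n)) n)
  artanh-cauchy {x} {ρ} r N h cx = Geometric.series-cauchy r (λ k n → artanhTerm (x n) k)
    (λ k → *-cauchy {λ n → oddPower (x n) k} {λ _ → recip (2 ℕ.* k)} (oddPower-cauchy cx k) (const-cauchy (recip (2 ℕ.* k))))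
    0 N 1ℚ 0≤1 λ k n hn → subst (λ z → ∣ artanhTerm (x n) z ∣ ≤ 1ℚ * power ρ k) (sym (ℕ.+-identityʳ k))
      (subst (∣ artanhTerm (x n) k ∣ ≤_) (ℚ.*-comm (power ρ k) 1ℚ)
        (∣*∣≤ {oddPower (x n) k} {recip (2 ℕ.* k)} {power ρ k} {1ℚ} (oddPower-bound r (h n hn) k)
          (subst (_≤ 1ℚ) (sym (ℚ.0≤p⇒∣p∣≡p (0≤recip (2 ℕ.* k)))) (recip≤1 (2 ℕ.* k)))))

  oddPower-nonneg : ∀ {p} → 0ℚ ≤ p → ∀ k → 0ℚ ≤ oddPower p k
  oddPower-nonneg 0≤p zero    = 0≤p
  oddPower-nonneg {p} 0≤p (suc k) = *-nonneg {oddPower p k} {p * p} (oddPower-nonneg 0≤p k) (*-nonneg {p} {p} 0≤p 0≤p)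

  artanhTerm-nonneg : ∀ {p} → 0ℚ ≤ p → ∀ k → 0ℚ ≤ artanhTerm p k
  artanhTerm-nonneg {p} 0≤p k = *-nonneg {oddPower p k} {recip (2 ℕ.* k)} (oddPower-nonneg 0≤p k) (0≤recip (2 ℕ.* k))

  two-terms : ℚ → ℚ
  two-terms η = η + η * (η * η) * recip 2

  artanh-lower : ∀ {p η} → 0ℚ ≤ η → η ≤ p → ∀ n → 2 ℕ.≤ n → two-terms η ≤ partialSum (artanhTerm p) n
  artanh-lower {p} {η} 0≤η η≤p n 2≤n = ℚ.≤-trans
    (ℚ.+-mono-≤ {η} {0ℚ + p * recip 0} {η * (η * η) * recip 2} {artanhTerm p 1}
      (subst (η ≤_) (sym (trans (ℚ.+-identityˡ (p * recip 0)) (ℚ.*-identityʳ p))) η≤p)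
      (ℚ.*-monoʳ-≤-nonNeg (recip 2) {{nonNegative (0≤recip 2)}}
        (*-mono {η} {p} {η * η} {p * p} 0≤η η≤p (*-nonneg {η} {η} 0≤η 0≤η) (*-mono {η} {p} {η} {p} 0≤η η≤p 0≤η η≤p))))
    (partialSum-mono (artanhTerm p) (artanhTerm-nonneg (ℚ.≤-trans 0≤η η≤p)) 2 n 2≤n)

  cayley : ℚ → ℚ
  cayley p = (p - 1ℚ) * inv (p + 1ℚ)

  cayley-inverse : ∀ {p} → 0ℚ < p → cayley p * (p + 1ℚ) ≡ p - 1ℚ
  cayley-inverse {p} 0<p = undo (p - 1ℚ) {p + 1ℚ} (+-pos {p} {1ℚ} 0<p 0≤1)

  cayley-cauchy : ∀ {x} ε N → 0ℚ < ε → (∀ n → N ℕ.≤ n → ε ≤ x n) → IsCauchy x → IsCauchy (cayley ∘ x)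
  cayley-cauchy {x} ε N 0<ε h cx = *-cauchy {λ n → x n - 1ℚ} {λ n → inv (x n + 1ℚ)}
    (+-cauchy {x} {λ _ → - 1ℚ} cx (const-cauchy (- 1ℚ)))
    (inv-cauchy {λ n → x n + 1ℚ} ε N 0<ε
      (λ n hn → ℚ.≤-trans (h n hn) (subst (_≤ x n + 1ℚ) (ℚ.+-identityʳ (x n)) (ℚ.+-monoʳ-≤ (x n) 0≤1)))
      (+-cauchy {x} {λ _ → 1ℚ} cx (const-cauchy 1ℚ)))

  module CayleyRatio (ε M : ℚ) (0<ε : 0ℚ < ε) (1≤M : 1ℚ ≤ M) where

    δ ρ : ℚ
    δ = (M + 1ℚ) * (inv ε + 1ℚ)
    ρ = (δ - 1ℚ) * inv δ

    0≤M+1 : 0ℚ ≤ M + 1ℚ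
    0≤M+1 = +-nonneg {M} {1ℚ} (ℚ.≤-trans 0≤1 1≤M) 0≤1

    M+1≤δ : M + 1ℚ ≤ δ
    M+1≤δ = subst (_≤ δ) (ℚ.*-identityʳ (M + 1ℚ)) (ℚ.*-monoˡ-≤-nonNeg (M + 1ℚ) {{nonNegative 0≤M+1}}
      (subst (_≤ inv ε + 1ℚ) (ℚ.+-identityˡ 1ℚ) (ℚ.+-monoˡ-≤ 1ℚ (ℚ.<⇒≤ (0<inv 0<ε)))))

    1≤δ : 1ℚ ≤ δ
    1≤δ = ℚ.≤-trans (subst (_≤ M + 1ℚ) (ℚ.+-identityˡ 1ℚ) (ℚ.+-monoˡ-≤ 1ℚ (ℚ.≤-trans 0≤1 1≤M))) M+1≤δ

    0<δ : 0ℚ < δ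
    0<δ = ℚ.<-≤-trans 0<1 1≤δ

    ρδ : ρ * δ ≡ δ - 1ℚ
    ρδ = undo (δ - 1ℚ) 0<δ

    ratio : Ratio ρ δ
    ratio = record
      { 0≤ρ = *-nonneg {δ - 1ℚ} {inv δ} (0≤diff 1≤δ) (ℚ.<⇒≤ (0<inv 0<δ))
      ; ρ≤1 = cancel δ 0<δ (subst₂ _≤_ (sym ρδ) (sym (ℚ.*-identityˡ δ))
          (subst (δ - 1ℚ ≤_) (ℚ.+-identityʳ δ) (ℚ.+-monoʳ-≤ δ (ℚ.nonPositive⁻¹ (- 1ℚ)))))
      ; 0≤δ = ℚ.<⇒≤ 0<δ
      ; geometric = ℚ.≤-reflexive (trans (cong (λ z → 1ℚ + z) ρδ) (restore δ))
      }
      where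
      restore : ∀ d → 1ℚ + (d - 1ℚ) ≡ d
      restore = solve 1 (λ d → con 1ℚ :+ (d :- con 1ℚ) := d) refl

    module _ {p : ℚ} (ε≤p : ε ≤ p) (p≤M : p ≤ M) where

      0<p : 0ℚ < p
      0<p = ℚ.<-≤-trans 0<ε ε≤p

      0<p+1 : 0ℚ < p + 1ℚ
      0<p+1 = +-pos {p} {1ℚ} 0<p 0≤1

      p+1≤M+1 : p + 1ℚ ≤ M + 1ℚ
      p+1≤M+1 = ℚ.+-monoˡ-≤ 1ℚ p≤M

      p+1≤δ : p + 1ℚ ≤ δ
      p+1≤δ = ℚ.≤-trans p+1≤M+1 M+1≤δ

      p+1≤δp : p + 1ℚ ≤ δ * p
      p+1≤δp = ℚ.≤-trans p+1≤M+1 (ℚ.≤-trans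
        (ℚ.≤-reflexive (sym (undo (M + 1ℚ) 0<ε)))
        (ℚ.≤-trans (ℚ.*-monoʳ-≤-nonNeg ε {{nonNegative (ℚ.<⇒≤ 0<ε)}}
            (ℚ.*-monoˡ-≤-nonNeg (M + 1ℚ) {{nonNegative 0≤M+1}}
              (subst (_≤ inv ε + 1ℚ) (ℚ.+-identityʳ (inv ε)) (ℚ.+-monoʳ-≤ (inv ε) 0≤1))))
          (ℚ.*-monoˡ-≤-nonNeg δ {{nonNegative (ℚ.<⇒≤ 0<δ)}} ε≤p)))

      upper : ∀ d p → (d - (p + 1ℚ)) + d ≡ (d - 1ℚ) * (p + 1ℚ) - (p - 1ℚ) * d
      upper = solve 2 (λ d p → (d :- (p :+ con 1ℚ)) :+ d
        := (d :- con 1ℚ) :* (p :+ con 1ℚ) :- (p :- con 1ℚ) :* d) refl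

      upper′ : ∀ d p → (d * p - (p + 1ℚ)) + d * p ≡ (d - 1ℚ) * (p + 1ℚ) - (- (p - 1ℚ)) * d
      upper′ = solve 2 (λ d p → (d :* p :- (p :+ con 1ℚ)) :+ d :* p
        := (d :- con 1ℚ) :* (p :+ con 1ℚ) :- (:- (p :- con 1ℚ)) :* d) refl

      swap : ∀ a b c → a * b * c ≡ a * c * b
      swap = solve 3 (λ a b c → a :* b :* c := a :* c :* b) refl

      below : ∀ z w → z * (p + 1ℚ) ≡ w → w * δ ≤ (δ - 1ℚ) * (p + 1ℚ) → z ≤ ρ
      below z w e h = cancel δ 0<δ (subst (z * δ ≤_) (sym ρδ) (cancel (p + 1ℚ) 0<p+1
        (subst (_≤ (δ - 1ℚ) * (p + 1ℚ)) (trans (cong (_* δ) (sym e)) (swap z (p + 1ℚ) δ)) h)))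

      cayley-bound : ∣ cayley p ∣ ≤ ρ
      cayley-bound = ∣∣≤
        (below (cayley p) (p - 1ℚ) (cayley-inverse 0<p)
          (diff⁻ (subst (0ℚ ≤_) (upper δ p) (+-nonneg {δ - (p + 1ℚ)} {δ} (0≤diff p+1≤δ) (ℚ.<⇒≤ 0<δ)))))
        (below (- cayley p) (- (p - 1ℚ))
          (trans (sym (ℚ.neg-distribˡ-* (cayley p) (p + 1ℚ))) (cong -_ (cayley-inverse 0<p)))
          (diff⁻ (subst (0ℚ ≤_) (upper′ δ p) (+-nonneg {δ * p - (p + 1ℚ)} {δ * p} (0≤diff p+1≤δp)
            (*-nonneg {δ} {p} (ℚ.<⇒≤ 0<δ) (ℚ.<⇒≤ 0<p))))))

  logSeq : (ℕ → ℚ) → ℕ → ℚ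
  logSeq x n = (1ℚ + 1ℚ) * partialSum (artanhTerm (cayley (x n))) n

  log-cauchy : ∀ {x} ε N → 0ℚ < ε → (∀ n → N ℕ.≤ n → ε ≤ x n) → IsCauchy x → IsCauchy (logSeq x)
  log-cauchy {x} ε N 0<ε h cx = *-cauchy {λ _ → 1ℚ + 1ℚ} {λ n → partialSum (artanhTerm (cayley (x n))) n}
      (const-cauchy (1ℚ + 1ℚ))
      (artanh-cauchy {cayley ∘ x} ratio (N ℕ.⊔ N′)
        (λ n hn → cayley-bound (h n (ℕ.m⊔n≤o⇒m≤o N N′ hn))
          (ℚ.≤-trans (p≤∣p∣ (x n)) (proj₂ (proj₂ (proj₂ b)) n (ℕ.m⊔n≤o⇒n≤o N N′ hn))))
        (cayley-cauchy {x} ε N 0<ε h cx))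
    where
    b = bounded cx
    N′ = proj₁ (proj₂ b)
    open CayleyRatio ε (proj₁ b) 0<ε (proj₁ (proj₂ (proj₂ b)))

  cayley-lower : ∀ {p η} → 0ℚ < p → η * (p + 1ℚ) ≤ p - 1ℚ → η ≤ cayley p
  cayley-lower {p} {η} 0<p h = cancel (p + 1ℚ) (+-pos {p} {1ℚ} 0<p 0≤1)
    (subst (η * (p + 1ℚ) ≤_) (sym (cayley-inverse 0<p)) h)

  log-lower : ∀ {x} η n → 0ℚ ≤ η → 0ℚ < x n → η * (x n + 1ℚ) ≤ x n - 1ℚ → 2 ℕ.≤ n
    → (1ℚ + 1ℚ) * two-terms η ≤ logSeq x n
  log-lower {x} η n 0≤η 0<xn h 2≤n = ℚ.*-monoˡ-≤-nonNeg (1ℚ + 1ℚ)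
    (artanh-lower {cayley (x n)} {η} 0≤η (cayley-lower {x n} {η} 0<xn h) n 2≤n)

-- Real numbers as Cauchy sequences of rationals; equality of reals is
-- x ≤ y together with y ≤ x.

record ℝ : Set where
  constructor mkℝ
  field
    seq    : ℕ → ℚ
    cauchy : IsCauchy seq

open ℝ public

infix 4 _<_ _≤_
infixl 6 _+_ _-_
infixl 7 _*_ _÷_[_]
infix 8 _[_]^_

_<_ : ℝ → ℝ → Set
x < y = ∃ λ ε → 0ℚ ℚ.< ε × ∃ λ N → ∀ n → N ℕ.≤ n → seq x n ℚ.+ ε ℚ.≤ seq y n

_≤_ : ℝ → ℝ → Set
x ≤ y = ∀ ε → 0ℚ ℚ.< ε → ∃ λ N → ∀ n → N ℕ.≤ n → seq x n ℚ.≤ seq y n ℚ.+ ε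

fromℚ : ℚ → ℝ
fromℚ p = mkℝ (λ _ → p) (Sequences.const-cauchy p)

_+_ : ℝ → ℝ → ℝ
x + y = mkℝ (λ n → seq x n ℚ.+ seq y n) (Sequences.+-cauchy {seq x} {seq y} (cauchy x) (cauchy y))

-_ : ℝ → ℝ
- x = mkℝ (λ n → ℚ.- seq x n) (Sequences.neg-cauchy {seq x} (cauchy x))

_-_ : ℝ → ℝ → ℝ
x - y = x + (- y)

_*_ : ℝ → ℝ → ℝ
x * y = mkℝ (λ n → seq x n ℚ.* seq y n) (Sequences.*-cauchy {seq x} {seq y} (cauchy x) (cauchy y))

Positive : ℝ → Set
Positive x = fromℚ 0ℚ < x

module Positivity (x : ℝ) (x>0 : Positive x) where

  gap : ℚ
  gap = proj₁ x>0

  gap>0 : 0ℚ ℚ.< gap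
  gap>0 = proj₁ (proj₂ x>0)

  start : ℕ
  start = proj₁ (proj₂ (proj₂ x>0))

  gap≤ : ∀ n → start ℕ.≤ n → gap ℚ.≤ seq x n
  gap≤ n hn = subst (ℚ._≤ seq x n) (ℚ.+-identityˡ gap) (proj₂ (proj₂ (proj₂ x>0)) n hn)

positive : ∀ {x} ε N → 0ℚ ℚ.< ε → (∀ n → N ℕ.≤ n → ε ℚ.≤ seq x n) → Positive x
positive {x} ε N ε>0 h = ε , ε>0 , N , λ n hn → subst (ℚ._≤ seq x n) (sym (ℚ.+-identityˡ ε)) (h n hn)

_÷_[_] : ℝ → (y : ℝ) → Positive y → ℝ
x ÷ y [ y>0 ] = x * mkℝ (inv ∘ seq y) (Sequences.inv-cauchy {seq y} gap start gap>0 gap≤ (cauchy y))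
  where open Positivity y y>0

-- exp x = Σ xᵏ / k!
exp : ℝ → ℝ
exp x = mkℝ (λ n → partialSum (expTerm (seq x n)) n) (Sequences.exp-cauchy {seq x} (cauchy x))

-- log x = 2 artanh ((x - 1) / (x + 1)) = 2 Σ ((x - 1) / (x + 1))²ᵏ⁺¹ / (2k + 1), valid for every x > 0
log : (x : ℝ) → Positive x → ℝ
log x x>0 = mkℝ (Sequences.logSeq (seq x)) (Sequences.log-cauchy {seq x} gap start gap>0 gap≤ (cauchy x))
  where open Positivity x x>0

_[_]^_ : (x : ℝ) → Positive x → ℝ → ℝ
x [ x>0 ]^ s = exp (s * log x x>0)

<⇒Positive : ∀ {p x} → 0ℚ ℚ.≤ p → fromℚ p < x → Positive x
<⇒Positive {p} {x} 0≤p (ε , ε>0 , N , h) = positive {x} ε N ε>0 λ n hn → ℚ.≤-trans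
  (subst (ℚ._≤ p ℚ.+ ε) (ℚ.+-identityˡ ε) (ℚ.+-monoˡ-≤ ε 0≤p)) (h n hn)

*-positive : ∀ {x y} → Positive x → Positive y → Positive (x * y)
*-positive {x} {y} x>0 y>0 = positive {x * y} (X.gap ℚ.* Y.gap) (X.start ℕ.⊔ Y.start)
    (Sequences.*-pos {X.gap} {Y.gap} X.gap>0 Y.gap>0)
    λ n hn → Sequences.*-mono {X.gap} {seq x n} {Y.gap} {seq y n}
      (ℚ.<⇒≤ X.gap>0) (X.gap≤ n (ℕ.m⊔n≤o⇒m≤o X.start Y.start hn))
      (ℚ.<⇒≤ Y.gap>0) (Y.gap≤ n (ℕ.m⊔n≤o⇒n≤o X.start Y.start hn))
  where
  module X = Positivity x x>0
  module Y = Positivity y y>0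

exp-positive : ∀ {x} → Positive x → Positive (exp x)
exp-positive {x} x>0 = positive {exp x} 1ℚ (suc start) Sequences.0<1 λ n hn →
    Sequences.1≤exp {seq x n} (ℚ.≤-trans (ℚ.<⇒≤ gap>0) (gap≤ n (ℕ.≤-trans (ℕ.n≤1+n start) hn)))
      n (ℕ.≤-trans (s≤s z≤n) hn)
  where open Positivity x x>0

log-positive : ∀ {x} (x>0 : Positive x) → fromℚ 1ℚ < x → Positive (log x x>0)
log-positive {x} x>0 (ε , ε>0 , N , h) = positive {log x x>0} ((1ℚ ℚ.+ 1ℚ) ℚ.* S.two-terms η) (N ℕ.⊔ (N′ ℕ.+ 2))
    (S.*-pos {1ℚ ℚ.+ 1ℚ} {S.two-terms η} (ℚ.positive⁻¹ (1ℚ ℚ.+ 1ℚ))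
      (S.+-pos {η} {η ℚ.* (η ℚ.* η) ℚ.* recip 2} η>0
        (S.*-nonneg {η ℚ.* (η ℚ.* η)} {recip 2}
          (S.*-nonneg {η} {η ℚ.* η} 0≤η (S.*-nonneg {η} {η} 0≤η 0≤η)) (S.0≤recip 2))))
    λ n hn → let N≤n = ℕ.m⊔n≤o⇒m≤o N (N′ ℕ.+ 2) hn
                 N′+2≤n = ℕ.m⊔n≤o⇒n≤o N (N′ ℕ.+ 2) hn
      in S.log-lower {seq x} η n 0≤η
        (ℚ.<-≤-trans S.0<1 (ℚ.≤-trans (subst (ℚ._≤ 1ℚ ℚ.+ ε) (ℚ.+-identityʳ 1ℚ) (ℚ.+-monoʳ-≤ 1ℚ (ℚ.<⇒≤ ε>0))) (h n N≤n)))
        (ℚ.≤-trans (ℚ.*-monoˡ-≤-nonNeg η {{ℚ.nonNegative 0≤η}}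
            (ℚ.+-monoˡ-≤ 1ℚ (ℚ.≤-trans (S.p≤∣p∣ (seq x n)) (proj₂ (proj₂ (proj₂ b)) n (ℕ.≤-trans (ℕ.m≤m+n N′ 2) N′+2≤n)))))
          (subst (ℚ._≤ seq x n ℚ.- 1ℚ) (sym (S.undo ε M+1>0))
            (subst (ℚ._≤ seq x n ℚ.- 1ℚ) (shift ε) (ℚ.+-monoˡ-≤ (ℚ.- 1ℚ) (h n N≤n)))))
        (ℕ.≤-trans (ℕ.m≤n+m 2 N′) N′+2≤n)
  where
  module S = Sequences
  open ℚSolver.+-*-Solver using (solve; _:+_; _:-_; _:=_; con)
  b = S.bounded {seq x} (cauchy x)
  M = proj₁ b
  N′ = proj₁ (proj₂ b)
  M+1>0 : 0ℚ ℚ.< M ℚ.+ 1ℚ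
  M+1>0 = S.+-pos {M} {1ℚ} (ℚ.<-≤-trans S.0<1 (proj₁ (proj₂ (proj₂ b)))) S.0≤1
  η = ε ℚ.* inv (M ℚ.+ 1ℚ)
  η>0 : 0ℚ ℚ.< η
  η>0 = S.*-pos {ε} {inv (M ℚ.+ 1ℚ)} ε>0 (S.0<inv M+1>0)
  0≤η : 0ℚ ℚ.≤ η
  0≤η = ℚ.<⇒≤ η>0
  shift : ∀ e → 1ℚ ℚ.+ e ℚ.- 1ℚ ≡ e
  shift = solve 1 (λ e → con 1ℚ :+ e :- con 1ℚ := e) refl

3ℚ : ℚ
3ℚ = + 3 ℚ./ 1

1<log : ∀ {x} (x>0 : Positive x) → fromℚ 3ℚ < x → fromℚ 1ℚ < log x x>0
1<log {x} x>0 (ε , ε>0 , N , h) = + 1 ℚ./ 12 , ℚ.positive⁻¹ (+ 1 ℚ./ 12) , N ℕ.+ 2 , λ n hn →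
    let 3≤xn = ℚ.≤-trans (subst (ℚ._≤ 3ℚ ℚ.+ ε) (ℚ.+-identityʳ 3ℚ) (ℚ.+-monoʳ-≤ 3ℚ (ℚ.<⇒≤ ε>0)))
                 (h n (ℕ.≤-trans (ℕ.m≤m+n N 2) hn))
    in S.log-lower {seq x} ½ n (ℚ.<⇒≤ S.0<½) (ℚ.<-≤-trans (ℚ.positive⁻¹ 3ℚ) 3≤xn)
         (S.diff⁻ (subst (0ℚ ℚ.≤_) (eq (seq x n)) (S.*-nonneg {½} {seq x n ℚ.- 3ℚ} (ℚ.<⇒≤ S.0<½) (S.0≤diff 3≤xn))))
         (ℕ.≤-trans (ℕ.m≤n+m 2 N) hn)
  where
  module S = Sequences
  open ℚSolver.+-*-Solver using (solve; _:+_; _:*_; _:-_; _:=_; con)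
  eq : ∀ p → ½ ℚ.* (p ℚ.- 3ℚ) ≡ p ℚ.- 1ℚ ℚ.- ½ ℚ.* (p ℚ.+ 1ℚ)
  eq = solve 1 (λ p → con ½ :* (p :- con 3ℚ) := p :- con 1ℚ :- con ½ :* (p :+ con 1ℚ)) refl

⅓ ⅙ : ℚ
⅓ = + 1 ℚ./ 3
⅙ = + 1 ℚ./ 6

module Majorant (γ X : ℝ) (γ>0 : fromℚ 0ℚ < γ) (γ<½ : γ < fromℚ ½) (X>3 : fromℚ 3ℚ < X) where

  X>0 : Positive X
  X>0 = <⇒Positive {3ℚ} {X} (ℚ.nonNegative⁻¹ 3ℚ) X>3

  logX : ℝ
  logX = log X X>0

  logX>1 : fromℚ 1ℚ < logX
  logX>1 = 1<log {X} X>0 X>3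

  logX>0 : Positive logX
  logX>0 = <⇒Positive {1ℚ} {logX} Sequences.0≤1 logX>1

  loglogX : ℝ
  loglogX = log logX logX>0

  loglogX>0 : Positive loglogX
  loglogX>0 = log-positive {logX} logX>0 logX>1

  e₁ e₂ : ℝ
  e₁ = fromℚ ⅙ - fromℚ ⅓ * γ
  e₂ = fromℚ ½ * γ

  e₁>0 : Positive e₁
  e₁>0 = positive {e₁} (⅓ ℚ.* proj₁ γ<½) (proj₁ (proj₂ (proj₂ γ<½)))
      (Sequences.*-pos {⅓} {proj₁ γ<½} (ℚ.positive⁻¹ ⅓) (proj₁ (proj₂ γ<½)))
      λ n hn → Sequences.diff⁻ (subst (0ℚ ℚ.≤_) (eq (seq γ n) (proj₁ γ<½))
        (Sequences.*-nonneg {⅓} {½ ℚ.- (seq γ n ℚ.+ proj₁ γ<½)} (ℚ.nonNegative⁻¹ ⅓)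
          (Sequences.0≤diff (proj₂ (proj₂ (proj₂ γ<½)) n hn))))
    where
    open ℚSolver.+-*-Solver using (solve; _:+_; _:*_; _:-_; _:=_; con)
    eq : ∀ g e → ⅓ ℚ.* (½ ℚ.- (g ℚ.+ e)) ≡ ⅙ ℚ.- ⅓ ℚ.* g ℚ.- ⅓ ℚ.* e
    eq = solve 2 (λ g e → con ⅓ :* (con ½ :- (g :+ e)) := con ⅙ :- con ⅓ :* g :- con ⅓ :* e) refl

  e₂>0 : Positive e₂
  e₂>0 = *-positive {fromℚ ½} {γ} (½ , Sequences.0<½ , 0 , λ _ _ → ℚ.≤-reflexive (ℚ.+-identityˡ ½)) γ>0

  logX^>0 : ∀ {s} → Positive s → Positive (logX [ logX>0 ]^ s)
  logX^>0 {s} s>0 = exp-positive {s * loglogX} (*-positive {s} {loglogX} s>0 loglogX>0)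

  q*logX^>0 : ∀ q → .{{ℕ.NonZero q}} → Positive (fromℚ (fromℕ q) * logX [ logX>0 ]^ e₂)
  q*logX^>0 q@(suc k) = *-positive {fromℚ (fromℕ q)} {logX [ logX>0 ]^ e₂}
    (positive {fromℚ (fromℕ q)} (fromℕ q) 0 (Sequences.0<fromℕ k) (λ _ _ → ℚ.≤-refl)) (logX^>0 {e₂} e₂>0)

  majorant : (q : ℕ) → .{{ℕ.NonZero q}} → ℝ
  majorant q =
      (X [ X>0 ]^ fromℚ ⅓ * loglogX [ loglogX>0 ]^ fromℚ (+ 7 ℚ./ 3)) ÷ logX [ logX>0 ]^ e₁ [ logX^>0 {e₁} e₁>0 ]
    + (X * (loglogX * loglogX)) ÷ (fromℚ (fromℕ q) * logX [ logX>0 ]^ e₂) [ q*logX^>0 q ]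

primeDivisors : ℕ → List ℕ
primeDivisors n = filter (λ p → prime? p ×-dec (p ∣? n)) (upTo (suc n))

-- The Möbius function; only its values at n ≥ 1 are meaningful.
μ : ℕ → ℤ
μ n = if does (any? (λ p → (p ℕ.* p) ∣? n) (primeDivisors n))
      then + 0
      else (ℤ.- (+ 1)) ℤ.^ length (primeDivisors n)

μ² : ℕ → ℤ
μ² n = μ n ℤ.* μ n

range : ℕ → List ℕ
range n = map suc (upTo n)

φ : ℕ → ℕ
φ q = length (filter (λ k → coprime? k q) (range q))

φ-nonZero : ∀ q → .{{ℕ.NonZero q}} → ℕ.NonZero (φ q)
φ-nonZero q@(suc k) = nonempty (∈-filter⁺ (λ k → coprime? k q) {xs = range q} (here refl) (1-coprimeTo q))
  where
  nonempty : ∀ {n : ℕ} {xs} → n ∈ xs → ℕ.NonZero (length xs)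
  nonempty (here _)  = _
  nonempty (there _) = _

_≡_[mod_] : ℕ → ℤ → ℕ → Set
n ≡ a [mod q ] = + q ∣ℤ (+ n ℤ.- a)

≡mod? : ∀ (a : ℤ) (q n : ℕ) → Dec (n ≡ a [mod q ])
≡mod? a q n = q ∣? ℤ.∣ + n ℤ.- a ∣

sumOver : List ℕ → (ℕ → ℤ) → ℤ
sumOver ns f = foldr (λ n s → f n ℤ.+ s) (+ 0) ns

-- Order on ℝ is undecidable constructively, so the finite set { n ≤ X } is
-- formed by means of excluded middle.
module _ (em : ExcludedMiddle 0ℓ) where

  _≤?_ : ∀ x y → Dec (x ≤ y)
  x ≤? y = em

  ceilingBound : ℝ → ℕ
  ceilingBound X = suc (proj₁ (Sequences.archimedean (proj₁ (Sequences.bounded {seq X} (cauchy X)))))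

  positives≤ : ℝ → List ℕ
  positives≤ X = filter (λ n → fromℚ (fromℕ n) ≤? X) (range (ceilingBound X))

  ∈-positives≤⁺ : ∀ {X n} → 1 ℕ.≤ n → fromℚ (fromℕ n) ≤ X → n ∈ positives≤ X
  ∈-positives≤⁺ {X} {n@(suc m)} _ n≤X = ∈-filter⁺ (λ n → fromℚ (fromℕ n) ≤? X)
      (∈-map⁺ suc (∈-upTo⁺ (Sequences.fromℕ-cancel {n} {suc B} n≤B))) n≤X
    where
    b = Sequences.bounded {seq X} (cauchy X)
    B = proj₁ (Sequences.archimedean (proj₁ b))
    N₁ = proj₁ (n≤X 1ℚ Sequences.0<1)
    N₂ = proj₁ (proj₂ b)
    k = N₁ ℕ.⊔ N₂
    n≤B : fromℕ n ℚ.≤ fromℕ (suc B)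
    n≤B = ℚ.≤-trans (proj₂ (n≤X 1ℚ Sequences.0<1) k (ℕ.m≤m⊔n N₁ N₂))
      (subst (seq X k ℚ.+ 1ℚ ℚ.≤_) (trans (ℚ.+-comm (fromℕ B) 1ℚ) (sym (Sequences.fromℕ-+ 1 B)))
        (ℚ.+-monoˡ-≤ 1ℚ (ℚ.≤-trans (Sequences.p≤∣p∣ (seq X k))
          (ℚ.≤-trans (proj₂ (proj₂ (proj₂ b)) k (ℕ.m≤n⊔m N₁ N₂))
            (proj₂ (Sequences.archimedean (proj₁ b)))))))

  ∈-positives≤⁻ : ∀ {X n} → n ∈ positives≤ X → 1 ℕ.≤ n × fromℚ (fromℕ n) ≤ X
  ∈-positives≤⁻ {X} n∈ with ∈-filter⁻ (λ n → fromℚ (fromℕ n) ≤? X) {xs = range (ceilingBound X)} n∈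
  ... | n∈range , n≤X with ∈-map⁻ suc n∈range
  ... | _ , _ , refl = s≤s z≤n , n≤X

  E : ℝ → (q : ℕ) → .{{ℕ.NonZero q}} → ℤ → ℚ
  E X q a =
      sumOver (filter (≡mod? a q) (positives≤ X)) μ² ℚ./ 1
    ℚ.- (sumOver (filter (λ n → coprime? n q) (positives≤ X)) μ² ℚ./ φ q) {{φ-nonZero q}}

{-# OPTIONS --safe #-}

-- For x = ⌊X⌋ write μ²(n) = Σ_{d² ∣ n} μ(d), so E = Σ_d μ(d) Δ_d, where |Δ_d| ≤ 1 and Δ_d is at most
-- the number of m with d² m ≤ x, d² m ≡ a (mod q), plus x/(d² φ(q)).  Everything thus reduces to counting
-- pairs (d, m) with d > D, D slightly below x^{1/3}.  Since m determines d inside intervals of length q/2,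
-- this number is trivially O(x^{1/3}), which suffices for q up to about x^{2/3}/(log x)^c.  For larger q
-- the gain over x^{1/3} comes from divisors: if d = k e with k in a range [K₀, K₁], then m k² < q is the
-- residue of a e⁻² modulo q, so e almost determines the pair (exactly so once the square part of m is
-- fixed) and there are few such pairs.  The remaining d have no divisor in [K₀, K₁], and a sieve based on
-- Chebyshev's bound shows that they are rarer than average by a factor (log log x)/(log x).
-- The saving is a power of log x exceeding (log x)^{1/6}.  The parameters are dyadic: with
-- 2^{12κ} ≤ x < 2^{12κ+12} and 2^{6i} ≤ κ+1 < 2^{6i+6}, the numbers 16^κ and 64^i stand for x^{1/3} and log x.
-- The majorant is compared with 16^κ/4^i + x/(q 8^i) through one-sided bounds for the partial sums of the
-- series of exp and log; only exp(⅓ log X) ≥ c·16^κ needs care, and it follows by climbing to 2^{12κ} in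
-- steps of ratio 1 + h, each of which raises the logarithm by at least h/(1+h).
module Submission where

open import Axiom.ExcludedMiddle using (ExcludedMiddle)
open import Level using (0ℓ)

-- The counting saves twice the exponents that the majorant asks for. With `64^i` for log x, the
-- savings `4^i` and `8^i` are (log x)^(1/3) and (log x)^(1/2), while the denominators carry
-- exponents below 1/6 and 1/4. This factor of two pays for the two crude estimates log 2^k ≤ k and
-- exp(k/2) ≤ 2^k, which together double an exponent. The factor X^(1/3) has no such slack, and this
-- is why it gets a fine multiplicative grid. The n-th term of a real `exp y` is the n-th partial
-- sum at the n-th approximation of y. An inequality between reals thus needs bounds on truncated
-- series for all large n, uniformly in the rational argument. For X near 3, log log X lies between
-- 0 and 1, so (log log X)^(7/3) is the exponential of a negative number. Its series alternates and
-- monotonicity is lost; the descent in small steps supplies a positive lower bound. The powers of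
-- log log X enter through such bounds. On the arithmetic side the obstacle is that with D = x^(1/3)
-- the d ≤ D alone contribute x^(1/3). Lowering D by `4^i` lengthens the range of m, and the
-- parameters balance this loss against the divisor argument and the sieve.

module Summation where

  open import Defs using (fromℕ; recip; range; module Sequences)
  open import Data.Integer as ℤ using (ℤ)
  import Data.Integer.Properties as ℤ
  open import Data.List using (List; []; _∷_; _++_; map; upTo; length; cartesianProduct)
  open import Data.List.Membership.Propositional using (_∈_)
  open import Data.List.Membership.Propositional.Properties using (∈-map⁺; ∈-map⁻; ∈-upTo⁺; ∈-upTo⁻)
  import Data.List.Properties as List
  open import Data.List.Relation.Unary.All as All using ()
  open import Data.List.Relation.Unary.AllPairs using ([]; _∷_)
  open import Data.List.Relation.Unary.Any using (here; there)
  open import Data.List.Relation.Unary.Unique.Propositional using (Unique)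
  import Data.List.Relation.Unary.Unique.Propositional.Properties as Unique
  open import Data.Nat as ℕ using (ℕ; zero; suc; z≤n; s≤s)
  import Data.Nat.Properties as ℕ
  open import Data.Product using (∃; _×_; _,_; proj₁; proj₂)
  open import Data.Rational
  import Data.Rational.Properties as ℚ
  import Data.Rational.Solver as ℚSolver
  import Data.Rational.Unnormalised as ℚᵘ
  import Data.Rational.Unnormalised.Properties as ℚᵘ
  open import Data.Sum using (_⊎_; inj₁; inj₂)
  open import Function using (_∘_)
  open import Relation.Binary.PropositionalEquality
  open import Relation.Nullary using (¬_; yes; no)
  open import Relation.Nullary.Negation using (contradiction)
  open Sequences using (*-nonneg; +-nonneg; 0≤1; toℚᵘ-fromℕ; fromℕ-mono; fromℕ-cancel; fromℕ-+; recip-inverse; 0≤recip; ∣+∣≤; cancel; 0≤fromℕ)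

  -- Rational inequalities, natural numbers and their reciprocals

  *-monoˡ : ∀ {c a b} → 0ℚ ≤ c → a ≤ b → c * a ≤ c * b
  *-monoˡ {c} 0≤c = ℚ.*-monoˡ-≤-nonNeg c {{nonNegative 0≤c}}

  *-monoʳ : ∀ {c a b} → 0ℚ ≤ c → a ≤ b → a * c ≤ b * c
  *-monoʳ {c} 0≤c = ℚ.*-monoʳ-≤-nonNeg c {{nonNegative 0≤c}}

  *-≤ˡ : ∀ {c a} → 0ℚ ≤ a → c ≤ 1ℚ → c * a ≤ a
  *-≤ˡ {c} {a} 0≤a c≤1 = subst (c * a ≤_) (ℚ.*-identityˡ a) (*-monoʳ 0≤a c≤1)

  ≤-+ʳ : ∀ {a b} → 0ℚ ≤ b → a ≤ a + b
  ≤-+ʳ {a} {b} h = subst (_≤ a + b) (ℚ.+-identityʳ a) (ℚ.+-monoʳ-≤ a h)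

  ≤-+ˡ : ∀ {a b} → 0ℚ ≤ a → b ≤ a + b
  ≤-+ˡ {a} {b} h = subst (_≤ a + b) (ℚ.+-identityˡ b) (ℚ.+-monoˡ-≤ b h)

  fromℕ-* : ∀ m n → fromℕ (m ℕ.* n) ≡ fromℕ m * fromℕ n
  fromℕ-* m n = ℚ.toℚᵘ-injective (ℚᵘ.≃-trans (toℚᵘ-fromℕ (m ℕ.* n))
    (ℚᵘ.≃-trans (ℚᵘ.*≡* (cong (ℤ._* ℤ.+ 1) (ℤ.pos-* m n)))
    (ℚᵘ.≃-sym (ℚᵘ.≃-trans (ℚ.toℚᵘ-homo-* (fromℕ m) (fromℕ n))
      (ℚᵘ.*-cong (toℚᵘ-fromℕ m) (toℚᵘ-fromℕ n))))))

  -- Opaque copies of fromℕ and of n ↦ 1/n (with 1/0 = 0): unfolding them would expose gcd computations.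
  opaque

    ι : ℕ → ℚ
    ι = fromℕ

    ι≡fromℕ : ∀ n → ι n ≡ fromℕ n
    ι≡fromℕ _ = refl

    ι-+ : ∀ m n → ι (m ℕ.+ n) ≡ ι m + ι n
    ι-+ = fromℕ-+

    ι-* : ∀ m n → ι (m ℕ.* n) ≡ ι m * ι n
    ι-* = fromℕ-*

    ι-0 : ι 0 ≡ 0ℚ
    ι-0 = refl

    ι-1 : ι 1 ≡ 1ℚ
    ι-1 = refl

    ι-mono : ∀ {m n} → m ℕ.≤ n → ι m ≤ ι n
    ι-mono {m} {n} = fromℕ-mono {m} {n}

    ι-cancel : ∀ {m n} → ι m ≤ ι n → m ℕ.≤ n
    ι-cancel {m} {n} = fromℕ-cancel {m} {n}

    0≤ι : ∀ n → 0ℚ ≤ ι n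
    0≤ι = 0≤fromℕ

    0<ι : ∀ {n} → 1 ℕ.≤ n → 0ℚ < ι n
    0<ι {suc n} _ = Sequences.0<fromℕ n

    rc : ℕ → ℚ
    rc zero = 0ℚ
    rc (suc k) = recip k

    rc-suc : ∀ k → rc (suc k) ≡ recip k
    rc-suc _ = refl

    0≤rc : ∀ n → 0ℚ ≤ rc n
    0≤rc zero = ℚ.≤-refl
    0≤rc (suc k) = 0≤recip k

    rc-inverse : ∀ {n} → 1 ℕ.≤ n → rc n * ι n ≡ 1ℚ
    rc-inverse {suc n} _ = recip-inverse n

  ι-suc : ∀ n → ι (suc n) ≡ ι n + 1ℚ
  ι-suc n = trans (ι-+ 1 n) (trans (ℚ.+-comm (ι 1) (ι n)) (cong (λ z → ι n + z) ι-1))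

  rc-inverseˡ : ∀ {n} → 1 ℕ.≤ n → ι n * rc n ≡ 1ℚ
  rc-inverseˡ {n} h = trans (ℚ.*-comm (ι n) (rc n)) (rc-inverse h)

  ≤-rc : ∀ {n a b} → 1 ℕ.≤ n → a * ι n ≤ b → a ≤ b * rc n
  ≤-rc {n} {a} {b} h le = cancel (ι n) (0<ι h) (subst (a * ι n ≤_)
    (trans (sym (ℚ.*-identityʳ b)) (trans (cong (b *_) (sym (rc-inverse h))) (sym (ℚ.*-assoc b (rc n) (ι n))))) le)

  rc-≤ : ∀ {n a b} → 1 ℕ.≤ n → a ≤ b * ι n → a * rc n ≤ b
  rc-≤ {n} {a} {b} h le = subst (a * rc n ≤_)
    (trans (ℚ.*-assoc b (ι n) (rc n)) (trans (cong (b *_) (rc-inverseˡ h)) (ℚ.*-identityʳ b)))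
    (*-monoʳ (0≤rc n) le)

  rc-unique : ∀ {n a} → 1 ℕ.≤ n → a * ι n ≡ 1ℚ → a ≡ rc n
  rc-unique {n} {a} h e = begin
    a ≡⟨ sym (ℚ.*-identityʳ a) ⟩
    a * 1ℚ ≡⟨ cong (a *_) (sym (rc-inverseˡ h)) ⟩
    a * (ι n * rc n) ≡⟨ sym (ℚ.*-assoc a (ι n) (rc n)) ⟩
    a * ι n * rc n ≡⟨ cong (_* rc n) e ⟩
    1ℚ * rc n ≡⟨ ℚ.*-identityˡ (rc n) ⟩
    rc n ∎
    where open ≡-Reasoning

  rc-* : ∀ {m n} → 1 ℕ.≤ m → 1 ℕ.≤ n → rc (m ℕ.* n) ≡ rc m * rc n
  rc-* {m} {n} hm hn = sym (rc-unique (ℕ.*-mono-≤ hm hn) (begin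
    rc m * rc n * ι (m ℕ.* n) ≡⟨ cong (rc m * rc n *_) (ι-* m n) ⟩
    rc m * rc n * (ι m * ι n) ≡⟨ solve 4 (λ a b c d → a :* b :* (c :* d) := (a :* c) :* (b :* d)) refl (rc m) (rc n) (ι m) (ι n) ⟩
    (rc m * ι m) * (rc n * ι n) ≡⟨ cong₂ _*_ (rc-inverse hm) (rc-inverse hn) ⟩
    1ℚ * 1ℚ ≡⟨ ℚ.*-identityˡ 1ℚ ⟩
    1ℚ ∎))
    where
    open ≡-Reasoning
    open ℚSolver.+-*-Solver using (solve; _:*_; _:=_)

  rc-anti : ∀ {m n} → 1 ℕ.≤ m → m ℕ.≤ n → rc n ≤ rc m
  rc-anti {m} {n} hm le = subst (_≤ rc m) (ℚ.*-identityˡ (rc n))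
    (rc-≤ (ℕ.≤-trans hm le) (subst (_≤ rc m * ι n) (rc-inverse hm) (*-monoˡ (0≤rc m) (ι-mono le))))

  cross : ∀ {a b c d} → 1 ℕ.≤ b → 1 ℕ.≤ d → a ℕ.* d ℕ.≤ c ℕ.* b → ι a * rc b ≤ ι c * rc d
  cross {a} {b} {c} {d} hb hd le = ≤-rc hd (subst (_≤ ι c) (swap (ι a) (ι d) (rc b))
    (rc-≤ hb (subst₂ _≤_ (ι-* a d) (ι-* c b) (ι-mono le))))
    where
    open ℚSolver.+-*-Solver using (solve; _:*_; _:=_)
    swap : ∀ x y z → x * y * z ≡ x * z * y
    swap = solve 3 (λ x y z → x :* y :* z := x :* z :* y) refl

  -- Finite sums

  ∑ : ∀ {A : Set} → List A → (A → ℚ) → ℚ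
  ∑ [] f = 0ℚ
  ∑ (x ∷ xs) f = f x + ∑ xs f

  module _ {A : Set} where

    ∑-cong : ∀ xs {f g : A → ℚ} → (∀ {a} → a ∈ xs → f a ≡ g a) → ∑ xs f ≡ ∑ xs g
    ∑-cong [] h = refl
    ∑-cong (x ∷ xs) h = cong₂ _+_ (h (here refl)) (∑-cong xs (h ∘ there))

    ∑-mono : ∀ xs {f g : A → ℚ} → (∀ {a} → a ∈ xs → f a ≤ g a) → ∑ xs f ≤ ∑ xs g
    ∑-mono [] h = ℚ.≤-refl
    ∑-mono (x ∷ xs) h = ℚ.+-mono-≤ (h (here refl)) (∑-mono xs (h ∘ there))

    ∑-zero : ∀ (xs : List A) → ∑ xs (λ _ → 0ℚ) ≡ 0ℚ
    ∑-zero [] = refl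
    ∑-zero (x ∷ xs) = trans (ℚ.+-identityˡ _) (∑-zero xs)

    ∑-nonneg : ∀ xs {f : A → ℚ} → (∀ {a} → a ∈ xs → 0ℚ ≤ f a) → 0ℚ ≤ ∑ xs f
    ∑-nonneg xs {f} h = subst (_≤ ∑ xs f) (∑-zero xs) (∑-mono xs h)

    ∑-+ : ∀ xs (f g : A → ℚ) → ∑ xs (λ a → f a + g a) ≡ ∑ xs f + ∑ xs g
    ∑-+ [] f g = refl
    ∑-+ (x ∷ xs) f g = trans (cong ((f x + g x) +_) (∑-+ xs f g))
      (solve 4 (λ a b c d → a :+ b :+ (c :+ d) := a :+ c :+ (b :+ d)) refl (f x) (g x) (∑ xs f) (∑ xs g))
      where open ℚSolver.+-*-Solver using (solve; _:+_; _:=_)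

    ∑-*ˡ : ∀ c xs (f : A → ℚ) → ∑ xs (λ a → c * f a) ≡ c * ∑ xs f
    ∑-*ˡ c [] f = sym (ℚ.*-zeroʳ c)
    ∑-*ˡ c (x ∷ xs) f = trans (cong (c * f x +_) (∑-*ˡ c xs f)) (sym (ℚ.*-distribˡ-+ c (f x) (∑ xs f)))

    ∑-*ʳ : ∀ c xs (f : A → ℚ) → ∑ xs (λ a → f a * c) ≡ ∑ xs f * c
    ∑-*ʳ c xs f = trans (∑-cong xs (λ {a} _ → ℚ.*-comm (f a) c)) (trans (∑-*ˡ c xs f) (ℚ.*-comm c (∑ xs f)))

    ∑-++ : ∀ xs ys (f : A → ℚ) → ∑ (xs ++ ys) f ≡ ∑ xs f + ∑ ys f
    ∑-++ [] ys f = sym (ℚ.+-identityˡ _)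
    ∑-++ (x ∷ xs) ys f = trans (cong (f x +_) (∑-++ xs ys f)) (sym (ℚ.+-assoc (f x) (∑ xs f) (∑ ys f)))

    ∑-one : ∀ (xs : List A) → ∑ xs (λ _ → 1ℚ) ≡ ι (length xs)
    ∑-one [] = sym ι-0
    ∑-one (x ∷ xs) = trans (cong (λ z → 1ℚ + z) (∑-one xs)) (trans (ℚ.+-comm 1ℚ (ι (length xs))) (sym (ι-suc (length xs))))

    term≤∑ : ∀ {xs} {f : A → ℚ} {a} → (∀ b → 0ℚ ≤ f b) → a ∈ xs → f a ≤ ∑ xs f
    term≤∑ {x ∷ xs} {f} h (here refl) = ≤-+ʳ (∑-nonneg xs (λ {b} _ → h b))
    term≤∑ {x ∷ xs} {f} h (there a∈) = ℚ.≤-trans (term≤∑ h a∈) (≤-+ˡ (h x))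

    ∑-∣∣ : ∀ xs (f : A → ℚ) → ∣ ∑ xs f ∣ ≤ ∑ xs (λ a → ∣ f a ∣)
    ∑-∣∣ [] f = ℚ.≤-refl
    ∑-∣∣ (x ∷ xs) f = ∣+∣≤ {f x} {∑ xs f} ℚ.≤-refl (∑-∣∣ xs f)

  module _ {A B : Set} where

    ∑-map : ∀ (h : A → B) xs (f : B → ℚ) → ∑ (map h xs) f ≡ ∑ xs (f ∘ h)
    ∑-map h [] f = refl
    ∑-map h (x ∷ xs) f = cong (f (h x) +_) (∑-map h xs f)

    ∑-swap : ∀ xs ys (f : A → B → ℚ) → ∑ xs (λ a → ∑ ys (f a)) ≡ ∑ ys (λ b → ∑ xs (λ a → f a b))
    ∑-swap [] ys f = sym (∑-zero ys)
    ∑-swap (x ∷ xs) ys f = trans (cong (∑ ys (f x) +_) (∑-swap xs ys f))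
      (sym (∑-+ ys (f x) (λ b → ∑ xs (λ a → f a b))))

  module _ {A B : Set} where

    ∑-product : ∀ (xs : List A) (ys : List B) (f : A × B → ℚ) → ∑ (cartesianProduct xs ys) f ≡ ∑ xs (λ a → ∑ ys (λ b → f (a , b)))
    ∑-product [] ys f = refl
    ∑-product (x ∷ xs) ys f = trans (∑-++ (map (x ,_) ys) (cartesianProduct xs ys) f)
      (cong₂ _+_ (∑-map (x ,_) ys f) (∑-product xs ys f))

  range-suc : ∀ n → range (suc n) ≡ range n ++ suc n ∷ []
  range-suc n = trans (cong (map suc) (sym (List.upTo-∷ʳ n))) (List.map-++ suc (upTo n) (n ∷ []))

  ∈-range⁺ : ∀ {n d} → 1 ℕ.≤ d → d ℕ.≤ n → d ∈ range n
  ∈-range⁺ {n} {suc d} _ d≤n = ∈-map⁺ suc (∈-upTo⁺ d≤n)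

  ∈-range⁻ : ∀ {n d} → d ∈ range n → 1 ℕ.≤ d × d ℕ.≤ n
  ∈-range⁻ d∈ with ∈-map⁻ suc d∈
  ... | _ , k∈ , refl = s≤s z≤n , ∈-upTo⁻ k∈

  range-unique : ∀ n → Unique (range n)
  range-unique n = Unique.map⁺ ℕ.suc-injective (Unique.upTo⁺ n)

  ∑-suc : ∀ n (f : ℕ → ℚ) → ∑ (range (suc n)) f ≡ ∑ (range n) f + f (suc n)
  ∑-suc n f = trans (cong (λ xs → ∑ xs f) (range-suc n))
    (trans (∑-++ (range n) (suc n ∷ []) f) (cong (∑ (range n) f +_) (ℚ.+-identityʳ (f (suc n)))))

  ∑-range-one : ∀ n → ∑ (range n) (λ _ → 1ℚ) ≡ ι n
  ∑-range-one n = trans (∑-one (range n)) (cong ι (trans (List.length-map suc (upTo n)) (List.length-upTo n)))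

  ∑-range-+ : ∀ m n (f : ℕ → ℚ) → ∑ (range (m ℕ.+ n)) f ≡ ∑ (range m) f + ∑ (range n) (λ s → f (m ℕ.+ s))
  ∑-range-+ m zero f = trans (cong (λ z → ∑ (range z) f) (ℕ.+-identityʳ m)) (sym (ℚ.+-identityʳ _))
  ∑-range-+ m (suc n) f = begin
    ∑ (range (m ℕ.+ suc n)) f ≡⟨ cong (λ z → ∑ (range z) f) (ℕ.+-suc m n) ⟩
    ∑ (range (suc (m ℕ.+ n))) f ≡⟨ ∑-suc (m ℕ.+ n) f ⟩
    ∑ (range (m ℕ.+ n)) f + f (suc (m ℕ.+ n)) ≡⟨ cong₂ (λ u z → u + f z) (∑-range-+ m n f) (sym (ℕ.+-suc m n)) ⟩
    ∑ (range m) f + ∑ (range n) g + g (suc n) ≡⟨ ℚ.+-assoc (∑ (range m) f) (∑ (range n) g) (g (suc n)) ⟩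
    ∑ (range m) f + (∑ (range n) g + g (suc n)) ≡⟨ cong (∑ (range m) f +_) (sym (∑-suc n g)) ⟩
    ∑ (range m) f + ∑ (range (suc n)) g ∎
    where
    open ≡-Reasoning
    g = λ s → f (m ℕ.+ s)

  ∑-range-mono : ∀ {m n} (f : ℕ → ℚ) → (∀ k → 0ℚ ≤ f k) → m ℕ.≤ n → ∑ (range m) f ≤ ∑ (range n) f
  ∑-range-mono {m} {n} f h m≤n = subst (λ z → ∑ (range m) f ≤ ∑ (range z) f) (ℕ.m+[n∸m]≡n m≤n)
    (subst (∑ (range m) f ≤_) (sym (∑-range-+ m (n ℕ.∸ m) f)) (≤-+ʳ (∑-nonneg (range (n ℕ.∸ m)) (λ {s} _ → h (m ℕ.+ s)))))

  -- Indicators and counting by injections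

  module Indicator (em : ExcludedMiddle 0ℓ) where

    opaque

      𝟙 : Set → ℚ
      𝟙 P with em {P}
      ... | yes _ = 1ℚ
      ... | no _ = 0ℚ

      𝟙-true : ∀ {P} → P → 𝟙 P ≡ 1ℚ
      𝟙-true {P} p with em {P}
      ... | yes _ = refl
      ... | no ¬p = contradiction p ¬p

      𝟙-false : ∀ {P} → ¬ P → 𝟙 P ≡ 0ℚ
      𝟙-false {P} ¬p with em {P}
      ... | yes p = contradiction p ¬p
      ... | no _ = refl

      0≤𝟙 : ∀ P → 0ℚ ≤ 𝟙 P
      0≤𝟙 P with em {P}
      ... | yes _ = 0≤1
      ... | no _ = ℚ.≤-refl

      𝟙≤1 : ∀ P → 𝟙 P ≤ 1ℚ
      𝟙≤1 P with em {P}
      ... | yes _ = ℚ.≤-refl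
      ... | no _ = 0≤1

    𝟙-≤ : ∀ {P a} → 0ℚ ≤ a → (P → 1ℚ ≤ a) → 𝟙 P ≤ a
    𝟙-≤ {P} 0≤a h with em {P}
    ... | yes p = subst (_≤ _) (sym (𝟙-true p)) (h p)
    ... | no ¬p = subst (_≤ _) (sym (𝟙-false ¬p)) 0≤a

    𝟙-mono : ∀ {P Q} → (P → Q) → 𝟙 P ≤ 𝟙 Q
    𝟙-mono {P} {Q} h = 𝟙-≤ (0≤𝟙 Q) (λ p → ℚ.≤-reflexive (sym (𝟙-true (h p))))

    𝟙-cong : ∀ {P Q} → (P → Q) → (Q → P) → 𝟙 P ≡ 𝟙 Q
    𝟙-cong f g = ℚ.≤-antisym (𝟙-mono f) (𝟙-mono g)

    𝟙-× : ∀ P Q → 𝟙 (P × Q) ≡ 𝟙 P * 𝟙 Q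
    𝟙-× P Q with em {P}
    ... | yes p = trans (𝟙-cong proj₂ (p ,_)) (sym (trans (cong (_* 𝟙 Q) (𝟙-true p)) (ℚ.*-identityˡ (𝟙 Q))))
    ... | no ¬p = trans (𝟙-false (¬p ∘ proj₁)) (sym (trans (cong (_* 𝟙 Q) (𝟙-false ¬p)) (ℚ.*-zeroˡ (𝟙 Q))))

    𝟙-⊎ : ∀ {P Q R} → (P → Q ⊎ R) → 𝟙 P ≤ 𝟙 Q + 𝟙 R
    𝟙-⊎ {P} {Q} {R} h = 𝟙-≤ (+-nonneg (0≤𝟙 Q) (0≤𝟙 R)) λ p → case (h p)
      where
      case : Q ⊎ R → 1ℚ ≤ 𝟙 Q + 𝟙 R
      case (inj₁ q) = subst (_≤ 𝟙 Q + 𝟙 R) (𝟙-true q) (≤-+ʳ (0≤𝟙 R))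
      case (inj₂ r) = subst (_≤ 𝟙 Q + 𝟙 R) (𝟙-true r) (≤-+ˡ (0≤𝟙 Q))

    𝟙*-≤ : ∀ {P a b} → 0ℚ ≤ b → (P → a ≤ b) → 𝟙 P * a ≤ b
    𝟙*-≤ {P} {a} {b} 0≤b h with em {P}
    ... | yes p = subst (_≤ b) (sym (trans (cong (_* a) (𝟙-true p)) (ℚ.*-identityˡ a))) (h p)
    ... | no ¬p = subst (_≤ b) (sym (trans (cong (_* a) (𝟙-false ¬p)) (ℚ.*-zeroˡ a))) 0≤b

    ∑-⊎ : ∀ {A : Set} (xs : List A) {P Q R : A → Set} → (∀ a → a ∈ xs → P a → Q a ⊎ R a)
      → ∑ xs (𝟙 ∘ P) ≤ ∑ xs (𝟙 ∘ Q) + ∑ xs (𝟙 ∘ R)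
    ∑-⊎ xs {P} {Q} {R} h = subst (∑ xs (𝟙 ∘ P) ≤_) (∑-+ xs (𝟙 ∘ Q) (𝟙 ∘ R)) (∑-mono xs (λ {a} a∈ → 𝟙-⊎ (h a a∈)))

    ∑-subsingleton : ∀ {A : Set} {xs : List A} {P : A → Set} → Unique xs
      → (∀ {a b} → a ∈ xs → b ∈ xs → P a → P b → a ≡ b) → ∑ xs (𝟙 ∘ P) ≤ 1ℚ
    ∑-subsingleton {xs = []} _ h = 0≤1
    ∑-subsingleton {xs = x ∷ xs} {P} (x∉ ∷ u) h with em {P x}
    ... | no ¬p = subst (_≤ 1ℚ) (sym (trans (cong (_+ ∑ xs (𝟙 ∘ P)) (𝟙-false ¬p)) (ℚ.+-identityˡ _))) (∑-subsingleton u (λ a∈ b∈ → h (there a∈) (there b∈)))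
    ... | yes p = ℚ.≤-reflexive (trans (cong₂ _+_ (𝟙-true p)
          (trans (∑-cong xs (λ a∈ → 𝟙-false (λ pa → All.lookup x∉ a∈ (h (here refl) (there a∈) p pa)))) (∑-zero xs))) (ℚ.+-identityʳ 1ℚ))

    -- Double counting over `R`: each `a` with `P a` has a neighbour `b` of at least its weight, and
    -- each `b` has at most one such neighbour. A relation in place of a function spares choosing,
    -- say, a divisor or a prime factor canonically.
    ∑-injection : ∀ {A B : Set} {xs : List A} {ys : List B} {P : A → Set} (R : A → B → Set) {f : A → ℚ} {g : B → ℚ}
      → Unique xs → (∀ b → 0ℚ ≤ g b)
      → (∀ {a} → a ∈ xs → P a → ∃ λ b → b ∈ ys × R a b × f a ≤ g b)
      → (∀ {a a′ b} → a ∈ xs → a′ ∈ xs → P a → P a′ → R a b → R a′ b → a ≡ a′)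
      → ∑ xs (λ a → 𝟙 (P a) * f a) ≤ ∑ ys g
    ∑-injection {xs = xs} {ys} {P} R {f} {g} u 0≤g total inj = begin
      ∑ xs (λ a → 𝟙 (P a) * f a) ≤⟨ ∑-mono xs (λ {a} a∈ → step a a∈) ⟩
      ∑ xs (λ a → ∑ ys (λ b → 𝟙 (P a × R a b) * g b)) ≡⟨ ∑-swap xs ys (λ a b → 𝟙 (P a × R a b) * g b) ⟩
      ∑ ys (λ b → ∑ xs (λ a → 𝟙 (P a × R a b) * g b)) ≤⟨ ∑-mono ys (λ {b} _ → fibre b) ⟩
      ∑ ys g ∎
      where
      open ℚ.≤-Reasoning
      0≤t : ∀ a b → 0ℚ ≤ 𝟙 (P a × R a b) * g b
      0≤t a b = *-nonneg (0≤𝟙 (P a × R a b)) (0≤g b)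
      step : ∀ a → a ∈ xs → 𝟙 (P a) * f a ≤ ∑ ys (λ b → 𝟙 (P a × R a b) * g b)
      step a a∈ = 𝟙*-≤ (∑-nonneg ys (λ {b} _ → 0≤t a b)) λ p → let b , b∈ , r , le = total a∈ p in
        ℚ.≤-trans (subst (f a ≤_) (sym (trans (cong (_* g b) (𝟙-true (p , r))) (ℚ.*-identityˡ (g b)))) le)
          (term≤∑ {f = λ b → 𝟙 (P a × R a b) * g b} (0≤t a) b∈)
      fibre : ∀ b → ∑ xs (λ a → 𝟙 (P a × R a b) * g b) ≤ g b
      fibre b = subst (_≤ g b) (sym (∑-*ʳ (g b) xs (λ a → 𝟙 (P a × R a b))))
        (*-≤ˡ (0≤g b) (∑-subsingleton u (λ a∈ a′∈ (p , r) (p′ , r′) → inj a∈ a′∈ p p′ r r′)))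

    count-injection : ∀ {A B : Set} {xs : List A} {ys : List B} {P : A → Set} {Q : B → Set} (R : A → B → Set)
      → Unique xs
      → (∀ {a} → a ∈ xs → P a → ∃ λ b → b ∈ ys × R a b × Q b)
      → (∀ {a a′ b} → a ∈ xs → a′ ∈ xs → P a → P a′ → R a b → R a′ b → a ≡ a′)
      → ∑ xs (𝟙 ∘ P) ≤ ∑ ys (𝟙 ∘ Q)
    count-injection {xs = xs} {P = P} {Q} R u total inj = subst (_≤ _) (∑-cong xs (λ {a} _ → ℚ.*-identityʳ (𝟙 (P a))))
      (∑-injection R u (λ b → 0≤𝟙 (Q b))
        (λ a∈ p → let b , b∈ , r , q = total a∈ p in b , b∈ , r , ℚ.≤-reflexive (sym (𝟙-true q))) inj)

    count-length : ∀ {A B : Set} {xs : List A} {ys : List B} {P : A → Set} (R : A → B → Set)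
      → Unique xs
      → (∀ {a} → a ∈ xs → P a → ∃ λ b → b ∈ ys × R a b)
      → (∀ {a a′ b} → a ∈ xs → a′ ∈ xs → P a → P a′ → R a b → R a′ b → a ≡ a′)
      → ∑ xs (𝟙 ∘ P) ≤ ι (length ys)
    count-length {xs = xs} {ys} {P} R u total inj = subst₂ _≤_ (∑-cong xs (λ {a} _ → ℚ.*-identityʳ (𝟙 (P a)))) (∑-one ys)
      (∑-injection R u (λ _ → 0≤1) (λ a∈ p → let b , b∈ , r = total a∈ p in b , b∈ , r , ℚ.≤-refl) inj)

module Arithmetic where

  open Summation
  open import Defs using (range; μ²; φ; primeDivisors; _≡_[mod_]; module Sequences)
  import Data.Bool as Bool
  open import Data.Integer as ℤ using (ℤ)
  import Data.Integer.Coprimality as ℤ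
  open import Data.Integer.DivMod using (_%ℕ_; _/ℕ_; a≡a%ℕn+[a/ℕn]*n; n%ℕd<d)
  import Data.Integer.Divisibility.Signed as Signed
  import Data.Integer.Properties as ℤ
  import Data.Integer.Solver as ℤSolver
  open import Data.List using (List; []; _∷_; map; length; filter; upTo; cartesianProduct)
  open import Data.List.Membership.Propositional using (_∈_; find; lose)
  open import Data.List.Membership.Propositional.Properties using (∈-map⁻; ∈-filter⁺; ∈-filter⁻; ∈-upTo⁺; ∈-cartesianProduct⁺; ∈-cartesianProduct⁻)
  import Data.List.Properties as List
  open import Data.List.Relation.Unary.All as All using (All; []; _∷_)
  open import Data.List.Relation.Unary.AllPairs using ([]; _∷_)
  open import Data.List.Relation.Unary.Any using (Any; here; there; any?)
  open import Data.List.Relation.Unary.Unique.Propositional using (Unique)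
  import Data.List.Relation.Unary.Unique.Propositional.Properties as Unique
  open import Data.Nat
  open import Data.Nat.Combinatorics using (_C_; nCk≡n!/k![n-k]!; k![n∸k]!∣n!; k>n⇒nCk≡0; nCk+nC[k+1]≡[n+1]C[k+1])
  open import Data.Nat.Coprimality as Coprimality using (Coprime; coprime?; coprime-divisor; coprime-Bézout; coprime-/gcd)
  open import Data.Nat.DivMod using (m/n*n≤m; m/n*n≡m; m*n/n≡m; m/n≤m; m<n⇒m/n≡0; m≡m%n+[m/n]*n; m%n<n; /-monoˡ-≤)
  open import Data.Nat.Divisibility
  open import Data.Nat.GCD using (gcd; gcd[m,n]∣m; gcd[m,n]∣n; gcd[m,n]≢0; module Bézout)
  open import Data.Nat.ListAction using (product)
  open import Data.Nat.Primality
  open import Data.Nat.Primality.Factorisation using (factorise; factorisationHasAllPrimeFactors; PrimeFactorisation)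
  open import Data.Nat.Properties
  open import Data.Nat.Solver using (module +-*-Solver)
  open import Data.Product using (∃; _×_; _,_; proj₁; proj₂)
  open import Data.Rational as ℚ using (ℚ; 0ℚ; 1ℚ)
  import Data.Rational.Properties as ℚ
  import Data.Rational.Solver as ℚSolver
  open import Data.Sum using (_⊎_; inj₁; inj₂)
  open import Function using (_∘_)
  open import Relation.Binary.PropositionalEquality hiding (J)
  open import Relation.Nullary using (¬_; Dec; yes; no)
  open import Relation.Nullary.Decidable using (_×-dec_)
  open import Relation.Nullary.Negation using (contradiction)
  open Sequences using (*-nonneg; +-nonneg; 0≤1; ∣*∣≤; ∣∣≤)
  open Signed using (∣ᵤ⇒∣; ∣⇒∣ᵤ; ∣m∣n⇒∣m-n)

  -- Chebyshev's upper bound for primes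

  prime>1 : ∀ {p} → Prime p → 1 < p
  prime>1 {p} pp = nonTrivial⇒n>1 p {{prime⇒nonTrivial pp}}

  product-∣ : ∀ {ps n} → All Prime ps → Unique ps → All (_∣ n) ps → product ps ∣ n
  product-∣ {[]} {n} [] _ _ = 1∣ n
  product-∣ {p ∷ ps} {n} (pp ∷ pps) (p∉ ∷ uniq) (p∣n ∷ ps∣n) with product-∣ pps uniq ps∣n
  ... | divides c n≡cΠ with euclidsLemma c (product ps) pp (subst (p ∣_) n≡cΠ p∣n)
  ... | inj₁ (divides e c≡ep) = divides e (trans n≡cΠ (trans (cong (_* product ps) c≡ep) (*-assoc e p (product ps))))
  ... | inj₂ p∣Π = contradiction refl (All.lookup p∉ (factorisationHasAllPrimeFactors pp p∣Π pps))

  product-≥ : ∀ {ps n} → All (n ≤_) ps → n ^ length ps ≤ product ps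
  product-≥ [] = ≤-refl
  product-≥ (h ∷ hs) = *-mono-≤ h (product-≥ hs)

  C≤2^ : ∀ n k → n C k ≤ 2 ^ n
  C≤2^ n zero = m^n>0 2 n
  C≤2^ zero (suc k) = ≤-trans (≤-reflexive (k>n⇒nCk≡0 {0} {suc k} (s≤s z≤n))) z≤n
  C≤2^ (suc n) (suc k) = subst₂ _≤_ (nCk+nC[k+1]≡[n+1]C[k+1] n k) (cong (2 ^ n +_) (sym (+-identityʳ (2 ^ n))))
    (+-mono-≤ (C≤2^ n k) (C≤2^ n (suc k)))

  ∣! : ∀ {m n} → 1 ≤ m → m ≤ n → m ∣ n !
  ∣! {suc m} _ m≤n = ∣-trans (m∣m*n (m !)) (m≤n⇒m!∣n! m≤n)

  prime∣!⇒≤ : ∀ {p} n → Prime p → p ∣ n ! → p ≤ n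
  prime∣!⇒≤ zero pp p∣ = contradiction (∣1⇒≡1 p∣) (λ { refl → <-irrefl refl (prime>1 pp) })
  prime∣!⇒≤ (suc n) pp p∣ with euclidsLemma (suc n) (n !) pp p∣
  ... | inj₁ p∣1+n = ∣⇒≤ p∣1+n
  ... | inj₂ p∣n! = m≤n⇒m≤1+n (prime∣!⇒≤ n pp p∣n!)

  prime∣central : ∀ {p} n → Prime p → n < p → p ≤ n + n → p ∣ (n + n) C n
  prime∣central {p} n pp n<p p≤2n = case (euclidsLemma ((n + n) C n) (n ! * (n + n ∸ n) !) pp
      (subst (p ∣_) (sym eq) (∣! (<⇒≤ (prime>1 pp)) p≤2n)))
    where
    n≤2n = m≤m+n n n
    eq : ((n + n) C n) * (n ! * (n + n ∸ n) !) ≡ (n + n) !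
    eq = trans (cong (_* (n ! * (n + n ∸ n) !)) (nCk≡n!/k![n-k]! {n + n} {n} n≤2n))
      (m/n*n≡m {{n !* (n + n ∸ n) !≢0}} (k![n∸k]!∣n! {n + n} {n} n≤2n))
    ¬p∣n! : ¬ p ∣ n !
    ¬p∣n! h = <⇒≱ n<p (prime∣!⇒≤ n pp h)
    case : p ∣ (n + n) C n ⊎ p ∣ n ! * (n + n ∸ n) ! → p ∣ (n + n) C n
    case (inj₁ h) = h
    case (inj₂ h) with euclidsLemma (n !) ((n + n ∸ n) !) pp h
    ... | inj₁ k = contradiction k ¬p∣n!
    ... | inj₂ k = contradiction (subst (λ z → p ∣ z !) (m+n∸n≡m n n) k) ¬p∣n!

  2^-cancel-≤ : ∀ m n → 2 ^ m ≤ 2 ^ n → m ≤ n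
  2^-cancel-≤ m n h with m ≤? n
  ... | yes m≤n = m≤n
  ... | no m≰n = contradiction h (<⇒≱ (^-monoʳ-< 2 (s≤s (s≤s z≤n)) (≰⇒> m≰n)))

  primesIn : ℕ → List ℕ
  primesIn n = filter prime? (map (n +_) (range n))

  -- For `n = 2 ^ s` both sides of `n ^ length ps ≤ 4ⁿ` are powers of two, so comparing exponents
  -- replaces taking logarithms.
  primesIn-bound : ∀ s → s * length (primesIn (2 ^ s)) ≤ 2 * 2 ^ s
  primesIn-bound s = 2^-cancel-≤ (s * length ps) (2 * n) (begin
    2 ^ (s * length ps) ≡⟨ sym (^-*-assoc 2 s (length ps)) ⟩
    n ^ length ps ≤⟨ product-≥ {ps} (All.tabulate (<⇒≤ ∘ proj₁ ∘ proj₂ ∘ spec)) ⟩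
    product ps ≤⟨ ∣⇒≤ {{>-nonZero C>0}} (product-∣ (All.tabulate (proj₁ ∘ spec)) uniq
                               (All.tabulate (λ p∈ → let pp , n<p , p≤2n = spec p∈ in prime∣central n pp n<p p≤2n))) ⟩
    (n + n) C n ≤⟨ C≤2^ (n + n) n ⟩
    2 ^ (n + n) ≡⟨ cong (λ z → 2 ^ (n + z)) (sym (+-identityʳ n)) ⟩
    2 ^ (2 * n) ∎)
    where
    open ≤-Reasoning
    n = 2 ^ s
    ps = primesIn n
    spec : ∀ {p} → p ∈ ps → Prime p × n < p × p ≤ n + n
    spec p∈ with ∈-filter⁻ prime? {xs = map (n +_) (range n)} p∈
    ... | p∈map , pp with ∈-map⁻ (n +_) p∈map
    ... | j , j∈ , refl = pp , subst (_< n + j) (+-identityʳ n) (+-monoʳ-< n (proj₁ (∈-range⁻ j∈))) , +-monoʳ-≤ n (proj₂ (∈-range⁻ j∈))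
    uniq : Unique ps
    uniq = Unique.filter⁺ prime? (Unique.map⁺ (+-cancelˡ-≡ n _ _) (range-unique n))
    C>0 : (n + n) C n > 0
    C>0 = n≢0⇒n>0 λ e → <⇒≢ (n!>0 (n + n)) (sym (trans (sym (m/n*n≡m {{n !* (n + n ∸ n) !≢0}} (k![n∸k]!∣n! {n + n} {n} (m≤m+n n n))))
      (trans (cong (_* (n ! * (n + n ∸ n) !)) (sym (nCk≡n!/k![n-k]! {n + n} {n} (m≤m+n n n)))) (cong (_* (n ! * (n + n ∸ n) !)) e))))
      where
      n!>0 : ∀ m → m ! > 0
      n!>0 m = >-nonZero⁻¹ (m !) {{m !≢0}}

  dyadic : ∀ n → ∃ λ s → n < 2 ^ s × 2 ^ s ≤ 2 * n ⊎ n ≡ 0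
  dyadic zero = 0 , inj₂ refl
  dyadic (suc n) with dyadic n
  ... | s , inj₂ refl = 1 , inj₁ (s≤s (s≤s z≤n) , s≤s (s≤s z≤n))
  ... | s , inj₁ (lo , hi) with suc n <? 2 ^ s
  ... | yes h = s , inj₁ (h , ≤-trans hi (*-monoʳ-≤ 2 (n≤1+n n)))
  ... | no ¬h = suc s , inj₁ (<-≤-trans lt (*-monoʳ-≤ 2 lo) , *-monoʳ-≤ 2 (≮⇒≥ ¬h))
    where
    lt : suc n < 2 * suc n
    lt = m<m+n (suc n) (s≤s z≤n)

  module _ (em : ExcludedMiddle 0ℓ) where
    open Indicator em

    count-filter : ∀ {A : Set} {P : A → Set} (P? : ∀ a → Dec (P a)) xs → ∑ xs (𝟙 ∘ P) ≡ ι (length (filter P? xs))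
    count-filter P? [] = sym ι-0
    count-filter {P = P} P? (x ∷ xs) with P? x
    ... | no ¬p = trans (cong₂ ℚ._+_ (𝟙-false ¬p) (count-filter P? xs)) (ℚ.+-identityˡ (ι (length (filter P? xs))))
    ... | yes p = trans (cong₂ ℚ._+_ (𝟙-true p) (count-filter P? xs))
      (trans (ℚ.+-comm 1ℚ (ι (length (filter P? xs)))) (sym (ι-suc (length (filter P? xs)))))

    -- The primes in (n, 2n] divide the central binomial coefficient, which is at most 4ⁿ.
    module _ (κ : ℕ) where

      private
        f : ℕ → ℚ
        f p = 𝟙 (Prime p × 2 ^ κ < p)

      -- Discarding the primes up to `2 ^ κ` leaves blocks `(2 ^ s, 2 ^ (s + 1)]` with `κ ≤ s`. All
      -- of them can then use the same factor `κ` in place of their own `s`, and their bounds add up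
      -- geometrically.
      chebyshev-dyadic : ∀ s → ι κ ℚ.* ∑ (range (2 ^ s)) f ℚ.≤ ι (2 * 2 ^ s)
      chebyshev-dyadic s with s ≤? κ
      ... | yes s≤κ = subst (ℚ._≤ ι (2 * 2 ^ s)) (sym (trans (cong (ι κ ℚ.*_) (trans
            (∑-cong (range (2 ^ s)) (λ p∈ → 𝟙-false (λ (_ , lt) → <⇒≱ lt (≤-trans (proj₂ (∈-range⁻ p∈)) (^-monoʳ-≤ 2 s≤κ)))))
            (∑-zero (range (2 ^ s))))) (ℚ.*-zeroʳ (ι κ)))) (0≤ι (2 * 2 ^ s))
      chebyshev-dyadic zero | no s≰κ = contradiction z≤n s≰κ
      chebyshev-dyadic (suc s) | no s≰κ = begin
        ι κ ℚ.* ∑ (range (2 * n)) f ≡⟨ cong (λ z → ι κ ℚ.* ∑ (range (n + z)) f) (+-identityʳ n) ⟩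
        ι κ ℚ.* ∑ (range (n + n)) f ≡⟨ cong (ι κ ℚ.*_) (∑-range-+ n n f) ⟩
        ι κ ℚ.* (∑ (range n) f ℚ.+ ∑ (range n) (λ j → f (n + j))) ≡⟨ ℚ.*-distribˡ-+ (ι κ) (∑ (range n) f) (∑ (range n) (λ j → f (n + j))) ⟩
        ι κ ℚ.* ∑ (range n) f ℚ.+ ι κ ℚ.* ∑ (range n) (λ j → f (n + j)) ≤⟨ ℚ.+-mono-≤ (chebyshev-dyadic s) block ⟩
        ι (2 * n) ℚ.+ ι (2 * n) ≡⟨ sym (ι-+ (2 * n) (2 * n)) ⟩
        ι (2 * n + 2 * n) ≡⟨ cong (λ z → ι (2 * n + z)) (sym (+-identityʳ (2 * n))) ⟩
        ι (2 * (2 * n)) ∎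
        where
        open ℚ.≤-Reasoning
        n = 2 ^ s
        κ≤s : κ ≤ s
        κ≤s = ≤-pred (≰⇒> s≰κ)
        block : ι κ ℚ.* ∑ (range n) (λ j → f (n + j)) ℚ.≤ ι (2 * n)
        block = begin
          ι κ ℚ.* ∑ (range n) (λ j → f (n + j)) ≤⟨ *-monoˡ (0≤ι κ) (∑-mono (range n) (λ _ → 𝟙-mono proj₁)) ⟩
          ι κ ℚ.* ∑ (range n) (λ j → 𝟙 (Prime (n + j))) ≡⟨ cong (ι κ ℚ.*_) (sym (∑-map (n +_) (range n) (𝟙 ∘ Prime))) ⟩
          ι κ ℚ.* ∑ (map (n +_) (range n)) (𝟙 ∘ Prime) ≡⟨ cong (ι κ ℚ.*_) (count-filter prime? (map (n +_) (range n))) ⟩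
          ι κ ℚ.* ι (length (primesIn n)) ≡⟨ sym (ι-* κ (length (primesIn n))) ⟩
          ι (κ * length (primesIn n)) ≤⟨ ι-mono (≤-trans (*-monoˡ-≤ (length (primesIn n)) κ≤s) (primesIn-bound s)) ⟩
          ι (2 * n) ∎

      chebyshev : ∀ y → ι κ ℚ.* ∑ (range y) f ℚ.≤ ι (4 * y)
      chebyshev y with dyadic y
      ... | _ , inj₂ refl = ℚ.≤-reflexive (trans (ℚ.*-zeroʳ (ι κ)) (sym ι-0))
      ... | s , inj₁ (lo , hi) = ℚ.≤-trans (*-monoˡ (0≤ι κ) (∑-range-mono f (λ p → 0≤𝟙 _) (<⇒≤ lo)))
        (ℚ.≤-trans (chebyshev-dyadic s) (ι-mono (subst (2 * 2 ^ s ≤_) (sym (*-assoc 2 2 y)) (*-monoʳ-≤ 2 hi))))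

  -- Integers without a divisor in an interval

  greatest : ∀ {P : ℕ → Set} (P? : ∀ n → Dec (P n)) {b} → P b → ∀ B → b ≤ B
    → ∃ λ u → P u × u ≤ B × (∀ {w} → P w → w ≤ B → w ≤ u)
  greatest P? {b} pb zero z≤n = 0 , pb , z≤n , λ _ h → h
  greatest P? {b} pb (suc B) b≤ with P? (suc B)
  ... | yes p = suc B , p , ≤-refl , λ _ h → h
  ... | no ¬p with m≤n⇒m<n∨m≡n b≤
  ... | inj₂ refl = contradiction pb ¬p
  ... | inj₁ (s≤s b≤B) with greatest P? pb B b≤B
  ... | u , pu , u≤B , max = u , pu , m≤n⇒m≤1+n u≤B , λ {w} pw w≤ → case pw (m≤n⇒m<n∨m≡n w≤)
    where
    case : ∀ {w} → _ → w < suc B ⊎ w ≡ suc B → w ≤ u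
    case pw (inj₁ (s≤s h)) = max pw h
    case pw (inj₂ refl) = contradiction pw ¬p

  primeFactor : ∀ {n} → 1 < n → ∃ λ p → Prime p × p ∣ n
  primeFactor {n} 1<n = go (factors f) (isFactorisation f) (factorsPrime f)
    where
    open PrimeFactorisation
    f = factorise n {{>-nonZero (<⇒≤ 1<n)}}
    go : ∀ ps → n ≡ product ps → All Prime ps → ∃ λ p → Prime p × p ∣ n
    go [] e _ = contradiction e (≢-sym (<⇒≢ 1<n))
    go (p ∷ ps) e (pp ∷ _) = p , pp , subst (p ∣_) (sym e) (m∣m*n (product ps))

  m*n≤o⇒m≤o/n : ∀ m n o .{{_ : NonZero n}} → m * n ≤ o → m ≤ o / n
  m*n≤o⇒m≤o/n m n o h = subst (_≤ o / n) (m*n/n≡m m n) (/-monoˡ-≤ n h)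

  m*n>0⇒m>0 : ∀ m {n} → 1 ≤ m * n → 1 ≤ m
  m*n>0⇒m>0 (suc m) _ = s≤s z≤n

  m*n>0⇒n>0 : ∀ m {n} → 1 ≤ m * n → 1 ≤ n
  m*n>0⇒n>0 m {n} h = m*n>0⇒m>0 n (subst (1 ≤_) (*-comm m n) h)

  -- The numbers without prime factors up to `z`, phrased with all divisors above 1 so that
  -- primality stays out of the splitting argument.
  Rough : ℕ → ℕ → Set
  Rough z v = ∀ {w} → w ∣ v → 1 < w → z < w

  Avoids : ℕ → ℕ → ℕ → Set
  Avoids K₀ K₁ d = ∀ {k} → k ∣ d → K₀ ≤ k → K₁ < k

  -- Take `u` to be the largest divisor of `d` below `K₀`. If `w > 1` divides the cofactor, then
  -- `u * w` is a larger divisor, hence at least `K₀`, hence above `K₀ * z` by avoidance; as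
  -- `u < K₀`, this gives `w > z`.
  avoids-split : ∀ {K₀ z d} → 1 < K₀ → 1 ≤ d → Avoids K₀ (K₀ * z) d
    → ∃ λ u → ∃ λ v → d ≡ u * v × u < K₀ × Rough z v
  avoids-split {suc K} {z} {d} (s≤s 1≤K) 1≤d av with greatest (_∣? d) (1∣ d) K 1≤K
  ... | u , divides v d≡vu , u≤K , max = u , v , trans d≡vu (*-comm v u) , s≤s u≤K , rough
    where
    1≤u : 1 ≤ u
    1≤u = m*n>0⇒n>0 v (subst (1 ≤_) d≡vu 1≤d)
    rough : Rough z v
    rough {w} (divides c v≡cw) 1<w with u * w ≤? K
    ... | yes uw≤K = contradiction (max uw∣d uw≤K) (<⇒≱ u<uw)
      where
      uw∣d : u * w ∣ d
      uw∣d = divides c (trans d≡vu (trans (cong (_* u) v≡cw) (trans (*-assoc c w u) (cong (c *_) (*-comm w u)))))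
      u<uw : u < u * w
      u<uw = subst (_< u * w) (*-identityʳ u) (*-monoʳ-< u {{>-nonZero 1≤u}} 1<w)
    ... | no uw≰K = *-cancelˡ-< (suc K) z w (<-≤-trans (av uw∣d (≰⇒> uw≰K)) (*-monoˡ-≤ w (m≤n⇒m≤1+n u≤K)))
      where
      uw∣d : u * w ∣ d
      uw∣d = divides c (trans d≡vu (trans (cong (_* u) v≡cw) (trans (*-assoc c w u) (cong (c *_) (*-comm w u)))))

  rough-coprime : ∀ {z v j} → Rough z v → 1 ≤ j → j ≤ z → Coprime v j
  rough-coprime {z} {v} {j} rough 1≤j j≤z {zero} (_ , 0∣j) = contradiction (0∣⇒≡0 0∣j) (≢-sym (<⇒≢ 1≤j))
  rough-coprime {z} {v} {j} rough 1≤j j≤z {suc zero} _ = refl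
  rough-coprime {z} {v} {j} rough 1≤j j≤z {suc (suc w)} (w∣v , w∣j) =
    contradiction (≤-trans (∣⇒≤ {{>-nonZero 1≤j}} w∣j) j≤z) (<⇒≱ (rough w∣v (s≤s (s≤s z≤n))))

  -- A `z`-rough number is coprime to every positive number up to `z`, so `v * j ≡ v′ * j′` makes
  -- `v` and `v′` divide each other.
  rough-unique : ∀ {z v j v′ j′} → Rough z v → Rough z v′ → 1 ≤ j → j ≤ z → 1 ≤ j′ → j′ ≤ z
    → v * j ≡ v′ * j′ → v ≡ v′
  rough-unique {z} {v} {j} {v′} {j′} r r′ 1≤j j≤z 1≤j′ j′≤z e = ∣-antisym
    (coprime-divisor (rough-coprime r 1≤j′ j′≤z) (subst (v ∣_) (trans e (*-comm v′ j′)) (m∣m*n j)))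
    (coprime-divisor (rough-coprime r′ 1≤j j≤z) (subst (v′ ∣_) (trans (sym e) (*-comm v j)) (m∣m*n j′)))

  H : ℕ → ℚ
  H n = ∑ (range n) rc

  0≤H : ∀ n → 0ℚ ℚ.≤ H n
  0≤H n = ∑-nonneg (range n) (λ {k} _ → 0≤rc k)

  H-double : ∀ s → H (2 ^ suc s) ≡ H (2 ^ s) ℚ.+ ∑ (range (2 ^ s)) (λ j → rc (2 ^ s + j))
  H-double s = trans (cong (λ z → H (2 ^ s + z)) (+-identityʳ (2 ^ s))) (∑-range-+ (2 ^ s) (2 ^ s) rc)

  ∑-const : ∀ n c → ∑ (range n) (λ _ → c) ≡ c ℚ.* ι n
  ∑-const n c = trans (∑-cong (range n) (λ _ → sym (ℚ.*-identityʳ c)))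
    (trans (∑-*ˡ c (range n) (λ _ → 1ℚ)) (cong (c ℚ.*_) (∑-range-one n)))

  H-upper : ∀ s → H (2 ^ s) ℚ.≤ ι (suc s)
  H-upper zero = ℚ.≤-reflexive (trans (ℚ.+-identityʳ (rc 1)) (trans (rc-suc 0) (sym ι-1)))
  H-upper (suc s) = subst₂ ℚ._≤_ (sym (H-double s)) (sym (ι-suc (suc s))) (ℚ.+-mono-≤ (H-upper s)
    (ℚ.≤-trans (∑-mono (range n) (λ {j} _ → rc-anti (m^n>0 2 s) (m≤m+n n j)))
      (ℚ.≤-reflexive (trans (∑-const n (rc n)) (rc-inverse (m^n>0 2 s))))))
    where n = 2 ^ s

  H-lower : ∀ s → ι s ℚ.≤ ι 2 ℚ.* H (2 ^ s)
  H-lower zero = subst (ℚ._≤ ι 2 ℚ.* H 1) (sym ι-0) (*-nonneg (0≤ι 2) (0≤H 1))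
  H-lower (suc s) = begin
    ι (suc s) ≡⟨ ι-suc s ⟩
    ι s ℚ.+ 1ℚ ≤⟨ ℚ.+-mono-≤ (H-lower s) half ⟩
    ι 2 ℚ.* H n ℚ.+ ι 2 ℚ.* ∑ (range n) g ≡⟨ sym (ℚ.*-distribˡ-+ (ι 2) (H n) (∑ (range n) g)) ⟩
    ι 2 ℚ.* (H n ℚ.+ ∑ (range n) g) ≡⟨ cong (ι 2 ℚ.*_) (sym (H-double s)) ⟩
    ι 2 ℚ.* H (2 * n) ∎
    where
    open ℚ.≤-Reasoning
    n = 2 ^ s
    g = λ j → rc (n + j)
    half : 1ℚ ℚ.≤ ι 2 ℚ.* ∑ (range n) g
    half = begin
      1ℚ ≡⟨ sym (rc-inverse (m^n>0 2 (suc s))) ⟩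
      rc (2 * n) ℚ.* ι (2 * n) ≡⟨ cong (rc (2 * n) ℚ.*_) (ι-* 2 n) ⟩
      rc (2 * n) ℚ.* (ι 2 ℚ.* ι n) ≡⟨ solve 3 (λ a b c → a :* (b :* c) := b :* (a :* c)) refl (rc (2 * n)) (ι 2) (ι n) ⟩
      ι 2 ℚ.* (rc (2 * n) ℚ.* ι n) ≡⟨ cong (ι 2 ℚ.*_) (sym (∑-const n (rc (2 * n)))) ⟩
      ι 2 ℚ.* ∑ (range n) (λ _ → rc (2 * n)) ≤⟨ *-monoˡ (0≤ι 2) (∑-mono (range n) (λ {j} j∈ → rc-anti
            (≤-trans (m^n>0 2 s) (m≤m+n n j))
            (subst (n + j ≤_) (cong (n +_) (sym (+-identityʳ n))) (+-monoʳ-≤ n (proj₂ (∈-range⁻ j∈)))))) ⟩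
      ι 2 ℚ.* ∑ (range n) g ∎
      where open ℚSolver.+-*-Solver using (solve; _:*_; _:=_)

  module _ (em : ExcludedMiddle 0ℓ) where
    open Indicator em

    roughSum : ℕ → ℕ → ℚ
    roughSum z Y = ∑ (range Y) (λ v → 𝟙 (Rough z v) ℚ.* rc v)

    0≤roughSum : ∀ z Y → 0ℚ ℚ.≤ roughSum z Y
    0≤roughSum z Y = ∑-nonneg (range Y) (λ {v} _ → *-nonneg (0≤𝟙 (Rough z v)) (0≤rc v))

    -- A z-rough number times a number up to z determines both factors.
    roughSum-bound : ∀ z Y → roughSum z Y ℚ.* H z ℚ.≤ H (Y * z)
    roughSum-bound z Y = begin
      roughSum z Y ℚ.* H z ≡⟨ sym (∑-*ʳ (H z) (range Y) _) ⟩
      ∑ (range Y) (λ v → 𝟙 (Rough z v) ℚ.* rc v ℚ.* H z) ≡⟨ ∑-cong (range Y) (λ {v} _ → sym (∑-*ˡ (𝟙 (Rough z v) ℚ.* rc v) (range z) rc)) ⟩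
      ∑ (range Y) (λ v → ∑ (range z) (λ j → 𝟙 (Rough z v) ℚ.* rc v ℚ.* rc j)) ≡⟨ sym (∑-product (range Y) (range z) (λ (v , j) → 𝟙 (Rough z v) ℚ.* rc v ℚ.* rc j)) ⟩
      ∑ pairs (λ (v , j) → 𝟙 (Rough z v) ℚ.* rc v ℚ.* rc j) ≡⟨ ∑-cong pairs (λ {(v , j)} _ → ℚ.*-assoc (𝟙 (Rough z v)) (rc v) (rc j)) ⟩
      ∑ pairs (λ (v , j) → 𝟙 (Rough z v) ℚ.* (rc v ℚ.* rc j)) ≤⟨ ∑-injection {P = λ (v , j) → Rough z v} (λ (v , j) n → n ≡ v * j)
            (Unique.cartesianProduct⁺ (range-unique Y) (range-unique z)) 0≤rc total inj ⟩
      H (Y * z) ∎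
      where
      open ℚ.≤-Reasoning
      pairs = cartesianProduct (range Y) (range z)
      spec : ∀ {v j} → (v , j) ∈ pairs → (1 ≤ v × v ≤ Y) × (1 ≤ j × j ≤ z)
      spec vj∈ with ∈-cartesianProduct⁻ (range Y) (range z) vj∈
      ... | v∈ , j∈ = ∈-range⁻ v∈ , ∈-range⁻ j∈
      total : ∀ {a} → a ∈ pairs → Rough z (proj₁ a) → ∃ λ n → n ∈ range (Y * z) × n ≡ proj₁ a * proj₂ a × rc (proj₁ a) ℚ.* rc (proj₂ a) ℚ.≤ rc n
      total {v , j} vj∈ _ with spec vj∈
      ... | (1≤v , v≤Y) , (1≤j , j≤z) = v * j , ∈-range⁺ (*-mono-≤ 1≤v 1≤j) (*-mono-≤ v≤Y j≤z) , refl , ℚ.≤-reflexive (sym (rc-* 1≤v 1≤j))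
      inj : ∀ {a a′ n} → a ∈ pairs → a′ ∈ pairs → Rough z (proj₁ a) → Rough z (proj₁ a′)
        → n ≡ proj₁ a * proj₂ a → n ≡ proj₁ a′ * proj₂ a′ → a ≡ a′
      inj {v , j} {v′ , j′} a∈ a′∈ r r′ e e′ with spec a∈ | spec a′∈
      ... | (1≤v , _) , (1≤j , j≤z) | _ , (1≤j′ , j′≤z) with rough-unique r r′ 1≤j j≤z 1≤j′ j′≤z (trans (sym e) e′)
      ... | refl = cong (v ,_) (*-cancelˡ-≡ j j′ v {{>-nonZero 1≤v}} (trans (sym e) e′))

    avoidSum : ℕ → ℕ → ℕ → ℚ
    avoidSum K₀ z Y = ∑ (range Y) (λ m → 𝟙 (Avoids K₀ (K₀ * z) m) ℚ.* rc m)

    -- The weight 1/m is multiplicative, so the factorisation from `avoids-split` bounds the sum by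
    -- a product; pairs `(u , v)` that do not arise only enlarge the right side.
    avoidSum-bound : ∀ {K₀} z Y → 1 < K₀ → avoidSum K₀ z Y ℚ.≤ H K₀ ℚ.* roughSum z Y
    avoidSum-bound {K₀} z Y 1<K₀ = begin
      avoidSum K₀ z Y ≤⟨ ∑-injection {P = Avoids K₀ (K₀ * z)}
            (λ m (u , v) → m ≡ u * v) {g = λ (u , v) → rc u ℚ.* (𝟙 (Rough z v) ℚ.* rc v)} (range-unique Y)
            (λ (u , v) → *-nonneg (0≤rc u) (*-nonneg (0≤𝟙 (Rough z v)) (0≤rc v))) total
            (λ _ _ _ _ e e′ → trans e (sym e′)) ⟩
      ∑ pairs (λ (u , v) → rc u ℚ.* (𝟙 (Rough z v) ℚ.* rc v)) ≡⟨ ∑-product (range K₀) (range Y) _ ⟩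
      ∑ (range K₀) (λ u → ∑ (range Y) (λ v → rc u ℚ.* (𝟙 (Rough z v) ℚ.* rc v))) ≡⟨ ∑-cong (range K₀) (λ {u} _ → ∑-*ˡ (rc u) (range Y) _) ⟩
      ∑ (range K₀) (λ u → rc u ℚ.* roughSum z Y) ≡⟨ ∑-*ʳ (roughSum z Y) (range K₀) rc ⟩
      H K₀ ℚ.* roughSum z Y ∎
      where
      open ℚ.≤-Reasoning
      pairs = cartesianProduct (range K₀) (range Y)
      total : ∀ {m} → m ∈ range Y → Avoids K₀ (K₀ * z) m → ∃ λ b → b ∈ pairs × m ≡ proj₁ b * proj₂ b
        × rc m ℚ.≤ rc (proj₁ b) ℚ.* (𝟙 (Rough z (proj₂ b)) ℚ.* rc (proj₂ b))
      total {m} m∈ av with ∈-range⁻ m∈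
      ... | 1≤m , m≤Y with avoids-split 1<K₀ 1≤m av
      ... | u , v , refl , u<K₀ , r = (u , v) , ∈-cartesianProduct⁺ (∈-range⁺ 1≤u (<⇒≤ u<K₀)) (∈-range⁺ 1≤v (≤-trans v≤uv m≤Y)) , refl
              , ℚ.≤-reflexive (trans (rc-* 1≤u 1≤v) (cong (rc u ℚ.*_) (sym (trans (cong (ℚ._* rc v) (𝟙-true {Rough z v} r)) (ℚ.*-identityˡ (rc v))))))
        where
        1≤u = m*n>0⇒m>0 u 1≤m
        1≤v = m*n>0⇒n>0 u 1≤m
        v≤uv : v ≤ u * v
        v≤uv = subst (_≤ u * v) (*-identityˡ v) (*-monoˡ-≤ v 1≤u)

    -- d > K₀ avoiding [K₀, K₀ 2^κ] has a prime factor p > 2^κ, and d / p still avoids this interval.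
    avoids-count : ∀ {K₀} κ Y → 1 < K₀
      → ι κ ℚ.* ∑ (range Y) (λ d → 𝟙 (K₀ ≤ d × Avoids K₀ (K₀ * 2 ^ κ) d)) ℚ.≤ ι (4 * Y) ℚ.* avoidSum K₀ (2 ^ κ) Y
    avoids-count {K₀} κ Y 1<K₀ = begin
      ι κ ℚ.* ∑ (range Y) (λ d → 𝟙 (K₀ ≤ d × Av d)) ≤⟨ *-monoˡ (0≤ι κ) (count-injection {ys = pairs} {Q = λ (m , p) → Av m × Q m p}
            (λ d (m , p) → d ≡ p * m) (range-unique Y) total (λ _ _ _ _ e e′ → trans e (sym e′))) ⟩
      ι κ ℚ.* ∑ pairs (λ (m , p) → 𝟙 (Av m × Q m p)) ≡⟨ cong (ι κ ℚ.*_) (∑-product (range Y) (range Y) _) ⟩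
      ι κ ℚ.* ∑ (range Y) (λ m → ∑ (range Y) (λ p → 𝟙 (Av m × Q m p))) ≡⟨ sym (∑-*ˡ (ι κ) (range Y) _) ⟩
      ∑ (range Y) (λ m → ι κ ℚ.* ∑ (range Y) (λ p → 𝟙 (Av m × Q m p))) ≤⟨ ∑-mono (range Y) (λ {m} m∈ → each m (proj₁ (∈-range⁻ m∈))) ⟩
      ∑ (range Y) (λ m → ι (4 * Y) ℚ.* (𝟙 (Av m) ℚ.* rc m)) ≡⟨ ∑-*ˡ (ι (4 * Y)) (range Y) _ ⟩
      ι (4 * Y) ℚ.* avoidSum K₀ (2 ^ κ) Y ∎
      where
      open ℚ.≤-Reasoning
      pairs = cartesianProduct (range Y) (range Y)
      Av : ℕ → Set
      Av = Avoids K₀ (K₀ * 2 ^ κ)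
      Q : ℕ → ℕ → Set
      Q m p = (Prime p × 2 ^ κ < p) × p * m ≤ Y
      total : ∀ {d} → d ∈ range Y → K₀ ≤ d × Av d → ∃ λ b → b ∈ pairs × d ≡ proj₂ b * proj₁ b × (Av (proj₁ b) × Q (proj₁ b) (proj₂ b))
      total {d} d∈ (K₀≤d , av) with avoids-split 1<K₀ (proj₁ (∈-range⁻ d∈)) av
      ... | u , v , d≡uv , u<K₀ , r with primeFactor {v} 1<v
        where
        1<v : 1 < v
        1<v with 1 <? v
        ... | yes h = h
        ... | no ¬h = contradiction (subst (K₀ ≤_) d≡uv K₀≤d) (<⇒≱ (≤-<-trans (subst (u * v ≤_) (*-identityʳ u) (*-monoʳ-≤ u (≮⇒≥ ¬h))) u<K₀))
      ... | p , pp , divides c v≡cp = (u * c , p) , ∈-cartesianProduct⁺ (∈-range⁺ (m*n>0⇒n>0 p 1≤pm) (≤-trans m≤pm pm≤Y)) (∈-range⁺ (m*n>0⇒m>0 p 1≤pm) (≤-trans p≤pm pm≤Y))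
              , d≡pm , (λ k∣m → av (∣-trans k∣m (divides p d≡pm))) , (pp , r (divides c v≡cp) (prime>1 pp)) , pm≤Y
        where
        d≡pm : d ≡ p * (u * c)
        d≡pm = trans d≡uv (trans (cong (u *_) v≡cp) (trans (sym (*-assoc u c p)) (*-comm (u * c) p)))
        1≤pm : 1 ≤ p * (u * c)
        1≤pm = subst (1 ≤_) d≡pm (proj₁ (∈-range⁻ d∈))
        pm≤Y : p * (u * c) ≤ Y
        pm≤Y = subst (_≤ Y) d≡pm (proj₂ (∈-range⁻ d∈))
        m≤pm : u * c ≤ p * (u * c)
        m≤pm = m≤n*m (u * c) p {{prime⇒nonZero pp}}
        p≤pm : p ≤ p * (u * c)
        p≤pm = m≤m*n p (u * c) {{>-nonZero (m*n>0⇒n>0 p 1≤pm)}}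
      -- For fixed `m` the primes run up to `Y / m`. Since only `p > 2 ^ κ` occur, Chebyshev's bound
      -- keeps its factor 1/`κ` however small `Y / m` is, and the sum over `m` becomes one of
      -- reciprocals.
      each : ∀ m → 1 ≤ m → ι κ ℚ.* ∑ (range Y) (λ p → 𝟙 (Av m × Q m p)) ℚ.≤ ι (4 * Y) ℚ.* (𝟙 (Av m) ℚ.* rc m)
      each m@(suc _) 1≤m = begin
        ι κ ℚ.* ∑ (range Y) (λ p → 𝟙 (Av m × Q m p)) ≡⟨ cong (ι κ ℚ.*_) (trans (∑-cong (range Y) (λ {p} _ → 𝟙-× (Av m) (Q m p))) (∑-*ˡ (𝟙 (Av m)) (range Y) _)) ⟩
        ι κ ℚ.* (𝟙 (Av m) ℚ.* ∑ (range Y) (λ p → 𝟙 (Q m p))) ≤⟨ *-monoˡ (0≤ι κ) (*-monoˡ (0≤𝟙 (Av m)) (count-injection {ys = range (Y / m)} {Q = λ p → Prime p × 2 ^ κ < p} _≡_ (range-unique Y)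
              (λ p∈ (pp , le) → _ , ∈-range⁺ (proj₁ (∈-range⁻ p∈)) (m*n≤o⇒m≤o/n _ m Y le) , refl , pp) (λ { _ _ _ _ refl refl → refl }))) ⟩
        ι κ ℚ.* (𝟙 (Av m) ℚ.* π) ≡⟨ swap (ι κ) (𝟙 (Av m)) π ⟩
        𝟙 (Av m) ℚ.* (ι κ ℚ.* π) ≤⟨ *-monoˡ (0≤𝟙 (Av m)) (ℚ.≤-trans (chebyshev em κ (Y / m)) (≤-rc 1≤m
              (subst (ℚ._≤ ι (4 * Y)) (ι-* (4 * (Y / m)) m) (ι-mono (subst (_≤ 4 * Y) (sym (*-assoc 4 (Y / m) m)) (*-monoʳ-≤ 4 (m/n*n≤m Y m))))))) ⟩
        𝟙 (Av m) ℚ.* (ι (4 * Y) ℚ.* rc m) ≡⟨ swap (𝟙 (Av m)) (ι (4 * Y)) (rc m) ⟩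
        ι (4 * Y) ℚ.* (𝟙 (Av m) ℚ.* rc m) ∎
        where
        π = ∑ (range (Y / m)) (λ p → 𝟙 (Prime p × 2 ^ κ < p))
        open ℚSolver.+-*-Solver using (solve; _:*_; _:=_)
        swap : ∀ a b c → a ℚ.* (b ℚ.* c) ≡ b ℚ.* (a ℚ.* c)
        swap = solve 3 (λ a b c → a :* (b :* c) := b :* (a :* c)) refl

    -- One factor `κ` comes from Chebyshev's bound, the other from the rough numbers through
    -- `H (2 ^ κ) ≥ κ / 2`. Against them stand `H (2 ^ α) ≤ α + 1` and
    -- `H (2 ^ (β + κ)) ≤ β + κ + 1`, so for `β = O(κ)` the count falls below `2 ^ β` by a factor of
    -- order `(α + 1) / κ`.
    sieve : ∀ κ α β → 1 ≤ α
      → ι κ ℚ.* ι κ ℚ.* ∑ (range (2 ^ β)) (λ d → 𝟙 (2 ^ α ≤ d × Avoids (2 ^ α) (2 ^ α * 2 ^ κ) d))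
        ℚ.≤ ι (8 * 2 ^ β * (suc α * suc (β + κ)))
    sieve κ α β 1≤α = begin
      ι κ ℚ.* ι κ ℚ.* N ≡⟨ ℚ.*-assoc (ι κ) (ι κ) N ⟩
      ι κ ℚ.* (ι κ ℚ.* N) ≤⟨ *-monoˡ (0≤ι κ) (avoids-count κ Y 1<K₀) ⟩
      ι κ ℚ.* (ι (4 * Y) ℚ.* avoidSum K₀ K Y) ≤⟨ *-monoˡ (0≤ι κ) (*-monoˡ (0≤ι (4 * Y)) (avoidSum-bound K Y 1<K₀)) ⟩
      ι κ ℚ.* (ι (4 * Y) ℚ.* (H K₀ ℚ.* R)) ≡⟨ solve 4 (λ a b c d → a :* (b :* (c :* d)) := b :* c :* (a :* d)) refl (ι κ) (ι (4 * Y)) (H K₀) R ⟩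
      ι (4 * Y) ℚ.* H K₀ ℚ.* (ι κ ℚ.* R) ≤⟨ *-monoˡ (*-nonneg (0≤ι (4 * Y)) (0≤H K₀)) (*-monoʳ (0≤roughSum K Y) (H-lower κ)) ⟩
      ι (4 * Y) ℚ.* H K₀ ℚ.* (ι 2 ℚ.* H K ℚ.* R) ≡⟨ solve 5 (λ a b c d e → a :* b :* (c :* d :* e) := a :* c :* (b :* (e :* d))) refl (ι (4 * Y)) (H K₀) (ι 2) (H K) R ⟩
      ι (4 * Y) ℚ.* ι 2 ℚ.* (H K₀ ℚ.* (R ℚ.* H K)) ≤⟨ *-monoˡ (*-nonneg (0≤ι (4 * Y)) (0≤ι 2)) (Sequences.*-mono (0≤H K₀) (H-upper α)
            (*-nonneg (0≤roughSum K Y) (0≤H K)) (ℚ.≤-trans (roughSum-bound K Y)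
            (subst (λ z → H z ℚ.≤ ι (suc (β + κ))) (^-distribˡ-+-* 2 β κ) (H-upper (β + κ))))) ⟩
      ι (4 * Y) ℚ.* ι 2 ℚ.* (ι (suc α) ℚ.* ι (suc (β + κ))) ≡⟨ cong₂ ℚ._*_ (sym (ι-* (4 * Y) 2)) (sym (ι-* (suc α) (suc (β + κ)))) ⟩
      ι (4 * Y * 2) ℚ.* ι (suc α * suc (β + κ)) ≡⟨ sym (ι-* (4 * Y * 2) (suc α * suc (β + κ))) ⟩
      ι (4 * Y * 2 * (suc α * suc (β + κ))) ≡⟨ cong (λ z → ι (z * (suc α * suc (β + κ)))) (trans (*-comm (4 * Y) 2) (sym (*-assoc 2 4 Y))) ⟩
      ι (8 * Y * (suc α * suc (β + κ))) ∎
      where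
      open ℚ.≤-Reasoning
      open ℚSolver.+-*-Solver using (solve; _:*_; _:=_)
      Y = 2 ^ β
      K₀ = 2 ^ α
      K = 2 ^ κ
      R = roughSum K Y
      N = ∑ (range Y) (λ d → 𝟙 (K₀ ≤ d × Avoids K₀ (K₀ * K) d))
      1<K₀ : 1 < K₀
      1<K₀ = ^-monoʳ-< 2 (s≤s (s≤s z≤n)) 1≤α

  -- Square parts of integers

  Squarefree : ℕ → Set
  Squarefree s = ∀ {g} → g * g ∣ s → g ≡ 1

  coprime-*ʳ : ∀ {m n o} → Coprime m n → Coprime m o → Coprime m (n * o)
  coprime-*ʳ cn co (d∣m , d∣no) = co (d∣m , coprime-divisor (λ (e∣d , e∣n) → cn (∣-trans e∣d d∣m , e∣n)) d∣no)

  coprime-square : ∀ {m n} → Coprime m n → Coprime (m * m) (n * n)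
  coprime-square {m} {n} c = Coprimality.sym (coprime-*ʳ n²⊥m n²⊥m)
    where
    n²⊥m : Coprime (n * n) m
    n²⊥m = Coprimality.sym (coprime-*ʳ c c)

  squarefree-part : ∀ {m} → 1 ≤ m → ∃ λ r → ∃ λ s → m ≡ r * r * s × Squarefree s
  squarefree-part {m} 1≤m with greatest (λ r → (r * r) ∣? m) (1∣ m) m 1≤m
  ... | r , divides s m≡srr , _ , max = r , s , m≡rrs , sqf
    where
    m≡rrs : m ≡ r * r * s
    m≡rrs = trans m≡srr (*-comm s (r * r))
    1≤rr : 1 ≤ r * r
    1≤rr = m*n>0⇒m>0 (r * r) (subst (1 ≤_) m≡rrs 1≤m)
    1≤r : 1 ≤ r
    1≤r = m*n>0⇒m>0 r 1≤rr
    1≤s : 1 ≤ s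
    1≤s = m*n>0⇒n>0 (r * r) (subst (1 ≤_) m≡rrs 1≤m)
    sqf : Squarefree s
    sqf {g} gg∣s@(divides c s≡cgg) = ≤-antisym (*-cancelˡ-≤ r {{>-nonZero 1≤r}} (subst (r * g ≤_) (sym (*-identityʳ r)) (max rg∣m rg≤m))) 1≤g
      where
      rg∣m : (r * g) * (r * g) ∣ m
      rg∣m = divides c (trans m≡rrs (trans (cong (r * r *_) s≡cgg)
        (solve 3 (λ r c g → r :* r :* (c :* (g :* g)) := c :* ((r :* g) :* (r :* g))) refl r c g)))
        where open +-*-Solver
      1≤g : 1 ≤ g
      1≤g = m*n>0⇒m>0 g (m*n>0⇒n>0 c (subst (1 ≤_) s≡cgg 1≤s))
      rg≤m : r * g ≤ m
      rg≤m = ≤-trans (m≤m*n (r * g) (r * g) {{>-nonZero (*-mono-≤ 1≤r 1≤g)}}) (∣⇒≤ {{>-nonZero 1≤m}} rg∣m)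

  -- Dividing `k` and `k′` by their gcd leaves `s α² = s′ β²` with `α` and `β` coprime. Then `α²`
  -- divides `s′` and `β²` divides `s`, so both are 1.
  squarefree-unique : ∀ {s k s′ k′} → Squarefree s → Squarefree s′ → 1 ≤ k → s * (k * k) ≡ s′ * (k′ * k′) → k ≡ k′
  squarefree-unique {s} {k} {s′} {k′} sq sq′ 1≤k e = trans k≡αg (trans (cong (_* g) (trans α≡1 (sym β≡1))) (sym k′≡βg))
    where
    open +-*-Solver
    g = gcd k k′
    1≤g : 1 ≤ g
    1≤g = n≢0⇒n>0 (gcd[m,n]≢0 k k′ (inj₁ (≢-sym (<⇒≢ 1≤k))))
    instance
      _ = >-nonZero 1≤g
      gg≢0 : NonZero (g * g)
      gg≢0 = >-nonZero (*-mono-≤ 1≤g 1≤g)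
    α = k / g
    β = k′ / g
    k≡αg : k ≡ α * g
    k≡αg = sym (m/n*n≡m (gcd[m,n]∣m k k′))
    k′≡βg : k′ ≡ β * g
    k′≡βg = sym (m/n*n≡m (gcd[m,n]∣n k k′))
    shape : ∀ s α g → s * ((α * g) * (α * g)) ≡ s * (α * α) * (g * g)
    shape = solve 3 (λ s α g → s :* ((α :* g) :* (α :* g)) := s :* (α :* α) :* (g :* g)) refl
    eq : s * (α * α) ≡ s′ * (β * β)
    eq = *-cancelʳ-≡ (s * (α * α)) (s′ * (β * β)) (g * g) (trans (sym (shape s α g))
      (trans (cong (λ z → s * (z * z)) (sym k≡αg)) (trans e (trans (cong (λ z → s′ * (z * z)) k′≡βg) (shape s′ β g)))))
    c : Coprime α β
    c = coprime-/gcd k k′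
    α≡1 : α ≡ 1
    α≡1 = sq′ {α} (coprime-divisor (coprime-square c) (subst (α * α ∣_) (trans eq (*-comm s′ (β * β))) (n∣m*n s)))
    β≡1 : β ≡ 1
    β≡1 = sq {β} (coprime-divisor (coprime-square (Coprimality.sym c)) (subst (β * β ∣_) (trans (sym eq) (*-comm s (α * α))) (n∣m*n s′)))

  module _ (em : ExcludedMiddle 0ℓ) where
    open Indicator em

    multiples-count : ∀ {D} N M → 1 ≤ D → ∑ (range N) (λ s → 𝟙 (D * s ≤ M)) ℚ.≤ ι M ℚ.* rc D
    multiples-count {D@(suc _)} N M 1≤D = ℚ.≤-trans
      (subst (∑ (range N) (λ s → 𝟙 (D * s ≤ M)) ℚ.≤_) (trans (sym (∑-one (range (M / D)))) (∑-range-one (M / D)))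
        (count-length {ys = range (M / D)} _≡_ (range-unique N)
          (λ {s} s∈ le → s , ∈-range⁺ (proj₁ (∈-range⁻ s∈)) (m*n≤o⇒m≤o/n s D M (subst (_≤ M) (*-comm D s) le)) , refl)
          (λ { _ _ _ _ refl refl → refl })))
      (≤-rc 1≤D (subst (ℚ._≤ ι M) (ι-* (M / D) D) (ι-mono (m/n*n≤m M D))))

    -- Telescoping: `go` carries the extra summand `rc N`, and 1/(N+1)² ≤ 1/N - 1/(N+1) keeps the
    -- total from growing.
    square-tail : ∀ {ρ} N → 1 ≤ ρ → ∑ (range N) (λ r → 𝟙 (ρ < r) ℚ.* rc (r * r)) ℚ.≤ rc ρ
    square-tail {ρ} N 1≤ρ with N ≤? ρ
    ... | yes N≤ρ = subst (ℚ._≤ rc ρ) (sym (trans (∑-cong (range N) (λ {r} r∈ →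
              trans (cong (ℚ._* rc (r * r)) (𝟙-false (≤⇒≯ (≤-trans (proj₂ (∈-range⁻ r∈)) N≤ρ)))) (ℚ.*-zeroˡ (rc (r * r))))) (∑-zero (range N)))) (0≤rc ρ)
    ... | no N≰ρ = ℚ.≤-trans (≤-+ʳ (0≤rc N)) (go N (<⇒≤ (≰⇒> N≰ρ)))
      where
      f : ℕ → ℚ
      f r = 𝟙 (ρ < r) ℚ.* rc (r * r)
      step : ∀ N → 1 ≤ N → f (suc N) ℚ.+ rc (suc N) ℚ.≤ rc N
      step N 1≤N = ℚ.≤-trans (ℚ.+-monoˡ-≤ (rc (suc N)) (*-≤ˡ (0≤rc (suc N * suc N)) (𝟙≤1 _)))
        (ℚ.≤-trans (ℚ.≤-reflexive eq) (rc-≤ (s≤s z≤n) (begin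
          rc (suc N) ℚ.+ 1ℚ ≤⟨ ℚ.+-monoˡ-≤ 1ℚ (rc-anti 1≤N (n≤1+n N)) ⟩
          rc N ℚ.+ 1ℚ ≡⟨ ℚ.+-comm (rc N) 1ℚ ⟩
          1ℚ ℚ.+ rc N ≡⟨ cong₂ ℚ._+_ (sym (rc-inverse 1≤N)) (sym (ℚ.*-identityʳ (rc N))) ⟩
          rc N ℚ.* ι N ℚ.+ rc N ℚ.* 1ℚ ≡⟨ sym (ℚ.*-distribˡ-+ (rc N) (ι N) 1ℚ) ⟩
          rc N ℚ.* (ι N ℚ.+ 1ℚ) ≡⟨ cong (rc N ℚ.*_) (sym (ι-suc N)) ⟩
          rc N ℚ.* ι (suc N) ∎)))
        where
        open ℚ.≤-Reasoning
        t = rc (suc N)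
        eq : rc (suc N * suc N) ℚ.+ t ≡ (t ℚ.+ 1ℚ) ℚ.* t
        eq = trans (cong (ℚ._+ t) (rc-* {suc N} {suc N} (s≤s z≤n) (s≤s z≤n)))
          (ℚS.solve 1 (λ t → t ℚS.:* t ℚS.:+ t ℚS.:= (t ℚS.:+ ℚS.con 1ℚ) ℚS.:* t) refl t)
          where module ℚS = ℚSolver.+-*-Solver
      go : ∀ N → ρ ≤ N → ∑ (range N) f ℚ.+ rc N ℚ.≤ rc ρ
      go N ρ≤N with m≤n⇒m<n∨m≡n ρ≤N
      ... | inj₂ refl = ℚ.≤-reflexive (trans (cong (ℚ._+ rc ρ) (trans (∑-cong (range ρ) (λ {r} r∈ →
              trans (cong (ℚ._* rc (r * r)) (𝟙-false (≤⇒≯ (proj₂ (∈-range⁻ r∈))))) (ℚ.*-zeroˡ (rc (r * r))))) (∑-zero (range ρ)))) (ℚ.+-identityˡ (rc ρ)))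
      go (suc N) _ | inj₁ (s≤s ρ≤N) = begin
        ∑ (range (suc N)) f ℚ.+ rc (suc N) ≡⟨ cong (ℚ._+ rc (suc N)) (∑-suc N f) ⟩
        ∑ (range N) f ℚ.+ f (suc N) ℚ.+ rc (suc N) ≡⟨ ℚ.+-assoc (∑ (range N) f) (f (suc N)) (rc (suc N)) ⟩
        ∑ (range N) f ℚ.+ (f (suc N) ℚ.+ rc (suc N)) ≤⟨ ℚ.+-monoʳ-≤ (∑ (range N) f) (step N (≤-trans 1≤ρ ρ≤N)) ⟩
        ∑ (range N) f ℚ.+ rc N ≤⟨ go N ρ≤N ⟩
        rc ρ ∎
        where open ℚ.≤-Reasoning

    square-tail-count : ∀ {ρ} N M → 1 ≤ ρ
      → ∑ (cartesianProduct (range N) (range N)) (λ (r , s) → 𝟙 (ρ < r × r * r * s ≤ M)) ℚ.≤ ι M ℚ.* rc ρ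
    square-tail-count {ρ} N M 1≤ρ = begin
      ∑ (cartesianProduct (range N) (range N)) (λ (r , s) → 𝟙 (ρ < r × r * r * s ≤ M)) ≡⟨ ∑-product (range N) (range N) _ ⟩
      ∑ (range N) (λ r → ∑ (range N) (λ s → 𝟙 (ρ < r × r * r * s ≤ M))) ≡⟨ ∑-cong (range N) (λ {r} _ → trans (∑-cong (range N) (λ {s} _ → 𝟙-× (ρ < r) (r * r * s ≤ M))) (∑-*ˡ (𝟙 (ρ < r)) (range N) _)) ⟩
      ∑ (range N) (λ r → 𝟙 (ρ < r) ℚ.* ∑ (range N) (λ s → 𝟙 (r * r * s ≤ M))) ≤⟨ ∑-mono (range N) (λ {r} r∈ → *-monoˡ (0≤𝟙 (ρ < r)) (multiples-count N M (*-mono-≤ (proj₁ (∈-range⁻ r∈)) (proj₁ (∈-range⁻ r∈))))) ⟩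
      ∑ (range N) (λ r → 𝟙 (ρ < r) ℚ.* (ι M ℚ.* rc (r * r))) ≡⟨ ∑-cong (range N) (λ {r} _ → swap (𝟙 (ρ < r)) (ι M) (rc (r * r))) ⟩
      ∑ (range N) (λ r → ι M ℚ.* (𝟙 (ρ < r) ℚ.* rc (r * r))) ≡⟨ ∑-*ˡ (ι M) (range N) _ ⟩
      ι M ℚ.* ∑ (range N) (λ r → 𝟙 (ρ < r) ℚ.* rc (r * r)) ≤⟨ *-monoˡ (0≤ι M) (square-tail N 1≤ρ) ⟩
      ι M ℚ.* rc ρ ∎
      where
      open ℚ.≤-Reasoning
      open ℚSolver.+-*-Solver using (solve; _:*_; _:=_)
      swap : ∀ a b c → a ℚ.* (b ℚ.* c) ≡ b ℚ.* (a ℚ.* c)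
      swap = solve 3 (λ a b c → a :* (b :* c) := b :* (a :* c)) refl

  -- Counting the pairs (d, m) with d² m in a residue class

  length-product : ∀ {A B : Set} (xs : List A) (ys : List B) → length (cartesianProduct xs ys) ≡ length xs * length ys
  length-product [] ys = refl
  length-product (x ∷ xs) ys = trans (List.length-++ (map (x ,_) ys)) (cong₂ _+_ (List.length-map (x ,_) ys) (length-product xs ys))

  length-range : ∀ n → length (range n) ≡ n
  length-range n = trans (List.length-map suc (upTo n)) (List.length-upTo n)

  -- The residue class of a enters through two properties: its members differ by multiples of `q`,
  -- and none of them is divisible by `q`.
  module Pairs (em : ExcludedMiddle 0ℓ) (q : ℕ) (pq : Prime q) (Cong : ℕ → Set)
    (cong-diff : ∀ {m n} → Cong m → Cong n → m ≤ n → q ∣ n ∸ m) (cong-unit : ∀ {n} → Cong n → ¬ q ∣ n) (x : ℕ) where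

    open Indicator em

    instance
      q≢0 : NonZero q
      q≢0 = prime⇒nonZero pq

    Sol : ℕ → ℕ → Set
    Sol d m = d * d * m ≤ x × Cong (d * d * m)

    pairs : List (ℕ × ℕ)
    pairs = cartesianProduct (range x) (range x)

    pairs-unique : Unique pairs
    pairs-unique = Unique.cartesianProduct⁺ (range-unique x) (range-unique x)

    ∈-pairs⁻ : ∀ {d m} → (d , m) ∈ pairs → 1 ≤ d × 1 ≤ m
    ∈-pairs⁻ dm∈ with ∈-cartesianProduct⁻ (range x) (range x) dm∈
    ... | d∈ , m∈ = proj₁ (∈-range⁻ d∈) , proj₁ (∈-range⁻ m∈)

    cancel-≤ : ∀ {c A B} → Cong (c * A) → Cong (c * B) → A ≤ B → B < q → A ≡ B
    cancel-≤ {c} {A} {B} hA hB A≤B B<q with euclidsLemma c (B ∸ A) pq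
        (subst (q ∣_) (sym (*-distribˡ-∸ c B A)) (cong-diff hA hB (*-monoʳ-≤ c A≤B)))
    ... | inj₁ q∣c = contradiction (∣-trans q∣c (m∣m*n A)) (cong-unit hA)
    ... | inj₂ q∣B-A with B ∸ A in eq
    ... | zero = ≤-antisym A≤B (m∸n≡0⇒m≤n eq)
    ... | suc k = contradiction (∣⇒≤ q∣B-A) (<⇒≱ (≤-<-trans (≤-trans (≤-reflexive (sym eq)) (m∸n≤m B A)) B<q))

    cong-cancel : ∀ {c A B} → Cong (c * A) → Cong (c * B) → A < q → B < q → A ≡ B
    cong-cancel {c} {A} {B} hA hB A<q B<q with ≤-total A B
    ... | inj₁ A≤B = cancel-≤ {c} hA hB A≤B B<q
    ... | inj₂ B≤A = sym (cancel-≤ {c} hB hA B≤A A<q)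

    -- The residue class of d² determines d inside each interval of length q/2.
    root-≤ : ∀ {d d′ m} → Cong (d * d * m) → Cong (d′ * d′ * m) → (2 * d) / q ≡ (2 * d′) / q → d ≤ d′ → d ≡ d′
    root-≤ {d} {d′} {m} h h′ same d≤d′ with euclidsLemma ((d′ ∸ d) * (d + d′)) m pq (subst (q ∣_) factor (cong-diff h h′ (*-monoˡ-≤ m (*-mono-≤ d≤d′ d≤d′))))
      where
      factor : d′ * d′ * m ∸ d * d * m ≡ (d′ ∸ d) * (d + d′) * m
      factor = trans (sym (*-distribʳ-∸ m (d′ * d′) (d * d))) (cong (_* m) (begin-equality
        d′ * d′ ∸ d * d ≡⟨ cong (λ z → z * z ∸ d * d) (sym (m+[n∸m]≡n d≤d′)) ⟩
        (d + e) * (d + e) ∸ d * d ≡⟨ cong (_∸ d * d) (solve 2 (λ d e → (d :+ e) :* (d :+ e) := e :* (d :+ (d :+ e)) :+ d :* d) refl d e) ⟩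
        e * (d + (d + e)) + d * d ∸ d * d ≡⟨ m+n∸n≡m (e * (d + (d + e))) (d * d) ⟩
        e * (d + (d + e)) ≡⟨ cong (λ z → e * (d + z)) (m+[n∸m]≡n d≤d′) ⟩
        e * (d + d′) ∎))
        where
        open ≤-Reasoning
        open +-*-Solver
        e = d′ ∸ d
    ... | inj₂ q∣m = contradiction (∣-trans q∣m (n∣m*n (d * d))) (cong-unit h)
    ... | inj₁ q∣ed with euclidsLemma (d′ ∸ d) (d + d′) pq q∣ed
    ... | inj₁ q∣e with d′ ∸ d in eq
    ... | zero = ≤-antisym d≤d′ (m∸n≡0⇒m≤n eq)
    ... | suc k = contradiction (∣⇒≤ q∣e) (<⇒≱ (≤-<-trans (≤-reflexive (sym eq)) (small)))
      where
      j = (2 * d) / q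
      lo : j * q ≤ 2 * d
      lo = m/n*n≤m (2 * d) q
      hi : 2 * d′ < q + j * q
      hi = subst (2 * d′ <_) (cong (λ z → q + z * q) (sym same)) (subst (_< q + (2 * d′) / q * q) (sym (m≡m%n+[m/n]*n (2 * d′) q)) (+-monoˡ-< ((2 * d′) / q * q) (m%n<n (2 * d′) q)))
      small : d′ ∸ d < q
      small = *-cancelˡ-< 2 (d′ ∸ d) q (subst (_< 2 * q) (sym (*-distribˡ-∸ 2 d′ d)) (<-≤-trans (≤-<-trans (∸-monoʳ-≤ (2 * d′) lo)
        (subst (2 * d′ ∸ j * q <_) (m+n∸n≡m q (j * q)) (∸-monoˡ-< hi (≤-trans lo (*-monoʳ-≤ 2 d≤d′))))) (m≤m+n q (q + 0))))
    -- Case `d + d′ = c * q`. Both `2 * d` and `2 * d′` lie in `[j q, (j + 1) q)`, so `c < j + 1`;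
    -- then `d + d′ ≤ j q ≤ 2 * d` forces `d′ ≤ d`.
    root-≤ {d} {d′} {m} h h′ same d≤d′ | inj₁ q∣ed | inj₂ (divides c d+d′≡cq) = ≤-antisym d≤d′ (*-cancelˡ-≤ 2 2d′≤2d)
      where
      j = (2 * d) / q
      lo : j * q ≤ 2 * d
      lo = m/n*n≤m (2 * d) q
      hi : ∀ d → 2 * d < q + (2 * d) / q * q
      hi d = subst (_< q + (2 * d) / q * q) (sym (m≡m%n+[m/n]*n (2 * d) q)) (+-monoˡ-< ((2 * d) / q * q) (m%n<n (2 * d) q))
      double : ∀ c q → c * q + c * q ≡ 2 * c * q
      double = solve 2 (λ c q → c :* q :+ c :* q := con 2 :* c :* q) refl
        where open +-*-Solver
      c≤j : c ≤ j
      c≤j = ≤-pred (*-cancelʳ-< q c (suc j) (*-cancelˡ-< 2 (c * q) (suc j * q) (begin-strict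
        2 * (c * q) ≡⟨ cong (2 *_) (sym d+d′≡cq) ⟩
        2 * (d + d′) ≡⟨ *-distribˡ-+ 2 d d′ ⟩
        2 * d + 2 * d′ <⟨ +-mono-< (hi d) (subst (λ z → 2 * d′ < q + z * q) (sym same) (hi d′)) ⟩
        (q + j * q) + (q + j * q) ≡⟨ cong (q + j * q +_) (sym (+-identityʳ (q + j * q))) ⟩
        2 * (suc j * q) ∎)))
        where open ≤-Reasoning
      2d′≤2d : 2 * d′ ≤ 2 * d
      2d′≤2d = +-cancelˡ-≤ (2 * d) (2 * d′) (2 * d) (begin
        2 * d + 2 * d′ ≡⟨ sym (*-distribˡ-+ 2 d d′) ⟩
        2 * (d + d′) ≡⟨ cong (2 *_) d+d′≡cq ⟩
        2 * (c * q) ≤⟨ *-monoʳ-≤ 2 (*-monoˡ-≤ q c≤j) ⟩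
        2 * (j * q) ≤⟨ *-monoʳ-≤ 2 lo ⟩
        2 * (2 * d) ≡⟨ cong (2 * d +_) (+-identityʳ (2 * d)) ⟩
        2 * d + 2 * d ∎)
        where open ≤-Reasoning

    root-unique : ∀ {d d′ m} → Cong (d * d * m) → Cong (d′ * d′ * m) → (2 * d) / q ≡ (2 * d′) / q → d ≡ d′
    root-unique {d} {d′} h h′ same with ≤-total d d′
    ... | inj₁ d≤d′ = root-≤ h h′ same d≤d′
    ... | inj₂ d′≤d = sym (root-≤ h′ h (sym same) d′≤d)

    -- A pair is recovered from `m` and the index of the interval of length q/2 that contains `d`.
    -- The index is shifted by one because `range` starts at 1.
    pairs-count : ∀ {P : ℕ × ℕ → Set} M J → (∀ {d m} → P (d , m) → Sol d m × m ≤ M × (2 * d) / q < J)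
      → ∑ pairs (𝟙 ∘ P) ℚ.≤ ι (M * J)
    pairs-count {P} M J spec = subst (λ z → ∑ pairs (𝟙 ∘ P) ℚ.≤ ι z)
      (trans (length-product (range M) (range J)) (cong₂ _*_ (length-range M) (length-range J)))
      (count-length {ys = cartesianProduct (range M) (range J)} (λ (d , m) (m′ , j) → m ≡ m′ × suc ((2 * d) / q) ≡ j) pairs-unique
        (λ { {d , m} dm∈ p → let _ , m≤M , lt = spec p in (m , suc ((2 * d) / q))
           , ∈-cartesianProduct⁺ (∈-range⁺ (proj₂ (∈-pairs⁻ dm∈)) m≤M) (∈-range⁺ (s≤s z≤n) lt) , refl , refl })
        (λ { {d , m} {d′ , _} _ _ p p′ (refl , e) (refl , e′) →
           cong (_, m) (root-unique (proj₂ (proj₁ (spec p))) (proj₂ (proj₁ (spec p′))) (suc-injective (trans e (sym e′)))) }))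

    -- `half` puts every `d` into the first interval of length q/2, so that `m` alone determines
    -- `d`. `M-small` says `m k² < q` for all `k ≤ K₁`, which turns congruences between such numbers
    -- into equalities. `E` bounds the cofactor `e = d / k` of a divisor `k ≥ K₀`.
    module Sieve (D₀ M α β κ ρ E : ℕ) (1≤ρ : 1 ≤ ρ)
      (half : ∀ {d m} → 1 ≤ m → Sol d m → 2 * d < q)
      (m-bound : ∀ {d m} → D₀ < d → Sol d m → m ≤ M)
      (d-bound : ∀ {d m} → D₀ < m → Sol d m → d ≤ 2 ^ β)
      (M-small : M * ((2 ^ α * 2 ^ κ) * (2 ^ α * 2 ^ κ)) < q)
      (K₀≤D₀ : 2 ^ α ≤ D₀)
      (Y≤E : 2 ^ β ≤ E * 2 ^ α) where

      K₀ K₁ Y : ℕ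
      K₀ = 2 ^ α
      K₁ = K₀ * 2 ^ κ
      Y = 2 ^ β

      K₁>0 : 1 ≤ K₁
      K₁>0 = *-mono-≤ (m^n>0 2 α) (m^n>0 2 κ)

      M<q : M < q
      M<q = ≤-<-trans (m≤m*n M (K₁ * K₁) {{>-nonZero (*-mono-≤ K₁>0 K₁>0)}}) M-small

      HasLargeSquare HasMiddleDivisor : ℕ → Set
      HasLargeSquare m = ∃ λ r → ρ < r × r * r ∣ m
      HasMiddleDivisor d = ∃ λ k → k ∣ d × K₀ ≤ k × k ≤ K₁

      -- `P₂` is split off because `e` determines only the product `m k²`: recovering `m` and `k`
      -- from it takes the square part of `m`, and in `P₃` at most `ρ` values of it remain.
      P P₁ P₂ P₃ P₄ : ℕ × ℕ → Set
      P (d , m) = D₀ < d × Sol d m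
      P₁ (d , m) = P (d , m) × 1 ≤ m × m ≤ D₀
      P₂ (d , m) = P (d , m) × 1 ≤ m × HasLargeSquare m
      P₃ (d , m) = P (d , m) × 1 ≤ m × D₀ < m × ¬ HasLargeSquare m × HasMiddleDivisor d
      P₄ (d , m) = P (d , m) × D₀ < m × Avoids K₀ K₁ d

      same-root : ∀ {d d′ m} → 1 ≤ m → Sol d m → Sol d′ m → d ≡ d′
      same-root {d} {d′} {m} 1≤m h h′ = root-unique (proj₂ h) (proj₂ h′)
        (trans (m<n⇒m/n≡0 (half {d} {m} 1≤m h)) (sym (m<n⇒m/n≡0 (half {d′} {m} 1≤m h′))))

      count₁ : ∑ pairs (𝟙 ∘ P₁) ℚ.≤ ι D₀
      count₁ = subst (λ z → ∑ pairs (𝟙 ∘ P₁) ℚ.≤ ι z) (*-identityʳ D₀) (pairs-count D₀ 1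
        (λ {d} {m} ((_ , sol) , 1≤m , m≤D₀) → sol , m≤D₀ , s≤s (≤-reflexive (m<n⇒m/n≡0 (half {d} {m} 1≤m sol)))))

      -- Since `m` determines `d`, it is enough to count the `m = r² s ≤ M` with `r > ρ`, and the
      -- sum of `M / r²` over these `r` is at most `M / ρ`.
      count₂ : ∑ pairs (𝟙 ∘ P₂) ℚ.≤ ι M ℚ.* rc ρ
      count₂ = ℚ.≤-trans (count-injection {ys = cartesianProduct (range M) (range M)} {Q = λ (r , s) → ρ < r × r * r * s ≤ M}
          (λ (d , m) (r , s) → m ≡ r * r * s) pairs-unique total
          (λ { {d , m} {d′ , m′} _ _ ((_ , sol) , 1≤m , _) ((_ , sol′) , _ , _) refl refl → cong (_, m) (same-root 1≤m sol sol′) }))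
        (square-tail-count em M M 1≤ρ)
        where
        total : ∀ {a} → a ∈ pairs → P₂ a → ∃ λ b → b ∈ cartesianProduct (range M) (range M)
          × proj₂ a ≡ proj₁ b * proj₁ b * proj₂ b × (ρ < proj₁ b × proj₁ b * proj₁ b * proj₂ b ≤ M)
        total {d , m} _ ((D₀<d , sol) , 1≤m , r , ρ<r , divides s m≡srr) =
            (r , s) , ∈-cartesianProduct⁺ (∈-range⁺ 1≤r (≤-trans (m≤m*n r r) (≤-trans (m≤m*n (r * r) s) rrs≤M)))
              (∈-range⁺ 1≤s (≤-trans (m≤n*m s (r * r) {{>-nonZero 1≤rr}}) rrs≤M)) , m≡rrs , ρ<r , rrs≤M
          where
          m≡rrs : m ≡ r * r * s
          m≡rrs = trans m≡srr (*-comm s (r * r))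
          1≤rr = m*n>0⇒m>0 (r * r) (subst (1 ≤_) m≡rrs 1≤m)
          1≤r = m*n>0⇒m>0 r 1≤rr
          1≤s = m*n>0⇒n>0 (r * r) (subst (1 ≤_) m≡rrs 1≤m)
          instance
            _ = >-nonZero 1≤r
            _ = >-nonZero 1≤s
          rrs≤M : r * r * s ≤ M
          rrs≤M = subst (_≤ M) m≡rrs (m-bound D₀<d sol)

      -- If d = k e then m k² is the residue of a e⁻² modulo q, so it depends on e only.
      count₃ : ∑ pairs (𝟙 ∘ P₃) ℚ.≤ ι (E * ρ)
      count₃ = subst (λ z → ∑ pairs (𝟙 ∘ P₃) ℚ.≤ ι z)
          (trans (length-product (range E) (range ρ)) (cong₂ _*_ (length-range E) (length-range ρ)))
          (count-length {ys = cartesianProduct (range E) (range ρ)} R pairs-unique total (λ {a} {a′} {b} → inj {a} {a′} {b}))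
        where
        R : ℕ × ℕ → ℕ × ℕ → Set
        R (d , m) (e , r) = (∃ λ k → d ≡ e * k × K₀ ≤ k × k ≤ K₁) × (∃ λ s → m ≡ r * r * s × Squarefree s)
        total : ∀ {a} → a ∈ pairs → P₃ a → ∃ λ b → b ∈ cartesianProduct (range E) (range ρ) × R a b
        total {d , m} dm∈ ((D₀<d , sol) , 1≤m , D₀<m , ¬large , k , divides e d≡ek , K₀≤k , k≤K₁) with squarefree-part 1≤m
        ... | r , s , m≡rrs , sqf = (e , r) , ∈-cartesianProduct⁺ (∈-range⁺ 1≤e e≤E) (∈-range⁺ 1≤r r≤ρ)
              , (k , d≡ek , K₀≤k , k≤K₁) , (s , m≡rrs , λ {g} → sqf {g})
          where
          1≤e = m*n>0⇒m>0 e (subst (1 ≤_) d≡ek (proj₁ (∈-pairs⁻ dm∈)))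
          1≤r = m*n>0⇒m>0 r (m*n>0⇒m>0 (r * r) (subst (1 ≤_) m≡rrs 1≤m))
          r≤ρ : r ≤ ρ
          r≤ρ = ≮⇒≥ λ ρ<r → ¬large (r , ρ<r , divides s (trans m≡rrs (*-comm (r * r) s)))
          e≤E : e ≤ E
          e≤E = *-cancelʳ-≤ e E K₀ {{>-nonZero (m^n>0 2 α)}} (≤-trans (*-monoʳ-≤ e K₀≤k) (subst (_≤ E * K₀) d≡ek (≤-trans (d-bound D₀<m sol) Y≤E)))
        inj : ∀ {a a′ b} → a ∈ pairs → a′ ∈ pairs → P₃ a → P₃ a′ → R a b → R a′ b → a ≡ a′
        inj {d , m} {d′ , m′} {e , r} _ _ ((D₀<d , sol) , 1≤m , _) ((D₀<d′ , sol′) , _)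
            ((k , d≡ek , K₀≤k , k≤K₁) , (s , m≡rrs , sqf)) ((k′ , d′≡ek′ , _ , k′≤K₁) , (s′ , m′≡rrs′ , sqf′)) =
            cong₂ _,_ (trans d≡ek (trans (cong (e *_) k≡k′) (sym d′≡ek′))) m≡m′
          where
          open +-*-Solver
          1≤rr = m*n>0⇒m>0 (r * r) (subst (1 ≤_) m≡rrs 1≤m)
          1≤k : 1 ≤ k
          1≤k = ≤-trans (m^n>0 2 α) K₀≤k
          shape : ∀ e k m → (e * k) * (e * k) * m ≡ e * e * (m * (k * k))
          shape = solve 3 (λ e k m → (e :* k) :* (e :* k) :* m := e :* e :* (m :* (k :* k))) refl
          shape′ : ∀ r s k → r * r * s * (k * k) ≡ r * r * (s * (k * k))
          shape′ = solve 3 (λ r s k → r :* r :* s :* (k :* k) := r :* r :* (s :* (k :* k))) refl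
          mkk : m * (k * k) ≡ m′ * (k′ * k′)
          mkk = cong-cancel {e * e}
            (subst Cong (trans (cong (λ z → z * z * m) d≡ek) (shape e k m)) (proj₂ sol))
            (subst Cong (trans (cong (λ z → z * z * m′) d′≡ek′) (shape e k′ m′)) (proj₂ sol′))
            (≤-<-trans (*-mono-≤ (m-bound D₀<d sol) (*-mono-≤ k≤K₁ k≤K₁)) M-small)
            (≤-<-trans (*-mono-≤ (m-bound D₀<d′ sol′) (*-mono-≤ k′≤K₁ k′≤K₁)) M-small)
          k≡k′ : k ≡ k′
          k≡k′ = squarefree-unique {s} {k} {s′} {k′} sqf sqf′ 1≤k (*-cancelˡ-≡ (s * (k * k)) (s′ * (k′ * k′)) (r * r) {{>-nonZero 1≤rr}} (begin
            r * r * (s * (k * k)) ≡⟨ sym (shape′ r s k) ⟩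
            r * r * s * (k * k) ≡⟨ cong (_* (k * k)) (sym m≡rrs) ⟩
            m * (k * k) ≡⟨ mkk ⟩
            m′ * (k′ * k′) ≡⟨ cong (_* (k′ * k′)) m′≡rrs′ ⟩
            r * r * s′ * (k′ * k′) ≡⟨ shape′ r s′ k′ ⟩
            r * r * (s′ * (k′ * k′)) ∎))
            where open ≡-Reasoning
          m≡m′ : m ≡ m′
          m≡m′ = *-cancelʳ-≡ m m′ (k * k) {{>-nonZero (*-mono-≤ 1≤k 1≤k)}} (trans mkk (cong (λ z → m′ * (z * z)) (sym k≡k′)))

      -- Here `d` determines `m`, because `m ≤ M < q`. The pairs are therefore counted by `d`, which
      -- is the form that the sieve bounds.
      count₄ : ∑ pairs (𝟙 ∘ P₄) ℚ.≤ ∑ (range Y) (λ d → 𝟙 (K₀ ≤ d × Avoids K₀ K₁ d))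
      count₄ = count-injection (λ (d , m) d′ → d ≡ d′) pairs-unique
        (λ { {d , m} dm∈ ((D₀<d , sol) , D₀<m , av) → d , ∈-range⁺ (proj₁ (∈-pairs⁻ dm∈)) (d-bound D₀<m sol) , refl , ≤-trans K₀≤D₀ (<⇒≤ D₀<d) , λ {k} → av {k} })
        (λ { {d , m} {_ , m′} _ _ ((D₀<d , sol) , _) ((_ , sol′) , _) refl refl →
           cong (d ,_) (cong-cancel {d * d} (proj₂ sol) (proj₂ sol′) (≤-<-trans (m-bound D₀<d sol) M<q) (≤-<-trans (m-bound D₀<d sol′) M<q)) })

      split : ∀ a → a ∈ pairs → P a → P₁ a ⊎ (P₂ a ⊎ (P₃ a ⊎ P₄ a))
      split (d , m) dm∈ p with m ≤? D₀ | em {HasLargeSquare m} | em {HasMiddleDivisor d}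
      ... | yes m≤D₀ | _ | _ = inj₁ (p , proj₂ (∈-pairs⁻ dm∈) , m≤D₀)
      ... | no _ | yes large | _ = inj₂ (inj₁ (p , proj₂ (∈-pairs⁻ dm∈) , large))
      ... | no m≰D₀ | no ¬large | yes mid = inj₂ (inj₂ (inj₁ (p , proj₂ (∈-pairs⁻ dm∈) , ≰⇒> m≰D₀ , ¬large , mid)))
      ... | no m≰D₀ | no ¬large | no ¬mid = inj₂ (inj₂ (inj₂ (p , ≰⇒> m≰D₀ , λ {k} k∣d K₀≤k → ≰⇒> (λ k≤K₁ → ¬mid (k , k∣d , K₀≤k , k≤K₁)))))

      sieve-count : ∑ pairs (𝟙 ∘ P) ℚ.≤ ι D₀ ℚ.+ (ι M ℚ.* rc ρ ℚ.+ (ι (E * ρ) ℚ.+ ∑ (range Y) (λ d → 𝟙 (K₀ ≤ d × Avoids K₀ K₁ d))))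
      sieve-count = begin
        ∑ pairs (𝟙 ∘ P) ≤⟨ ∑-⊎ pairs split ⟩
        ∑ pairs (𝟙 ∘ P₁) ℚ.+ ∑ pairs (λ a → 𝟙 (P₂ a ⊎ (P₃ a ⊎ P₄ a))) ≤⟨ ℚ.+-mono-≤ count₁ (∑-⊎ pairs (λ _ _ h → h)) ⟩
        ι D₀ ℚ.+ (∑ pairs (𝟙 ∘ P₂) ℚ.+ ∑ pairs (λ a → 𝟙 (P₃ a ⊎ P₄ a))) ≤⟨ ℚ.+-monoʳ-≤ (ι D₀) (ℚ.+-mono-≤ count₂ (∑-⊎ pairs (λ _ _ h → h))) ⟩
        ι D₀ ℚ.+ (ι M ℚ.* rc ρ ℚ.+ (∑ pairs (𝟙 ∘ P₃) ℚ.+ ∑ pairs (𝟙 ∘ P₄))) ≤⟨ ℚ.+-monoʳ-≤ (ι D₀) (ℚ.+-monoʳ-≤ (ι M ℚ.* rc ρ) (ℚ.+-mono-≤ count₃ count₄)) ⟩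
        ι D₀ ℚ.+ (ι M ℚ.* rc ρ ℚ.+ (ι (E * ρ) ℚ.+ ∑ (range Y) (λ d → 𝟙 (K₀ ≤ d × Avoids K₀ K₁ d)))) ∎
        where open ℚ.≤-Reasoning

  -- The Möbius function and the indicator of squarefree numbers

  prime∣prime : ∀ {p r} → Prime p → Prime r → p ∣ r → p ≡ r
  prime∣prime pp pr p∣r with prime⇒irreducible pr p∣r
  ... | inj₁ refl = contradiction pp ¬prime[1]
  ... | inj₂ e = e

  prime-coprime : ∀ {p e} → Prime p → ¬ p ∣ e → Coprime p e
  prime-coprime pp p∤e (d∣p , d∣e) with prime⇒irreducible pp d∣p
  ... | inj₁ d≡1 = d≡1
  ... | inj₂ refl = contradiction d∣e p∤e

  ∑-vanish : ∀ {A : Set} (xs : List A) {f : A → ℚ} → (∀ {a} → a ∈ xs → f a ≡ 0ℚ) → ∑ xs f ≡ 0ℚ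
  ∑-vanish xs h = trans (∑-cong xs h) (∑-zero xs)

  ∑-single : ∀ {A : Set} {xs : List A} {f : A → ℚ} {a} → Unique xs → a ∈ xs
    → (∀ {b} → b ∈ xs → b ≢ a → f b ≡ 0ℚ) → ∑ xs f ≡ f a
  ∑-single {xs = x ∷ xs} {f} (x∉ ∷ _) (here refl) h = trans (cong (f x ℚ.+_) (∑-vanish xs (λ b∈ → h (there b∈) (λ e → All.lookup x∉ b∈ (sym e)))))
    (ℚ.+-identityʳ (f x))
  ∑-single {xs = x ∷ xs} {f} {a} (x∉ ∷ u) (there a∈) h = trans (cong₂ ℚ._+_ (h (here refl) (All.lookup x∉ a∈)) (∑-single u a∈ (h ∘ there)))
    (ℚ.+-identityˡ (f a))

  -- Squarefreeness tested on primes, as in the definition of `μ`.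
  SF : ℕ → Set
  SF n = ∀ {p} → Prime p → ¬ p * p ∣ n

  ω : ℕ → ℕ
  ω n = length (primeDivisors n)

  sgn : ℕ → ℚ
  sgn zero = 1ℚ
  sgn (suc k) = ℚ.- sgn k

  ∣sgn∣ : ∀ k → ℚ.∣ sgn k ∣ ≡ 1ℚ
  ∣sgn∣ zero = refl
  ∣sgn∣ (suc k) = trans (ℚ.∣-p∣≡∣p∣ (sgn k)) (∣sgn∣ k)

  ι-injective : ∀ {m n} → ι m ≡ ι n → m ≡ n
  ι-injective e = ≤-antisym (ι-cancel (ℚ.≤-reflexive e)) (ι-cancel (ℚ.≤-reflexive (sym e)))

  SF-prime-* : ∀ {p e} → Prime p → ¬ p ∣ e → SF e → SF (p * e)
  SF-prime-* {p} {e} pp p∤e sf {r} pr (divides c pe≡crr) with r ≟ p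
  ... | yes refl = p∤e (divides c (*-cancelˡ-≡ e (c * r) r {{prime⇒nonZero pr}} (trans pe≡crr
          (trans (sym (*-assoc c r r)) (*-comm (c * r) r)))))
  ... | no r≢p = sf pr (coprime-divisor (Coprimality.sym (coprime-*ʳ p⊥r p⊥r)) (divides c pe≡crr))
    where
    p⊥r : Coprime p r
    p⊥r = prime-coprime pp (λ p∣r → r≢p (sym (prime∣prime pp pr p∣r)))

  SF-∣ : ∀ {m n} → m ∣ n → SF n → SF m
  SF-∣ m∣n sf pp h = sf pp (∣-trans h m∣n)

  -1^k-square : ∀ k → (ℤ.- (ℤ.+ 1)) ℤ.^ k ℤ.* (ℤ.- (ℤ.+ 1)) ℤ.^ k ≡ ℤ.+ 1
  -1^k-square zero = refl
  -1^k-square (suc k) = trans (cong₂ ℤ._*_ (ℤ.-1*i≡-i s) (ℤ.-1*i≡-i s)) (trans (sym (ℤ.neg-distribˡ-* s (ℤ.- s))) (trans (cong ℤ.-_ (sym (ℤ.neg-distribʳ-* s s))) (trans (ℤ.neg-involutive (s ℤ.* s)) (-1^k-square k))))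
    where
    s = (ℤ.- (ℤ.+ 1)) ℤ.^ k

  module _ (em : ExcludedMiddle 0ℓ) where
    open Indicator em

    𝟙*-true : ∀ {P} a → P → 𝟙 P ℚ.* a ≡ a
    𝟙*-true a p = trans (cong (ℚ._* a) (𝟙-true p)) (ℚ.*-identityˡ a)

    𝟙*-false : ∀ {P} a → ¬ P → 𝟙 P ℚ.* a ≡ 0ℚ
    𝟙*-false a ¬p = trans (cong (ℚ._* a) (𝟙-false ¬p)) (ℚ.*-zeroˡ a)

    ∑-multiples : ∀ {D} x (g : ℕ → ℚ) → 1 ≤ D
      → ∑ (range x) (λ n → 𝟙 (D ∣ n) ℚ.* g n) ≡ ∑ (range x) (λ m → 𝟙 (D * m ≤ x) ℚ.* g (D * m))
    ∑-multiples {D} x g 1≤D = begin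
      ∑ (range x) (λ n → 𝟙 (D ∣ n) ℚ.* g n) ≡⟨ ∑-cong (range x) (λ n∈ → expand n∈) ⟩
      ∑ (range x) (λ n → ∑ (range x) (λ m → 𝟙 (n ≡ D * m) ℚ.* g n)) ≡⟨ ∑-swap (range x) (range x) _ ⟩
      ∑ (range x) (λ m → ∑ (range x) (λ n → 𝟙 (n ≡ D * m) ℚ.* g n)) ≡⟨ ∑-cong (range x) (λ m∈ → collapse m∈) ⟩
      ∑ (range x) (λ m → 𝟙 (D * m ≤ x) ℚ.* g (D * m)) ∎
      where
      open ≡-Reasoning
      expand : ∀ {n} → n ∈ range x → 𝟙 (D ∣ n) ℚ.* g n ≡ ∑ (range x) (λ m → 𝟙 (n ≡ D * m) ℚ.* g n)
      expand {n} n∈ with em {D ∣ n}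
      ... | no D∤n = trans (𝟙*-false (g n) D∤n) (sym (∑-vanish (range x) (λ {m} _ → 𝟙*-false (g n) (λ e → D∤n (divides m (trans e (*-comm D m)))))))
      ... | yes D∣n@(divides m n≡mD) = trans (𝟙*-true (g n) D∣n) (sym (trans (∑-single (range-unique x) m∈
              (λ {b} _ b≢m → 𝟙*-false (g n) (λ e → b≢m (*-cancelˡ-≡ b m D {{>-nonZero 1≤D}} (trans (sym e) n≡Dm))))) (𝟙*-true (g n) n≡Dm)))
        where
        n≡Dm : n ≡ D * m
        n≡Dm = trans n≡mD (*-comm m D)
        m∈ : m ∈ range x
        m∈ = ∈-range⁺ (m*n>0⇒m>0 m (subst (1 ≤_) n≡mD (proj₁ (∈-range⁻ n∈))))
          (≤-trans (m≤m*n m D {{>-nonZero 1≤D}}) (subst (_≤ x) n≡mD (proj₂ (∈-range⁻ n∈))))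
      collapse : ∀ {m} → m ∈ range x → ∑ (range x) (λ n → 𝟙 (n ≡ D * m) ℚ.* g n) ≡ 𝟙 (D * m ≤ x) ℚ.* g (D * m)
      collapse {m} m∈ with em {D * m ≤ x}
      ... | yes le = trans (∑-single (range-unique x) (∈-range⁺ (*-mono-≤ 1≤D (proj₁ (∈-range⁻ m∈))) le) (λ {b} _ ne → 𝟙*-false (g b) ne))
                       (trans (𝟙*-true (g (D * m)) refl) (sym (𝟙*-true (g (D * m)) le)))
      ... | no ¬le = trans (∑-vanish (range x) (λ {n} n∈ → 𝟙*-false (g n) (λ e → ¬le (subst (_≤ x) e (proj₂ (∈-range⁻ n∈))))))
                       (sym (𝟙*-false (g (D * m)) ¬le))

    ∑-cutoff : ∀ {P : ℕ → Set} {B y} (f : ℕ → ℚ) → y ≤ B → (∀ {n} → 1 ≤ n → P n → n ≤ y) → (∀ {n} → 1 ≤ n → n ≤ y → P n)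
      → ∑ (range B) (λ n → 𝟙 (P n) ℚ.* f n) ≡ ∑ (range y) f
    ∑-cutoff {P} {B} {y} f y≤B to from = begin
      ∑ (range B) g ≡⟨ cong (λ z → ∑ (range z) g) (sym (m+[n∸m]≡n y≤B)) ⟩
      ∑ (range (y + (B ∸ y))) g ≡⟨ ∑-range-+ y (B ∸ y) g ⟩
      ∑ (range y) g ℚ.+ ∑ (range (B ∸ y)) (λ s → g (y + s)) ≡⟨ cong₂ ℚ._+_
          (∑-cong (range y) (λ {n} n∈ → 𝟙*-true (f n) (from (proj₁ (∈-range⁻ n∈)) (proj₂ (∈-range⁻ n∈)))))
          (∑-vanish (range (B ∸ y)) (λ {s} s∈ → 𝟙*-false (f (y + s)) (λ p → <⇒≱ (m<m+n y (proj₁ (∈-range⁻ s∈))) (to (≤-trans (proj₁ (∈-range⁻ s∈)) (m≤n+m s y)) p)))) ⟩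
      ∑ (range y) f ℚ.+ 0ℚ ≡⟨ ℚ.+-identityʳ (∑ (range y) f) ⟩
      ∑ (range y) f ∎
      where
      open ≡-Reasoning
      g : ℕ → ℚ
      g n = 𝟙 (P n) ℚ.* f n

    -- The Möbius function with values in ℚ. The factor `𝟙 (SF d)` replaces the case distinction of
    -- `μ`, so that the sign change from `e` to `p * e` splits into one statement on `SF` and one on
    -- `ω`.
    ν : ℕ → ℚ
    ν d = 𝟙 (SF d) ℚ.* sgn (ω d)

    ∣ν∣≤1 : ∀ d → ℚ.∣ ν d ∣ ℚ.≤ 1ℚ
    ∣ν∣≤1 d = ∣*∣≤ {𝟙 (SF d)} {sgn (ω d)} {1ℚ} {1ℚ} (subst (ℚ._≤ 1ℚ) (sym (ℚ.0≤p⇒∣p∣≡p (0≤𝟙 (SF d)))) (𝟙≤1 (SF d))) (ℚ.≤-reflexive (∣sgn∣ (ω d)))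

    -- The upper limit `N` is free so that `ω e` and `ω (p * e)` become sums over the same range and
    -- can be compared termwise.
    ω-count : ∀ n N → 1 ≤ n → n ≤ N → ι (ω n) ≡ ∑ (range N) (λ p → 𝟙 (Prime p × p ∣ n))
    ω-count n N 1≤n n≤N = begin
      ι (ω n) ≡⟨ sym (count-filter em (λ p → prime? p ×-dec (p ∣? n)) (upTo (suc n))) ⟩
      ∑ (upTo (suc n)) f ≡⟨ cong (λ xs → f 0 ℚ.+ ∑ xs f) (sym (List.map-upTo suc n)) ⟩
      f 0 ℚ.+ ∑ (range n) f ≡⟨ cong (ℚ._+ ∑ (range n) f) (𝟙-false (λ (p0 , _) → ¬prime[0] p0)) ⟩
      0ℚ ℚ.+ ∑ (range n) f ≡⟨ ℚ.+-identityˡ (∑ (range n) f) ⟩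
      ∑ (range n) f ≡⟨ sym (ℚ.+-identityʳ (∑ (range n) f)) ⟩
      ∑ (range n) f ℚ.+ 0ℚ ≡⟨ cong (∑ (range n) f ℚ.+_) (sym (∑-vanish (range (N ∸ n)) (λ {s} s∈ →
            𝟙-false (λ (_ , n+s∣n) → <⇒≱ (m<m+n n (proj₁ (∈-range⁻ s∈))) (∣⇒≤ {{>-nonZero 1≤n}} n+s∣n))))) ⟩
      ∑ (range n) f ℚ.+ ∑ (range (N ∸ n)) (λ s → f (n + s)) ≡⟨ sym (∑-range-+ n (N ∸ n) f) ⟩
      ∑ (range (n + (N ∸ n))) f ≡⟨ cong (λ z → ∑ (range z) f) (m+[n∸m]≡n n≤N) ⟩
      ∑ (range N) f ∎
      where
      open ≡-Reasoning
      f : ℕ → ℚ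
      f p = 𝟙 (Prime p × p ∣ n)

    ω-prime-* : ∀ {p e} → Prime p → 1 ≤ e → ¬ p ∣ e → ω (p * e) ≡ suc (ω e)
    ω-prime-* {p} {e} pp 1≤e p∤e = ι-injective (begin
      ι (ω (p * e)) ≡⟨ ω-count (p * e) N 1≤N ≤-refl ⟩
      ∑ (range N) (λ r → 𝟙 (Prime r × r ∣ p * e)) ≡⟨ ∑-cong (range N) (λ {r} _ → split r) ⟩
      ∑ (range N) (λ r → 𝟙 (Prime r × r ∣ e) ℚ.+ 𝟙 (r ≡ p)) ≡⟨ ∑-+ (range N) _ _ ⟩
      ∑ (range N) (λ r → 𝟙 (Prime r × r ∣ e)) ℚ.+ ∑ (range N) (λ r → 𝟙 (r ≡ p)) ≡⟨ cong₂ ℚ._+_ (sym (ω-count e N 1≤e (m≤n*m e p {{prime⇒nonZero pp}})))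
            (trans (∑-single {f = λ r → 𝟙 (r ≡ p)} (range-unique N) (∈-range⁺ (<⇒≤ (prime>1 pp)) (m≤m*n p e {{>-nonZero 1≤e}})) (λ _ ne → 𝟙-false ne)) (𝟙-true refl)) ⟩
      ι (ω e) ℚ.+ 1ℚ ≡⟨ sym (ι-suc (ω e)) ⟩
      ι (suc (ω e)) ∎)
      where
      open ≡-Reasoning
      N = p * e
      1≤N : 1 ≤ N
      1≤N = *-mono-≤ (<⇒≤ (prime>1 pp)) 1≤e
      split : ∀ r → 𝟙 (Prime r × r ∣ p * e) ≡ 𝟙 (Prime r × r ∣ e) ℚ.+ 𝟙 (r ≡ p)
      split r with em {r ≡ p}
      ... | yes refl = trans (𝟙-true (pp , m∣m*n e)) (sym (trans (cong₂ ℚ._+_ (𝟙-false (λ (_ , h) → p∤e h)) (𝟙-true refl)) (ℚ.+-identityˡ 1ℚ)))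
      ... | no r≢p = trans (𝟙-cong to (λ (pr , h) → pr , ∣-trans h (n∣m*n p)))
                       (sym (trans (cong (𝟙 (Prime r × r ∣ e) ℚ.+_) (𝟙-false r≢p)) (ℚ.+-identityʳ _)))
        where
        to : Prime r × r ∣ p * e → Prime r × r ∣ e
        to (pr , h) with euclidsLemma p e pr h
        ... | inj₁ r∣p = contradiction (prime∣prime pr pp r∣p) r≢p
        ... | inj₂ r∣e = pr , r∣e

    ν-prime-* : ∀ {p e} → Prime p → 1 ≤ e → ¬ p ∣ e → ν (p * e) ≡ ℚ.- ν e
    ν-prime-* {p} {e} pp 1≤e p∤e = trans (cong₂ (λ a k → a ℚ.* sgn k)
        (𝟙-cong (λ sf {r} → SF-∣ (n∣m*n p) sf {r}) (λ sf {r} → SF-prime-* pp p∤e sf {r})) (ω-prime-* pp 1≤e p∤e))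
      (sym (ℚ.neg-distribʳ-* (𝟙 (SF e)) (sgn (ω e))))

    ν-vanish : ∀ {p d} → Prime p → p * p ∣ d → ν d ≡ 0ℚ
    ν-vanish {p} {d} pp h = 𝟙*-false (sgn (ω d)) (λ sf → sf pp h)

    -- Pairing d with p d when p² ∣ n and p ∤ d cancels the divisor sum.
    squarefree-indicator : ∀ {n x} → 1 ≤ n → n ≤ x → ∑ (range x) (λ d → ν d ℚ.* 𝟙 (d * d ∣ n)) ≡ 𝟙 (SF n)
    squarefree-indicator {n} {x} 1≤n n≤x with em {∃ λ p → Prime p × p * p ∣ n}
    ... | no none = begin
        ∑ (range x) (λ d → ν d ℚ.* 𝟙 (d * d ∣ n)) ≡⟨ ∑-single (range-unique x) (∈-range⁺ ≤-refl (≤-trans 1≤n n≤x)) other ⟩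
        ν 1 ℚ.* 𝟙 (1 ∣ n) ≡⟨ cong₂ ℚ._*_ (𝟙*-true (sgn (ω 1)) (λ {r} → sf1 {r})) (𝟙-true (1∣ n)) ⟩
        1ℚ ℚ.* 1ℚ ≡⟨ ℚ.*-identityˡ 1ℚ ⟩
        1ℚ ≡⟨ sym (𝟙-true (λ {p} pp h → none (p , pp , h))) ⟩
        𝟙 (SF n) ∎
      where
      open ≡-Reasoning
      sf1 : SF 1
      sf1 {p} pp h = <⇒≱ (prime>1 pp) (≤-trans (m≤m*n p p {{prime⇒nonZero pp}}) (∣⇒≤ h))
      other : ∀ {d} → d ∈ range x → d ≢ 1 → ν d ℚ.* 𝟙 (d * d ∣ n) ≡ 0ℚ
      other {d} d∈ d≢1 = trans (cong (ν d ℚ.*_) (𝟙-false no-square)) (ℚ.*-zeroʳ (ν d))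
        where
        no-square : ¬ d * d ∣ n
        no-square h with primeFactor (≤∧≢⇒< (proj₁ (∈-range⁻ d∈)) (≢-sym d≢1))
        ... | p , pp , p∣d = none (p , pp , ∣-trans (*-pres-∣ p∣d p∣d) h)
    ... | yes (p , pp , pp∣n) = trans total≡0 (sym (𝟙-false (λ sf → sf pp pp∣n)))
      where
      open ≡-Reasoning
      f : ℕ → ℚ
      f d = ν d ℚ.* 𝟙 (d * d ∣ n)
      1≤p : 1 ≤ p
      1≤p = <⇒≤ (prime>1 pp)
      g : ℕ → ℚ
      g e = 𝟙 (¬ p ∣ e) ℚ.* f e
      square-mul : ∀ {e} → ¬ p ∣ e → e * e ∣ n → (p * e) * (p * e) ∣ n
      square-mul {e} p∤e ee∣n@(divides c n≡cee) with coprime-divisor (coprime-square (prime-coprime pp p∤e)) (subst (p * p ∣_) (trans n≡cee (*-comm c (e * e))) pp∣n)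
      ... | divides b c≡bpp = divides b (trans n≡cee (trans (cong (_* (e * e)) c≡bpp)
              (solve 3 (λ b p e → b :* (p :* p) :* (e :* e) := b :* ((p :* e) :* (p :* e))) refl b p e)))
        where open +-*-Solver
      pair : ∀ {e} → e ∈ range x → 𝟙 (p * e ≤ x) ℚ.* f (p * e) ≡ ℚ.- g e
      pair {e} e∈ with em {p ∣ e}
      ... | yes p∣e = trans (cong (𝟙 (p * e ≤ x) ℚ.*_) (trans (cong (ℚ._* 𝟙 ((p * e) * (p * e) ∣ n)) (ν-vanish pp (*-monoʳ-∣ p p∣e))) (ℚ.*-zeroˡ (𝟙 ((p * e) * (p * e) ∣ n)))))
            (trans (ℚ.*-zeroʳ (𝟙 (p * e ≤ x))) (cong ℚ.-_ (sym (𝟙*-false (f e) (λ h → h p∣e)))))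
      ... | no p∤e = begin
          𝟙 (p * e ≤ x) ℚ.* f (p * e) ≡⟨ cong (𝟙 (p * e ≤ x) ℚ.*_) (ℚ.*-comm (ν (p * e)) (𝟙 ((p * e) * (p * e) ∣ n))) ⟩
          𝟙 (p * e ≤ x) ℚ.* (𝟙 ((p * e) * (p * e) ∣ n) ℚ.* ν (p * e)) ≡⟨ sym (ℚ.*-assoc (𝟙 (p * e ≤ x)) _ (ν (p * e))) ⟩
          𝟙 (p * e ≤ x) ℚ.* 𝟙 ((p * e) * (p * e) ∣ n) ℚ.* ν (p * e) ≡⟨ cong₂ ℚ._*_ (trans (sym (𝟙-× (p * e ≤ x) ((p * e) * (p * e) ∣ n))) (𝟙-cong to from)) (ν-prime-* pp (proj₁ (∈-range⁻ e∈)) p∤e) ⟩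
          𝟙 (e * e ∣ n) ℚ.* ℚ.- ν e ≡⟨ sym (ℚ.neg-distribʳ-* (𝟙 (e * e ∣ n)) (ν e)) ⟩
          ℚ.- (𝟙 (e * e ∣ n) ℚ.* ν e) ≡⟨ cong ℚ.-_ (trans (ℚ.*-comm (𝟙 (e * e ∣ n)) (ν e)) (sym (𝟙*-true (f e) p∤e))) ⟩
          ℚ.- g e ∎
        where
        to : p * e ≤ x × (p * e) * (p * e) ∣ n → e * e ∣ n
        to (_ , h) = ∣-trans (*-pres-∣ (n∣m*n p) (n∣m*n p)) h
        -- The cutoff `p * e ≤ x` costs nothing: the square of `p * e` divides `n`, and `n ≤ x`.
        from : e * e ∣ n → p * e ≤ x × (p * e) * (p * e) ∣ n
        from h = ≤-trans (≤-trans (m≤m*n (p * e) (p * e) {{>-nonZero (*-mono-≤ 1≤p (proj₁ (∈-range⁻ e∈)))}}) (∣⇒≤ {{>-nonZero 1≤n}} (square-mul p∤e h))) n≤x , square-mul p∤e h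
      divisible : ∑ (range x) (λ d → 𝟙 (p ∣ d) ℚ.* f d) ≡ ℚ.- ∑ (range x) g
      divisible = begin
        ∑ (range x) (λ d → 𝟙 (p ∣ d) ℚ.* f d) ≡⟨ ∑-multiples x f 1≤p ⟩
        ∑ (range x) (λ e → 𝟙 (p * e ≤ x) ℚ.* f (p * e)) ≡⟨ ∑-cong (range x) pair ⟩
        ∑ (range x) (λ e → ℚ.- g e) ≡⟨ ∑-cong (range x) (λ {e} _ → neg (g e)) ⟩
        ∑ (range x) (λ e → ℚ.- 1ℚ ℚ.* g e) ≡⟨ ∑-*ˡ (ℚ.- 1ℚ) (range x) g ⟩
        ℚ.- 1ℚ ℚ.* ∑ (range x) g ≡⟨ sym (neg (∑ (range x) g)) ⟩
        ℚ.- ∑ (range x) g ∎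
        where
        neg : ∀ z → ℚ.- z ≡ ℚ.- 1ℚ ℚ.* z
        neg z = trans (cong ℚ.-_ (sym (ℚ.*-identityˡ z))) (ℚ.neg-distribˡ-* 1ℚ z)
      cases : ∀ {d} → d ∈ range x → f d ≡ 𝟙 (p ∣ d) ℚ.* f d ℚ.+ g d
      cases {d} _ with em {p ∣ d}
      ... | yes h = sym (trans (cong₂ ℚ._+_ (𝟙*-true (f d) h) (𝟙*-false (f d) (λ k → k h))) (ℚ.+-identityʳ (f d)))
      ... | no ¬h = sym (trans (cong₂ ℚ._+_ (𝟙*-false (f d) ¬h) (𝟙*-true (f d) ¬h)) (ℚ.+-identityˡ (f d)))
      total≡0 : ∑ (range x) f ≡ 0ℚ
      total≡0 = begin
        ∑ (range x) f ≡⟨ ∑-cong (range x) cases ⟩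
        ∑ (range x) (λ d → 𝟙 (p ∣ d) ℚ.* f d ℚ.+ g d) ≡⟨ ∑-+ (range x) _ g ⟩
        ∑ (range x) (λ d → 𝟙 (p ∣ d) ℚ.* f d) ℚ.+ ∑ (range x) g ≡⟨ cong (ℚ._+ ∑ (range x) g) divisible ⟩
        ℚ.- ∑ (range x) g ℚ.+ ∑ (range x) g ≡⟨ ℚ.+-inverseˡ (∑ (range x) g) ⟩
        0ℚ ∎

    μ²-indicator : ∀ {n} → 1 ≤ n → μ² n ℚ./ 1 ≡ 𝟙 (SF n)
    μ²-indicator {n} 1≤n with any? (λ p → (p * p) ∣? n) (primeDivisors n)
    ... | yes h = sym (𝟙-false (λ sf → no-sf sf h))
      where
      no-sf : SF n → ¬ Any (λ p → p * p ∣ n) (primeDivisors n)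
      no-sf sf a with find a
        where open import Data.List.Membership.Propositional using (find)
      ... | p , p∈ , pp∣n = sf (proj₁ (proj₂ (∈-filter⁻ (λ p → prime? p ×-dec (p ∣? n)) {xs = upTo (suc n)} p∈))) pp∣n
    ... | no ¬h = trans (cong (ℚ._/ 1) (-1^k-square (length (primeDivisors n)))) (sym (𝟙-true sf))
      where
      sf : SF n
      sf {p} pp pp∣n = ¬h (lose (∈-filter⁺ (λ p → prime? p ×-dec (p ∣? n)) (∈-upTo⁺ (s≤s (∣⇒≤ {{>-nonZero 1≤n}} p∣n))) (pp , p∣n)) pp∣n)
        where
        p∣n : p ∣ n
        p∣n = ∣-trans (m∣m*n p) pp∣n

  -- The residue class of a modulo q

  module Residues (q : ℕ) (pq : Prime q) (a : ℤ) (a⊥q : ℤ.Coprime a (ℤ.+ q)) where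

    instance
      q≢0 : NonZero q
      q≢0 = prime⇒nonZero pq

    opaque

      Cong : ℕ → Set
      Cong n = n ≡ a [mod q ]

      cong-signed : ∀ {n} → Cong n → ℤ.+ q Signed.∣ ℤ.+ n ℤ.- a
      cong-signed {n} h = ∣ᵤ⇒∣ {ℤ.+ q} {ℤ.+ n ℤ.- a} h

      signed-cong : ∀ {n} → ℤ.+ q Signed.∣ ℤ.+ n ℤ.- a → Cong n
      signed-cong {n} h = ∣⇒∣ᵤ {ℤ.+ q} {ℤ.+ n ℤ.- a} h

      cong⇒mod : ∀ {n} → Cong n → n ≡ a [mod q ]
      cong⇒mod h = h

      mod⇒cong : ∀ {n} → n ≡ a [mod q ] → Cong n
      mod⇒cong h = h

    cong-diff : ∀ {m n} → Cong m → Cong n → m ≤ n → q ∣ n ∸ m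
    cong-diff {m} {n} hm hn m≤n = ∣⇒∣ᵤ {ℤ.+ q} {ℤ.+ (n ∸ m)} (subst (ℤ.+ q Signed.∣_)
      (trans (solve 3 (λ n m a → (n :- a) :- (m :- a) := n :- m) refl (ℤ.+ n) (ℤ.+ m) a) (trans (ℤ.m-n≡m⊖n n m) (ℤ.⊖-≥ m≤n)))
      (∣m∣n⇒∣m-n (cong-signed {n} hn) (cong-signed {m} hm)))
      where open ℤSolver.+-*-Solver

    cong-unit : ∀ {n} → Cong n → ¬ q ∣ n
    cong-unit {n} hn q∣n = contradiction (a⊥q (q∣a , ∣-refl)) (≢-sym (<⇒≢ (prime>1 pq)))
      where
      open ℤSolver.+-*-Solver
      q∣a : q ∣ ℤ.∣ a ∣
      q∣a = ∣⇒∣ᵤ {ℤ.+ q} {a} (subst (ℤ.+ q Signed.∣_) (solve 2 (λ n a → n :- (n :- a) := a) refl (ℤ.+ n) a)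
        (∣m∣n⇒∣m-n (∣ᵤ⇒∣ {ℤ.+ q} {ℤ.+ n} q∣n) (cong-signed {n} hn)))

    cong-shift : ∀ {n} c → Cong n → Cong (c * q + n)
    cong-shift {n} c hn = signed-cong {c * q + n} (subst (ℤ.+ q Signed.∣_) (sym eq)
      (Signed.∣m∣n⇒∣m+n (Signed.divides (ℤ.+ c) refl) (cong-signed {n} hn)))
      where
      eq : ℤ.+ (c * q + n) ℤ.- a ≡ ℤ.+ c ℤ.* ℤ.+ q ℤ.+ (ℤ.+ n ℤ.- a)
      eq = trans (cong (λ z → z ℤ.+ ℤ.+ n ℤ.- a) (ℤ.pos-* c q)) (ℤ.+-assoc (ℤ.+ c ℤ.* ℤ.+ q) (ℤ.+ n) (ℤ.- a))

    cong-unshift : ∀ {n} c → Cong (c * q + n) → Cong n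
    cong-unshift {n} c hn = signed-cong {n} (subst (ℤ.+ q Signed.∣_) eq
      (∣m∣n⇒∣m-n (cong-signed {c * q + n} hn) (Signed.divides (ℤ.+ c) refl)))
      where
      open ℤSolver.+-*-Solver
      eq : ℤ.+ (c * q + n) ℤ.- a ℤ.- ℤ.+ c ℤ.* ℤ.+ q ≡ ℤ.+ n ℤ.- a
      eq = trans (cong (λ z → z ℤ.+ ℤ.+ n ℤ.- a ℤ.- ℤ.+ c ℤ.* ℤ.+ q) (ℤ.pos-* c q))
        (solve 3 (λ u n a → u :+ n :- a :- u := n :- a) refl (ℤ.+ c ℤ.* ℤ.+ q) (ℤ.+ n) a)

    inverse : ∀ {D} → ¬ q ∣ D → ∃ λ t → ∃ λ k → ℤ.+ D ℤ.* t ≡ ℤ.+ 1 ℤ.+ k ℤ.* ℤ.+ q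
    inverse {D} q∤D with coprime-Bézout (Coprimality.sym (prime-coprime pq q∤D))
    ... | Bézout.+- x y eq = ℤ.+ x , ℤ.+ y , trans (ℤ.*-comm (ℤ.+ D) (ℤ.+ x)) (trans (sym (ℤ.pos-* x D)) (trans (cong ℤ.+_ (sym eq)) (cong (λ z → ℤ.+ 1 ℤ.+ z) (ℤ.pos-* y q))))
    ... | Bézout.-+ x y eq = ℤ.- ℤ.+ x , ℤ.- ℤ.+ y , (begin
        ℤ.+ D ℤ.* ℤ.- ℤ.+ x ≡⟨ solve 2 (λ D x → D :* (:- x) := con (ℤ.+ 1) :- (con (ℤ.+ 1) :+ x :* D)) refl (ℤ.+ D) (ℤ.+ x) ⟩
        ℤ.+ 1 ℤ.- (ℤ.+ 1 ℤ.+ ℤ.+ x ℤ.* ℤ.+ D) ≡⟨ cong (λ z → ℤ.+ 1 ℤ.- (ℤ.+ 1 ℤ.+ z)) (sym (ℤ.pos-* x D)) ⟩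
        ℤ.+ 1 ℤ.- (ℤ.+ (1 + x * D)) ≡⟨ cong (λ z → ℤ.+ 1 ℤ.- ℤ.+ z) eq ⟩
        ℤ.+ 1 ℤ.- ℤ.+ (y * q) ≡⟨ cong (λ z → ℤ.+ 1 ℤ.- z) (ℤ.pos-* y q) ⟩
        ℤ.+ 1 ℤ.- ℤ.+ y ℤ.* ℤ.+ q ≡⟨ cong (λ z → ℤ.+ 1 ℤ.+ z) (ℤ.neg-distribˡ-* (ℤ.+ y) (ℤ.+ q)) ⟩
        ℤ.+ 1 ℤ.+ ℤ.- ℤ.+ y ℤ.* ℤ.+ q ∎)
      where
      open ≡-Reasoning
      open ℤSolver.+-*-Solver

    -- `m` is the residue of a D⁻¹. It is not 0, because the class of a contains no multiple of `q`.
    solvable : ∀ {D} → ¬ q ∣ D → ∃ λ m → 1 ≤ m × m ≤ q × Cong (D * m)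
    solvable {D} q∤D with inverse q∤D
    ... | t , k , Dt≡1+kq = m , 1≤m , <⇒≤ (n%ℕd<d (a ℤ.* t) q) , h
      where
      open ℤSolver.+-*-Solver
      m = (a ℤ.* t) %ℕ q
      l = (a ℤ.* t) /ℕ q
      at≡ : a ℤ.* t ≡ ℤ.+ m ℤ.+ l ℤ.* ℤ.+ q
      at≡ = a≡a%ℕn+[a/ℕn]*n (a ℤ.* t) q
      eq : ℤ.+ (D * m) ℤ.- a ≡ (a ℤ.* k ℤ.- ℤ.+ D ℤ.* l) ℤ.* ℤ.+ q
      eq = begin
        ℤ.+ (D * m) ℤ.- a ≡⟨ cong (ℤ._- a) (ℤ.pos-* D m) ⟩
        ℤ.+ D ℤ.* ℤ.+ m ℤ.- a ≡⟨ solve 5 (λ D m a l q → D :* m :- a := D :* (m :+ l :* q) :- a :- D :* l :* q) refl (ℤ.+ D) (ℤ.+ m) a l (ℤ.+ q) ⟩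
        ℤ.+ D ℤ.* (ℤ.+ m ℤ.+ l ℤ.* ℤ.+ q) ℤ.- a ℤ.- ℤ.+ D ℤ.* l ℤ.* ℤ.+ q ≡⟨ cong (λ z → ℤ.+ D ℤ.* z ℤ.- a ℤ.- ℤ.+ D ℤ.* l ℤ.* ℤ.+ q) (sym at≡) ⟩
        ℤ.+ D ℤ.* (a ℤ.* t) ℤ.- a ℤ.- ℤ.+ D ℤ.* l ℤ.* ℤ.+ q ≡⟨ solve 5 (λ D a t l q → D :* (a :* t) :- a :- D :* l :* q := a :* (D :* t) :- a :- D :* l :* q) refl (ℤ.+ D) a t l (ℤ.+ q) ⟩
        a ℤ.* (ℤ.+ D ℤ.* t) ℤ.- a ℤ.- ℤ.+ D ℤ.* l ℤ.* ℤ.+ q ≡⟨ cong (λ z → a ℤ.* z ℤ.- a ℤ.- ℤ.+ D ℤ.* l ℤ.* ℤ.+ q) Dt≡1+kq ⟩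
        a ℤ.* (ℤ.+ 1 ℤ.+ k ℤ.* ℤ.+ q) ℤ.- a ℤ.- ℤ.+ D ℤ.* l ℤ.* ℤ.+ q ≡⟨ solve 5 (λ a k q D l → a :* (con (ℤ.+ 1) :+ k :* q) :- a :- D :* l :* q := (a :* k :- D :* l) :* q) refl a k (ℤ.+ q) (ℤ.+ D) l ⟩
        (a ℤ.* k ℤ.- ℤ.+ D ℤ.* l) ℤ.* ℤ.+ q ∎
        where open ≡-Reasoning
      h : Cong (D * m)
      h = signed-cong {D * m} (Signed.divides (a ℤ.* k ℤ.- ℤ.+ D ℤ.* l) eq)
      1≤m : 1 ≤ m
      1≤m = n≢0⇒n>0 λ m≡0 → cong-unit {D * m} h (subst (q ∣_) (sym (trans (cong (D *_) m≡0) (*-zeroʳ D))) (q ∣0))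

  -- Discrepancies of progressions and reduction to pairs

  ∑-periodic : ∀ {q f} → (∀ m → f (q + m) ≡ f m) → ∀ k r
    → ∑ (range (r + k * q)) f ≡ ∑ (range r) f ℚ.+ ι k ℚ.* ∑ (range q) f
  ∑-periodic {q} {f} per zero r = trans (cong (λ z → ∑ (range z) f) (+-identityʳ r))
    (sym (trans (cong (λ z → ∑ (range r) f ℚ.+ z ℚ.* ∑ (range q) f) ι-0) (trans (cong (∑ (range r) f ℚ.+_) (ℚ.*-zeroˡ (∑ (range q) f))) (ℚ.+-identityʳ _))))
  ∑-periodic {q} {f} per (suc k) r = begin
    ∑ (range (r + (q + k * q))) f ≡⟨ cong (λ z → ∑ (range z) f) (trans (sym (+-assoc r q (k * q))) (trans (cong (_+ k * q) (+-comm r q)) (+-assoc q r (k * q)))) ⟩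
    ∑ (range (q + (r + k * q))) f ≡⟨ ∑-range-+ q (r + k * q) f ⟩
    ∑ (range q) f ℚ.+ ∑ (range (r + k * q)) (λ s → f (q + s)) ≡⟨ cong (∑ (range q) f ℚ.+_) (trans (∑-cong (range (r + k * q)) (λ {s} _ → per s)) (∑-periodic per k r)) ⟩
    ∑ (range q) f ℚ.+ (∑ (range r) f ℚ.+ ι k ℚ.* ∑ (range q) f) ≡⟨ S.solve 3 (λ a b c → a S.:+ (b S.:+ c S.:* a) S.:= b S.:+ (c S.:+ S.con 1ℚ) S.:* a) refl (∑ (range q) f) (∑ (range r) f) (ι k) ⟩
    ∑ (range r) f ℚ.+ (ι k ℚ.+ 1ℚ) ℚ.* ∑ (range q) f ≡⟨ cong (λ z → ∑ (range r) f ℚ.+ z ℚ.* ∑ (range q) f) (sym (ι-suc k)) ⟩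
    ∑ (range r) f ℚ.+ ι (suc k) ℚ.* ∑ (range q) f ∎
    where
    open ≡-Reasoning
    module S = ℚSolver.+-*-Solver

  ∣-∣≤1 : ∀ {a b} → 0ℚ ℚ.≤ a → a ℚ.≤ 1ℚ → 0ℚ ℚ.≤ b → b ℚ.≤ 1ℚ → ℚ.∣ a ℚ.- b ∣ ℚ.≤ 1ℚ
  ∣-∣≤1 {a} {b} 0≤a a≤1 0≤b b≤1 = ∣∣≤ {a ℚ.- b}
    (ℚ.≤-trans (ℚ.+-mono-≤ a≤1 (ℚ.neg-antimono-≤ 0≤b)) (ℚ.≤-reflexive (ℚ.+-identityʳ 1ℚ)))
    (ℚ.≤-trans (ℚ.≤-reflexive (S.solve 2 (λ a b → S.:- (a S.:- b) S.:= b S.:- a) refl a b))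
      (ℚ.≤-trans (ℚ.+-mono-≤ b≤1 (ℚ.neg-antimono-≤ 0≤a)) (ℚ.≤-reflexive (ℚ.+-identityʳ 1ℚ))))
    where module S = ℚSolver.+-*-Solver

  module Discrepancy (em : ExcludedMiddle 0ℓ) (q : ℕ) (pq : Prime q) (a : ℤ) (a⊥q : ℤ.Coprime a (ℤ.+ q)) (x : ℕ) where

    open Indicator em
    open Residues q pq a a⊥q
    open Pairs em q pq Cong (λ {m} {n} → cong-diff {m} {n}) (λ {n} → cong-unit {n}) x public hiding (q≢0)

    coprime⇒∤ : ∀ {n} → Coprime n q → ¬ q ∣ n
    coprime⇒∤ c q∣n = contradiction (c (q∣n , ∣-refl)) (≢-sym (<⇒≢ (prime>1 pq)))

    ∤⇒coprime : ∀ {n} → ¬ q ∣ n → Coprime n q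
    ∤⇒coprime q∤n = Coprimality.sym (prime-coprime pq q∤n)

    φ-count : ∑ (range q) (λ m → 𝟙 (Coprime m q)) ≡ ι (φ q)
    φ-count = count-filter em (λ m → coprime? m q) (range q)

    q≤1+φ : q ≤ suc (φ q)
    q≤1+φ = subst (_≤ suc (φ q)) (suc-pred q) (s≤s (ι-cancel (begin
      ι (pred q) ≡⟨ sym (∑-range-one (pred q)) ⟩
      ∑ (range (pred q)) (λ _ → 1ℚ) ≤⟨ ∑-mono (range (pred q)) (λ m∈ → ℚ.≤-reflexive (sym (𝟙-true (∤⇒coprime (small m∈))))) ⟩
      ∑ (range (pred q)) (λ m → 𝟙 (Coprime m q)) ≤⟨ ∑-range-mono (λ m → 𝟙 (Coprime m q)) (λ m → 0≤𝟙 (Coprime m q)) (pred[n]≤n {q}) ⟩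
      ∑ (range q) (λ m → 𝟙 (Coprime m q)) ≡⟨ φ-count ⟩
      ι (φ q) ∎)))
      where
      open ℚ.≤-Reasoning
      small : ∀ {m} → m ∈ range (pred q) → ¬ q ∣ m
      small m∈ q∣m = <⇒≱ (≤-<-trans (proj₂ (∈-range⁻ m∈)) (≤-reflexive (suc-pred q))) (∣⇒≤ {{>-nonZero (proj₁ (∈-range⁻ m∈))}} q∣m)

    1≤φ : 1 ≤ φ q
    1≤φ = ≤-pred (≤-trans (prime>1 pq) q≤1+φ)

    rφ : ℚ
    rφ = rc (φ q)

    rφ≤ : rφ ℚ.≤ ι 2 ℚ.* rc q
    rφ≤ = subst (ℚ._≤ ι 2 ℚ.* rc q) (trans (cong (ℚ._* rφ) ι-1) (ℚ.*-identityˡ rφ))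
      (cross {1} {φ q} {2} {q} 1≤φ (<⇒≤ (prime>1 pq)) (≤-trans (≤-reflexive (*-identityˡ q)) (≤-trans q≤1+φ (+-mono-≤ 1≤φ (m≤m+n (φ q) 0)))))

    divisorSum : (ℕ → Set) → ℕ → ℚ
    divisorSum A d = ∑ (range x) (λ n → 𝟙 (A n) ℚ.* 𝟙 (d * d ∣ n))

    squarefreeSum : (ℕ → Set) → ℚ
    squarefreeSum A = ∑ (range x) (λ n → 𝟙 (A n) ℚ.* 𝟙 (SF n))

    squarefreeSum-expand : ∀ A → squarefreeSum A ≡ ∑ (range x) (λ d → ν em d ℚ.* divisorSum A d)
    squarefreeSum-expand A = begin
      ∑ (range x) (λ n → 𝟙 (A n) ℚ.* 𝟙 (SF n)) ≡⟨ ∑-cong (range x) (λ {n} n∈ → expand n n∈) ⟩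
      ∑ (range x) (λ n → ∑ (range x) (λ d → ν em d ℚ.* (𝟙 (A n) ℚ.* 𝟙 (d * d ∣ n)))) ≡⟨ ∑-swap (range x) (range x) _ ⟩
      ∑ (range x) (λ d → ∑ (range x) (λ n → ν em d ℚ.* (𝟙 (A n) ℚ.* 𝟙 (d * d ∣ n)))) ≡⟨ ∑-cong (range x) (λ {d} _ → ∑-*ˡ (ν em d) (range x) _) ⟩
      ∑ (range x) (λ d → ν em d ℚ.* divisorSum A d) ∎
      where
      open ≡-Reasoning
      module S = ℚSolver.+-*-Solver
      expand : ∀ n → n ∈ range x → 𝟙 (A n) ℚ.* 𝟙 (SF n) ≡ ∑ (range x) (λ d → ν em d ℚ.* (𝟙 (A n) ℚ.* 𝟙 (d * d ∣ n)))
      expand n n∈ = trans (cong (𝟙 (A n) ℚ.*_) (sym (squarefree-indicator em (proj₁ (∈-range⁻ n∈)) (proj₂ (∈-range⁻ n∈)))))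
        (trans (sym (∑-*ˡ (𝟙 (A n)) (range x) _)) (∑-cong (range x) (λ {d} _ →
          S.solve 3 (λ u v w → u S.:* (v S.:* w) S.:= v S.:* (u S.:* w)) refl (𝟙 (A n)) (ν em d) (𝟙 (d * d ∣ n)))))

    divisorSum-multiples : ∀ A {d} → 1 ≤ d → divisorSum A d ≡ ∑ (range x) (λ m → 𝟙 (d * d * m ≤ x) ℚ.* 𝟙 (A (d * d * m)))
    divisorSum-multiples A {d} 1≤d = trans (∑-cong (range x) (λ {n} _ → ℚ.*-comm (𝟙 (A n)) (𝟙 (d * d ∣ n))))
      (∑-multiples em x (𝟙 ∘ A) (*-mono-≤ 1≤d 1≤d))

    divisorSum≤ : ∀ A {d} → 1 ≤ d → divisorSum A d ℚ.≤ ι x ℚ.* rc (d * d)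
    divisorSum≤ A {d} 1≤d = subst (ℚ._≤ ι x ℚ.* rc (d * d)) (sym (divisorSum-multiples A 1≤d))
      (ℚ.≤-trans (∑-mono (range x) (λ {m} _ → subst (𝟙 (d * d * m ≤ x) ℚ.* 𝟙 (A (d * d * m)) ℚ.≤_) (ℚ.*-identityʳ _) (*-monoˡ (0≤𝟙 (d * d * m ≤ x)) (𝟙≤1 (A (d * d * m))))))
        (multiples-count em x x (*-mono-≤ 1≤d 1≤d)))

    0≤divisorSum : ∀ A d → 0ℚ ℚ.≤ divisorSum A d
    0≤divisorSum A d = ∑-nonneg (range x) (λ {n} _ → *-nonneg (0≤𝟙 (A n)) (0≤𝟙 (d * d ∣ n)))

    N M′ Δ : ℕ → ℚ
    N = divisorSum Cong
    M′ = divisorSum (λ n → Coprime n q)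
    Δ d = N d ℚ.- M′ d ℚ.* rφ

    -- A residue class and the coprime residues are equidistributed over full periods modulo q.
    module Coprime-case {D : ℕ} (q∤D : ¬ q ∣ D) where

      f g : ℕ → ℚ
      f m = 𝟙 (Cong (D * m))
      g m = 𝟙 (Coprime (D * m) q)

      shift : ∀ m → D * (q + m) ≡ D * q + D * m
      shift m = *-distribˡ-+ D q m

      f-periodic : ∀ m → f (q + m) ≡ f m
      f-periodic m = trans (cong (𝟙 ∘ Cong) (shift m)) (𝟙-cong (cong-unshift {D * m} D) (cong-shift {D * m} D))

      g-periodic : ∀ m → g (q + m) ≡ g m
      g-periodic m = trans (cong (λ z → 𝟙 (Coprime z q)) (shift m)) (𝟙-cong {Coprime (D * q + D * m) q} {Coprime (D * m) q}
        (λ c → ∤⇒coprime (λ h → coprime⇒∤ {D * q + D * m} c (∣m∣n⇒∣m+n (n∣m*n D) h)))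
        (λ c → ∤⇒coprime (λ h → coprime⇒∤ {D * m} c (∣m+n∣m⇒∣n h (n∣m*n D)))))

      f-period : ∑ (range q) f ≡ 1ℚ
      f-period = ℚ.≤-antisym f≤1 (f≥1 (solvable q∤D))
        where
        f≥1 : (∃ λ m → 1 ≤ m × m ≤ q × Cong (D * m)) → 1ℚ ℚ.≤ ∑ (range q) f
        f≥1 (m , 1≤m , m≤q , h) = subst (ℚ._≤ ∑ (range q) f) (𝟙-true h) (term≤∑ {f = f} (λ m → 0≤𝟙 (Cong (D * m))) (∈-range⁺ 1≤m m≤q))
        q∤m : ∀ {m} → Cong (D * m) → ¬ q ∣ m
        q∤m {m} h q∣m = cong-unit {D * m} h (∣-trans q∣m (n∣m*n D))
        <q : ∀ {m} → m ∈ range q → Cong (D * m) → m < q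
        <q {m} m∈ h = ≤∧≢⇒< (proj₂ (∈-range⁻ m∈)) (λ { refl → q∤m {m} h ∣-refl })
        f≤1 : ∑ (range q) f ℚ.≤ 1ℚ
        f≤1 = ∑-subsingleton {P = λ m → Cong (D * m)} (range-unique q) (λ a∈ b∈ ha hb → cong-cancel {D} ha hb (<q a∈ ha) (<q b∈ hb))

      g-period : ∑ (range q) g ≡ ι (φ q)
      g-period = trans (∑-cong (range q) (λ {m} _ → 𝟙-cong {Coprime (D * m) q} {Coprime m q}
        (λ c → ∤⇒coprime (λ h → coprime⇒∤ {D * m} c (∣-trans h (n∣m*n D))))
        (λ c → ∤⇒coprime (λ h → case-euclid {m} c (euclidsLemma D m pq h))))) φ-count
        where
        case-euclid : ∀ {m} → Coprime m q → ¬ (q ∣ D ⊎ q ∣ m)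
        case-euclid c (inj₁ h) = q∤D h
        case-euclid {m} c (inj₂ h) = coprime⇒∤ {m} c h

      -- Each full period contributes 1 - φ(q)/φ(q) = 0. In the remaining incomplete period both
      -- terms lie between 0 and 1, by comparison with a full one.
      discrepancy : ∀ z → ℚ.∣ ∑ (range z) f ℚ.- ∑ (range z) g ℚ.* rφ ∣ ℚ.≤ 1ℚ
      discrepancy z = subst (λ w → ℚ.∣ w ∣ ℚ.≤ 1ℚ) (sym eq) (∣-∣≤1 (0≤f r) (subst (∑ (range r) f ℚ.≤_) f-period (∑-range-mono f (λ m → 0≤𝟙 _) r≤q))
          (*-nonneg (∑-nonneg (range r) (λ {m} _ → 0≤𝟙 _)) (0≤rc (φ q)))
          (rc-≤ 1≤φ (subst (∑ (range r) g ℚ.≤_) (trans g-period (sym (ℚ.*-identityˡ (ι (φ q))))) (∑-range-mono g (λ m → 0≤𝟙 _) r≤q))))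
        where
        open ≡-Reasoning
        module S = ℚSolver.+-*-Solver
        r = z % q
        k = z / q
        r≤q : r ≤ q
        r≤q = <⇒≤ (m%n<n z q)
        0≤f : ∀ r → 0ℚ ℚ.≤ ∑ (range r) f
        0≤f r = ∑-nonneg (range r) (λ {m} _ → 0≤𝟙 _)
        eq : ∑ (range z) f ℚ.- ∑ (range z) g ℚ.* rφ ≡ ∑ (range r) f ℚ.- ∑ (range r) g ℚ.* rφ
        eq = begin
          ∑ (range z) f ℚ.- ∑ (range z) g ℚ.* rφ ≡⟨ cong (λ w → ∑ (range w) f ℚ.- ∑ (range w) g ℚ.* rφ) (m≡m%n+[m/n]*n z q) ⟩
          ∑ (range (r + k * q)) f ℚ.- ∑ (range (r + k * q)) g ℚ.* rφ ≡⟨ cong₂ (λ u v → u ℚ.- v ℚ.* rφ) (∑-periodic f-periodic k r) (∑-periodic g-periodic k r) ⟩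
          fr ℚ.+ ι k ℚ.* ∑ (range q) f ℚ.- (gr ℚ.+ ι k ℚ.* ∑ (range q) g) ℚ.* rφ ≡⟨ cong₂ (λ u v → fr ℚ.+ ι k ℚ.* u ℚ.- (gr ℚ.+ ι k ℚ.* v) ℚ.* rφ) f-period g-period ⟩
          fr ℚ.+ ι k ℚ.* 1ℚ ℚ.- (gr ℚ.+ ι k ℚ.* ι (φ q)) ℚ.* rφ ≡⟨ S.solve 5 (λ fr gr k p r → fr S.:+ k S.:* S.con 1ℚ S.:- (gr S.:+ k S.:* p) S.:* r S.:= fr S.:- gr S.:* r S.:+ k S.:* (S.con 1ℚ S.:- p S.:* r)) refl fr gr (ι k) (ι (φ q)) rφ ⟩
          fr ℚ.- gr ℚ.* rφ ℚ.+ ι k ℚ.* (1ℚ ℚ.- ι (φ q) ℚ.* rφ) ≡⟨ cong (λ w → fr ℚ.- gr ℚ.* rφ ℚ.+ ι k ℚ.* (1ℚ ℚ.- w)) (rc-inverseˡ 1≤φ) ⟩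
          fr ℚ.- gr ℚ.* rφ ℚ.+ ι k ℚ.* (1ℚ ℚ.- 1ℚ) ≡⟨ S.solve 2 (λ w k → w S.:+ k S.:* (S.con 1ℚ S.:- S.con 1ℚ) S.:= w) refl (fr ℚ.- gr ℚ.* rφ) (ι k) ⟩
          fr ℚ.- gr ℚ.* rφ ∎
          where
          fr = ∑ (range r) f
          gr = ∑ (range r) g

    -- If `q` divides `d`, no multiple of `d²` is coprime to `q` or in the class of a, and both sums
    -- vanish. Otherwise `d²` is a unit and the sums run over an initial segment of the cofactors
    -- `m`.
    ∣Δ∣≤1 : ∀ {d} → 1 ≤ d → ℚ.∣ Δ d ∣ ℚ.≤ 1ℚ
    ∣Δ∣≤1 {d} 1≤d with q ∣? d
    ... | yes q∣d = subst (λ w → ℚ.∣ w ∣ ℚ.≤ 1ℚ) (sym (cong₂ (λ u v → u ℚ.- v ℚ.* rφ) N≡0 M′≡0)) (subst (λ w → ℚ.∣ 0ℚ ℚ.- w ∣ ℚ.≤ 1ℚ) (sym (ℚ.*-zeroˡ rφ)) 0≤1)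
      where
      q∣n : ∀ {n} → d * d ∣ n → q ∣ n
      q∣n h = ∣-trans (∣-trans q∣d (m∣m*n d)) h
      N≡0 : N d ≡ 0ℚ
      N≡0 = ∑-vanish (range x) (λ {n} _ → trans (sym (𝟙-× (Cong n) (d * d ∣ n))) (𝟙-false (λ (c , h) → cong-unit {n} c (q∣n h))))
      M′≡0 : M′ d ≡ 0ℚ
      M′≡0 = ∑-vanish (range x) (λ {n} _ → trans (sym (𝟙-× (Coprime n q) (d * d ∣ n))) (𝟙-false (λ (c , h) → coprime⇒∤ {n} c (q∣n h))))
    ... | no q∤d = subst (λ w → ℚ.∣ w ∣ ℚ.≤ 1ℚ) (sym (cong₂ (λ u v → u ℚ.- v ℚ.* rφ) (reduce Cong) (reduce (λ n → Coprime n q)))) (Coprime-case.discrepancy q∤D (x / D))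
      where
      D = d * d
      instance
        _ = >-nonZero (*-mono-≤ 1≤d 1≤d)
      q∤D : ¬ q ∣ D
      q∤D h with euclidsLemma d d pq h
      ... | inj₁ k = q∤d k
      ... | inj₂ k = q∤d k
      reduce : ∀ A → divisorSum A d ≡ ∑ (range (x / D)) (λ m → 𝟙 (A (D * m)))
      reduce A = trans (divisorSum-multiples A 1≤d) (∑-cutoff em {P = λ m → D * m ≤ x} (λ m → 𝟙 (A (D * m))) (m/n≤m′ x D)
        (λ {m} _ le → m*n≤o⇒m≤o/n m D x (subst (_≤ x) (*-comm D m) le))
        (λ {m} _ le → ≤-trans (≤-reflexive (*-comm D m)) (≤-trans (*-monoˡ-≤ D le) (m/n*n≤m x D))))
        where open import Data.Nat.DivMod using () renaming (m/n≤m to m/n≤m′)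

    ∣Δ∣≤ : ∀ {d} → 1 ≤ d → ℚ.∣ Δ d ∣ ℚ.≤ N d ℚ.+ ι x ℚ.* rφ ℚ.* rc (d * d)
    ∣Δ∣≤ {d} 1≤d = begin
      ℚ.∣ N d ℚ.- M′ d ℚ.* rφ ∣ ≤⟨ ℚ.∣p-q∣≤∣p∣+∣q∣ (N d) (M′ d ℚ.* rφ) ⟩
      ℚ.∣ N d ∣ ℚ.+ ℚ.∣ M′ d ℚ.* rφ ∣ ≡⟨ cong₂ ℚ._+_ (ℚ.0≤p⇒∣p∣≡p (0≤divisorSum Cong d)) (ℚ.0≤p⇒∣p∣≡p (*-nonneg (0≤divisorSum _ d) (0≤rc (φ q)))) ⟩
      N d ℚ.+ M′ d ℚ.* rφ ≤⟨ ℚ.+-monoʳ-≤ (N d) (*-monoʳ (0≤rc (φ q)) (divisorSum≤ (λ n → Coprime n q) 1≤d)) ⟩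
      N d ℚ.+ ι x ℚ.* rc (d * d) ℚ.* rφ ≡⟨ cong (N d ℚ.+_) (S.solve 3 (λ u v w → u S.:* v S.:* w S.:= u S.:* w S.:* v) refl (ι x) (rc (d * d)) rφ) ⟩
      N d ℚ.+ ι x ℚ.* rφ ℚ.* rc (d * d) ∎
      where
      open ℚ.≤-Reasoning
      module S = ℚSolver.+-*-Solver

    E₀ : ℚ
    E₀ = squarefreeSum Cong ℚ.- squarefreeSum (λ n → Coprime n q) ℚ.* rφ

    E₀≡ : E₀ ≡ ∑ (range x) (λ d → ν em d ℚ.* Δ d)
    E₀≡ = begin
      E₀ ≡⟨ cong₂ (λ u v → u ℚ.- v ℚ.* rφ) (squarefreeSum-expand Cong) (squarefreeSum-expand (λ n → Coprime n q)) ⟩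
      ∑ (range x) (λ d → ν em d ℚ.* N d) ℚ.- ∑ (range x) (λ d → ν em d ℚ.* M′ d) ℚ.* rφ ≡⟨ cong (∑ (range x) (λ d → ν em d ℚ.* N d) ℚ.+_) (trans (ℚ.neg-distribʳ-* B rφ) (sym (∑-*ʳ (ℚ.- rφ) (range x) _))) ⟩
      ∑ (range x) (λ d → ν em d ℚ.* N d) ℚ.+ ∑ (range x) (λ d → ν em d ℚ.* M′ d ℚ.* ℚ.- rφ) ≡⟨ sym (∑-+ (range x) _ _) ⟩
      ∑ (range x) (λ d → ν em d ℚ.* N d ℚ.+ ν em d ℚ.* M′ d ℚ.* ℚ.- rφ) ≡⟨ ∑-cong (range x) (λ {d} _ → S.solve 4 (λ v n m r → v S.:* n S.:+ v S.:* m S.:* (S.:- r) S.:= v S.:* (n S.:- m S.:* r)) refl (ν em d) (N d) (M′ d) rφ) ⟩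
      ∑ (range x) (λ d → ν em d ℚ.* Δ d) ∎
      where
      open ≡-Reasoning
      module S = ℚSolver.+-*-Solver
      B = ∑ (range x) (λ d → ν em d ℚ.* M′ d)

    S : ℕ → ℚ
    S D₀ = ∑ pairs (λ (d , m) → 𝟙 (D₀ < d × Sol d m))

    E₀-bound : ∀ D₀ → 1 ≤ D₀ → ℚ.∣ E₀ ∣ ℚ.≤ ι D₀ ℚ.+ (S D₀ ℚ.+ ι x ℚ.* rφ ℚ.* rc D₀)
    E₀-bound D₀ 1≤D₀ = begin
      ℚ.∣ E₀ ∣ ≡⟨ cong ℚ.∣_∣ E₀≡ ⟩
      ℚ.∣ ∑ (range x) (λ d → ν em d ℚ.* Δ d) ∣ ≤⟨ ∑-∣∣ (range x) _ ⟩
      ∑ (range x) (λ d → ℚ.∣ ν em d ℚ.* Δ d ∣) ≤⟨ ∑-mono (range x) (λ d∈ → each (proj₁ (∈-range⁻ d∈))) ⟩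
      ∑ (range x) (λ d → 𝟙 (d ≤ D₀) ℚ.+ (𝟙 (D₀ < d) ℚ.* N d ℚ.+ c ℚ.* (𝟙 (D₀ < d) ℚ.* rc (d * d)))) ≡⟨ trans (∑-+ (range x) _ _) (cong (∑ (range x) (λ d → 𝟙 (d ≤ D₀)) ℚ.+_) (trans (∑-+ (range x) _ _) (cong (∑ (range x) (λ d → 𝟙 (D₀ < d) ℚ.* N d) ℚ.+_) (∑-*ˡ c (range x) _)))) ⟩
      ∑ (range x) (λ d → 𝟙 (d ≤ D₀)) ℚ.+ (∑ (range x) (λ d → 𝟙 (D₀ < d) ℚ.* N d) ℚ.+ c ℚ.* ∑ (range x) (λ d → 𝟙 (D₀ < d) ℚ.* rc (d * d)))
            ≤⟨ ℚ.+-mono-≤ small (ℚ.+-mono-≤ (ℚ.≤-reflexive large) (*-monoˡ (*-nonneg (0≤ι x) (0≤rc (φ q))) (square-tail em x 1≤D₀))) ⟩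
      ι D₀ ℚ.+ (S D₀ ℚ.+ c ℚ.* rc D₀) ∎
      where
      open ℚ.≤-Reasoning
      c = ι x ℚ.* rφ
      each : ∀ {d} → 1 ≤ d → ℚ.∣ ν em d ℚ.* Δ d ∣ ℚ.≤ 𝟙 (d ≤ D₀) ℚ.+ (𝟙 (D₀ < d) ℚ.* N d ℚ.+ c ℚ.* (𝟙 (D₀ < d) ℚ.* rc (d * d)))
      each {d} 1≤d = ℚ.≤-trans (subst (ℚ.∣ ν em d ℚ.* Δ d ∣ ℚ.≤_) (ℚ.*-identityˡ ℚ.∣ Δ d ∣) (∣*∣≤ {ν em d} {Δ d} (∣ν∣≤1 em d) ℚ.≤-refl)) main
        where
        main : ℚ.∣ Δ d ∣ ℚ.≤ 𝟙 (d ≤ D₀) ℚ.+ (𝟙 (D₀ < d) ℚ.* N d ℚ.+ c ℚ.* (𝟙 (D₀ < d) ℚ.* rc (d * d)))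
        main with d ≤? D₀
        ... | yes le = ℚ.≤-trans (subst (ℚ.∣ Δ d ∣ ℚ.≤_) (sym (𝟙-true le)) (∣Δ∣≤1 1≤d)) (≤-+ʳ (+-nonneg
                (*-nonneg (0≤𝟙 (D₀ < d)) (0≤divisorSum Cong d)) (*-nonneg (*-nonneg (0≤ι x) (0≤rc (φ q))) (*-nonneg (0≤𝟙 (D₀ < d)) (0≤rc (d * d))))))
        ... | no ¬le = ℚ.≤-trans (∣Δ∣≤ 1≤d) (subst (λ w → N d ℚ.+ c ℚ.* rc (d * d) ℚ.≤ 𝟙 (d ≤ D₀) ℚ.+ w)
                (cong₂ (λ u v → u ℚ.+ c ℚ.* v) (sym (𝟙*-true em (N d) (≰⇒> ¬le))) (sym (𝟙*-true em (rc (d * d)) (≰⇒> ¬le)))) (≤-+ˡ (0≤𝟙 (d ≤ D₀))))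
      small : ∑ (range x) (λ d → 𝟙 (d ≤ D₀)) ℚ.≤ ι D₀
      small = subst (λ z → ∑ (range x) (λ d → 𝟙 (d ≤ D₀)) ℚ.≤ ι z) (length-range D₀)
        (count-length {ys = range D₀} _≡_ (range-unique x) (λ {d} d∈ le → d , ∈-range⁺ (proj₁ (∈-range⁻ d∈)) le , refl) (λ { _ _ _ _ refl refl → refl }))
      large : ∑ (range x) (λ d → 𝟙 (D₀ < d) ℚ.* N d) ≡ S D₀
      large = trans (∑-cong (range x) (λ {d} d∈ → trans (cong (𝟙 (D₀ < d) ℚ.*_) (divisorSum-multiples Cong (proj₁ (∈-range⁻ d∈))))
          (trans (sym (∑-*ˡ (𝟙 (D₀ < d)) (range x) _)) (∑-cong (range x) (λ {m} _ → trans (cong (𝟙 (D₀ < d) ℚ.*_) (sym (𝟙-× (d * d * m ≤ x) (Cong (d * d * m)))))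
            (sym (𝟙-× (D₀ < d) (Sol d m))))))))
        (sym (∑-product (range x) (range x) (λ (d , m) → 𝟙 (D₀ < d × Sol d m))))

  -- Dyadic parameters and the two ranges of q

  opaque

    pw : ℕ → ℕ
    pw n = 2 ^ n

    pw≡ : ∀ n → pw n ≡ 2 ^ n
    pw≡ _ = refl

    pw-+ : ∀ m n → pw (m + n) ≡ pw m * pw n
    pw-+ = ^-distribˡ-+-* 2

    pw-mono : ∀ {m n} → m ≤ n → pw m ≤ pw n
    pw-mono = ^-monoʳ-≤ 2

    pw>0 : ∀ n → 1 ≤ pw n
    pw>0 = m^n>0 2

  pw-* : ∀ {m n k} → m + n ≡ k → pw m * pw n ≡ pw k
  pw-* {m} {n} refl = sym (pw-+ m n)

  cofactor< : ∀ {D m s u} → pw s ≤ D → D * m < pw (s + u) → m < pw u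
  cofactor< {D} {m} {s} {u} le lt = *-cancelˡ-< (pw s) m (pw u) (≤-<-trans (*-monoˡ-≤ m le) (subst (D * m <_) (pw-+ s u) lt))

  root< : ∀ {d m w u} → pw u ≤ m → d * d * m < pw (w + w + u) → d < pw w
  root< {d} {m} {w} {u} le lt = ≰⇒> λ pw≤d → <⇒≱ lt (≤-trans (≤-reflexive (trans (pw-+ (w + w) u) (cong (_* pw u) (pw-+ w w))))
    (*-mono-≤ (*-mono-≤ pw≤d pw≤d) le))

  -- Together with `pw (6 * i) ≤ suc κ` this yields `63 * i ≤ κ`: every exponent linear in `i` that
  -- occurs below is a small fraction of `κ`.
  bernoulli-64 : ∀ i → 1 + 63 * i ≤ pw (6 * i)
  bernoulli-64 i = subst (1 + 63 * i ≤_) (trans (^-*-assoc 2 6 i) (sym (pw≡ (6 * i)))) (go i)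
    where
    go : ∀ i → 1 + 63 * i ≤ 64 ^ i
    go zero = ≤-refl
    go (suc i) = ≤-trans (≤-trans (m≤m+n (1 + 63 * suc i) (63 * 63 * i)) (≤-reflexive
      (solve 1 (λ i → con 1 :+ con 63 :* (con 1 :+ i) :+ con 63 :* con 63 :* i := con 64 :* (con 1 :+ con 63 :* i)) refl i))) (*-monoʳ-≤ 64 (go i))
      where open +-*-Solver

  -- Absorbs the factor `suc α` of the sieve for `α = 9 * i`, which stands for log log x, into
  -- `8^i`, which stands for the square root of log x.
  bernoulli-8 : ∀ i → suc (9 * i) ≤ 2 * pw (3 * i)
  bernoulli-8 i = subst (λ z → suc (9 * i) ≤ 2 * z) (trans (^-*-assoc 2 3 i) (sym (pw≡ (3 * i)))) (go i)
    where
    go : ∀ i → suc (9 * i) ≤ 2 * 8 ^ i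
    go zero = s≤s z≤n
    -- The inductive step rests on `10 + 9 i ≤ 8 (1 + 9 i)`, which fails at `i = 0`; so `i = 1` is
    -- checked by hand.
    go (suc zero) = ≤ᵇ⇒≤ 10 16 _
    go (suc i@(suc j)) = ≤-trans (≤-trans (m≤m+n (1 + 9 * suc i) (61 + 63 * j)) (≤-reflexive
      (solve 1 (λ j → con 1 :+ con 9 :* (con 2 :+ j) :+ (con 61 :+ con 63 :* j) := con 8 :* (con 1 :+ con 9 :* (con 1 :+ j))) refl j)))
      (≤-trans (*-monoʳ-≤ 8 (go i)) (≤-reflexive (solve 1 (λ z → con 8 :* (con 2 :* z) := con 2 :* (con 8 :* z)) refl (8 ^ i))))
      where open +-*-Solver

  module _ {u : ℚ} (0≤u : 0ℚ ℚ.≤ u) where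

    combine : ∀ {a b} c d → a ℚ.≤ ι c ℚ.* u → b ℚ.≤ ι d ℚ.* u → a ℚ.+ b ℚ.≤ ι (c + d) ℚ.* u
    combine {a} {b} c d ha hb = subst (a ℚ.+ b ℚ.≤_) (trans (sym (ℚ.*-distribʳ-+ u (ι c) (ι d))) (cong (ℚ._* u) (sym (ι-+ c d)))) (ℚ.+-mono-≤ ha hb)

    enlarge : ∀ {a c d} → c ≤ d → a ℚ.≤ ι c ℚ.* u → a ℚ.≤ ι d ℚ.* u
    enlarge c≤d h = ℚ.≤-trans h (*-monoʳ 0≤u (ι-mono c≤d))

  module Core (em : ExcludedMiddle 0ℓ) (q : ℕ) (pq : Prime q) (a : ℤ) (a⊥q : ℤ.Coprime a (ℤ.+ q)) (x κ i : ℕ)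
    (x-lower : pw (12 * κ) ≤ x) (x-upper : x < pw (12 * κ + 12)) (i-upper : pw (6 * i) ≤ suc κ) where

    open Indicator em
    open Residues q pq a a⊥q using (cong-unit; q≢0)
    open Discrepancy em q pq a a⊥q x
    open +-*-Solver using (solve; _:+_; _:*_; _:=_; con)

    T : ℕ
    T = pw (4 * κ)

    t₁ t₂ u : ℚ
    t₁ = ι T ℚ.* rc (pw (2 * i))
    t₂ = ι x ℚ.* rc (q * pw (3 * i))
    u = t₁ ℚ.+ t₂

    -- Large enough for the sum of the constants collected in either case: 528387 in `CaseI` and
    -- 36932 in `CaseII`.
    C : ℕ
    C = pw 21

    0≤t₁ : 0ℚ ℚ.≤ t₁
    0≤t₁ = *-nonneg (0≤ι T) (0≤rc (pw (2 * i)))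

    0≤t₂ : 0ℚ ℚ.≤ t₂
    0≤t₂ = *-nonneg (0≤ι x) (0≤rc (q * pw (3 * i)))

    0≤u : 0ℚ ℚ.≤ u
    0≤u = +-nonneg 0≤t₁ 0≤t₂

    t₁≤u : ∀ {a} c → a ℚ.≤ ι c ℚ.* t₁ → a ℚ.≤ ι c ℚ.* u
    t₁≤u c h = ℚ.≤-trans h (*-monoˡ (0≤ι c) (≤-+ʳ 0≤t₂))

    t₂≤u : ∀ {a} c → a ℚ.≤ ι c ℚ.* t₂ → a ℚ.≤ ι c ℚ.* u
    t₂≤u c h = ℚ.≤-trans h (*-monoˡ (0≤ι c) (≤-+ˡ 0≤t₁))

    1≤q : 1 ≤ q
    1≤q = <⇒≤ (prime>1 pq)

    1≤qB : 1 ≤ q * pw (3 * i)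
    1≤qB = *-mono-≤ 1≤q (pw>0 (3 * i))

    63i≤κ : 63 * i ≤ κ
    63i≤κ = ≤-pred (≤-trans (bernoulli-64 i) i-upper)

    -- With `63 * i ≤ κ` at hand, an inequality between exponents reduces to a comparison of
    -- numerals.
    scale : ∀ c b → Bool.T (c ≤ᵇ b * 63) → c * i ≤ b * κ
    scale c b h = ≤-trans (subst (c * i ≤_) (*-assoc b 63 i) (*-monoˡ-≤ i (≤ᵇ⇒≤ c (b * 63) h))) (*-monoʳ-≤ b 63i≤κ)

    sol-m≢0 : ∀ {d m} → Sol d m → 1 ≤ m
    sol-m≢0 {d} {zero} (_ , h) = contradiction (subst (q ∣_) (sym (*-zeroʳ (d * d))) (q ∣0)) (cong-unit {d * d * 0} h)
    sol-m≢0 {d} {suc m} _ = s≤s z≤n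

    sol< : ∀ {d m e} → e ≡ 12 * κ + 12 → Sol d m → d * d * m < pw e
    sol< refl (le , _) = ≤-<-trans le x-upper

    sol-d< : ∀ {d m} → Sol d m → d < pw (6 * κ + 6)
    sol-d< {d} {m} h = root< {d} {m} {6 * κ + 6} {0} (≤-trans (≤-reflexive (pw≡ 0)) (sol-m≢0 {d} {m} h))
      (sol< {d} {m} (solve 1 (λ k → (con 6 :* k :+ con 6) :+ (con 6 :* k :+ con 6) :+ con 0 := con 12 :* k :+ con 12) refl κ) h)

    tail-bound : ∀ D₀ → pw (3 * i) ≤ D₀ → ι x ℚ.* rφ ℚ.* rc D₀ ℚ.≤ ι 2 ℚ.* t₂
    tail-bound D₀ le = begin
      ι x ℚ.* rφ ℚ.* rc D₀ ≤⟨ *-monoʳ (0≤rc D₀) (*-monoˡ (0≤ι x) rφ≤) ⟩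
      ι x ℚ.* (ι 2 ℚ.* rc q) ℚ.* rc D₀ ≡⟨ S.solve 4 (λ x t q d → x S.:* (t S.:* q) S.:* d S.:= t S.:* (x S.:* (q S.:* d))) refl (ι x) (ι 2) (rc q) (rc D₀) ⟩
      ι 2 ℚ.* (ι x ℚ.* (rc q ℚ.* rc D₀)) ≤⟨ *-monoˡ (0≤ι 2) (*-monoˡ (0≤ι x) (*-monoˡ (0≤rc q) (rc-anti (pw>0 (3 * i)) le))) ⟩
      ι 2 ℚ.* (ι x ℚ.* (rc q ℚ.* rc (pw (3 * i)))) ≡⟨ cong (λ z → ι 2 ℚ.* (ι x ℚ.* z)) (sym (rc-* 1≤q (pw>0 (3 * i)))) ⟩
      ι 2 ℚ.* t₂ ∎
      where
      open ℚ.≤-Reasoning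
      module S = ℚSolver.+-*-Solver

    -- The trivial count with `D₀ = T`. It suffices once `T ≤ u`: for `i = 0`, where `t₁` is `T`
    -- itself, and for `q * 8^i ≤ 2^(8κ)`, where `t₂` is at least `T`.
    module CaseI where

      M J w2 : ℕ
      M = pw (4 * κ + 12)
      w2 = 2 * pw (6 * κ + 6)
      J = suc (w2 / q)

      S-bound : S T ℚ.≤ ι (M * J)
      S-bound = pairs-count M J λ {d} {m} (T<d , sol) → sol
        , <⇒≤ (cofactor< {d * d} {m} {8 * κ} {4 * κ + 12}
            (≤-trans (≤-reflexive (sym (pw-* (solve 1 (λ k → con 4 :* k :+ con 4 :* k := con 8 :* k) refl κ)))) (*-mono-≤ (<⇒≤ T<d) (<⇒≤ T<d)))
            (sol< {d} {m} (solve 1 (λ k → con 8 :* k :+ (con 4 :* k :+ con 12) := con 12 :* k :+ con 12) refl κ) sol))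
        , s≤s (/-monoˡ-≤ q (*-monoʳ-≤ 2 (<⇒≤ (sol-d< {d} {m} sol))))

      M≤ : ι M ℚ.≤ ι (pw 12) ℚ.* ι T
      M≤ = ℚ.≤-reflexive (trans (cong ι (trans (pw-+ (4 * κ) 12) (*-comm T (pw 12)))) (ι-* (pw 12) T))

      3i≤2κ : 3 * i ≤ 2 * κ
      3i≤2κ = scale 3 2 _

      -- The intervals of length q/2 after the first contribute at most `2^(10κ+19) / q`. Since
      -- `x ≥ 2^(12κ)`, there is room for a further factor `2^(2κ)`, and this covers the `8^i` in
      -- `t₂`.
      MJ≤ : ι (M * (w2 / q)) ℚ.≤ ι (pw 19) ℚ.* t₂
      MJ≤ = ℚ.≤-trans (≤-rc 1≤q (subst (ℚ._≤ ι (M * w2)) (ι-* (M * (w2 / q)) q) (ι-mono (subst (_≤ M * w2) (sym (*-assoc M (w2 / q) q)) (*-monoʳ-≤ M (m/n*n≤m w2 q))))))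
        (ℚ.≤-trans (cross {M * w2} {q} {pw 19 * x} {q * pw (3 * i)} 1≤q 1≤qB le) (ℚ.≤-reflexive (trans (cong (ℚ._* rc (q * pw (3 * i))) (ι-* (pw 19) x)) (ℚ.*-assoc (ι (pw 19)) (ι x) (rc (q * pw (3 * i)))))))
        where
        open ≤-Reasoning
        le : M * w2 * (q * pw (3 * i)) ≤ pw 19 * x * q
        le = begin
          M * w2 * (q * pw (3 * i)) ≡⟨ cong (λ z → M * (z * pw (6 * κ + 6)) * (q * pw (3 * i))) (sym (pw≡ 1)) ⟩
          M * (pw 1 * pw (6 * κ + 6)) * (q * pw (3 * i)) ≡⟨ cong (λ z → M * z * (q * pw (3 * i))) (pw-* {1} refl) ⟩
          M * pw (1 + (6 * κ + 6)) * (q * pw (3 * i)) ≡⟨ cong (_* (q * pw (3 * i))) (pw-* (solve 1 (λ k → (con 4 :* k :+ con 12) :+ (con 1 :+ (con 6 :* k :+ con 6)) := con 19 :+ con 10 :* k) refl κ)) ⟩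
          pw (19 + 10 * κ) * (q * pw (3 * i)) ≤⟨ *-monoʳ-≤ (pw (19 + 10 * κ)) (*-monoʳ-≤ q (pw-mono 3i≤2κ)) ⟩
          pw (19 + 10 * κ) * (q * pw (2 * κ)) ≡⟨ solve 3 (λ a b c → a :* (b :* c) := a :* c :* b) refl (pw (19 + 10 * κ)) q (pw (2 * κ)) ⟩
          pw (19 + 10 * κ) * pw (2 * κ) * q ≡⟨ cong (_* q) (pw-* (solve 1 (λ k → con 19 :+ con 10 :* k :+ con 2 :* k := con 19 :+ con 12 :* k) refl κ)) ⟩
          pw (19 + 12 * κ) * q ≡⟨ cong (_* q) (pw-+ 19 (12 * κ)) ⟩
          pw 19 * pw (12 * κ) * q ≤⟨ *-monoˡ-≤ q (*-monoʳ-≤ (pw 19) x-lower) ⟩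
          pw 19 * x * q ∎

      bound : ι T ℚ.≤ u → ℚ.∣ E₀ ∣ ℚ.≤ ι C ℚ.* u
      bound T≤u = ℚ.≤-trans (E₀-bound T (pw>0 (4 * κ))) (enlarge 0≤u {c = 1 + ((pw 12 + pw 19) + 2)} (≤ᵇ⇒≤′)
        (combine 0≤u 1 ((pw 12 + pw 19) + 2) (ℚ.≤-trans T≤u (ℚ.≤-reflexive (sym (trans (cong (ℚ._* u) ι-1) (ℚ.*-identityˡ u)))))
          (combine 0≤u (pw 12 + pw 19) 2 S≤ (t₂≤u 2 (tail-bound T (pw-mono (≤-trans 3i≤2κ (*-monoˡ-≤ κ (≤ᵇ⇒≤ 2 4 _)))))))))
        where
        ≤ᵇ⇒≤′ : 1 + ((pw 12 + pw 19) + 2) ≤ C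
        ≤ᵇ⇒≤′ = subst₂ (λ a b → 1 + ((a + b) + 2) ≤ C) (sym (pw≡ 12)) (sym (pw≡ 19)) (subst (528387 ≤_) (sym (pw≡ 21)) (≤ᵇ⇒≤ 528387 2097152 _))
        S≤ : S T ℚ.≤ ι (pw 12 + pw 19) ℚ.* u
        S≤ = ℚ.≤-trans S-bound (subst (ℚ._≤ ι (pw 12 + pw 19) ℚ.* u) (sym (trans (cong ι (*-suc M (w2 / q))) (ι-+ M (M * (w2 / q)))))
          (combine 0≤u (pw 12) (pw 19) (ℚ.≤-trans M≤ (*-monoˡ (0≤ι (pw 12)) T≤u)) (t₂≤u (pw 19) MJ≤)))

    -- D₀ = 16^κ / 4ⁱ, ρ = 64ⁱ, K₀ = 512ⁱ and K₁ = 512ⁱ 2^κ make each of the four counts O(D₀); the bounds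
    -- M = 2^μ for m and Y = 2^β for d are what D₀ < d, respectively D₀ < m, and d² m ≤ x allow.
    module CaseII (1≤i : 1 ≤ i) (q-large : pw (8 * κ) < q * pw (3 * i)) where

      i≤κ : i ≤ κ
      i≤κ = ≤-trans (m≤n*m i 63) 63i≤κ

      1≤κ : 1 ≤ κ
      1≤κ = ≤-trans 1≤i i≤κ

      const-≤ : ∀ c → c ≤ c * i
      const-≤ c = m≤m*n c i {{>-nonZero 1≤i}}

      -- `e₁` is the exponent form of `2 d < q` for `d < 2^(6κ+6)`, and `e₂` that of `M K₁² < q`; in
      -- both the `3 * i` of `q-large` is included. The constants are absorbed into multiples of `i`
      -- because `1 ≤ i`.
      e₁ : 7 + 3 * i ≤ 2 * κ
      e₁ = ≤-trans (+-monoˡ-≤ (3 * i) (const-≤ 7)) (≤-trans (≤-reflexive (sym (*-distribʳ-+ i 7 3))) (scale 10 2 _))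

      e₂ : 12 + 25 * i ≤ 2 * κ
      e₂ = ≤-trans (+-monoˡ-≤ (25 * i) (const-≤ 12)) (≤-trans (≤-reflexive (sym (*-distribʳ-+ i 12 25))) (scale 37 2 _))

      11i≤4κ : 11 * i ≤ 4 * κ
      11i≤4κ = scale 11 4 _

      2i≤4κ : 2 * i ≤ 4 * κ
      2i≤4κ = ≤-trans (*-monoˡ-≤ i (s≤s (s≤s (z≤n {9})))) 11i≤4κ

      -- The exponents solve `2δ + μ = 12κ + 12` and `2β + δ = 12κ + 12`, the sizes allowed by d² m
      -- ≤ x. `pw ε` bounds the cofactor `d / k` when `k ≥ 512^i`.
      δ ε β μ D₀ : ℕ
      δ = 4 * κ ∸ 2 * i
      β = 4 * κ + i + 6
      ε = β ∸ 9 * i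
      μ = 4 * κ + 4 * i + 12
      D₀ = pw δ

      δ+2i : δ + 2 * i ≡ 4 * κ
      δ+2i = m∸n+n≡m 2i≤4κ

      9i≤δ : 9 * i ≤ δ
      9i≤δ = +-cancelʳ-≤ (2 * i) (9 * i) δ (subst₂ _≤_ (*-distribʳ-+ i 9 2) (sym δ+2i) 11i≤4κ)

      ε+9i : ε + 9 * i ≡ β
      ε+9i = m∸n+n≡m (≤-trans 9i≤δ (≤-trans (m∸n≤m (4 * κ) (2 * i)) (≤-trans (m≤m+n (4 * κ) i) (m≤m+n (4 * κ + i) 6))))

      <q : ∀ {e} → e + 3 * i ≤ 8 * κ → pw e < q
      <q {e} le = *-cancelʳ-< (pw (3 * i)) (pw e) q (≤-<-trans (≤-trans (≤-reflexive (sym (pw-+ e (3 * i)))) (pw-mono le)) q-large)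

      half : ∀ {d m} → 1 ≤ m → Sol d m → 2 * d < q
      half {d} {m} _ sol = ≤-<-trans (≤-trans (*-monoʳ-≤ 2 (<⇒≤ (sol-d< {d} {m} sol))) (≤-reflexive (trans (cong (_* pw (6 * κ + 6)) (sym (pw≡ 1))) (pw-* {1} refl))))
        (<q (≤-trans (≤-reflexive (solve 2 (λ k i → con 1 :+ (con 6 :* k :+ con 6) :+ con 3 :* i := con 6 :* k :+ (con 7 :+ con 3 :* i)) refl κ i))
          (≤-trans (+-monoʳ-≤ (6 * κ) e₁) (≤-reflexive (sym (*-distribʳ-+ κ 6 2))))))

      m-bound : ∀ {d m} → D₀ < d → Sol d m → m ≤ pw μ
      m-bound {d} {m} D₀<d sol = <⇒≤ (cofactor< {d * d} {m} {δ + δ} {μ} (≤-trans (≤-reflexive (pw-+ δ δ)) (*-mono-≤ (<⇒≤ D₀<d) (<⇒≤ D₀<d)))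
        (sol< {d} {m} (begin-equality
          δ + δ + (4 * κ + 4 * i + 12) ≡⟨ solve 3 (λ d k i → d :+ d :+ (con 4 :* k :+ con 4 :* i :+ con 12) := (d :+ con 2 :* i) :+ (d :+ con 2 :* i) :+ (con 4 :* k :+ con 12)) refl δ κ i ⟩
          (δ + 2 * i) + (δ + 2 * i) + (4 * κ + 12) ≡⟨ cong (λ z → z + z + (4 * κ + 12)) δ+2i ⟩
          4 * κ + 4 * κ + (4 * κ + 12) ≡⟨ solve 1 (λ k → con 4 :* k :+ con 4 :* k :+ (con 4 :* k :+ con 12) := con 12 :* k :+ con 12) refl κ ⟩
          12 * κ + 12 ∎) sol))
        where open ≤-Reasoning

      d-bound : ∀ {d m} → D₀ < m → Sol d m → d ≤ 2 ^ β
      d-bound {d} {m} D₀<m sol = subst (d ≤_) (pw≡ β) (<⇒≤ (root< {d} {m} {β} {δ} (<⇒≤ D₀<m) (sol< {d} {m} (begin-equality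
          (4 * κ + i + 6) + (4 * κ + i + 6) + δ ≡⟨ solve 3 (λ d k i → (con 4 :* k :+ i :+ con 6) :+ (con 4 :* k :+ i :+ con 6) :+ d := con 8 :* k :+ (d :+ con 2 :* i) :+ con 12) refl δ κ i ⟩
          8 * κ + (δ + 2 * i) + 12 ≡⟨ cong (λ z → 8 * κ + z + 12) δ+2i ⟩
          8 * κ + 4 * κ + 12 ≡⟨ solve 1 (λ k → con 8 :* k :+ con 4 :* k :+ con 12 := con 12 :* k :+ con 12) refl κ ⟩
          12 * κ + 12 ∎) sol)))
        where open ≤-Reasoning

      M-small : pw μ * ((2 ^ (9 * i) * 2 ^ κ) * (2 ^ (9 * i) * 2 ^ κ)) < q
      M-small = subst (_< q) eq (<q {μ + ((9 * i + κ) + (9 * i + κ))} (≤-trans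
          (≤-reflexive (solve 2 (λ k i → con 4 :* k :+ con 4 :* i :+ con 12 :+ ((con 9 :* i :+ k) :+ (con 9 :* i :+ k)) :+ con 3 :* i := con 6 :* k :+ (con 12 :+ con 25 :* i)) refl κ i))
          (≤-trans (+-monoʳ-≤ (6 * κ) e₂) (≤-reflexive (sym (*-distribʳ-+ κ 6 2))))))
        where
        eq : pw (μ + ((9 * i + κ) + (9 * i + κ))) ≡ pw μ * ((2 ^ (9 * i) * 2 ^ κ) * (2 ^ (9 * i) * 2 ^ κ))
        eq = trans (pw-+ μ ((9 * i + κ) + (9 * i + κ))) (cong (pw μ *_) (trans (pw-+ (9 * i + κ) (9 * i + κ))
          (cong (λ z → z * z) (trans (pw-+ (9 * i) κ) (cong₂ _*_ (pw≡ (9 * i)) (pw≡ κ))))))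

      K₀≤D₀ : 2 ^ (9 * i) ≤ D₀
      K₀≤D₀ = subst (_≤ D₀) (pw≡ (9 * i)) (pw-mono 9i≤δ)

      Y≤E : 2 ^ β ≤ pw ε * 2 ^ (9 * i)
      Y≤E = ≤-reflexive (trans (sym (pw≡ β)) (trans (cong pw (sym ε+9i)) (trans (pw-+ ε (9 * i)) (cong (pw ε *_) (pw≡ (9 * i))))))

      module Sv = Sieve D₀ (pw μ) (9 * i) β κ (pw (6 * i)) (pw ε) (pw>0 (6 * i))
        (λ {d} {m} → half {d} {m}) (λ {d} {m} → m-bound {d} {m}) (λ {d} {m} → d-bound {d} {m}) M-small K₀≤D₀ Y≤E

      via-t₁ : ∀ {e} c → e + 2 * i ≡ c + 4 * κ → ι (pw e) ℚ.≤ ι (pw c) ℚ.* t₁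
      via-t₁ {e} c eq = ℚ.≤-trans (≤-rc (pw>0 (2 * i)) (ℚ.≤-reflexive (trans (sym (ι-* (pw e) (pw (2 * i)))) (cong ι (trans (pw-* {e} eq) (pw-+ c (4 * κ)))))))
        (ℚ.≤-reflexive (trans (cong (ℚ._* rc (pw (2 * i))) (ι-* (pw c) T)) (ℚ.*-assoc (ι (pw c)) (ι T) (rc (pw (2 * i))))))

      D₀≤ : ι D₀ ℚ.≤ ι (pw 0) ℚ.* t₁
      D₀≤ = via-t₁ 0 δ+2i

      -- `M / ρ` has exponent `4κ + 4i + 12 - 6i`. Bringing it down to `4κ - 2i`, up to the
      -- constant, is what calls for `ρ = 64^i`.
      large-square≤ : ι (pw μ) ℚ.* rc (pw (6 * i)) ℚ.≤ ι (pw 12) ℚ.* t₁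
      large-square≤ = ℚ.≤-trans (cross {pw μ} {pw (6 * i)} {pw 12 * T} {pw (2 * i)} (pw>0 (6 * i)) (pw>0 (2 * i)) (≤-reflexive (begin-equality
          pw μ * pw (2 * i) ≡⟨ pw-* {μ} refl ⟩
          pw (μ + 2 * i) ≡⟨ cong pw (solve 2 (λ k i → con 4 :* k :+ con 4 :* i :+ con 12 :+ con 2 :* i := con 12 :+ con 4 :* k :+ con 6 :* i) refl κ i) ⟩
          pw (12 + 4 * κ + 6 * i) ≡⟨ trans (pw-+ (12 + 4 * κ) (6 * i)) (cong (_* pw (6 * i)) (pw-+ 12 (4 * κ))) ⟩
          pw 12 * T * pw (6 * i) ∎)))
        (ℚ.≤-reflexive (trans (cong (ℚ._* rc (pw (2 * i))) (ι-* (pw 12) T)) (ℚ.*-assoc (ι (pw 12)) (ι T) (rc (pw (2 * i))))))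
        where open ≤-Reasoning

      -- `E ρ` has exponent `(4κ + i + 6 - 9i) + 6i`. Given `ρ = 64^i`, the choice `K₀ = 512^i` is
      -- the one that brings this down to `4κ - 2i + 6`.
      fibre≤ : ι (pw ε * pw (6 * i)) ℚ.≤ ι (pw 6) ℚ.* t₁
      fibre≤ = subst (λ z → ι z ℚ.≤ ι (pw 6) ℚ.* t₁) (pw-+ ε (6 * i)) (via-t₁ {ε + 6 * i} 6 (+-cancelʳ-≡ i _ _ (begin-equality
          ε + 6 * i + 2 * i + i ≡⟨ solve 2 (λ e i → e :+ con 6 :* i :+ con 2 :* i :+ i := e :+ con 9 :* i) refl ε i ⟩
          ε + 9 * i ≡⟨ ε+9i ⟩
          4 * κ + i + 6 ≡⟨ solve 2 (λ k i → con 4 :* k :+ i :+ con 6 := con 6 :+ con 4 :* k :+ i) refl κ i ⟩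
          6 + 4 * κ + i ∎)))
        where open ≤-Reasoning

      Z : ℚ
      Z = ∑ (range (2 ^ β)) (λ d → 𝟙 (2 ^ (9 * i) ≤ d × Avoids (2 ^ (9 * i)) (2 ^ (9 * i) * 2 ^ κ) d))

      -- `Y` exceeds `T` by `2^(i+6)`, and `t₁` asks for another `4^i`, so the sieve must gain `8^i`
      -- besides its own factor `9i + 1`. As `9i + 1 ≤ 2 · 8^i`, the total is at most
      -- `2 · 64^i ≤ 4κ`, one of the two factors `κ` at hand; `β + κ + 1 ≤ 13κ` takes the other.
      -- This is where `64^i ≤ κ + 1` is spent.
      Z≤ : Z ℚ.≤ ι (pw 15) ℚ.* t₁
      Z≤ = ℚ.≤-trans (≤-rc (pw>0 (2 * i)) Z*≤) (ℚ.≤-reflexive (trans (cong (ℚ._* rc (pw (2 * i))) (ι-* (pw 15) T)) (ℚ.*-assoc (ι (pw 15)) (ι T) (rc (pw (2 * i))))))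
        where
        κκ : 0ℚ ℚ.< ι (κ * κ)
        κκ = 0<ι (*-mono-≤ 1≤κ 1≤κ)
        B : ℕ
        B = 8 * 2 ^ β * (suc (9 * i) * suc (β + κ))
        count : B * pw (2 * i) ≤ pw 15 * T * (κ * κ)
        count = begin
          8 * 2 ^ β * (suc (9 * i) * suc (β + κ)) * pw (2 * i) ≤⟨ *-monoˡ-≤ (pw (2 * i)) (*-monoʳ-≤ (8 * 2 ^ β) (*-monoʳ-≤ (suc (9 * i)) β+κ≤)) ⟩
          8 * 2 ^ β * (suc (9 * i) * (13 * κ)) * pw (2 * i) ≡⟨ cong (λ z → 8 * z * (suc (9 * i) * (13 * κ)) * pw (2 * i)) (trans (sym (pw≡ β)) (trans (pw-+ (4 * κ + i) 6) (cong₂ _*_ (pw-+ (4 * κ) i) (pw≡ 6)))) ⟩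
          8 * (T * pw i * 64) * (suc (9 * i) * (13 * κ)) * pw (2 * i) ≡⟨ solve 5 (λ t a s k b → con 8 :* (t :* a :* con 64) :* (s :* (con 13 :* k)) :* b := con 6656 :* t :* k :* (a :* b :* s)) refl T (pw i) (suc (9 * i)) κ (pw (2 * i)) ⟩
          6656 * T * κ * (pw i * pw (2 * i) * suc (9 * i)) ≤⟨ *-monoʳ-≤ (6656 * T * κ) small ⟩
          6656 * T * κ * (4 * κ) ≡⟨ solve 2 (λ t k → con 6656 :* t :* k :* (con 4 :* k) := con 26624 :* t :* (k :* k)) refl T κ ⟩
          26624 * T * (κ * κ) ≤⟨ *-monoˡ-≤ (κ * κ) (*-monoˡ-≤ T (subst (26624 ≤_) (sym (pw≡ 15)) (≤ᵇ⇒≤ 26624 32768 _))) ⟩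
          pw 15 * T * (κ * κ) ∎
          where
          open ≤-Reasoning
          β+κ≤ : suc (β + κ) ≤ 13 * κ
          β+κ≤ = ≤-trans (≤-reflexive (solve 2 (λ k i → con 1 :+ (con 4 :* k :+ i :+ con 6 :+ k) := con 5 :* k :+ i :+ con 7) refl κ i))
            (≤-trans (+-mono-≤ (+-monoʳ-≤ (5 * κ) i≤κ) (m≤m*n 7 κ {{>-nonZero 1≤κ}})) (≤-reflexive (solve 1 (λ k → con 5 :* k :+ k :+ con 7 :* k := con 13 :* k) refl κ)))
          small : pw i * pw (2 * i) * suc (9 * i) ≤ 4 * κ
          small = begin
            pw i * pw (2 * i) * suc (9 * i) ≡⟨ cong (_* suc (9 * i)) (pw-* {i} refl) ⟩
            pw (3 * i) * suc (9 * i) ≤⟨ *-monoʳ-≤ (pw (3 * i)) (bernoulli-8 i) ⟩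
            pw (3 * i) * (2 * pw (3 * i)) ≡⟨ solve 1 (λ z → z :* (con 2 :* z) := con 2 :* (z :* z)) refl (pw (3 * i)) ⟩
            2 * (pw (3 * i) * pw (3 * i)) ≡⟨ cong (2 *_) (pw-* (sym (*-distribʳ-+ i 3 3))) ⟩
            2 * pw (6 * i) ≤⟨ *-monoʳ-≤ 2 (≤-trans i-upper (+-monoˡ-≤ κ 1≤κ)) ⟩
            2 * (κ + κ) ≡⟨ solve 1 (λ k → con 2 :* (k :+ k) := con 4 :* k) refl κ ⟩
            4 * κ ∎
        Z*≤ : Z ℚ.* ι (pw (2 * i)) ℚ.≤ ι (pw 15 * T)
        Z*≤ = Sequences.cancel (ι (κ * κ)) κκ (begin
          Z ℚ.* ι (pw (2 * i)) ℚ.* ι (κ * κ) ≡⟨ cong (Z ℚ.* ι (pw (2 * i)) ℚ.*_) (ι-* κ κ) ⟩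
          Z ℚ.* ι (pw (2 * i)) ℚ.* (ι κ ℚ.* ι κ) ≡⟨ S′.solve 3 (λ z b k → z S′.:* b S′.:* (k S′.:* k) S′.:= k S′.:* k S′.:* z S′.:* b) refl Z (ι (pw (2 * i))) (ι κ) ⟩
          ι κ ℚ.* ι κ ℚ.* Z ℚ.* ι (pw (2 * i)) ≤⟨ *-monoʳ (0≤ι (pw (2 * i))) (sieve em κ (9 * i) β (≤-trans 1≤i (m≤n*m i 9))) ⟩
          ι B ℚ.* ι (pw (2 * i)) ≡⟨ sym (ι-* B (pw (2 * i))) ⟩
          ι (B * pw (2 * i)) ≤⟨ ι-mono count ⟩
          ι (pw 15 * T * (κ * κ)) ≡⟨ ι-* (pw 15 * T) (κ * κ) ⟩
          ι (pw 15 * T) ℚ.* ι (κ * κ) ∎)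
          where
          open ℚ.≤-Reasoning
          module S′ = ℚSolver.+-*-Solver

      bound : ℚ.∣ E₀ ∣ ℚ.≤ ι C ℚ.* u
      bound = ℚ.≤-trans (E₀-bound D₀ (pw>0 δ)) (enlarge 0≤u {c = c} small-enough
        (combine 0≤u (pw 0) _ (t₁≤u (pw 0) D₀≤) (combine 0≤u _ 2 S≤ (t₂≤u 2 (tail-bound D₀ (pw-mono (≤-trans (*-monoˡ-≤ i (s≤s (s≤s (s≤s (z≤n {6}))))) 9i≤δ)))))))
        where
        c = pw 0 + ((pw 0 + (pw 12 + (pw 6 + pw 15))) + 2)
        S≤ : S D₀ ℚ.≤ ι (pw 0 + (pw 12 + (pw 6 + pw 15))) ℚ.* u
        S≤ = ℚ.≤-trans Sv.sieve-count (combine 0≤u (pw 0) _ (t₁≤u (pw 0) D₀≤) (combine 0≤u (pw 12) _ (t₁≤u (pw 12) large-square≤)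
          (combine 0≤u (pw 6) (pw 15) (t₁≤u (pw 6) fibre≤) (t₁≤u (pw 15) Z≤))))
        opaque
          unfolding pw
          small-enough : c ≤ C
          small-enough = ≤ᵇ⇒≤ 36932 2097152 _

    core : ℚ.∣ E₀ ∣ ℚ.≤ ι C ℚ.* u
    core with i ≟ 0 | q * pw (3 * i) ≤? pw (8 * κ)
    ... | yes i≡0 | _ = CaseI.bound (ℚ.≤-trans (ℚ.≤-reflexive (sym (trans (cong (λ z → ι T ℚ.* rc (pw z)) (trans (cong (2 *_) i≡0) (*-zeroʳ 2)))
          (trans (cong (ι T ℚ.*_) rc1) (ℚ.*-identityʳ (ι T)))))) (≤-+ʳ 0≤t₂))
      where
      rc1 : rc (pw 0) ≡ 1ℚ
      rc1 = trans (cong rc (pw≡ 0)) (rc-suc 0)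
    ... | no i≢0 | no q-large = CaseII.bound (n≢0⇒n>0 i≢0) (≰⇒> q-large)
    ... | no i≢0 | yes q-small = CaseI.bound (ℚ.≤-trans (≤-rc 1≤qB (subst (ℚ._≤ ι x) (ι-* T (q * pw (3 * i))) (ι-mono
          (≤-trans (*-monoʳ-≤ T q-small) (≤-trans (≤-reflexive (pw-* (sym (*-distribʳ-+ κ 4 8)))) x-lower))))) (≤-+ˡ 0≤t₁))

-- Truncated exponential series

module Analysis where

  open Summation
  open Arithmetic using (greatest)
  open import Defs using (fromℕ; recip; inv; partialSum; expTerm; artanhTerm; oddPower; module Sequences)
  import Data.Integer as ℤ
  open import Data.Nat as ℕ using (ℕ; zero; suc; z≤n; s≤s)
  import Data.Nat.Properties as ℕ
  import Data.Nat.Solver as ℕSolver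
  open import Data.Product using (∃; _×_; _,_; proj₁; proj₂)
  open import Data.Rational
  import Data.Rational.Properties as ℚ
  import Data.Rational.Solver as ℚSolver
  open import Data.Sum using (inj₁; inj₂)
  open import Relation.Binary.PropositionalEquality hiding (J)
  open import Relation.Nullary using (yes; no)
  open import Relation.Nullary.Negation using (contradiction)
  open Sequences hiding (bounded; mul-split; three-split)
  open ℚSolver.+-*-Solver using (solve; _:+_; _:*_; _:-_; :-_; _:=_; con)

  -- The n-th term of the real `exp y` is `expSum n` of the n-th term of `y`, so bounds on these
  -- partial sums transfer to reals index by index.
  expSum : ℕ → ℚ → ℚ
  expSum n y = partialSum (expTerm y) n

  expTerm-suc : ∀ y k → expTerm y (suc k) * fromℕ (suc k) ≡ expTerm y k * y
  expTerm-suc y k = trans (ℚ.*-assoc (expTerm y k * y) (recip k) (fromℕ (suc k)))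
    (trans (cong (expTerm y k * y *_) (recip-inverse k)) (ℚ.*-identityʳ _))

  recip-split : ∀ k → recip (suc k) + fromℕ (suc k) * recip (suc k) ≡ 1ℚ
  recip-split k = trans (solve 2 (λ r a → r :+ a :* r := r :* (con 1ℚ :+ a)) refl (recip (suc k)) (fromℕ (suc k)))
    (trans (cong (recip (suc k) *_) (sym (fromℕ-+ 1 (suc k)))) (recip-inverse (suc k)))

  expTerm-mono : ∀ {y z} → 0ℚ ≤ y → y ≤ z → ∀ k → expTerm y k ≤ expTerm z k
  expTerm-mono 0≤y y≤z zero = ℚ.≤-refl
  expTerm-mono {y} {z} 0≤y y≤z (suc k) = *-monoʳ (0≤recip k)
    (*-mono (expTerm-nonneg 0≤y k) (expTerm-mono 0≤y y≤z k) 0≤y y≤z)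

  partialSum-≤ : ∀ {u v : ℕ → ℚ} → (∀ k → u k ≤ v k) → ∀ n → partialSum u n ≤ partialSum v n
  partialSum-≤ h zero = ℚ.≤-refl
  partialSum-≤ h (suc n) = ℚ.+-mono-≤ (partialSum-≤ h n) (h n)

  expSum-mono : ∀ n {y z} → 0ℚ ≤ y → y ≤ z → expSum n y ≤ expSum n z
  expSum-mono n 0≤y y≤z = partialSum-≤ (expTerm-mono 0≤y y≤z) n

  expSum-nonneg : ∀ n {y} → 0ℚ ≤ y → 0ℚ ≤ expSum n y
  expSum-nonneg n {y} 0≤y = partialSum-nonneg (expTerm y) (expTerm-nonneg 0≤y) n

  expSum-zero : ∀ n → expSum n 0ℚ ≤ 1ℚ
  expSum-zero zero = 0≤1
  expSum-zero (suc zero) = ℚ.≤-reflexive (ℚ.+-identityˡ 1ℚ)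
  expSum-zero (suc (suc n)) = subst (_≤ 1ℚ) (sym (trans (cong (expSum (suc n) 0ℚ +_) (term n)) (ℚ.+-identityʳ _))) (expSum-zero (suc n))
    where
    term : ∀ n → expTerm 0ℚ (suc n) ≡ 0ℚ
    term n = trans (cong (_* recip n) (ℚ.*-zeroʳ (expTerm 0ℚ n))) (ℚ.*-zeroˡ (recip n))

  -- These are the first two terms of the binomial expansion of (y + δ)^(k+1)/(k+1)!; the others are
  -- nonnegative.
  expTerm-lower : ∀ {y δ} → 0ℚ ≤ y → 0ℚ ≤ δ → ∀ k → expTerm y (suc k) + δ * expTerm y k ≤ expTerm (y + δ) (suc k)
  expTerm-lower {y} {δ} 0≤y 0≤δ zero = ℚ.≤-reflexive
    (solve 2 (λ y d → con 1ℚ :* y :* con 1ℚ :+ d :* con 1ℚ := con 1ℚ :* (y :+ d) :* con 1ℚ) refl y δ)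
  expTerm-lower {y} {δ} 0≤y 0≤δ (suc k) = begin
    t * y * r + δ * t ≡⟨ cong (λ z → t * y * r + δ * z) (trans (sym (ℚ.*-identityʳ t)) (cong (t *_) (sym (recip-split k)))) ⟩
    t * y * r + δ * (t * (r + a * r)) ≡⟨ solve 5 (λ t y r d a → t :* y :* r :+ d :* (t :* (r :+ a :* r)) := (t :* y :+ d :* t :+ d :* (t :* a)) :* r) refl t y r δ a ⟩
    (t * y + δ * t + δ * (t * a)) * r ≡⟨ cong (λ z → (t * y + δ * t + δ * z) * r) (expTerm-suc y k) ⟩
    (t * y + δ * t + δ * (s * y)) * r ≤⟨ *-monoʳ (0≤recip (suc k)) (≤-+ʳ {t * y + δ * t + δ * (s * y)} (*-nonneg (*-nonneg 0≤δ 0≤δ) (expTerm-nonneg 0≤y k))) ⟩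
    (t * y + δ * t + δ * (s * y) + δ * δ * s) * r ≡⟨ cong (_* r) (solve 4 (λ t y d s → t :* y :+ d :* t :+ d :* (s :* y) :+ d :* d :* s := (t :+ d :* s) :* (y :+ d)) refl t y δ s) ⟩
    (t + δ * s) * (y + δ) * r ≤⟨ *-monoʳ (0≤recip (suc k)) (*-monoʳ (+-nonneg 0≤y 0≤δ) (expTerm-lower 0≤y 0≤δ k)) ⟩
    expTerm (y + δ) (suc k) * (y + δ) * r ∎
    where
    open ℚ.≤-Reasoning
    s = expTerm y k
    t = expTerm y (suc k)
    r = recip (suc k)
    a = fromℕ (suc k)

  -- The truncated form of exp(y + δ) ≥ (1 + δ) exp y. Multiplication by `δ` raises the degree,
  -- hence one more term on the right.
  expSum-lower : ∀ n {y δ} → 0ℚ ≤ y → 0ℚ ≤ δ → (1ℚ + δ) * expSum n y ≤ expSum (suc n) (y + δ)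
  expSum-lower n {y} {δ} 0≤y 0≤δ = ℚ.≤-trans
    (subst (_≤ expSum (suc n) y + δ * expSum n y) (solve 2 (λ d e → e :+ d :* e := (con 1ℚ :+ d) :* e) refl δ (expSum n y))
      (ℚ.+-monoˡ-≤ (δ * expSum n y) {expSum n y} {expSum (suc n) y} (≤-+ʳ {expSum n y} (expTerm-nonneg 0≤y n)))) (go n)
    where
    open ℚ.≤-Reasoning
    go : ∀ n → expSum (suc n) y + δ * expSum n y ≤ expSum (suc n) (y + δ)
    go zero = ℚ.≤-reflexive (trans (cong (expSum 1 y +_) (ℚ.*-zeroʳ δ)) (ℚ.+-identityʳ _))
    go (suc n) = begin
      expSum (suc n) y + expTerm y (suc n) + δ * (expSum n y + expTerm y n) ≡⟨ solve 5 (λ e t d f s → e :+ t :+ d :* (f :+ s) := e :+ d :* f :+ (t :+ d :* s)) refl (expSum (suc n) y) (expTerm y (suc n)) δ (expSum n y) (expTerm y n) ⟩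
      expSum (suc n) y + δ * expSum n y + (expTerm y (suc n) + δ * expTerm y n) ≤⟨ ℚ.+-mono-≤ (go n) (expTerm-lower 0≤y 0≤δ n) ⟩
      expSum (suc n) (y + δ) + expTerm (y + δ) (suc n) ∎

  expSum-power : ∀ {δ} → 0ℚ ≤ δ → ∀ N → power (1ℚ + δ) N ≤ expSum (suc N) (fromℕ N * δ)
  expSum-power {δ} 0≤δ zero = ℚ.≤-reflexive (sym (ℚ.+-identityˡ 1ℚ))
  expSum-power {δ} 0≤δ (suc N) = begin
    power (1ℚ + δ) N * (1ℚ + δ) ≡⟨ ℚ.*-comm (power (1ℚ + δ) N) (1ℚ + δ) ⟩
    (1ℚ + δ) * power (1ℚ + δ) N ≤⟨ *-monoˡ (+-nonneg 0≤1 0≤δ) (expSum-power 0≤δ N) ⟩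
    (1ℚ + δ) * expSum (suc N) (fromℕ N * δ) ≤⟨ expSum-lower (suc N) (*-nonneg (0≤fromℕ N) 0≤δ) 0≤δ ⟩
    expSum (suc (suc N)) (fromℕ N * δ + δ) ≡⟨ cong (expSum (suc (suc N))) (trans (solve 2 (λ n d → n :* d :+ d := (con 1ℚ :+ n) :* d) refl (fromℕ N) δ) (cong (_* δ) (sym (fromℕ-+ 1 N)))) ⟩
    expSum (suc (suc N)) (fromℕ (suc N) * δ) ∎
    where open ℚ.≤-Reasoning

  expTerm-upper : ∀ {y δ} → 0ℚ ≤ y → 0ℚ ≤ δ → ∀ k → expTerm (y + δ) (suc k) ≤ expTerm y (suc k) + δ * expTerm (y + δ) k
  expTerm-upper {y} {δ} 0≤y 0≤δ zero = ℚ.≤-reflexive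
    (solve 2 (λ y d → con 1ℚ :* (y :+ d) :* con 1ℚ := con 1ℚ :* y :* con 1ℚ :+ d :* con 1ℚ) refl y δ)
  expTerm-upper {y} {δ} 0≤y 0≤δ (suc k) = begin
    t′ * (y + δ) * r ≡⟨ cong (_* r) (ℚ.*-distribˡ-+ t′ y δ) ⟩
    (t′ * y + t′ * δ) * r ≤⟨ *-monoʳ (0≤recip (suc k)) (ℚ.+-monoˡ-≤ (t′ * δ) (*-monoʳ 0≤y (expTerm-upper 0≤y 0≤δ k))) ⟩
    ((t + δ * s′) * y + t′ * δ) * r ≤⟨ *-monoʳ (0≤recip (suc k)) (≤-+ʳ {(t + δ * s′) * y + t′ * δ} (*-nonneg (*-nonneg 0≤δ 0≤δ) (expTerm-nonneg (+-nonneg 0≤y 0≤δ) k))) ⟩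
    ((t + δ * s′) * y + t′ * δ + δ * δ * s′) * r ≡⟨ solve 6 (λ t y r d s t′ → ((t :+ d :* s) :* y :+ t′ :* d :+ d :* d :* s) :* r := t :* y :* r :+ d :* (t′ :+ s :* (y :+ d)) :* r) refl t y r δ s′ t′ ⟩
    t * y * r + δ * (t′ + s′ * (y + δ)) * r ≡⟨ cong (λ z → t * y * r + δ * (t′ + z) * r) (sym (expTerm-suc (y + δ) k)) ⟩
    t * y * r + δ * (t′ + t′ * a) * r ≡⟨ solve 6 (λ t y r d a t′ → t :* y :* r :+ d :* (t′ :+ t′ :* a) :* r := t :* y :* r :+ d :* (t′ :* (r :+ a :* r))) refl t y r δ a t′ ⟩
    t * y * r + δ * (t′ * (r + a * r)) ≡⟨ cong (λ z → t * y * r + δ * z) (trans (cong (t′ *_) (recip-split k)) (ℚ.*-identityʳ t′)) ⟩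
    t * y * r + δ * t′ ∎
    where
    open ℚ.≤-Reasoning
    t = expTerm y (suc k)
    s′ = expTerm (y + δ) k
    t′ = expTerm (y + δ) (suc k)
    r = recip (suc k)
    a = fromℕ (suc k)

  -- The truncated form of (1 - δ) exp(y + δ) ≤ exp y.
  expSum-upper : ∀ n {y δ} → 0ℚ ≤ y → 0ℚ ≤ δ → expSum n (y + δ) ≤ expSum n y + δ * expSum n (y + δ)
  expSum-upper zero {y} {δ} 0≤y 0≤δ = ℚ.≤-reflexive (sym (trans (ℚ.+-identityˡ (δ * 0ℚ)) (ℚ.*-zeroʳ δ)))
  expSum-upper (suc n) {y} {δ} 0≤y 0≤δ = ℚ.≤-trans (go n)
    (ℚ.+-monoʳ-≤ (expSum (suc n) y) (*-monoˡ 0≤δ (≤-+ʳ (expTerm-nonneg (+-nonneg 0≤y 0≤δ) n))))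
    where
    open ℚ.≤-Reasoning
    go : ∀ n → expSum (suc n) (y + δ) ≤ expSum (suc n) y + δ * expSum n (y + δ)
    go zero = ℚ.≤-reflexive (sym (trans (cong (expSum 1 y +_) (ℚ.*-zeroʳ δ)) (ℚ.+-identityʳ _)))
    go (suc n) = begin
      expSum (suc n) (y + δ) + expTerm (y + δ) (suc n) ≤⟨ ℚ.+-mono-≤ (go n) (expTerm-upper 0≤y 0≤δ n) ⟩
      expSum (suc n) y + δ * expSum n (y + δ) + (expTerm y (suc n) + δ * expTerm (y + δ) n) ≡⟨ solve 5 (λ e t d f s → e :+ d :* f :+ (t :+ d :* s) := e :+ t :+ d :* (f :+ s)) refl (expSum (suc n) y) (expTerm y (suc n)) δ (expSum n (y + δ)) (expTerm (y + δ) n) ⟩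
      expSum (suc n) y + expTerm y (suc n) + δ * (expSum n (y + δ) + expTerm (y + δ) n) ∎

  -- For `δ = ½` the preceding inequality says that a step of ½ at most doubles the partial sum.
  -- This is half of the doubling of exponents that the savings in the counting can afford.
  expSum-half-integer : ∀ n k → expSum n (fromℕ k * ½) ≤ power (1ℚ + 1ℚ) k
  expSum-half-integer n zero = subst (λ z → expSum n z ≤ 1ℚ) (sym (ℚ.*-zeroˡ ½)) (expSum-zero n)
  expSum-half-integer n (suc k) = subst (λ z → expSum n z ≤ power (1ℚ + 1ℚ) (suc k))
      (trans (solve 1 (λ a → a :* con ½ :+ con ½ := (con 1ℚ :+ a) :* con ½) refl (fromℕ k)) (cong (_* ½) (sym (fromℕ-+ 1 k))))
      (ℚ.≤-trans double (*-monoʳ (ℚ.<⇒≤ (ℚ.positive⁻¹ (1ℚ + 1ℚ))) (expSum-half-integer n k)))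
    where
    y = fromℕ k * ½
    e = expSum n (y + ½)
    double : e ≤ expSum n y * (1ℚ + 1ℚ)
    double = diff⁻ (subst (0ℚ ≤_) (solve 2 (λ e f → con (1ℚ + 1ℚ) :* (f :+ con ½ :* e :- e) := f :* con (1ℚ + 1ℚ) :- e) refl e (expSum n y))
      (*-nonneg (ℚ.<⇒≤ (ℚ.positive⁻¹ (1ℚ + 1ℚ))) (0≤diff (expSum-upper n (*-nonneg (0≤fromℕ k) (ℚ.<⇒≤ 0<½)) (ℚ.<⇒≤ 0<½)))))

  power-mono : ∀ {a b} → 0ℚ ≤ a → a ≤ b → ∀ k → power a k ≤ power b k
  power-mono 0≤a a≤b zero = ℚ.≤-refl
  power-mono 0≤a a≤b (suc k) = *-mono (power-nonneg 0≤a k) (power-mono 0≤a a≤b k) 0≤a a≤b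

  power-* : ∀ a b k → power (a * b) k ≡ power a k * power b k
  power-* a b zero = sym (ℚ.*-identityˡ 1ℚ)
  power-* a b (suc k) = trans (cong (_* (a * b)) (power-* a b k))
    (solve 4 (λ x y a b → x :* y :* (a :* b) := x :* a :* (y :* b)) refl (power a k) (power b k) a b)

  power-power : ∀ a m k → power a (k ℕ.* m) ≡ power (power a m) k
  power-power a m zero = refl
  power-power a m (suc k) = trans (power-+ a m (k ℕ.* m)) (cong (_* power a m) (power-power a m k))

  power-one : ∀ k → power 1ℚ k ≡ 1ℚ
  power-one zero = refl
  power-one (suc k) = trans (ℚ.*-identityʳ (power 1ℚ k)) (power-one k)

  bernoulli : ∀ {h} → 0ℚ ≤ h → h ≤ 1ℚ → ∀ k → 1ℚ - fromℕ k * h ≤ power (1ℚ - h) k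
  bernoulli {h} 0≤h h≤1 zero = ℚ.≤-reflexive (trans (cong (λ z → 1ℚ - z) (ℚ.*-zeroˡ h)) (ℚ.+-identityʳ 1ℚ))
  bernoulli {h} 0≤h h≤1 (suc k) = begin
    1ℚ - fromℕ (suc k) * h ≡⟨ cong (λ z → 1ℚ - z * h) (fromℕ-+ 1 k) ⟩
    1ℚ - (1ℚ + a) * h ≤⟨ ≤-+ʳ (*-nonneg (*-nonneg (0≤fromℕ k) 0≤h) 0≤h) ⟩
    1ℚ - (1ℚ + a) * h + a * h * h ≡⟨ solve 2 (λ a h → con 1ℚ :- (con 1ℚ :+ a) :* h :+ a :* h :* h := (con 1ℚ :- a :* h) :* (con 1ℚ :- h)) refl a h ⟩
    (1ℚ - a * h) * (1ℚ - h) ≤⟨ *-monoʳ (0≤diff h≤1) (bernoulli 0≤h h≤1 k) ⟩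
    power (1ℚ - h) k * (1ℚ - h) ∎
    where
    open ℚ.≤-Reasoning
    a = fromℕ k

  ∣expTerm∣≤ : ∀ {y Y} → ∣ y ∣ ≤ Y → ∀ k → ∣ expTerm y k ∣ ≤ expTerm Y k
  ∣expTerm∣≤ h zero = ℚ.≤-refl
  ∣expTerm∣≤ {y} {Y} h (suc k) = ∣*∣≤ {expTerm y k * y} {recip k} (∣*∣≤ {expTerm y k} {y} (∣expTerm∣≤ h k) h)
    (ℚ.≤-reflexive (ℚ.0≤p⇒∣p∣≡p (0≤recip k)))

  -- At negative arguments the terms alternate in sign and the monotonicity arguments above are
  -- void. In their place comes a second-order remainder, measured by the series at a majorant `Y`
  -- of both points.
  module Taylor {y δ Y : ℚ} (∣y∣≤Y : ∣ y ∣ ≤ Y) (∣y+δ∣≤Y : ∣ y + δ ∣ ≤ Y) where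

    0≤Y : 0ℚ ≤ Y
    0≤Y = ℚ.≤-trans (ℚ.0≤∣p∣ y) ∣y∣≤Y

    err : ℕ → ℚ
    err k = expTerm (y + δ) (suc k) - expTerm y (suc k) - δ * expTerm y k

    err-zero : err 0 ≡ 0ℚ
    err-zero = solve 2 (λ y d → con 1ℚ :* (y :+ d) :* con 1ℚ :- con 1ℚ :* y :* con 1ℚ :- d :* con 1ℚ := con 0ℚ) refl y δ

    err-suc : ∀ k → err (suc k) ≡ (δ * δ * expTerm y k + err k * (y + δ)) * recip (suc k)
    err-suc k = begin
      t′ * (y + δ) * r - t * y * r - δ * t ≡⟨ cong (λ z → t′ * (y + δ) * r - t * y * r - δ * z) (trans (sym (ℚ.*-identityʳ t)) (cong (t *_) (sym (recip-split k)))) ⟩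
      t′ * (y + δ) * r - t * y * r - δ * (t * (r + a * r)) ≡⟨ solve 6 (λ t′ y d r t a → t′ :* (y :+ d) :* r :- t :* y :* r :- d :* (t :* (r :+ a :* r)) := (t′ :* (y :+ d) :- t :* y :- d :* t :- d :* (t :* a)) :* r) refl t′ y δ r t a ⟩
      (t′ * (y + δ) - t * y - δ * t - δ * (t * a)) * r ≡⟨ cong (λ z → (t′ * (y + δ) - t * y - δ * t - δ * z) * r) (expTerm-suc y k) ⟩
      (t′ * (y + δ) - t * y - δ * t - δ * (s * y)) * r ≡⟨ cong (_* r) (solve 5 (λ t′ y d t s → t′ :* (y :+ d) :- t :* y :- d :* t :- d :* (s :* y) := d :* d :* s :+ (t′ :- t :- d :* s) :* (y :+ d)) refl t′ y δ t s) ⟩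
      (δ * δ * s + (t′ - t - δ * s) * (y + δ)) * r ∎
      where
      open ≡-Reasoning
      s = expTerm y k
      t = expTerm y (suc k)
      t′ = expTerm (y + δ) (suc k)
      r = recip (suc k)
      a = fromℕ (suc k)

    0≤δδ : 0ℚ ≤ δ * δ
    0≤δδ with ℚ.≤-total 0ℚ δ
    ... | inj₁ h = *-nonneg h h
    ... | inj₂ h = subst (0ℚ ≤_) (solve 1 (λ d → :- d :* :- d := d :* d) refl δ) (*-nonneg (ℚ.neg-antimono-≤ h) (ℚ.neg-antimono-≤ h))

    err-bound : ∀ k → ∣ err (suc k) ∣ ≤ δ * δ * expTerm Y k
    err-bound zero = subst (_≤ δ * δ * 1ℚ) (cong ∣_∣ (sym (trans (err-suc 0) (trans (cong (λ z → (δ * δ * 1ℚ + z * (y + δ)) * recip 1) err-zero)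
        (solve 3 (λ d y r → (d :* con 1ℚ :+ con 0ℚ :* y) :* r := d :* r) refl (δ * δ) (y + δ) (recip 1))))))
      (subst (_≤ δ * δ * 1ℚ) (sym (ℚ.0≤p⇒∣p∣≡p (*-nonneg 0≤δδ (0≤recip 1)))) (*-monoˡ 0≤δδ (recip≤1 1)))
    err-bound (suc k) = begin
      ∣ err (suc (suc k)) ∣ ≡⟨ cong ∣_∣ (err-suc (suc k)) ⟩
      ∣ (δ * δ * expTerm y (suc k) + err (suc k) * (y + δ)) * r ∣ ≤⟨ ∣*∣≤ {δ * δ * expTerm y (suc k) + err (suc k) * (y + δ)} {r}
            (∣+∣≤ {δ * δ * expTerm y (suc k)} {err (suc k) * (y + δ)}
            (∣*∣≤ {δ * δ} {expTerm y (suc k)} (ℚ.≤-reflexive (ℚ.0≤p⇒∣p∣≡p 0≤δδ)) (∣expTerm∣≤ ∣y∣≤Y (suc k)))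
            (∣*∣≤ {err (suc k)} {y + δ} (err-bound k) ∣y+δ∣≤Y))
            (ℚ.≤-reflexive (ℚ.0≤p⇒∣p∣≡p (0≤recip (suc (suc k))))) ⟩
      (δ * δ * t + δ * δ * s * Y) * r ≡⟨ solve 5 (λ d t s y r → (d :* t :+ d :* s :* y) :* r := d :* (t :+ s :* y) :* r) refl (δ * δ) t s Y r ⟩
      δ * δ * (t + s * Y) * r ≡⟨ cong (λ z → δ * δ * (t + z) * r) (sym (expTerm-suc Y k)) ⟩
      δ * δ * (t + t * a) * r ≤⟨ recip-bound (suc (suc k)) (subst₂ _≤_ (ℚ.*-comm (t + t * a) (δ * δ)) (solve 3 (λ d t b → t :* b :* d := d :* t :* b) refl (δ * δ) t (fromℕ (3 ℕ.+ k)))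
            (*-monoʳ 0≤δδ (subst (_≤ t * fromℕ (3 ℕ.+ k)) (trans (cong (t *_) (fromℕ-+ 1 (suc k))) (solve 2 (λ t a → t :* (con 1ℚ :+ a) := t :+ t :* a) refl t a))
            (*-monoˡ (expTerm-nonneg 0≤Y (suc k)) (fromℕ-mono {2 ℕ.+ k} {3 ℕ.+ k} (ℕ.n≤1+n (2 ℕ.+ k))))))) ⟩
      δ * δ * t ∎
      where
      open ℚ.≤-Reasoning
      s = expTerm Y k
      t = expTerm Y (suc k)
      r = recip (suc (suc k))
      a = fromℕ (suc k)

    taylor : ∀ n → ∣ expSum (2 ℕ.+ n) (y + δ) - expSum (2 ℕ.+ n) y - δ * expSum (1 ℕ.+ n) y ∣ ≤ δ * δ * expSum n Y
    taylor zero = subst (_≤ δ * δ * 0ℚ) (cong ∣_∣ (sym eq)) (ℚ.≤-reflexive (sym (ℚ.*-zeroʳ (δ * δ))))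
      where
      eq : expSum 2 (y + δ) - expSum 2 y - δ * expSum 1 y ≡ 0ℚ
      eq = solve 2 (λ y d → (con 0ℚ :+ con 1ℚ :+ con 1ℚ :* (y :+ d) :* con 1ℚ) :- (con 0ℚ :+ con 1ℚ :+ con 1ℚ :* y :* con 1ℚ) :- d :* (con 0ℚ :+ con 1ℚ) := con 0ℚ) refl y δ
    taylor (suc n) = subst₂ _≤_
      (cong ∣_∣ (solve 7 (λ a b c e f g d → (a :- b :- d :* c) :+ (e :- f :- d :* g) := (a :+ e) :- (b :+ f) :- d :* (c :+ g)) refl
        (expSum (2 ℕ.+ n) (y + δ)) (expSum (2 ℕ.+ n) y) (expSum (1 ℕ.+ n) y) (expTerm (y + δ) (2 ℕ.+ n)) (expTerm y (2 ℕ.+ n)) (expTerm y (1 ℕ.+ n)) δ))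
      (solve 3 (λ d a b → d :* a :+ d :* b := d :* (a :+ b)) refl (δ * δ) (expSum n Y) (expTerm Y n))
      (∣+∣≤ {expSum (2 ℕ.+ n) (y + δ) - expSum (2 ℕ.+ n) y - δ * expSum (1 ℕ.+ n) y} {err (suc n)} (taylor n) (err-bound n))

  2ℚ ¼ : ℚ
  2ℚ = 1ℚ + 1ℚ
  ¼ = ½ * ½

  0≤2 : 0ℚ ≤ 2ℚ
  0≤2 = ℚ.<⇒≤ (ℚ.positive⁻¹ 2ℚ)

  expSum-integer : ∀ n U → expSum n (fromℕ U) ≤ power 2ℚ (U ℕ.+ U)
  expSum-integer n U = subst (λ z → expSum n z ≤ power 2ℚ (U ℕ.+ U))
    (trans (cong (_* ½) (fromℕ-+ U U)) (solve 1 (λ u → (u :+ u) :* con ½ := u) refl (fromℕ U))) (expSum-half-integer n (U ℕ.+ U))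

  expTerm-small : ∀ U τ → 0ℚ < τ → ∃ λ N → ∀ n → N ℕ.≤ n → expTerm (fromℕ U) n ≤ τ
  expTerm-small U τ 0<τ = J ℕ.+ K , λ n N≤n → subst (λ z → expTerm u z ≤ τ) (eq n N≤n) (step (n ℕ.∸ (J ℕ.+ K)))
    where
    u = fromℕ U
    0≤u = 0≤fromℕ U
    K = U ℕ.+ U
    A = expTerm u K
    0≤A : 0ℚ ≤ A
    0≤A = expTerm-nonneg 0≤u K
    sm = Geometric.small halving A τ 0≤A 0<τ
    J = proj₁ sm
    eq : ∀ n → J ℕ.+ K ℕ.≤ n → (J ℕ.+ (n ℕ.∸ (J ℕ.+ K))) ℕ.+ K ≡ n
    eq n le = trans (ℕ.+-assoc J (n ℕ.∸ (J ℕ.+ K)) K) (trans (cong (J ℕ.+_) (ℕ.+-comm (n ℕ.∸ (J ℕ.+ K)) K)) (trans (sym (ℕ.+-assoc J K (n ℕ.∸ (J ℕ.+ K)))) (ℕ.m+[n∸m]≡n le)))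
    step : ∀ i → expTerm u ((J ℕ.+ i) ℕ.+ K) ≤ τ
    step i = ℚ.≤-trans (p≤∣p∣ (expTerm u ((J ℕ.+ i) ℕ.+ K))) (ℚ.≤-trans
      (expTerm-bound u U A (ℚ.≤-reflexive (ℚ.0≤p⇒∣p∣≡p 0≤u)) (ℚ.≤-reflexive (ℚ.0≤p⇒∣p∣≡p 0≤A)) (J ℕ.+ i))
      (ℚ.≤-trans (subst (A * power ½ (J ℕ.+ i) ≤_) (solve 1 (λ a → a :+ a := a :* con 2ℚ) refl (A * power ½ (J ℕ.+ i))) (≤-+ʳ (*-nonneg 0≤A (power-nonneg (ℚ.<⇒≤ 0<½) (J ℕ.+ i))))) (proj₂ sm i)))

  -- Walking from 0 to a negative y in s steps of length h, each step costs a factor 1 - h up to a second-order error.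
  module Descent (U s : ℕ) {h τ : ℚ} (0≤h : 0ℚ ≤ h) (h≤1 : h ≤ 1ℚ) (sh≤U : fromℕ s * h ≤ fromℕ U) (hh≤τ : h * h ≤ τ) (0≤τ : 0ℚ ≤ τ)
    (N : ℕ) (1≤N : 1 ℕ.≤ N) (small : ∀ n → N ℕ.≤ n → expTerm (fromℕ U) n ≤ τ) where

    c : ℚ
    c = 1ℚ + power 2ℚ (U ℕ.+ U)

    0≤c : 0ℚ ≤ c
    0≤c = +-nonneg 0≤1 (power-nonneg 0≤2 (U ℕ.+ U))

    y : ℕ → ℚ
    y j = - (fromℕ j * h)

    ∣y∣≤U : ∀ j → j ℕ.≤ s → ∣ y j ∣ ≤ fromℕ U
    ∣y∣≤U j j≤s = subst (_≤ fromℕ U) (sym (trans (ℚ.∣-p∣≡∣p∣ (fromℕ j * h)) (ℚ.0≤p⇒∣p∣≡p (*-nonneg (0≤fromℕ j) 0≤h))))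
      (ℚ.≤-trans (*-monoʳ 0≤h (fromℕ-mono {j} {s} j≤s)) sh≤U)

    y-suc : ∀ j → y (suc j) ≡ y j + - h
    y-suc j = trans (cong (λ z → - (z * h)) (fromℕ-+ 1 j)) (solve 2 (λ a h → :- ((con 1ℚ :+ a) :* h) := :- (a :* h) :+ :- h) refl (fromℕ j) h)

    -- Each step compares `expSum (2 + n)` at the new point with `expSum (1 + n)` at the old one, so
    -- `j` steps consume `j` terms; hence `N + j ≤ n`. The loss per step is at most `τ * c`: one `τ`
    -- for the top term, and `τ` times the bound on exp U for the remainder.
    descend : ∀ j → j ℕ.≤ s → ∀ n → N ℕ.+ j ℕ.≤ n → power (1ℚ - h) j - fromℕ j * (τ * c) ≤ expSum n (y j)
    descend zero _ n N≤n = subst (1ℚ - 0ℚ * (τ * c) ≤_) (cong (expSum n) (sym (cong -_ (ℚ.*-zeroˡ h))))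
      (ℚ.≤-trans (ℚ.≤-reflexive (trans (cong (λ z → 1ℚ - z) (ℚ.*-zeroˡ (τ * c))) (ℚ.+-identityʳ 1ℚ)))
        (1≤exp {0ℚ} ℚ.≤-refl n (ℕ.≤-trans 1≤N (ℕ.≤-trans (ℕ.m≤m+n N 0) N≤n))))
    descend (suc j) j<s zero N≤n with () ← ℕ.≤-trans 1≤N (ℕ.≤-trans (ℕ.m≤m+n N (suc j)) N≤n)
    descend (suc j) j<s (suc zero) N≤n with s≤s () ← ℕ.≤-trans (ℕ.+-mono-≤ 1≤N (s≤s (z≤n {j}))) N≤n
    descend (suc j) j<s (suc (suc n)) N≤n = subst (λ z → power (1ℚ - h) (suc j) - fromℕ (suc j) * (τ * c) ≤ expSum (2 ℕ.+ n) z) (sym (y-suc j)) (begin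
      P * (1ℚ - h) - fromℕ (suc j) * (τ * c) ≡⟨ cong (λ z → P * (1ℚ - h) - z * (τ * c)) (fromℕ-+ 1 j) ⟩
      P * (1ℚ - h) - (1ℚ + J) * (τ * c) ≤⟨ ≤-+ʳ (*-nonneg (*-nonneg (0≤fromℕ j) 0≤h) (*-nonneg 0≤τ 0≤c)) ⟩
      P * (1ℚ - h) - (1ℚ + J) * (τ * c) + J * h * (τ * c) ≡⟨ solve 5 (λ P h J τ k → P :* (con 1ℚ :- h) :- (con 1ℚ :+ J) :* (τ :* (con 1ℚ :+ k)) :+ J :* h :* (τ :* (con 1ℚ :+ k)) := (con 1ℚ :- h) :* (P :- J :* (τ :* (con 1ℚ :+ k))) :- τ :- τ :* k) refl P h J τ (power 2ℚ (U ℕ.+ U)) ⟩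
      (1ℚ - h) * (P - J * (τ * c)) - τ - τ * power 2ℚ (U ℕ.+ U) ≤⟨ ℚ.+-mono-≤ (ℚ.+-mono-≤ (*-monoˡ (0≤diff h≤1) (descend j (ℕ.<⇒≤ j<s) (suc n) N+j≤)) (ℚ.neg-antimono-≤ (small (suc n) (ℕ.≤-trans (ℕ.m≤m+n N j) N+j≤)))) (ℚ.neg-antimono-≤ (*-mono 0≤hh hh≤τ (expSum-nonneg n (0≤fromℕ U)) (expSum-integer n U))) ⟩
      (1ℚ - h) * e - expTerm (fromℕ U) (suc n) - h * h * expSum n (fromℕ U) ≤⟨ ℚ.+-monoˡ-≤ (- (h * h * expSum n (fromℕ U))) (ℚ.+-monoʳ-≤ ((1ℚ - h) * e) (neg-≤ (expTerm-suc-bound))) ⟩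
      (1ℚ - h) * e + expTerm (y j) (suc n) - h * h * expSum n (fromℕ U) ≡⟨ cong₂ (λ u v → u - v) (solve 3 (λ h e t → (con 1ℚ :- h) :* e :+ t := (e :+ t) :+ :- h :* e) refl h e (expTerm (y j) (suc n))) (solve 2 (λ h k → h :* h :* k := :- h :* :- h :* k) refl h (expSum n (fromℕ U))) ⟩
      expSum (2 ℕ.+ n) (y j) + - h * e - - h * - h * expSum n (fromℕ U) ≤⟨ from-taylor (Taylor.taylor {y j} {δ = - h} {fromℕ U} (∣y∣≤U j (ℕ.<⇒≤ j<s)) (subst (λ z → ∣ z ∣ ≤ fromℕ U) (y-suc j) (∣y∣≤U (suc j) j<s)) n) ⟩
      expSum (2 ℕ.+ n) (y j + - h) ∎)
      where
      open ℚ.≤-Reasoning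
      P = power (1ℚ - h) j
      J = fromℕ j
      e = expSum (suc n) (y j)
      0≤hh = *-nonneg 0≤h 0≤h
      N+j≤ : N ℕ.+ j ℕ.≤ suc n
      N+j≤ = ℕ.≤-pred (subst (ℕ._≤ suc (suc n)) (ℕ.+-suc N j) N≤n)
      expTerm-suc-bound : ∣ expTerm (y j) (suc n) ∣ ≤ expTerm (fromℕ U) (suc n)
      expTerm-suc-bound = ∣expTerm∣≤ (∣y∣≤U j (ℕ.<⇒≤ j<s)) (suc n)
      neg-≤ : ∀ {p b} → ∣ p ∣ ≤ b → - b ≤ p
      neg-≤ {p} {b} le = subst (- b ≤_) (solve 1 (λ p → :- (:- p) := p) refl p) (ℚ.neg-antimono-≤ (ℚ.≤-trans (-p≤∣p∣ p) le))
      from-taylor : ∀ {a b f g} → ∣ a - b - f ∣ ≤ g → b + f - g ≤ a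
      from-taylor {a} {b} {f} {g} le = subst₂ _≤_ (solve 3 (λ b f g → :- g :+ (b :+ f) := b :+ f :- g) refl b f g) (solve 3 (λ a b f → a :- b :- f :+ (b :+ f) := a) refl a b f)
        (ℚ.+-monoˡ-≤ (b + f) (neg-≤ {a - b - f} le))

  -- By Bernoulli's inequality (1 - θ)^l ≥ 1 - l θ = ½, and the exponent consists of 2U blocks of
  -- length `l`.
  power-quarter : ∀ {θ} l → 0ℚ ≤ θ → θ ≤ 1ℚ → fromℕ l * θ ≡ ½ → ∀ U → power ¼ U ≤ power (1ℚ - θ) (U ℕ.* (l ℕ.+ l))
  power-quarter {θ} l 0≤θ θ≤1 lθ U = subst (power ¼ U ≤_) (sym (power-power (1ℚ - θ) (l ℕ.+ l) U))
    (power-mono (ℚ.nonNegative⁻¹ ¼) (subst (¼ ≤_) (sym (power-+ (1ℚ - θ) l l)) (*-mono (ℚ.<⇒≤ 0<½) half (ℚ.<⇒≤ 0<½) half)) U)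
    where
    half : ½ ≤ power (1ℚ - θ) l
    half = ℚ.≤-trans (ℚ.≤-reflexive (sym (cong (λ z → 1ℚ - z) lθ))) (bernoulli 0≤θ θ≤1 l)

  0<recip : ∀ k → 0ℚ < recip k
  0<recip k = ℚ.*-cancelʳ-<-nonNeg (fromℕ (suc k)) {{nonNegative (0≤fromℕ (suc k))}} (subst₂ _<_ (sym (ℚ.*-zeroˡ (fromℕ (suc k)))) (sym (recip-inverse k)) 0<1)

  power-pos : ∀ {a} → 0ℚ < a → ∀ j → 0ℚ < power a j
  power-pos 0<a zero = 0<1
  power-pos 0<a (suc j) = *-pos (power-pos 0<a j) 0<a

  0<¼ : 0ℚ < ¼
  0<¼ = ℚ.positive⁻¹ ¼

  half-power≤1 : ∀ j → ½ * power ¼ j ≤ 1ℚ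
  half-power≤1 j = ℚ.≤-trans (*-mono (ℚ.<⇒≤ 0<½) ½≤1 (ℚ.<⇒≤ (power-pos 0<¼ j)) (ℚ.≤-trans (power-mono (ℚ.<⇒≤ 0<¼) ¼≤1 j) (ℚ.≤-reflexive (power-one j))))
      (ℚ.≤-reflexive (ℚ.*-identityˡ 1ℚ))
    where
    ½≤1 : ½ ≤ 1ℚ
    ½≤1 = ≤-+ʳ {½} {½} (ℚ.<⇒≤ 0<½)
    ¼≤1 : ¼ ≤ 1ℚ
    ¼≤1 = ≤-+ʳ {¼} {1ℚ - ¼} (ℚ.nonNegative⁻¹ (1ℚ - ¼))

  -- `s = 2 l U` steps of length at most `θ = 1/(2 l)` reach every point of [-U, 0]. The main term
  -- stays above 4^(-U), while the accumulated error is proportional to 1/l; `enough` takes `l` so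
  -- large that the error is at most half of it.
  module Below (U′ l N : ℕ) (θ : ℚ) (0≤θ : 0ℚ ≤ θ) (θ≤1 : θ ≤ 1ℚ) (lθ : fromℕ l * θ ≡ ½)
    (enough : fromℕ (suc U′) * (1ℚ + power 2ℚ (suc U′ ℕ.+ suc U′)) ≤ fromℕ l * power ¼ (suc U′))
    (small : ∀ n → N ℕ.≤ n → expTerm (fromℕ (suc U′)) n ≤ θ * θ) where

    U s : ℕ
    U = suc U′
    s = U ℕ.* (l ℕ.+ l)

    u k τ : ℚ
    u = fromℕ U
    k = 1ℚ + power 2ℚ (U ℕ.+ U)
    τ = θ * θ

    sθ : fromℕ s * θ ≡ u
    sθ = trans (cong (_* θ) (trans (fromℕ-* U (l ℕ.+ l)) (cong (u *_) (fromℕ-+ l l))))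
      (trans (solve 3 (λ u l t → u :* (l :+ l) :* t := u :* (l :* t :+ l :* t)) refl u (fromℕ l) θ) (trans (cong (λ z → u * (z + z)) lθ) (ℚ.*-identityʳ u)))

    error : fromℕ s * (τ * k) ≤ ½ * power ¼ U
    error = begin
      fromℕ s * (θ * θ * k) ≡⟨ solve 3 (λ s t k → s :* (t :* t :* k) := s :* t :* k :* t) refl (fromℕ s) θ k ⟩
      fromℕ s * θ * k * θ ≡⟨ cong (λ z → z * k * θ) sθ ⟩
      u * k * θ ≤⟨ *-monoʳ 0≤θ enough ⟩
      fromℕ l * power ¼ U * θ ≡⟨ solve 3 (λ l p t → l :* p :* t := l :* t :* p) refl (fromℕ l) (power ¼ U) θ ⟩
      fromℕ l * θ * power ¼ U ≡⟨ cong (_* power ¼ U) lθ ⟩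
      ½ * power ¼ U ∎
      where open ℚ.≤-Reasoning

    below : ∀ n → suc N ℕ.+ s ℕ.≤ n → ∀ y → - u ≤ y → ½ * power ¼ U ≤ expSum n y
    below n N≤n y -u≤y with ℚ.≤-total 0ℚ y
    ... | inj₁ 0≤y = ℚ.≤-trans (half-power≤1 U) (1≤exp 0≤y n (ℕ.≤-trans (s≤s z≤n) N≤n))
    ... | inj₂ y≤0 = begin
        ½ * power ¼ U ≡⟨ solve 1 (λ p → con ½ :* p := p :- con ½ :* p) refl (power ¼ U) ⟩
        power ¼ U - ½ * power ¼ U ≤⟨ ℚ.+-mono-≤ (ℚ.≤-trans (power-quarter l 0≤θ θ≤1 lθ U) (power-mono (0≤diff θ≤1) (ℚ.+-monoʳ-≤ 1ℚ (ℚ.neg-antimono-≤ h≤θ)) s)) (ℚ.neg-antimono-≤ error) ⟩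
        power (1ℚ - h) s - fromℕ s * (τ * k) ≤⟨ Descent.descend U s 0≤h (ℚ.≤-trans h≤θ θ≤1) (subst (_≤ u) (sym sh) -y≤u) (*-mono 0≤h h≤θ 0≤h h≤θ) (*-nonneg 0≤θ 0≤θ) (suc N) (s≤s z≤n) (λ n le → small n (ℕ.≤-trans (ℕ.n≤1+n N) le)) s ℕ.≤-refl n N≤n ⟩
        expSum n (- (fromℕ s * h)) ≡⟨ cong (expSum n) (trans (cong -_ sh) (solve 1 (λ y → :- (:- y) := y) refl y)) ⟩
        expSum n y ∎
      where
      open ℚ.≤-Reasoning
      -- The step is scaled so that exactly `s` of them lead from 0 to `y`.
      h = - y * recip U′ * θ
      0≤-y : 0ℚ ≤ - y
      0≤-y = ℚ.neg-antimono-≤ y≤0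
      -y≤u : - y ≤ u
      -y≤u = subst (- y ≤_) (solve 1 (λ u → :- (:- u) := u) refl u) (ℚ.neg-antimono-≤ -u≤y)
      0≤h : 0ℚ ≤ h
      0≤h = *-nonneg (*-nonneg 0≤-y (0≤recip U′)) 0≤θ
      h≤θ : h ≤ θ
      h≤θ = *-≤ˡ 0≤θ (recip-bound U′ (subst (- y ≤_) (sym (ℚ.*-identityˡ u)) -y≤u))
      sh : fromℕ s * h ≡ - y
      sh = trans (solve 4 (λ s y r t → s :* (y :* r :* t) := y :* (r :* (s :* t))) refl (fromℕ s) (- y) (recip U′) θ)
        (trans (cong (λ z → - y * (recip U′ * z)) sθ) (trans (cong (- y *_) (recip-inverse U′)) (ℚ.*-identityʳ (- y))))

  -- The threshold `N` is uniform in `y`, as it must be: in the application `y` is itself the n-th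
  -- term of a sequence.
  expSum-bounded-below : ∀ U′ → ∃ λ c → 0ℚ < c × ∃ λ N → ∀ n → N ℕ.≤ n → ∀ y → - fromℕ (suc U′) ≤ y → c ≤ expSum n y
  expSum-bounded-below U′ = ½ * power ¼ (suc U′) , *-pos 0<½ (power-pos 0<¼ (suc U′)) , choose (archimedean (A * inv P))
    where
    A = fromℕ (suc U′) * (1ℚ + power 2ℚ (suc U′ ℕ.+ suc U′))
    P = power ¼ (suc U′)
    choose : (∃ λ l → A * inv P ≤ fromℕ l) → ∃ λ N → ∀ n → N ℕ.≤ n → ∀ y → - fromℕ (suc U′) ≤ y → ½ * P ≤ expSum n y
    choose (l′ , le) = pick (expTerm-small (suc U′) (θ * θ) (*-pos 0<θ 0<θ))
      where
      l = suc l′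
      θ = ½ * recip l′
      0<θ : 0ℚ < θ
      0<θ = *-pos 0<½ (0<recip l′)
      θ≤1 : θ ≤ 1ℚ
      θ≤1 = ℚ.≤-trans (*-≤ˡ {½} (0≤recip l′) (≤-+ʳ {½} {½} (ℚ.<⇒≤ 0<½))) (recip≤1 l′)
      lθ : fromℕ l * θ ≡ ½
      lθ = trans (solve 2 (λ l r → l :* (con ½ :* r) := con ½ :* (r :* l)) refl (fromℕ l) (recip l′)) (trans (cong (½ *_) (recip-inverse l′)) (ℚ.*-identityʳ ½))
      enough : A ≤ fromℕ l * P
      enough = ℚ.≤-trans (ℚ.≤-reflexive (sym (undo A (power-pos 0<¼ (suc U′))))) (*-monoʳ (ℚ.<⇒≤ (power-pos 0<¼ (suc U′))) (ℚ.≤-trans le (fromℕ-mono {l′} {l} (ℕ.n≤1+n l′))))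
      pick : (∃ λ N → ∀ n → N ℕ.≤ n → expTerm (fromℕ (suc U′)) n ≤ θ * θ) → ∃ λ N → ∀ n → N ℕ.≤ n → ∀ y → - fromℕ (suc U′) ≤ y → ½ * P ≤ expSum n y
      pick (N , small) = suc N ℕ.+ suc U′ ℕ.* (l ℕ.+ l) , Below.below U′ l N θ (ℚ.<⇒≤ 0<θ) θ≤1 lθ enough small

  -- Truncated series of artanh and log

  artanhSum : ℕ → ℚ → ℚ
  artanhSum n p = partialSum (artanhTerm p) n

  geomSum : ℕ → ℚ → ℚ
  geomSum n ρ = partialSum (power ρ) n

  geomSum-closed : ∀ n ρ → (1ℚ - ρ) * geomSum n ρ ≡ 1ℚ - power ρ n
  geomSum-closed zero ρ = trans (ℚ.*-zeroʳ (1ℚ - ρ)) (sym (ℚ.+-inverseʳ 1ℚ))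
  geomSum-closed (suc n) ρ = trans (ℚ.*-distribˡ-+ (1ℚ - ρ) (geomSum n ρ) (power ρ n))
    (trans (cong (_+ (1ℚ - ρ) * power ρ n) (geomSum-closed n ρ))
      (solve 2 (λ r p → con 1ℚ :- p :+ (con 1ℚ :- r) :* p := con 1ℚ :- p :* r) refl ρ (power ρ n)))

  oddPower≡ : ∀ p k → oddPower p k ≡ p * power (p * p) k
  oddPower≡ p zero = sym (ℚ.*-identityʳ p)
  oddPower≡ p (suc k) = trans (cong (_* (p * p)) (oddPower≡ p k)) (ℚ.*-assoc p (power (p * p) k) (p * p))

  odd-suc : ∀ k → fromℕ (suc (2 ℕ.* suc k)) ≡ fromℕ (suc (2 ℕ.* k)) + 2ℚ
  odd-suc k = trans (cong fromℕ (trans (cong suc (ℕ.*-suc 2 k)) (ℕ.+-comm 2 (suc (2 ℕ.* k))))) (fromℕ-+ (suc (2 ℕ.* k)) 2)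

  module _ {p q : ℚ} (0≤p : 0ℚ ≤ p) (p≤q : p ≤ q) where

    private
      0≤q = ℚ.≤-trans 0≤p p≤q
      0≤pp = *-nonneg 0≤p 0≤p
      0≤qq = *-nonneg 0≤q 0≤q
      pp≤qq = *-mono 0≤p p≤q 0≤p p≤q
      0≤d = 0≤diff p≤q

    diff-step : ∀ k → oddPower q (suc k) - oddPower p (suc k) ≡ (oddPower q k - oddPower p k) * (q * q) + (q - p) * (power (p * p) k * (p * (q + p)))
    diff-step k = trans (solve 4 (λ a b q p → a :* (q :* q) :- b :* (p :* p) := (a :- b) :* (q :* q) :+ (q :- p) :* (b :* (q :+ p))) refl (oddPower q k) (oddPower p k) q p)
      (cong (λ z → (oddPower q k - oddPower p k) * (q * q) + (q - p) * z) (trans (cong (_* (q + p)) (oddPower≡ p k))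
        (solve 3 (λ p w r → p :* w :* r := w :* (p :* r)) refl p (power (p * p) k) (q + p))))

    -- The mean value inequality for t^(2k+1), with the derivative taken at the larger end; the
    -- lower bound takes it at the smaller one. The factor 2k+1 cancels against the coefficient in
    -- the series of artanh, which leaves a geometric sum.
    oddPower-diff-upper : ∀ k → oddPower q k - oddPower p k ≤ (q - p) * power (q * q) k * fromℕ (suc (2 ℕ.* k))
    oddPower-diff-upper zero = ℚ.≤-reflexive (solve 2 (λ q p → q :- p := (q :- p) :* con 1ℚ :* con 1ℚ) refl q p)
    oddPower-diff-upper (suc k) = begin
      oddPower q (suc k) - oddPower p (suc k) ≡⟨ diff-step k ⟩
      (oddPower q k - oddPower p k) * (q * q) + (q - p) * (power (p * p) k * (p * (q + p))) ≤⟨ ℚ.+-mono-≤ (*-monoʳ 0≤qq (oddPower-diff-upper k)) (*-monoˡ 0≤d (*-mono (power-nonneg 0≤pp k) (power-mono 0≤pp pp≤qq k) (*-nonneg 0≤p (+-nonneg 0≤q 0≤p)) (*-mono 0≤p p≤q (+-nonneg 0≤q 0≤p) (ℚ.+-monoʳ-≤ q p≤q)))) ⟩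
      (q - p) * w * m * (q * q) + (q - p) * (w * (q * (q + q))) ≡⟨ solve 4 (λ d w m q → d :* w :* m :* (q :* q) :+ d :* (w :* (q :* (q :+ q))) := d :* (w :* (q :* q)) :* (m :+ con 2ℚ)) refl (q - p) w m q ⟩
      (q - p) * (w * (q * q)) * (m + 2ℚ) ≡⟨ cong ((q - p) * (w * (q * q)) *_) (sym (odd-suc k)) ⟩
      (q - p) * power (q * q) (suc k) * fromℕ (suc (2 ℕ.* suc k)) ∎
      where
      open ℚ.≤-Reasoning
      w = power (q * q) k
      m = fromℕ (suc (2 ℕ.* k))

    oddPower-diff-lower : ∀ k → (q - p) * power (p * p) k * fromℕ (suc (2 ℕ.* k)) ≤ oddPower q k - oddPower p k
    oddPower-diff-lower zero = ℚ.≤-reflexive (solve 2 (λ q p → (q :- p) :* con 1ℚ :* con 1ℚ := q :- p) refl q p)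
    oddPower-diff-lower (suc k) = begin
      (q - p) * power (p * p) (suc k) * fromℕ (suc (2 ℕ.* suc k)) ≡⟨ cong ((q - p) * (w * (p * p)) *_) (odd-suc k) ⟩
      (q - p) * (w * (p * p)) * (m + 2ℚ) ≡⟨ solve 4 (λ d w m p → d :* (w :* (p :* p)) :* (m :+ con 2ℚ) := d :* w :* m :* (p :* p) :+ d :* (w :* (p :* (p :+ p)))) refl (q - p) w m p ⟩
      (q - p) * w * m * (p * p) + (q - p) * (w * (p * (p + p))) ≤⟨ ℚ.+-mono-≤ (*-mono (*-nonneg (*-nonneg 0≤d (power-nonneg 0≤pp k)) (0≤fromℕ (suc (2 ℕ.* k)))) (oddPower-diff-lower k) 0≤pp pp≤qq) (*-monoˡ 0≤d (*-monoˡ (power-nonneg 0≤pp k) (*-monoˡ 0≤p (ℚ.+-monoˡ-≤ p p≤q)))) ⟩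
      (oddPower q k - oddPower p k) * (q * q) + (q - p) * (w * (p * (q + p))) ≡⟨ sym (diff-step k) ⟩
      oddPower q (suc k) - oddPower p (suc k) ∎
      where
      open ℚ.≤-Reasoning
      w = power (p * p) k
      m = fromℕ (suc (2 ℕ.* k))

    artanhTerm-diff : ∀ k → artanhTerm q k - artanhTerm p k ≡ (oddPower q k - oddPower p k) * recip (2 ℕ.* k)
    artanhTerm-diff k = solve 3 (λ a b r → a :* r :- b :* r := (a :- b) :* r) refl (oddPower q k) (oddPower p k) (recip (2 ℕ.* k))

    artanhSum-diff-upper : ∀ n → artanhSum n q - artanhSum n p ≤ (q - p) * geomSum n (q * q)
    artanhSum-diff-upper zero = ℚ.≤-reflexive (sym (ℚ.*-zeroʳ (q - p)))
    artanhSum-diff-upper (suc n) = subst₂ _≤_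
      (solve 4 (λ a b c d → (a :- b) :+ (c :- d) := (a :+ c) :- (b :+ d)) refl (artanhSum n q) (artanhSum n p) (artanhTerm q n) (artanhTerm p n))
      (sym (ℚ.*-distribˡ-+ (q - p) (geomSum n (q * q)) (power (q * q) n)))
      (ℚ.+-mono-≤ (artanhSum-diff-upper n) (subst (_≤ (q - p) * power (q * q) n) (sym (artanhTerm-diff n)) (recip-bound (2 ℕ.* n) (oddPower-diff-upper n))))

    artanhSum-diff-lower : ∀ n → (q - p) * geomSum n (p * p) ≤ artanhSum n q - artanhSum n p
    artanhSum-diff-lower zero = ℚ.≤-reflexive (ℚ.*-zeroʳ (q - p))
    artanhSum-diff-lower (suc n) = subst₂ _≤_
      (sym (ℚ.*-distribˡ-+ (q - p) (geomSum n (p * p)) (power (p * p) n)))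
      (solve 4 (λ a b c d → (a :- b) :+ (c :- d) := (a :+ c) :- (b :+ d)) refl (artanhSum n q) (artanhSum n p) (artanhTerm q n) (artanhTerm p n))
      (ℚ.+-mono-≤ (artanhSum-diff-lower n) (subst ((q - p) * power (p * p) n ≤_) (sym (artanhTerm-diff n))
        (subst (_≤ (oddPower q n - oddPower p n) * recip (2 ℕ.* n)) (cancel-recip n) (*-monoʳ (0≤recip (2 ℕ.* n)) (oddPower-diff-lower n)))))
      where
      cancel-recip : ∀ n → (q - p) * power (p * p) n * fromℕ (suc (2 ℕ.* n)) * recip (2 ℕ.* n) ≡ (q - p) * power (p * p) n
      cancel-recip n = trans (solve 3 (λ a m r → a :* m :* r := a :* (r :* m)) refl ((q - p) * power (p * p) n) (fromℕ (suc (2 ℕ.* n))) (recip (2 ℕ.* n)))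
        (trans (cong ((q - p) * power (p * p) n *_) (recip-inverse (2 ℕ.* n))) (ℚ.*-identityʳ _))

    artanhSum-mono : ∀ n → artanhSum n p ≤ artanhSum n q
    artanhSum-mono n = diff⁻ (ℚ.≤-trans (*-nonneg 0≤d (partialSum-nonneg (power (p * p)) (power-nonneg 0≤pp) n)) (artanhSum-diff-lower n))

    artanhSum-upper : ∀ n → q * q ≤ 1ℚ → (1ℚ - q * q) * (artanhSum n q - artanhSum n p) ≤ q - p
    artanhSum-upper n qq≤1 = begin
      (1ℚ - q * q) * (artanhSum n q - artanhSum n p) ≤⟨ *-monoˡ (0≤diff qq≤1) (artanhSum-diff-upper n) ⟩
      (1ℚ - q * q) * ((q - p) * geomSum n (q * q)) ≡⟨ solve 3 (λ a d g → a :* (d :* g) := d :* (a :* g)) refl (1ℚ - q * q) (q - p) (geomSum n (q * q)) ⟩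
      (q - p) * ((1ℚ - q * q) * geomSum n (q * q)) ≡⟨ cong ((q - p) *_) (geomSum-closed n (q * q)) ⟩
      (q - p) * (1ℚ - power (q * q) n) ≤⟨ *-monoˡ 0≤d (ℚ.≤-trans (ℚ.+-monoʳ-≤ 1ℚ (ℚ.neg-antimono-≤ (power-nonneg 0≤qq n))) (ℚ.≤-reflexive (ℚ.+-identityʳ 1ℚ))) ⟩
      (q - p) * 1ℚ ≡⟨ ℚ.*-identityʳ (q - p) ⟩
      q - p ∎
      where open ℚ.≤-Reasoning

    -- The truncated derivative at `p` is (1 - p^(2n))/(1 - p²); the numerator is the price of
    -- truncation and has to be shown close to 1 where this is used.
    artanhSum-lower : ∀ n → p * p ≤ 1ℚ → (q - p) * (1ℚ - power (p * p) n) ≤ (1ℚ - p * p) * (artanhSum n q - artanhSum n p)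
    artanhSum-lower n pp≤1 = begin
      (q - p) * (1ℚ - power (p * p) n) ≡⟨ cong ((q - p) *_) (sym (geomSum-closed n (p * p))) ⟩
      (q - p) * ((1ℚ - p * p) * geomSum n (p * p)) ≡⟨ solve 3 (λ a d g → d :* (a :* g) := a :* (d :* g)) refl (1ℚ - p * p) (q - p) (geomSum n (p * p)) ⟩
      (1ℚ - p * p) * ((q - p) * geomSum n (p * p)) ≤⟨ *-monoˡ (0≤diff pp≤1) (artanhSum-diff-lower n) ⟩
      (1ℚ - p * p) * (artanhSum n q - artanhSum n p) ∎
      where open ℚ.≤-Reasoning

  -- With s = 1/(a+1) the Cayley transform of a is 1 - 2s, and 1 - (1-2s)² = 4 a s².
  module Cayley {a : ℚ} (0<a : 0ℚ < a) where

    s : ℚ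
    s = inv (a + 1ℚ)

    0<a+1 : 0ℚ < a + 1ℚ
    0<a+1 = +-pos 0<a 0≤1

    0<s : 0ℚ < s
    0<s = 0<inv 0<a+1

    [a+1]s : (a + 1ℚ) * s ≡ 1ℚ
    [a+1]s = inv-inverse 0<a+1

    cayley≡ : cayley a ≡ 1ℚ - 2ℚ * s
    cayley≡ = trans (solve 2 (λ a s → (a :- con 1ℚ) :* s := (a :+ con 1ℚ) :* s :- con 2ℚ :* s) refl a s) (cong (λ z → z - 2ℚ * s) [a+1]s)

    complement : 1ℚ - cayley a * cayley a ≡ 2ℚ * 2ℚ * (a * (s * s))
    complement = trans (cong (λ z → 1ℚ - z * z) cayley≡) (trans
      (solve 1 (λ s → con 1ℚ :- (con 1ℚ :- con 2ℚ :* s) :* (con 1ℚ :- con 2ℚ :* s) := con 2ℚ :* con 2ℚ :* (con 1ℚ :* s :- s :* s)) refl s)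
      (trans (cong (λ z → 2ℚ * 2ℚ * (z * s - s * s)) (sym [a+1]s))
        (solve 2 (λ a s → con 2ℚ :* con 2ℚ :* ((a :+ con 1ℚ) :* s :* s :- s :* s) := con 2ℚ :* con 2ℚ :* (a :* (s :* s))) refl a s)))

    0<complement : 0ℚ < 1ℚ - cayley a * cayley a
    0<complement = subst (0ℚ <_) (sym complement) (*-pos (ℚ.positive⁻¹ (2ℚ * 2ℚ)) (*-pos 0<a (*-pos 0<s 0<s)))

    square≤1 : cayley a * cayley a ≤ 1ℚ
    square≤1 = diff⁻ (ℚ.<⇒≤ 0<complement)

    0≤cayley : 1ℚ ≤ a → 0ℚ ≤ cayley a
    0≤cayley 1≤a = *-nonneg (0≤diff 1≤a) (ℚ.<⇒≤ 0<s)

  inv-diff : ∀ {a b} (0<a : 0ℚ < a) (0<b : 0ℚ < b) → Cayley.s 0<a - Cayley.s 0<b ≡ (b - a) * (Cayley.s 0<a * Cayley.s 0<b)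
  inv-diff {a} {b} 0<a 0<b = trans (cong₂ _-_ (sym (trans (cong (s *_) (Cayley.[a+1]s 0<b)) (ℚ.*-identityʳ s))) (sym (trans (cong (t *_) (Cayley.[a+1]s 0<a)) (ℚ.*-identityʳ t))))
    (solve 4 (λ a b s t → s :* ((b :+ con 1ℚ) :* t) :- t :* ((a :+ con 1ℚ) :* s) := (b :- a) :* (s :* t)) refl a b s t)
    where
    s = Cayley.s 0<a
    t = Cayley.s 0<b

  cayley-diff : ∀ {a b} (0<a : 0ℚ < a) (0<b : 0ℚ < b) → cayley b - cayley a ≡ 2ℚ * ((b - a) * (Cayley.s 0<a * Cayley.s 0<b))
  cayley-diff {a} {b} 0<a 0<b = trans (cong₂ _-_ (Cayley.cayley≡ 0<b) (Cayley.cayley≡ 0<a))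
    (trans (solve 2 (λ s t → (con 1ℚ :- con 2ℚ :* t) :- (con 1ℚ :- con 2ℚ :* s) := con 2ℚ :* (s :- t)) refl (Cayley.s 0<a) (Cayley.s 0<b))
      (cong (2ℚ *_) (inv-diff 0<a 0<b)))

  cayley-mono : ∀ {a b} → 0ℚ < a → a ≤ b → cayley a ≤ cayley b
  cayley-mono {a} {b} 0<a a≤b = diff⁻ (subst (0ℚ ≤_) (sym (cayley-diff 0<a 0<b))
    (*-nonneg 0≤2 (*-nonneg (0≤diff a≤b) (*-nonneg (ℚ.<⇒≤ (Cayley.0<s 0<a)) (ℚ.<⇒≤ (Cayley.0<s 0<b))))))
    where 0<b = ℚ.<-≤-trans 0<a a≤b

  logSum : ℕ → ℚ → ℚ
  logSum n x = 2ℚ * artanhSum n (cayley x)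

  logSum-mono : ∀ n {a b} → 1ℚ ≤ a → a ≤ b → logSum n a ≤ logSum n b
  logSum-mono n {a} {b} 1≤a a≤b = *-monoˡ 0≤2 (artanhSum-mono (Cayley.0≤cayley 0<a 1≤a) (cayley-mono 0<a a≤b) n)
    where 0<a = ℚ.<-≤-trans 0<1 1≤a

  -- By `artanhSum-upper` it is enough that 2(q - p) ≤ 1 - q² for the Cayley transforms `p` of `a`
  -- and `q` of `2a`. With `s = 1/(a+1)` and `t = 1/(2a+1)` the difference of the two sides is 4 a s
  -- t².
  logSum-double : ∀ n {a} → 1ℚ ≤ a → logSum n (2ℚ * a) ≤ logSum n a + 1ℚ
  logSum-double n {a} 1≤a = diff⁻ (subst (0ℚ ≤_) (solve 2 (λ A B → con 1ℚ :- con 2ℚ :* (B :- A) := con 2ℚ :* A :+ con 1ℚ :- con 2ℚ :* B) refl (artanhSum n p) (artanhSum n q))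
      (0≤diff (cancel {2ℚ * Δ} {1ℚ} w 0<w (begin
        2ℚ * Δ * w ≡⟨ solve 2 (λ d w → con 2ℚ :* d :* w := con 2ℚ :* (w :* d)) refl Δ w ⟩
        2ℚ * (w * Δ) ≤⟨ *-monoˡ 0≤2 (artanhSum-upper 0≤p p≤q n (Cayley.square≤1 0<b)) ⟩
        2ℚ * (q - p) ≤⟨ bound ⟩
        w ≡⟨ sym (ℚ.*-identityˡ w) ⟩
        1ℚ * w ∎))))
    where
    open ℚ.≤-Reasoning
    0<a = ℚ.<-≤-trans 0<1 1≤a
    b = 2ℚ * a
    0<b : 0ℚ < b
    0<b = *-pos (ℚ.positive⁻¹ 2ℚ) 0<a
    a≤b : a ≤ b
    a≤b = subst (a ≤_) (solve 1 (λ a → a :+ a := con 2ℚ :* a) refl a) (≤-+ʳ (ℚ.<⇒≤ 0<a))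
    p = cayley a
    q = cayley b
    s = Cayley.s 0<a
    t = Cayley.s 0<b
    w = 1ℚ - q * q
    Δ = artanhSum n q - artanhSum n p
    0<w = Cayley.0<complement 0<b
    0≤p = Cayley.0≤cayley 0<a 1≤a
    p≤q = cayley-mono 0<a a≤b
    bound : 2ℚ * (q - p) ≤ w
    bound = diff⁻ (subst (0ℚ ≤_) eq (*-nonneg (ℚ.nonNegative⁻¹ (2ℚ * 2ℚ)) (*-nonneg (ℚ.<⇒≤ 0<a) (*-nonneg (ℚ.<⇒≤ (Cayley.0<s 0<a)) (*-nonneg (ℚ.<⇒≤ (Cayley.0<s 0<b)) (ℚ.<⇒≤ (Cayley.0<s 0<b)))))))
      where
      eq : 2ℚ * 2ℚ * (a * (s * (t * t))) ≡ w - 2ℚ * (q - p)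
      eq = begin-equality
        2ℚ * 2ℚ * (a * (s * (t * t))) ≡⟨ solve 3 (λ a s t → con 2ℚ :* con 2ℚ :* (a :* (s :* (t :* t))) := con 2ℚ :* con 2ℚ :* (con 2ℚ :* a :* (t :* t) :* ((a :+ con 1ℚ) :* s) :- ((con 2ℚ :* a :- a) :* (s :* t)) :* ((con 2ℚ :* a :+ con 1ℚ) :* t))) refl a s t ⟩
        2ℚ * 2ℚ * (b * (t * t) * ((a + 1ℚ) * s) - (b - a) * (s * t) * ((b + 1ℚ) * t)) ≡⟨ cong₂ (λ u v → 2ℚ * 2ℚ * (b * (t * t) * u - (b - a) * (s * t) * v)) (Cayley.[a+1]s 0<a) (Cayley.[a+1]s 0<b) ⟩
        2ℚ * 2ℚ * (b * (t * t) * 1ℚ - (b - a) * (s * t) * 1ℚ) ≡⟨ solve 2 (λ u v → con 2ℚ :* con 2ℚ :* (u :* con 1ℚ :- v :* con 1ℚ) := con 2ℚ :* con 2ℚ :* u :- con 2ℚ :* (con 2ℚ :* v)) refl (b * (t * t)) ((b - a) * (s * t)) ⟩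
        2ℚ * 2ℚ * (b * (t * t)) - 2ℚ * (2ℚ * ((b - a) * (s * t))) ≡⟨ cong₂ (λ u v → u - 2ℚ * v) (sym (Cayley.complement 0<b)) (sym (cayley-diff 0<a 0<b)) ⟩
        w - 2ℚ * (q - p) ∎

  artanhSum-zero : ∀ n → artanhSum n 0ℚ ≡ 0ℚ
  artanhSum-zero zero = refl
  artanhSum-zero (suc n) = trans (cong₂ _+_ (artanhSum-zero n) (trans (cong (_* recip (2 ℕ.* n)) (trans (oddPower≡ 0ℚ n) (ℚ.*-zeroˡ (power (0ℚ * 0ℚ) n)))) (ℚ.*-zeroˡ (recip (2 ℕ.* n))))) (ℚ.+-identityˡ 0ℚ)

  logSum-one : ∀ n → logSum n 1ℚ ≡ 0ℚ
  logSum-one n = trans (cong (2ℚ *_) (artanhSum-zero n)) (ℚ.*-zeroʳ 2ℚ)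

  1≤power : ∀ {a} → 1ℚ ≤ a → ∀ k → 1ℚ ≤ power a k
  1≤power {a} 1≤a k = subst (_≤ power a k) (power-one k) (power-mono 0≤1 1≤a k)

  logSum-power-two : ∀ n k → logSum n (power 2ℚ k) ≤ fromℕ k
  logSum-power-two n zero = ℚ.≤-reflexive (logSum-one n)
  logSum-power-two n (suc k) = begin
    logSum n (power 2ℚ k * 2ℚ) ≡⟨ cong (logSum n) (ℚ.*-comm (power 2ℚ k) 2ℚ) ⟩
    logSum n (2ℚ * power 2ℚ k) ≤⟨ logSum-double n (1≤power (≤-+ʳ {1ℚ} {1ℚ} 0≤1) k) ⟩
    logSum n (power 2ℚ k) + 1ℚ ≤⟨ ℚ.+-monoˡ-≤ 1ℚ (logSum-power-two n k) ⟩
    fromℕ k + 1ℚ ≡⟨ trans (ℚ.+-comm (fromℕ k) 1ℚ) (sym (fromℕ-+ 1 k)) ⟩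
    fromℕ (suc k) ∎
    where open ℚ.≤-Reasoning

  logSum-upper : ∀ n k {x} → 1ℚ ≤ x → x ≤ power 2ℚ k → logSum n x ≤ fromℕ k
  logSum-upper n k 1≤x x≤ = ℚ.≤-trans (logSum-mono n 1≤x x≤) (logSum-power-two n k)

  -- One step of ratio 1 + h raises the logarithm by at least θ = h/(1+h), up to the truncation error.
  module Growth {h θ : ℚ} (0≤h : 0ℚ ≤ h) (0≤θ : 0ℚ ≤ θ) (θ[1+h] : θ * (1ℚ + h) ≡ h) where

    logSum-step : ∀ n {a} → 1ℚ ≤ a → logSum n a + θ * (1ℚ - power (cayley a * cayley a) n) ≤ logSum n (a * (1ℚ + h))
    logSum-step n {a} 1≤a = diff⁻ (subst (0ℚ ≤_) (solve 3 (λ A B c → con 2ℚ :* (B :- A) :- c := con 2ℚ :* B :- (con 2ℚ :* A :+ c)) refl (artanhSum n p) (artanhSum n q) (θ * ε))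
        (0≤diff (cancel {θ * ε} {2ℚ * Δ} w 0<w (begin
          θ * ε * w ≡⟨ solve 3 (λ t e w → t :* e :* w := t :* w :* e) refl θ ε w ⟩
          θ * w * ε ≤⟨ *-monoʳ 0≤ε bound ⟩
          2ℚ * (q - p) * ε ≡⟨ ℚ.*-assoc 2ℚ (q - p) ε ⟩
          2ℚ * ((q - p) * ε) ≤⟨ *-monoˡ 0≤2 (artanhSum-lower 0≤p p≤q n (Cayley.square≤1 0<a)) ⟩
          2ℚ * (w * Δ) ≡⟨ solve 2 (λ d w → con 2ℚ :* (w :* d) := con 2ℚ :* d :* w) refl Δ w ⟩
          2ℚ * Δ * w ∎))))
      where
      open ℚ.≤-Reasoning
      0<a = ℚ.<-≤-trans 0<1 1≤a
      b = a * (1ℚ + h)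
      0<1+h : 0ℚ < 1ℚ + h
      0<1+h = +-pos 0<1 0≤h
      0<b : 0ℚ < b
      0<b = *-pos 0<a 0<1+h
      a≤b : a ≤ b
      a≤b = subst (a ≤_) (solve 2 (λ a h → a :+ a :* h := a :* (con 1ℚ :+ h)) refl a h) (≤-+ʳ (*-nonneg (ℚ.<⇒≤ 0<a) 0≤h))
      p = cayley a
      q = cayley b
      s = Cayley.s 0<a
      t = Cayley.s 0<b
      w = 1ℚ - p * p
      ε = 1ℚ - power (p * p) n
      Δ = artanhSum n q - artanhSum n p
      0<w = Cayley.0<complement 0<a
      0≤p = Cayley.0≤cayley 0<a 1≤a
      p≤q = cayley-mono 0<a a≤b
      0≤ε : 0ℚ ≤ ε
      0≤ε = 0≤diff (ℚ.≤-trans (power-mono (*-nonneg 0≤p 0≤p) (Cayley.square≤1 0<a) n) (ℚ.≤-reflexive (power-one n)))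
      bound : θ * w ≤ 2ℚ * (q - p)
      bound = diff⁻ (subst (0ℚ ≤_) eq (*-nonneg (ℚ.nonNegative⁻¹ (2ℚ * 2ℚ)) (*-nonneg (*-nonneg (ℚ.<⇒≤ 0<a) 0≤θ) (*-nonneg 0≤h (*-nonneg (*-nonneg (ℚ.<⇒≤ (Cayley.0<s 0<a)) (ℚ.<⇒≤ (Cayley.0<s 0<a))) (ℚ.<⇒≤ (Cayley.0<s 0<b)))))))
        where
        eq : 2ℚ * 2ℚ * (a * θ * (h * (s * s * t))) ≡ 2ℚ * (q - p) - θ * w
        eq = begin-equality
          2ℚ * 2ℚ * (a * θ * (h * (s * s * t))) ≡⟨ solve 5 (λ a θ h s t → con 2ℚ :* con 2ℚ :* (a :* θ :* (h :* (s :* s :* t))) := con 2ℚ :* con 2ℚ :* (a :* (θ :* (con 1ℚ :+ h)) :* (s :* t) :* ((a :+ con 1ℚ) :* s) :- θ :* a :* (s :* s) :* ((a :* (con 1ℚ :+ h) :+ con 1ℚ) :* t))) refl a θ h s t ⟩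
          2ℚ * 2ℚ * (a * (θ * (1ℚ + h)) * (s * t) * ((a + 1ℚ) * s) - θ * a * (s * s) * ((b + 1ℚ) * t)) ≡⟨ cong (λ z → 2ℚ * 2ℚ * (a * z * (s * t) * ((a + 1ℚ) * s) - θ * a * (s * s) * ((b + 1ℚ) * t))) θ[1+h] ⟩
          2ℚ * 2ℚ * (a * h * (s * t) * ((a + 1ℚ) * s) - θ * a * (s * s) * ((b + 1ℚ) * t)) ≡⟨ cong₂ (λ u v → 2ℚ * 2ℚ * (a * h * (s * t) * u - θ * a * (s * s) * v)) (Cayley.[a+1]s 0<a) (Cayley.[a+1]s 0<b) ⟩
          2ℚ * 2ℚ * (a * h * (s * t) * 1ℚ - θ * a * (s * s) * 1ℚ) ≡⟨ solve 5 (λ a θ h s t → con 2ℚ :* con 2ℚ :* (a :* h :* (s :* t) :* con 1ℚ :- θ :* a :* (s :* s) :* con 1ℚ) := con 2ℚ :* (con 2ℚ :* ((a :* (con 1ℚ :+ h) :- a) :* (s :* t))) :- θ :* (con 2ℚ :* con 2ℚ :* (a :* (s :* s)))) refl a θ h s t ⟩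
          2ℚ * (2ℚ * ((b - a) * (s * t))) - θ * (2ℚ * 2ℚ * (a * (s * s))) ≡⟨ cong₂ (λ u v → 2ℚ * u - θ * v) (sym (cayley-diff 0<a 0<b)) (sym (Cayley.complement 0<a)) ⟩
          2ℚ * (q - p) - θ * w ∎

    a : ℕ → ℚ
    a = power (1ℚ + h)

    1≤1+h : 1ℚ ≤ 1ℚ + h
    1≤1+h = ≤-+ʳ 0≤h

    power-increasing : ∀ {i j} → i ℕ.≤ j → a i ≤ a j
    power-increasing {i} {j} i≤j = subst (λ z → a i ≤ a z) (ℕ.m+[n∸m]≡n i≤j) (subst (a i ≤_) (sym (trans (power-+ (1ℚ + h) i (j ℕ.∸ i)) (ℚ.*-comm (a (j ℕ.∸ i)) (a i))))
      (subst (_≤ a i * a (j ℕ.∸ i)) (ℚ.*-identityʳ (a i)) (*-monoˡ (power-nonneg (ℚ.≤-trans 0≤1 1≤1+h) i) (1≤power 1≤1+h (j ℕ.∸ i)))))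

    -- The truncation factor is taken at the top point `a N`, where the Cayley transform is largest,
    -- so one factor serves all steps.
    logSum-power : ∀ n N j → j ℕ.≤ N → fromℕ j * (θ * (1ℚ - power (cayley (a N) * cayley (a N)) n)) ≤ logSum n (a j)
    logSum-power n N zero _ = ℚ.≤-reflexive (trans (ℚ.*-zeroˡ (θ * (1ℚ - power (cayley (a N) * cayley (a N)) n))) (sym (logSum-one n)))
    logSum-power n N (suc j) j<N = begin
      fromℕ (suc j) * c ≡⟨ trans (cong (_* c) (fromℕ-+ 1 j)) (solve 2 (λ j c → (con 1ℚ :+ j) :* c := j :* c :+ c) refl (fromℕ j) c) ⟩
      fromℕ j * c + c ≤⟨ ℚ.+-mono-≤ (logSum-power n N j (ℕ.<⇒≤ j<N)) (*-monoˡ 0≤θ (ℚ.+-monoʳ-≤ 1ℚ (ℚ.neg-antimono-≤ (power-mono (*-nonneg 0≤p 0≤p) (*-mono 0≤p p≤ 0≤p p≤) n)))) ⟩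
      logSum n (a j) + θ * (1ℚ - power (cayley (a j) * cayley (a j)) n) ≤⟨ logSum-step n (1≤power 1≤1+h j) ⟩
      logSum n (a j * (1ℚ + h)) ∎
      where
      open ℚ.≤-Reasoning
      c = θ * (1ℚ - power (cayley (a N) * cayley (a N)) n)
      0<aj : 0ℚ < a j
      0<aj = ℚ.<-≤-trans 0<1 (1≤power 1≤1+h j)
      0≤p : 0ℚ ≤ cayley (a j)
      0≤p = Cayley.0≤cayley 0<aj (1≤power 1≤1+h j)
      p≤ : cayley (a j) ≤ cayley (a N)
      p≤ = cayley-mono 0<aj (power-increasing (ℕ.<⇒≤ j<N))

    -- `n₀` is chosen so that ρ^n ≤ 1/(N+1) from there on. The truncation errors of the `N` steps
    -- then add up to at most `θ`, the gain of a single step.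
    logSum-lower : ∀ N → ∃ λ n₀ → ∀ n → n₀ ℕ.≤ n → ∀ x → a N ≤ x → fromℕ N * θ - θ ≤ logSum n x
    logSum-lower N = J , λ n J≤n x aN≤x → ℚ.≤-trans (main n J≤n) (logSum-mono n (1≤power 1≤1+h N) aN≤x)
      where
      0<aN : 0ℚ < a N
      0<aN = ℚ.<-≤-trans 0<1 (1≤power 1≤1+h N)
      p = cayley (a N)
      ρ = p * p
      0≤p = Cayley.0≤cayley 0<aN (1≤power 1≤1+h N)
      0<1-ρ = Cayley.0<complement 0<aN
      δ = inv (1ℚ - ρ)
      0<δ = 0<inv 0<1-ρ
      eq : 1ℚ + ρ * δ ≡ δ
      eq = trans (cong (_+ ρ * δ) (sym (inv-inverse 0<1-ρ))) (solve 2 (λ r d → (con 1ℚ :- r) :* d :+ r :* d := d) refl ρ δ)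
      ratio : Ratio ρ δ
      ratio = record { 0≤ρ = *-nonneg 0≤p 0≤p ; ρ≤1 = Cayley.square≤1 0<aN ; 0≤δ = ℚ.<⇒≤ 0<δ ; geometric = ℚ.≤-reflexive eq }
      1≤δ : 1ℚ ≤ δ
      1≤δ = subst (1ℚ ≤_) eq (≤-+ʳ (*-nonneg (*-nonneg 0≤p 0≤p) (ℚ.<⇒≤ 0<δ)))
      sm = Geometric.small ratio 1ℚ (recip N) 0≤1 (0<recip N)
      J = proj₁ sm
      decayed : ∀ n → J ℕ.≤ n → power ρ n ≤ recip N
      decayed n J≤n = ℚ.≤-trans (subst (λ z → power ρ n ≤ 1ℚ * power ρ z * δ) (sym (ℕ.m+[n∸m]≡n J≤n))
        (subst (power ρ n ≤_) (cong (_* δ) (sym (ℚ.*-identityˡ (power ρ n)))) (subst (_≤ power ρ n * δ) (ℚ.*-identityʳ (power ρ n)) (*-monoˡ (power-nonneg (*-nonneg 0≤p 0≤p) n) 1≤δ)))) (proj₂ sm (n ℕ.∸ J))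
      main : ∀ n → J ℕ.≤ n → fromℕ N * θ - θ ≤ logSum n (a N)
      main n J≤n = ℚ.≤-trans (subst (fromℕ N * θ - θ ≤_) (solve 3 (λ m t e → m :* t :- t :* (m :* e) := m :* (t :* (con 1ℚ :- e))) refl (fromℕ N) θ (power ρ n))
        (ℚ.+-monoʳ-≤ (fromℕ N * θ) (ℚ.neg-antimono-≤ (subst (θ * (fromℕ N * power ρ n) ≤_) (ℚ.*-identityʳ θ) (*-monoˡ 0≤θ
          (ℚ.≤-trans (*-mono (0≤fromℕ N) (fromℕ-mono {N} {suc N} (ℕ.n≤1+n N)) (power-nonneg (*-nonneg 0≤p 0≤p) n) (decayed n J≤n)) (ℚ.≤-reflexive (trans (ℚ.*-comm (fromℕ (suc N)) (recip N)) (recip-inverse N)))))))))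
        (logSum-power n N N ℕ.≤-refl)

  -- Lower bounds for the cube root and the iterated logarithm

  ⅓ ⅛ : ℚ
  ⅓ = ℤ.+ 1 / 3
  ⅛ = ½ * (½ * ½)

  0≤⅓ : 0ℚ ≤ ⅓
  0≤⅓ = ℚ.nonNegative⁻¹ ⅓

  bernoulli⁺ : ∀ {h} → 0ℚ ≤ h → ∀ k → 1ℚ + fromℕ k * h ≤ power (1ℚ + h) k
  bernoulli⁺ {h} 0≤h zero = ℚ.≤-reflexive (trans (cong (λ z → 1ℚ + z) (ℚ.*-zeroˡ h)) (ℚ.+-identityʳ 1ℚ))
  bernoulli⁺ {h} 0≤h (suc k) = begin
    1ℚ + fromℕ (suc k) * h ≡⟨ cong (λ z → 1ℚ + z * h) (fromℕ-+ 1 k) ⟩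
    1ℚ + (1ℚ + a) * h ≤⟨ ≤-+ʳ (*-nonneg (*-nonneg (0≤fromℕ k) 0≤h) 0≤h) ⟩
    1ℚ + (1ℚ + a) * h + a * h * h ≡⟨ solve 2 (λ a h → con 1ℚ :+ (con 1ℚ :+ a) :* h :+ a :* h :* h := (con 1ℚ :+ a :* h) :* (con 1ℚ :+ h)) refl a h ⟩
    (1ℚ + a * h) * (1ℚ + h) ≤⟨ *-monoʳ (+-nonneg 0≤1 0≤h) (bernoulli⁺ 0≤h k) ⟩
    power (1ℚ + h) k * (1ℚ + h) ∎
    where
    open ℚ.≤-Reasoning
    a = fromℕ k

  logSum-nonneg : ∀ n {x} → 1ℚ ≤ x → 0ℚ ≤ logSum n x
  logSum-nonneg n {x} 1≤x = subst (_≤ logSum n x) (logSum-one n) (logSum-mono n ℚ.≤-refl 1≤x)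

  -- The grid of ratio 1 + h = (8κ+2)/(8κ+1) is fine enough that (1+θ)ᴺ and (1+h)ᴺ stay within a factor 2 up to 2^(4κ).
  module Grid (κ : ℕ) (h θ : ℚ) (h-def : h * fromℕ (1 ℕ.+ 8 ℕ.* κ) ≡ 1ℚ) (θ-def : θ * fromℕ (2 ℕ.+ 8 ℕ.* κ) ≡ 1ℚ)
    (0<h : 0ℚ < h) (h≤1 : h ≤ 1ℚ) (0≤θ : 0ℚ ≤ θ) (θ≤1 : θ ≤ 1ℚ) where

    m : ℕ
    m = 2 ℕ.+ 8 ℕ.* κ

    0≤h = ℚ.<⇒≤ 0<h

    1+h : 1ℚ + h ≡ h * fromℕ m
    1+h = trans (cong (_+ h) (sym h-def)) (trans (solve 2 (λ h a → h :* a :+ h := h :* (con 1ℚ :+ a)) refl h (fromℕ (1 ℕ.+ 8 ℕ.* κ))) (cong (h *_) (sym (fromℕ-+ 1 (1 ℕ.+ 8 ℕ.* κ)))))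

    θ[1+h] : θ * (1ℚ + h) ≡ h
    θ[1+h] = trans (cong (θ *_) 1+h) (trans (solve 3 (λ t h m → t :* (h :* m) := h :* (t :* m)) refl θ h (fromℕ m)) (trans (cong (h *_) θ-def) (ℚ.*-identityʳ h)))

    open Growth 0≤h 0≤θ θ[1+h]

    -- A cap on the search for `N`. As (1 + h)^m ≥ 2, the grid reaches `top` within `B` steps, and
    -- `N ≤ B` is what yields `N θ² ≤ ½`.
    B : ℕ
    B = (1 ℕ.+ 4 ℕ.* κ) ℕ.* m

    top : ℚ
    top = power 2ℚ (4 ℕ.* κ)

    1≤2 : 1ℚ ≤ 2ℚ
    1≤2 = ≤-+ʳ {1ℚ} {1ℚ} 0≤1

    chosen : ∃ λ N → a N ≤ top × N ℕ.≤ B × (∀ {w} → a w ≤ top → w ℕ.≤ B → w ℕ.≤ N)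
    chosen = greatest (λ w → a w ℚ.≤? top) {0} (1≤power 1≤2 (4 ℕ.* κ)) B z≤n

    module _ (N : ℕ) (aN≤top : a N ≤ top) (N≤B : N ℕ.≤ B) (max : ∀ {w} → a w ≤ top → w ℕ.≤ B → w ℕ.≤ N) where

      2≤power-m : 2ℚ ≤ a m
      2≤power-m = ℚ.≤-trans (ℚ.+-monoʳ-≤ 1ℚ (subst (1ℚ ≤_) (trans 1+h (ℚ.*-comm h (fromℕ m))) 1≤1+h)) (bernoulli⁺ 0≤h m)

      top≤ : top ≤ a N * 2ℚ
      top≤ with suc N ℕ.≤? B | a (suc N) ℚ.≤? top
      ... | yes N<B | yes le = contradiction (max le N<B) (ℕ.<⇒≱ (ℕ.n<1+n N))
      ... | yes _ | no ¬le = ℚ.≤-trans (ℚ.<⇒≤ (ℚ.≰⇒> ¬le)) (*-monoˡ (power-nonneg (ℚ.≤-trans 0≤1 1≤1+h) N) (ℚ.+-monoʳ-≤ 1ℚ h≤1))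
      ... | no N≮B | _ = begin
        power 2ℚ (4 ℕ.* κ) ≤⟨ power-mono 0≤2 2≤power-m (4 ℕ.* κ) ⟩
        power (a m) (4 ℕ.* κ) ≤⟨ subst (_≤ power (a m) (1 ℕ.+ 4 ℕ.* κ)) (ℚ.*-identityʳ _) (*-monoˡ (power-nonneg 0≤am (4 ℕ.* κ)) (ℚ.≤-trans 1≤2 2≤power-m)) ⟩
        power (a m) (1 ℕ.+ 4 ℕ.* κ) ≡⟨ sym (power-power (1ℚ + h) m (1 ℕ.+ 4 ℕ.* κ)) ⟩
        a B ≡⟨ cong a (ℕ.≤-antisym (ℕ.≮⇒≥ N≮B) N≤B) ⟩
        a N ≤⟨ subst (a N ≤_) (solve 1 (λ z → z :+ z := z :* (con 1ℚ :+ con 1ℚ)) refl (a N)) (≤-+ʳ (power-nonneg (ℚ.≤-trans 0≤1 1≤1+h) N)) ⟩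
        a N * 2ℚ ∎
        where
        open ℚ.≤-Reasoning
        0≤am : 0ℚ ≤ a m
        0≤am = power-nonneg (ℚ.≤-trans 0≤1 1≤1+h) m

      Nθθ : fromℕ N * (θ * θ) ≤ ½
      Nθθ = begin
        fromℕ N * (θ * θ) ≤⟨ *-monoʳ (*-nonneg 0≤θ 0≤θ) (fromℕ-mono {N} {B} N≤B) ⟩
        fromℕ B * (θ * θ) ≡⟨ cong (_* (θ * θ)) (fromℕ-* (1 ℕ.+ 4 ℕ.* κ) m) ⟩
        k * fromℕ m * (θ * θ) ≡⟨ solve 3 (λ k m t → k :* m :* (t :* t) := k :* t :* (t :* m)) refl k (fromℕ m) θ ⟩
        k * θ * (θ * fromℕ m) ≡⟨ trans (cong (k * θ *_) θ-def) (ℚ.*-identityʳ (k * θ)) ⟩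
        k * θ ≡⟨ solve 2 (λ k t → k :* t := con ½ :* (t :* (k :+ k))) refl k θ ⟩
        ½ * (θ * (k + k)) ≡⟨ cong (λ z → ½ * (θ * z)) (trans (sym (fromℕ-+ (1 ℕ.+ 4 ℕ.* κ) (1 ℕ.+ 4 ℕ.* κ))) (cong fromℕ (S.solve 1 (λ z → S.con 1 S.:+ S.con 4 S.:* z S.:+ (S.con 1 S.:+ S.con 4 S.:* z) S.:= S.con 2 S.:+ S.con 8 S.:* z) refl κ))) ⟩
        ½ * (θ * fromℕ m) ≡⟨ trans (cong (½ *_) θ-def) (ℚ.*-identityʳ ½) ⟩
        ½ ∎
        where
        open ℚ.≤-Reasoning
        module S = ℕSolver.+-*-Solver
        k = fromℕ (1 ℕ.+ 4 ℕ.* κ)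

      -- From θ (1 + h) = h follows 1 + θ = (1 - θ²)(1 + h), and (1 - θ²)^N ≥ 1 - N θ² ≥ ½.
      θ-power : ½ * a N ≤ power (1ℚ + θ) N
      θ-power = begin
        ½ * a N ≤⟨ *-monoʳ (power-nonneg (ℚ.≤-trans 0≤1 1≤1+h) N) (ℚ.≤-trans (ℚ.+-monoʳ-≤ 1ℚ (ℚ.neg-antimono-≤ Nθθ)) (bernoulli (*-nonneg 0≤θ 0≤θ) (ℚ.≤-trans (*-≤ˡ 0≤θ θ≤1) θ≤1) N)) ⟩
        power (1ℚ - θ * θ) N * a N ≡⟨ sym (power-* (1ℚ - θ * θ) (1ℚ + h) N) ⟩
        power ((1ℚ - θ * θ) * (1ℚ + h)) N ≡⟨ cong (λ z → power z N) eq ⟩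
        power (1ℚ + θ) N ∎
        where
        open ℚ.≤-Reasoning
        eq : (1ℚ - θ * θ) * (1ℚ + h) ≡ 1ℚ + θ
        eq = trans (solve 2 (λ t h → (con 1ℚ :- t :* t) :* (con 1ℚ :+ h) := (con 1ℚ :+ t) :* (con 1ℚ :+ h :- t :* (con 1ℚ :+ h))) refl θ h)
          (trans (cong (λ z → (1ℚ + θ) * (1ℚ + h - z)) θ[1+h]) (solve 2 (λ t h → (con 1ℚ :+ t) :* (con 1ℚ :+ h :- h) := con 1ℚ :+ t) refl θ h))

    Goal : Set
    Goal = ∃ λ ε → 0ℚ < ε × ∃ λ n₀ → ∀ n → n₀ ℕ.≤ n → ∀ x → 1ℚ ≤ x → power 2ℚ (12 ℕ.* κ) ≤ x + ε → ⅛ * top ≤ expSum n (⅓ * logSum n x)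

    goal : (∃ λ N → a N ≤ top × N ℕ.≤ B × (∀ {w} → a w ≤ top → w ℕ.≤ B → w ℕ.≤ N)) → Goal
    -- With no grid step below it, `top` is at most 2, so `⅛ * top ≤ 1` and the constant term of exp
    -- is enough; `ε = 1` is an arbitrary choice.
    goal (zero , aN≤ , N≤B , max) = 1ℚ , 0<1 , 1 , λ n 1≤n x 1≤x _ → ℚ.≤-trans
      (ℚ.≤-trans (*-monoˡ (ℚ.nonNegative⁻¹ ⅛) (top≤ 0 aN≤ N≤B max)) (ℚ.≤-trans (≤-+ʳ {⅛ * (1ℚ * 2ℚ)} {½ + ¼} (ℚ.nonNegative⁻¹ (½ + ¼))) (ℚ.≤-reflexive refl)))
      (1≤exp (*-nonneg 0≤⅓ (logSum-nonneg n 1≤x)) n 1≤n)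
    goal (suc N , aN≤ , N≤B , max) = ε , *-pos (power-pos 0<1+h (3 ℕ.* N ℕ.+ 2)) 0<h , pick (logSum-lower (3 ℕ.* N ℕ.+ 2))
      where
      0<1+h : 0ℚ < 1ℚ + h
      0<1+h = ℚ.<-≤-trans 0<1 1≤1+h
      b = a (3 ℕ.* N ℕ.+ 2)
      -- The slack is one grid step: `b (1 + h)` is the cube of the grid point with index `N + 1`,
      -- at most 2^(12κ), so `2^(12κ) ≤ x + b h` still gives `b ≤ x`.
      ε = b * h
      cube : b * (1ℚ + h) ≤ power 2ℚ (12 ℕ.* κ)
      cube = begin
        b * (1ℚ + h) ≡⟨ cong (λ z → power (1ℚ + h) z) (S.solve 1 (λ n → S.con 1 S.:+ (S.con 3 S.:* n S.:+ S.con 2) S.:= S.con 3 S.:* (S.con 1 S.:+ n)) refl N) ⟩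
        a (3 ℕ.* suc N) ≡⟨ power-power (1ℚ + h) (suc N) 3 ⟩
        power (a (suc N)) 3 ≤⟨ power-mono (power-nonneg (ℚ.<⇒≤ 0<1+h) (suc N)) aN≤ 3 ⟩
        power top 3 ≡⟨ sym (power-power 2ℚ (4 ℕ.* κ) 3) ⟩
        power 2ℚ (3 ℕ.* (4 ℕ.* κ)) ≡⟨ cong (power 2ℚ) (sym (ℕ.*-assoc 3 4 κ)) ⟩
        power 2ℚ (12 ℕ.* κ) ∎
        where
        open ℚ.≤-Reasoning
        module S = ℕSolver.+-*-Solver
      b≤ : ∀ x → power 2ℚ (12 ℕ.* κ) ≤ x + ε → b ≤ x
      b≤ x le = subst₂ _≤_ (solve 2 (λ b h → b :* (con 1ℚ :+ h) :+ :- (b :* h) := b) refl b h) (solve 2 (λ x e → x :+ e :+ :- e := x) refl x ε) (ℚ.+-monoˡ-≤ (- ε) (ℚ.≤-trans cube le))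
      -- The constant ⅛ collects three halves: from `top` to the grid point below it, from powers of
      -- 1 + h to powers of 1 + θ, and from N + 1 steps to N. The last makes up for the steps lost
      -- to the slack `ε` and to truncation.
      enough : ∀ n → suc N ℕ.≤ n → ∀ y → fromℕ (3 ℕ.* N ℕ.+ 2) * θ - θ ≤ y → ⅛ * top ≤ expSum n (⅓ * y)
      enough n N<n y le = begin
        ⅛ * top ≤⟨ *-monoˡ (ℚ.nonNegative⁻¹ ⅛) (top≤ (suc N) aN≤ N≤B max) ⟩
        ⅛ * (a (suc N) * 2ℚ) ≡⟨ solve 1 (λ z → con ⅛ :* (z :* con 2ℚ) := con ½ :* (con ½ :* z)) refl (a (suc N)) ⟩
        ½ * (½ * a (suc N)) ≤⟨ *-monoˡ (ℚ.<⇒≤ 0<½) (θ-power (suc N) aN≤ N≤B max) ⟩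
        ½ * (power (1ℚ + θ) N * (1ℚ + θ)) ≤⟨ *-monoˡ (ℚ.<⇒≤ 0<½) (*-monoˡ (power-nonneg 0≤1+θ N) (ℚ.+-monoʳ-≤ 1ℚ θ≤1)) ⟩
        ½ * (power (1ℚ + θ) N * 2ℚ) ≡⟨ solve 1 (λ z → con ½ :* (z :* con 2ℚ) := z) refl (power (1ℚ + θ) N) ⟩
        power (1ℚ + θ) N ≤⟨ expSum-power 0≤θ N ⟩
        expSum (suc N) (fromℕ N * θ) ≤⟨ partialSum-mono (expTerm (fromℕ N * θ)) (expTerm-nonneg 0≤Nθ) (suc N) n N<n ⟩
        expSum n (fromℕ N * θ) ≤⟨ expSum-mono n 0≤Nθ third ⟩
        expSum n (⅓ * y) ∎
        where
        open ℚ.≤-Reasoning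
        0≤1+θ = +-nonneg 0≤1 0≤θ
        0≤Nθ = *-nonneg (0≤fromℕ N) 0≤θ
        third : fromℕ N * θ ≤ ⅓ * y
        third = ℚ.≤-trans (≤-+ʳ (*-nonneg 0≤⅓ 0≤θ)) (subst (_≤ ⅓ * y) eq (*-monoˡ 0≤⅓ le))
          where
          eq : ⅓ * (fromℕ (3 ℕ.* N ℕ.+ 2) * θ - θ) ≡ fromℕ N * θ + ⅓ * θ
          eq = trans (cong (λ z → ⅓ * (z * θ - θ)) (trans (fromℕ-+ (3 ℕ.* N) 2) (cong (_+ fromℕ 2) (fromℕ-* 3 N))))
            (solve 2 (λ n t → con ⅓ :* ((con (fromℕ 3) :* n :+ con (fromℕ 2)) :* t :- t) := n :* t :+ con ⅓ :* t) refl (fromℕ N) θ)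
      pick : (∃ λ n₀ → ∀ n → n₀ ℕ.≤ n → ∀ x → b ≤ x → fromℕ (3 ℕ.* N ℕ.+ 2) * θ - θ ≤ logSum n x)
        → ∃ λ n₀ → ∀ n → n₀ ℕ.≤ n → ∀ x → 1ℚ ≤ x → power 2ℚ (12 ℕ.* κ) ≤ x + ε → ⅛ * top ≤ expSum n (⅓ * logSum n x)
      pick (n₀ , lower) = n₀ ℕ.+ suc N , λ n n≥ x _ le → enough n (ℕ.≤-trans (ℕ.m≤n+m (suc N) n₀) n≥) (logSum n x) (lower n (ℕ.≤-trans (ℕ.m≤m+n n₀ (suc N)) n≥) x (b≤ x le))

  -- The slack `ε` is fixed before `n` and `x`, because an inequality `p ≤ X` between a rational and
  -- a real gives at index n only `p ≤ seq X n + ε`.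
  cube-root-lower : ∀ κ → ∃ λ ε → 0ℚ < ε × ∃ λ n₀ → ∀ n → n₀ ℕ.≤ n → ∀ x → 1ℚ ≤ x → power 2ℚ (12 ℕ.* κ) ≤ x + ε
    → ⅛ * power 2ℚ (4 ℕ.* κ) ≤ expSum n (⅓ * logSum n x)
  cube-root-lower κ = goal chosen
    where
    open Grid κ (recip (8 ℕ.* κ)) (recip (1 ℕ.+ 8 ℕ.* κ)) (recip-inverse (8 ℕ.* κ)) (recip-inverse (1 ℕ.+ 8 ℕ.* κ))
      (0<recip (8 ℕ.* κ)) (recip≤1 (8 ℕ.* κ)) (0≤recip (1 ℕ.+ 8 ℕ.* κ)) (recip≤1 (1 ℕ.+ 8 ℕ.* κ))

  -- log 3 ≥ 13/12 has Cayley transform at least η = 1/25, so log log X ≥ 2η = ζ; the Cayley transform of ζ is -r,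
  -- and W = 2r/(1 - r²) bounds 2 artanh r.
  η ζ r : ℚ
  η = ℤ.+ 1 / 25
  ζ = η + η
  r = ℤ.+ 23 / 27

  logSum-at-13/12 : ∀ n {x} → 1 ℕ.≤ n → 1ℚ + ℤ.+ 1 / 12 ≤ x → ζ ≤ logSum n x
  logSum-at-13/12 n {x} 1≤n le = ℚ.≤-trans (ℚ.≤-reflexive (sym (solve 1 (λ e → (con 1ℚ :+ con 1ℚ) :* e := e :+ e) refl η))) (*-monoˡ 0≤2 (begin
      η ≡⟨ sym (trans (ℚ.+-identityˡ (η * recip 0)) (ℚ.*-identityʳ η)) ⟩
      artanhSum 1 η ≤⟨ partialSum-mono (artanhTerm η) (artanhTerm-nonneg 0≤η) 1 n 1≤n ⟩
      artanhSum n η ≤⟨ artanhSum-mono 0≤η η≤cayley n ⟩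
      artanhSum n (cayley x) ∎))
    where
    open ℚ.≤-Reasoning
    0≤η : 0ℚ ≤ η
    0≤η = ℚ.nonNegative⁻¹ η
    0<x : 0ℚ < x
    0<x = ℚ.<-≤-trans (ℚ.positive⁻¹ (1ℚ + ℤ.+ 1 / 12)) le
    η≤cayley : η ≤ cayley x
    η≤cayley = cayley-lower 0<x (diff⁻ (subst (0ℚ ≤_) (solve 1 (λ x → con (ℤ.+ 24 / 25) :* (x :- con (1ℚ + ℤ.+ 1 / 12)) := x :- con 1ℚ :- con η :* (x :+ con 1ℚ)) refl x)
      (*-nonneg (ℚ.nonNegative⁻¹ (ℤ.+ 24 / 25)) (0≤diff le))))

  oddPower-neg-bound : ∀ {p ρ} → 0ℚ ≤ ρ → - ρ ≤ p → ∀ k → - oddPower ρ k ≤ oddPower p k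
  oddPower-neg-bound {p} {ρ} 0≤ρ -ρ≤p k with ℚ.≤-total 0ℚ p
  ... | inj₁ 0≤p = ℚ.≤-trans (ℚ.neg-antimono-≤ (oddPower-nonneg 0≤ρ k)) (oddPower-nonneg 0≤p k)
  ... | inj₂ p≤0 = subst (- oddPower ρ k ≤_) (sym flip) (ℚ.neg-antimono-≤ (subst₂ _≤_ (sym (oddPower≡ (- p) k)) (sym (oddPower≡ ρ k))
        (*-mono 0≤-p -p≤ρ (power-nonneg (*-nonneg 0≤-p 0≤-p) k) (power-mono (*-nonneg 0≤-p 0≤-p) (*-mono 0≤-p -p≤ρ 0≤-p -p≤ρ) k))))
    where
    0≤-p : 0ℚ ≤ - p
    0≤-p = ℚ.neg-antimono-≤ p≤0
    -p≤ρ : - p ≤ ρ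
    -p≤ρ = subst (- p ≤_) (solve 1 (λ z → :- (:- z) := z) refl ρ) (ℚ.neg-antimono-≤ -ρ≤p)
    flip : oddPower p k ≡ - oddPower (- p) k
    flip = trans (oddPower≡ p k) (trans (solve 2 (λ p w → p :* w := :- (:- p :* w)) refl p (power (p * p) k))
      (cong -_ (trans (cong (λ z → - p * power z k) (solve 1 (λ p → p :* p := :- p :* :- p) refl p)) (sym (oddPower≡ (- p) k)))))

  W : ℚ
  W = ℤ.+ 621 / 100

  logSum-bounded-below : ∀ n {z} → ζ ≤ z → - W ≤ logSum n z
  logSum-bounded-below n {z} le = begin
    - W ≡⟨ refl ⟩
    2ℚ * - (ℤ.+ 621 / 200) ≤⟨ *-monoˡ 0≤2 (ℚ.neg-antimono-≤ artanh≤) ⟩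
    2ℚ * - artanhSum n r ≤⟨ *-monoˡ 0≤2 (neg-sum n) ⟩
    2ℚ * artanhSum n (cayley z) ∎
    where
    open ℚ.≤-Reasoning
    0≤r : 0ℚ ≤ r
    0≤r = ℚ.nonNegative⁻¹ r
    0<z : 0ℚ < z
    0<z = ℚ.<-≤-trans (ℚ.positive⁻¹ ζ) le
    -r≤ : - r ≤ cayley z
    -r≤ = cayley-lower 0<z (diff⁻ (subst (0ℚ ≤_) (solve 1 (λ z → con (ℤ.+ 50 / 27) :* (z :- con ζ) := z :- con 1ℚ :- con (- r) :* (z :+ con 1ℚ)) refl z)
      (*-nonneg (ℚ.nonNegative⁻¹ (ℤ.+ 50 / 27)) (0≤diff le))))
    neg-sum : ∀ n → - artanhSum n r ≤ artanhSum n (cayley z)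
    neg-sum zero = ℚ.≤-refl
    neg-sum (suc n) = subst (_≤ artanhSum (suc n) (cayley z)) (sym (ℚ.neg-distrib-+ (artanhSum n r) (artanhTerm r n)))
      (ℚ.+-mono-≤ (neg-sum n) (subst (_≤ artanhTerm (cayley z) n) (sym (ℚ.neg-distribˡ-* (oddPower r n) (recip (2 ℕ.* n)))) (*-monoʳ (0≤recip (2 ℕ.* n)) (oddPower-neg-bound 0≤r -r≤ n))))
    artanh≤ : artanhSum n r ≤ ℤ.+ 621 / 200
    artanh≤ = cancel (1ℚ - r * r) (ℚ.positive⁻¹ (1ℚ - r * r)) (ℚ.≤-trans (subst (_≤ r - 0ℚ)
        (trans (cong (λ z → (1ℚ - r * r) * (artanhSum n r - z)) (artanhSum-zero n)) (trans (cong ((1ℚ - r * r) *_) (ℚ.+-identityʳ (artanhSum n r))) (ℚ.*-comm (1ℚ - r * r) (artanhSum n r))))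
        (artanhSum-upper ℚ.≤-refl 0≤r n (diff⁻ (ℚ.nonNegative⁻¹ (1ℚ - r * r))))) (ℚ.≤-reflexive refl))

module Conclusion where

  open Summation
  open Arithmetic using (greatest; 𝟙*-true; 𝟙*-false; ∑-cutoff; SF; μ²-indicator; pw; pw≡; pw-+; pw-*; pw>0; module Residues; module Discrepancy; module Core)
  open Analysis hiding (⅓; 0≤⅓; η; r)
  open import Defs renaming (_≤_ to _≤ℝ_; _<_ to _<ℝ_; _+_ to _+ℝ_; _*_ to _*ℝ_; _-_ to _-ℝ_; -_ to -ℝ_)
  open import Data.Integer as ℤ using (ℤ)
  import Data.Integer.Coprimality as ℤ
  import Data.Integer.Properties as ℤ
  open import Data.List using ([]; _∷_; filter)
  open import Data.List.Membership.Propositional.Properties using (∈-filter⁻)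
  open import Data.Nat as ℕ using (ℕ; zero; suc; z≤n; s≤s)
  open import Data.Nat.Coprimality using (coprime?)
  open import Data.Nat.Primality using (Prime; prime⇒nonZero)
  import Data.Nat.Properties as ℕ
  import Data.Nat.Solver as ℕSolver
  open import Data.Product using (∃; _×_; _,_; proj₁; proj₂)
  open import Data.Rational hiding (positive; floor; _≤?_)
  import Data.Rational.Properties as ℚ
  import Data.Rational.Solver as ℚSolver
  import Data.Rational.Unnormalised as ℚᵘ
  import Data.Rational.Unnormalised.Properties as ℚᵘ
  open import Relation.Binary.PropositionalEquality hiding (J)
  open import Relation.Nullary using (¬_; Dec; yes; no)
  open import Relation.Nullary.Negation using (contradiction)
  open Sequences hiding (bounded; mul-split; three-split; lower)
  open ℚSolver.+-*-Solver using (solve; _:+_; _:*_; _:-_; :-_; _:=_; con)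

  -- Transfer to `E` and to the real majorant

  /1-+ : ∀ i j → (i ℤ.+ j) / 1 ≡ i / 1 + j / 1
  /1-+ i j = ℚ.toℚᵘ-injective (ℚᵘ.≃-trans (ℚ.toℚᵘ-fromℚᵘ (ℚᵘ.mkℚᵘ (i ℤ.+ j) 0))
    (ℚᵘ.≃-trans (ℚᵘ.*≡* (cong (ℤ._* ℤ.+ 1) (cong₂ ℤ._+_ (sym (ℤ.*-identityʳ i)) (sym (ℤ.*-identityʳ j)))))
    (ℚᵘ.≃-sym (ℚᵘ.≃-trans (ℚ.toℚᵘ-homo-+ (i / 1) (j / 1)) (ℚᵘ.+-cong (ℚ.toℚᵘ-fromℚᵘ (ℚᵘ.mkℚᵘ i 0)) (ℚ.toℚᵘ-fromℚᵘ (ℚᵘ.mkℚᵘ j 0)))))))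

  /-rc : ∀ i n .{{_ : ℕ.NonZero n}} → i / n ≡ i / 1 * rc n
  /-rc i n@(suc k) = trans (ℚ.toℚᵘ-injective (ℚᵘ.≃-trans (ℚ.toℚᵘ-fromℚᵘ (ℚᵘ.mkℚᵘ i k))
    (ℚᵘ.≃-trans (ℚᵘ.*≡* (cong₂ ℤ._*_ (sym (ℤ.*-identityʳ i)) (cong (λ z → ℤ.+ suc z) (ℕ.+-identityʳ k))))
    (ℚᵘ.≃-sym (ℚᵘ.≃-trans (ℚ.toℚᵘ-homo-* (i / 1) (recip k)) (ℚᵘ.*-cong (ℚ.toℚᵘ-fromℚᵘ (ℚᵘ.mkℚᵘ i 0)) (ℚ.toℚᵘ-fromℚᵘ (ℚᵘ.mkℚᵘ (ℤ.+ 1) k)))))))) (cong (i / 1 *_) (sym (rc-suc k)))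

  sumOver-∑ : ∀ xs (f : ℕ → ℤ) → sumOver xs f / 1 ≡ ∑ xs (λ n → f n / 1)
  sumOver-∑ [] f = refl
  sumOver-∑ (x ∷ xs) f = trans (/1-+ (f x) (sumOver xs f)) (cong (f x / 1 +_) (sumOver-∑ xs f))

  inv-anti : ∀ {a b} → 0ℚ < a → a ≤ b → inv b ≤ inv a
  inv-anti {a} {b} 0<a a≤b = cancel b 0<b (subst (_≤ inv a * b) (trans (ℚ.*-comm (inv a) a) (trans (inv-inverse 0<a) (sym (trans (ℚ.*-comm (inv b) b) (inv-inverse 0<b)))))
    (*-monoˡ (ℚ.<⇒≤ (0<inv 0<a)) a≤b))
    where 0<b = ℚ.<-≤-trans 0<a a≤b

  inv-ι : ∀ {n} → 1 ℕ.≤ n → inv (ι n) ≡ rc n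
  inv-ι {n} 1≤n = rc-unique 1≤n (trans (ℚ.*-comm (inv (ι n)) (ι n)) (inv-inverse (0<ι 1≤n)))

  power-two : ∀ k → power 2ℚ k ≡ ι (pw k)
  power-two zero = trans (sym ι-1) (cong ι (sym (pw≡ 0)))
  power-two (suc k) = trans (cong₂ _*_ (power-two k) (trans (cong₂ _+_ (sym ι-1) (sym ι-1)) (trans (sym (ι-+ 1 1)) (cong ι (sym (pw≡ 1))))))
    (trans (sym (ι-* (pw k) (pw 1))) (cong ι (trans (sym (pw-+ k 1)) (cong pw (ℕ.+-comm k 1)))))

  -- `k₁` and `k₂` collect the constants lost in the two terms of the majorant: in `k₁` the ⅛ of the
  -- cube root, the bound `c` for (log log X)^(7/3) and the 2^4 of the denominator; in `k₂` the ½
  -- from X ≥ x/2, the square of log log X ≥ ζ and the 2^6 of the denominator.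
  k₁ : ℚ → ℚ
  k₁ c = ⅛ * c * rc (pw 4)

  k₂ : ℚ
  k₂ = ½ * (ζ * ζ) * rc (pw 6)

  first-lower : ∀ κ i {e₁ e₂ e₃ c} → 0ℚ ≤ c → ⅛ * power 2ℚ (4 ℕ.* κ) ≤ e₁ → c ≤ e₂ → 1ℚ ≤ e₃ → e₃ ≤ power 2ℚ (2 ℕ.* i ℕ.+ 4)
    → k₁ c * (ι (pw (4 ℕ.* κ)) * rc (pw (2 ℕ.* i))) ≤ e₁ * e₂ * inv e₃
  first-lower κ i {e₁} {e₂} {e₃} {c} 0≤c h₁ h₂ 1≤e₃ h₃ = begin
    ⅛ * c * rc (pw 4) * (T * rc (pw (2 ℕ.* i))) ≡⟨ solve 5 (λ e c f t r → e :* c :* f :* (t :* r) := e :* t :* c :* (r :* f)) refl ⅛ c (rc (pw 4)) T (rc (pw (2 ℕ.* i))) ⟩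
    ⅛ * T * c * (rc (pw (2 ℕ.* i)) * rc (pw 4)) ≡⟨ cong (⅛ * T * c *_) (trans (sym (rc-* (pw>0 (2 ℕ.* i)) (pw>0 4))) (trans (cong rc (sym (pw-+ (2 ℕ.* i) 4)))
          (trans (sym (inv-ι (pw>0 (2 ℕ.* i ℕ.+ 4)))) (cong inv (sym (power-two (2 ℕ.* i ℕ.+ 4))))))) ⟩
    ⅛ * T * c * inv (power 2ℚ (2 ℕ.* i ℕ.+ 4)) ≤⟨ *-mono (*-nonneg 0≤⅛T 0≤c) (*-mono 0≤⅛T (subst (λ z → ⅛ * z ≤ e₁) (power-two (4 ℕ.* κ)) h₁) 0≤c h₂)
          (ℚ.<⇒≤ (0<inv (ℚ.<-≤-trans 0<e₃ h₃))) (inv-anti 0<e₃ h₃) ⟩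
    e₁ * e₂ * inv e₃ ∎
    where
    open ℚ.≤-Reasoning
    T = ι (pw (4 ℕ.* κ))
    0<e₃ = ℚ.<-≤-trans 0<1 1≤e₃
    0≤⅛T : 0ℚ ≤ ⅛ * T
    0≤⅛T = *-nonneg (ℚ.nonNegative⁻¹ ⅛) (0≤ι (pw (4 ℕ.* κ)))

  second-lower : ∀ i q x {X LL e₄} → 1 ℕ.≤ q → ½ * ι x ≤ X → ζ ≤ LL → 1ℚ ≤ e₄ → e₄ ≤ power 2ℚ (3 ℕ.* i ℕ.+ 6)
    → k₂ * (ι x * rc (q ℕ.* pw (3 ℕ.* i))) ≤ X * (LL * LL) * inv (fromℕ q * e₄)
  second-lower i q x {X} {LL} {e₄} 1≤q hX hL 1≤e₄ h₄ = begin
    ½ * (ζ * ζ) * rc (pw 6) * (ι x * r) ≡⟨ solve 5 (λ a z f t r → a :* z :* f :* (t :* r) := a :* t :* z :* (r :* f)) refl ½ (ζ * ζ) (rc (pw 6)) (ι x) r ⟩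
    ½ * ι x * (ζ * ζ) * (r * rc (pw 6)) ≡⟨ cong (½ * ι x * (ζ * ζ) *_) eq ⟩
    ½ * ι x * (ζ * ζ) * inv (fromℕ q * power 2ℚ (3 ℕ.* i ℕ.+ 6)) ≤⟨ *-mono (*-nonneg 0≤½x (*-nonneg 0≤ζ 0≤ζ)) (*-mono 0≤½x hX (*-nonneg 0≤ζ 0≤ζ) (*-mono 0≤ζ hL 0≤ζ hL))
          (ℚ.<⇒≤ (0<inv (ℚ.<-≤-trans 0<qe le))) (inv-anti 0<qe le) ⟩
    X * (LL * LL) * inv (fromℕ q * e₄) ∎
    where
    open ℚ.≤-Reasoning
    r = rc (q ℕ.* pw (3 ℕ.* i))
    0≤ζ : 0ℚ ≤ ζ
    0≤ζ = ℚ.nonNegative⁻¹ ζ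
    0≤½x : 0ℚ ≤ ½ * ι x
    0≤½x = *-nonneg (ℚ.<⇒≤ 0<½) (0≤ι x)
    0<q : 0ℚ < fromℕ q
    0<q = subst (0ℚ <_) (ι≡fromℕ q) (0<ι 1≤q)
    0<qe : 0ℚ < fromℕ q * e₄
    0<qe = *-pos 0<q (ℚ.<-≤-trans 0<1 1≤e₄)
    le : fromℕ q * e₄ ≤ fromℕ q * power 2ℚ (3 ℕ.* i ℕ.+ 6)
    le = *-monoˡ (ℚ.<⇒≤ 0<q) h₄
    1≤qB : 1 ℕ.≤ q ℕ.* pw (3 ℕ.* i)
    1≤qB = ℕ.*-mono-≤ 1≤q (pw>0 (3 ℕ.* i))
    eq : r * rc (pw 6) ≡ inv (fromℕ q * power 2ℚ (3 ℕ.* i ℕ.+ 6))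
    eq = begin-equality
      r * rc (pw 6) ≡⟨ sym (rc-* 1≤qB (pw>0 6)) ⟩
      rc (q ℕ.* pw (3 ℕ.* i) ℕ.* pw 6) ≡⟨ cong rc (trans (ℕ.*-assoc q (pw (3 ℕ.* i)) (pw 6)) (cong (q ℕ.*_) (sym (pw-+ (3 ℕ.* i) 6)))) ⟩
      rc (q ℕ.* pw (3 ℕ.* i ℕ.+ 6)) ≡⟨ sym (inv-ι (ℕ.*-mono-≤ 1≤q (pw>0 (3 ℕ.* i ℕ.+ 6)))) ⟩
      inv (ι (q ℕ.* pw (3 ℕ.* i ℕ.+ 6))) ≡⟨ cong inv (trans (ι-* q (pw (3 ℕ.* i ℕ.+ 6))) (cong₂ _*_ (ι≡fromℕ q) (sym (power-two (3 ℕ.* i ℕ.+ 6))))) ⟩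
      inv (fromℕ q * power 2ℚ (3 ℕ.* i ℕ.+ 6)) ∎

  module _ (em : ExcludedMiddle 0ℓ) where
    open Indicator em

    ∑-filter : ∀ {A : Set} {P : A → Set} (P? : ∀ a → Dec (P a)) xs (f : A → ℚ) → ∑ (filter P? xs) f ≡ ∑ xs (λ a → 𝟙 (P a) * f a)
    ∑-filter P? [] f = refl
    ∑-filter {P = P} P? (x ∷ xs) f with P? x
    ... | yes p = cong₂ _+_ (sym (𝟙*-true em (f x) p)) (∑-filter P? xs f)
    ... | no ¬p = trans (∑-filter P? xs f) (sym (trans (cong (_+ ∑ xs (λ a → 𝟙 (P a) * f a)) (𝟙*-false em (f x) ¬p)) (ℚ.+-identityˡ _)))

    IsFloor : ℝ → ℕ → Set
    IsFloor X x = x ℕ.≤ ceilingBound em X × (∀ {n} → 1 ℕ.≤ n → fromℚ (fromℕ n) ≤ℝ X → n ℕ.≤ x) × (∀ {n} → n ℕ.≤ x → fromℚ (fromℕ n) ≤ℝ X)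

    floor : ∀ X → fromℚ (fromℕ 1) ≤ℝ X → ∃ (IsFloor X)
    floor X 1≤X = build (greatest {P = λ n → fromℚ (fromℕ n) ≤ℝ X} (λ n → em) {1} 1≤X (ceilingBound em X) (s≤s z≤n))
      where
      build : (∃ λ u → fromℚ (fromℕ u) ≤ℝ X × u ℕ.≤ ceilingBound em X × (∀ {w} → fromℚ (fromℕ w) ≤ℝ X → w ℕ.≤ ceilingBound em X → w ℕ.≤ u)) → ∃ (IsFloor X)
      build (x , x≤X , x≤B , max) = x , x≤B
        , (λ {n} 1≤n n≤X → max {n} n≤X (proj₂ (∈-range⁻ (proj₁ (∈-filter⁻ (λ n → _≤?_ em (fromℚ (fromℕ n)) X) {xs = range (ceilingBound em X)} (∈-positives≤⁺ em {X} {n} 1≤n n≤X))))))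
        , λ {n} n≤x ε 0<ε → let N , h = x≤X ε 0<ε in N , λ m N≤m → ℚ.≤-trans (fromℕ-mono {n} {x} n≤x) (h m N≤m)

    positives-sum : ∀ {X x} → IsFloor X x → ∀ {P : ℕ → Set} (P? : ∀ n → Dec (P n))
      → sumOver (filter P? (positives≤ em X)) μ² / 1 ≡ ∑ (range x) (λ n → 𝟙 (P n) * 𝟙 (SF n))
    positives-sum {X} {x} (x≤B , to , from) {P} P? = begin
      sumOver (filter P? (positives≤ em X)) μ² / 1 ≡⟨ sumOver-∑ (filter P? (positives≤ em X)) μ² ⟩
      ∑ (filter P? (positives≤ em X)) (λ n → μ² n / 1) ≡⟨ ∑-filter P? (positives≤ em X) _ ⟩
      ∑ (positives≤ em X) (λ n → 𝟙 (P n) * (μ² n / 1)) ≡⟨ ∑-filter (λ n → _≤?_ em (fromℚ (fromℕ n)) X) (range (ceilingBound em X)) _ ⟩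
      ∑ (range (ceilingBound em X)) (λ n → 𝟙 (fromℚ (fromℕ n) ≤ℝ X) * (𝟙 (P n) * (μ² n / 1))) ≡⟨ ∑-cutoff em {P = λ n → fromℚ (fromℕ n) ≤ℝ X} (λ n → 𝟙 (P n) * (μ² n / 1)) x≤B to (λ {n} _ → from {n}) ⟩
      ∑ (range x) (λ n → 𝟙 (P n) * (μ² n / 1)) ≡⟨ ∑-cong (range x) (λ {n} n∈ → cong (𝟙 (P n) *_) (μ²-indicator em (proj₁ (∈-range⁻ n∈)))) ⟩
      ∑ (range x) (λ n → 𝟙 (P n) * 𝟙 (SF n)) ∎
      where open ≡-Reasoning

    -- If `y ≤ X` fails, then some `ε` has `seq X n + ε < y` for arbitrarily large n. One such index
    -- beyond the Cauchy threshold for this `ε` controls all later terms.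
    reals-total : ∀ X y → ¬ fromℚ y ≤ℝ X → ∃ λ N → ∀ n → N ℕ.≤ n → seq X n ≤ y
    reals-total X y ¬y≤X with em {∃ λ ε → 0ℚ < ε × (∀ N → ∃ λ n → N ℕ.≤ n × seq X n + ε < y)}
    ... | yes (ε , 0<ε , frequently) = let N , close = cauchy X ε 0<ε ; n , N≤n , lt = frequently N
          in N , λ m N≤m → ℚ.≤-trans (subst (_≤ seq X n + ε) (solve 2 (λ a b → b :+ (a :- b) := a) refl (seq X m) (seq X n))
               (ℚ.+-monoʳ-≤ (seq X n) (ℚ.≤-trans (p≤∣p∣ (seq X m - seq X n)) (close m n N≤m N≤n)))) (ℚ.<⇒≤ lt)
    ... | no ¬frequently = contradiction y≤X ¬y≤X
      where
      y≤X : fromℚ y ≤ℝ X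
      y≤X ε 0<ε with em {∃ λ N → ∀ n → N ℕ.≤ n → y ≤ seq X n + ε}
      ... | yes h = h
      ... | no ¬h = contradiction (ε , 0<ε , often) ¬frequently
        where
        often : ∀ N → ∃ λ n → N ℕ.≤ n × seq X n + ε < y
        often N with em {∃ λ n → N ℕ.≤ n × seq X n + ε < y}
        ... | yes h = h
        ... | no ¬h′ = contradiction (N , λ n N≤n → ℚ.≮⇒≥ (λ lt → ¬h′ (n , N≤n , lt))) ¬h

  rc-pos : ∀ {n} → 1 ℕ.≤ n → 0ℚ < rc n
  rc-pos {n} 1≤n = ℚ.*-cancelʳ-<-nonNeg (ι n) {{nonNegative (0≤ι n)}} (subst₂ _<_ (sym (ℚ.*-zeroˡ (ι n))) (sym (rc-inverse 1≤n)) 0<1)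

  n≤pw : ∀ n → n ℕ.≤ pw n
  n≤pw zero = z≤n
  n≤pw (suc n) = ℕ.≤-trans (ℕ.+-mono-≤ (pw>0 n) (n≤pw n)) (ℕ.≤-reflexive (trans (cong (pw n ℕ.+_) (sym (ℕ.+-identityʳ (pw n))))
    (trans (cong (ℕ._* pw n) (sym (pw≡ 1))) (sym (pw-+ 1 n)))))

  binary-log : ∀ c n → 1 ℕ.≤ c → 1 ℕ.≤ n → ∃ λ k → pw (c ℕ.* k) ℕ.≤ n × n ℕ.< pw (c ℕ.* suc k)
  binary-log c n 1≤c 1≤n = build (greatest (λ k → pw (c ℕ.* k) ℕ.≤? n) {0} (ℕ.≤-trans (ℕ.≤-reflexive (trans (cong pw (ℕ.*-zeroʳ c)) (pw≡ 0))) 1≤n) n z≤n)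
    where
    build : (∃ λ u → pw (c ℕ.* u) ℕ.≤ n × u ℕ.≤ n × (∀ {w} → pw (c ℕ.* w) ℕ.≤ n → w ℕ.≤ n → w ℕ.≤ u)) → ∃ λ k → pw (c ℕ.* k) ℕ.≤ n × n ℕ.< pw (c ℕ.* suc k)
    build (k , le , _ , max) = k , le , ℕ.≰⇒> λ h → ℕ.<⇒≱ (ℕ.n<1+n k) (max h (ℕ.≤-trans (ℕ.m≤n*m (suc k) c {{ℕ.>-nonZero 1≤c}}) (ℕ.≤-trans (n≤pw (c ℕ.* suc k)) h)))

  weigh : ∀ {k₁ k₂ t₁ t₂ f g} → 0ℚ < k₁ → 0ℚ < k₂ → 0ℚ ≤ f → 0ℚ ≤ g → k₁ * t₁ ≤ f → k₂ * t₂ ≤ g → t₁ + t₂ ≤ (inv k₁ + inv k₂) * (f + g)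
  weigh {k₁} {k₂} {t₁} {t₂} {f} {g} 0<k₁ 0<k₂ 0≤f 0≤g h₁ h₂ = begin
    t₁ + t₂ ≤⟨ ℚ.+-mono-≤ (one 0<k₁ h₁) (one 0<k₂ h₂) ⟩
    inv k₁ * f + inv k₂ * g ≤⟨ ≤-+ʳ (+-nonneg (*-nonneg (ℚ.<⇒≤ (0<inv 0<k₁)) 0≤g) (*-nonneg (ℚ.<⇒≤ (0<inv 0<k₂)) 0≤f)) ⟩
    inv k₁ * f + inv k₂ * g + (inv k₁ * g + inv k₂ * f) ≡⟨ solve 4 (λ a b f g → a :* f :+ b :* g :+ (a :* g :+ b :* f) := (a :+ b) :* (f :+ g)) refl (inv k₁) (inv k₂) f g ⟩
    (inv k₁ + inv k₂) * (f + g) ∎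
    where
    open ℚ.≤-Reasoning
    one : ∀ {k t f} → 0ℚ < k → k * t ≤ f → t ≤ inv k * f
    one {k} {t} {f} 0<k h = subst (_≤ inv k * f) (trans (solve 3 (λ i k t → i :* (k :* t) := (k :* i) :* t) refl (inv k) k t) (trans (cong (_* t) (inv-inverse 0<k)) (ℚ.*-identityˡ t))) (*-monoˡ (ℚ.<⇒≤ (0<inv 0<k)) h)

  -- Everything happens at one index `n`: `X` and `g` are the n-th approximations of the reals X and
  -- γ.
  module Pointwise (n κ i : ℕ) (1≤n : 1 ℕ.≤ n) {X g : ℚ} (0≤g : 0ℚ ≤ g) (g≤½ : g ≤ ½) (1≤X : 1ℚ ≤ X)
    (X≤ : X ≤ power 2ℚ (12 ℕ.* suc κ)) (κ< : suc κ ℕ.< pw (6 ℕ.* suc i)) (L≥ : 1ℚ + ℤ.+ 1 / 12 ≤ logSum n X) where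

    L LL : ℚ
    L = logSum n X
    LL = logSum n L

    1≤L : 1ℚ ≤ L
    1≤L = ℚ.≤-trans (≤-+ʳ {1ℚ} {ℤ.+ 1 / 12} (ℚ.nonNegative⁻¹ (ℤ.+ 1 / 12))) L≥

    L≤ : L ≤ power 2ℚ (6 ℕ.* i ℕ.+ 12)
    -- The 12 is rounded up to 2^6 so that the exponent remains a multiple of 6; a sixth of it is
    -- then an integer and a quarter of it a half-integer, as `exponent-bound` requires.
    L≤ = ℚ.≤-trans (logSum-upper n (12 ℕ.* suc κ) 1≤X X≤) (subst₂ _≤_ (ι≡fromℕ (12 ℕ.* suc κ)) (sym (power-two (6 ℕ.* i ℕ.+ 12))) (ι-mono (begin
      12 ℕ.* suc κ ≤⟨ ℕ.*-mono-≤ (ℕ.≤-trans (ℕ.≤ᵇ⇒≤ 12 64 _) (ℕ.≤-reflexive (sym (pw≡ 6)))) (ℕ.<⇒≤ κ<) ⟩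
      pw 6 ℕ.* pw (6 ℕ.* suc i) ≡⟨ pw-* (S.solve 1 (λ i → S.con 6 S.:+ S.con 6 S.:* (S.con 1 S.:+ i) S.:= S.con 6 S.:* i S.:+ S.con 12) refl i) ⟩
      pw (6 ℕ.* i ℕ.+ 12) ∎)))
      where
      open ℕ.≤-Reasoning
      module S = ℕSolver.+-*-Solver

    ζ≤LL : ζ ≤ LL
    ζ≤LL = logSum-at-13/12 n 1≤n L≥

    0≤LL : 0ℚ ≤ LL
    0≤LL = ℚ.≤-trans (ℚ.nonNegative⁻¹ ζ) ζ≤LL

    LL≤ : LL ≤ fromℕ (6 ℕ.* i ℕ.+ 12)
    LL≤ = logSum-upper n (6 ℕ.* i ℕ.+ 12) 1≤L L≤

    -- As LL ≤ 6i + 12 and exp(m/2) ≤ 2^m, an exponent `c` of log X costs a power of 2 with exponent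
    -- 2c(6i + 12): the value 1/6 gives `4^i` and 1/4 gives `8^i`, up to constants.
    exponent-bound : ∀ {w c} m → 0ℚ ≤ w → w ≤ c → c * fromℕ (6 ℕ.* i ℕ.+ 12) ≡ fromℕ m * ½ → 1ℚ ≤ expSum n (w * LL) × expSum n (w * LL) ≤ power 2ℚ m
    exponent-bound {w} {c} m 0≤w w≤c e = 1≤exp (*-nonneg 0≤w 0≤LL) n 1≤n
      , ℚ.≤-trans (expSum-mono n (*-nonneg 0≤w 0≤LL) (subst (w * LL ≤_) e (*-mono 0≤w w≤c 0≤LL LL≤))) (expSum-half-integer n m)

    scaled : ∀ c a b → c * fromℕ 6 ≡ fromℕ a * ½ → c * fromℕ 12 ≡ fromℕ b * ½ → c * fromℕ (6 ℕ.* i ℕ.+ 12) ≡ fromℕ (a ℕ.* i ℕ.+ b) * ½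
    scaled c a b ea eb = begin
      c * fromℕ (6 ℕ.* i ℕ.+ 12) ≡⟨ cong (c *_) (trans (fromℕ-+ (6 ℕ.* i) 12) (cong (_+ fromℕ 12) (fromℕ-* 6 i))) ⟩
      c * (fromℕ 6 * fromℕ i + fromℕ 12) ≡⟨ solve 4 (λ c s i t → c :* (s :* i :+ t) := c :* s :* i :+ c :* t) refl c (fromℕ 6) (fromℕ i) (fromℕ 12) ⟩
      c * fromℕ 6 * fromℕ i + c * fromℕ 12 ≡⟨ cong₂ (λ u v → u * fromℕ i + v) ea eb ⟩
      fromℕ a * ½ * fromℕ i + fromℕ b * ½ ≡⟨ solve 4 (λ a h i b → a :* h :* i :+ b :* h := (a :* i :+ b) :* h) refl (fromℕ a) ½ (fromℕ i) (fromℕ b) ⟩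
      (fromℕ a * fromℕ i + fromℕ b) * ½ ≡⟨ cong (_* ½) (sym (trans (fromℕ-+ (a ℕ.* i) b) (cong (_+ fromℕ b) (fromℕ-* a i)))) ⟩
      fromℕ (a ℕ.* i ℕ.+ b) * ½ ∎
      where open ≡-Reasoning

    first-denominator : 1ℚ ≤ expSum n ((⅙ - ⅓ * g) * LL) × expSum n ((⅙ - ⅓ * g) * LL) ≤ power 2ℚ (2 ℕ.* i ℕ.+ 4)
    first-denominator = exponent-bound {⅙ - ⅓ * g} {⅙} (2 ℕ.* i ℕ.+ 4)
      (0≤diff (ℚ.≤-trans (*-monoˡ (ℚ.nonNegative⁻¹ ⅓) g≤½) (ℚ.≤-reflexive refl)))
      (ℚ.≤-trans (ℚ.+-monoʳ-≤ ⅙ (ℚ.neg-antimono-≤ (*-nonneg (ℚ.nonNegative⁻¹ ⅓) 0≤g))) (ℚ.≤-reflexive (ℚ.+-identityʳ ⅙)))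
      (scaled ⅙ 2 4 refl refl)

    second-denominator : 1ℚ ≤ expSum n (½ * g * LL) × expSum n (½ * g * LL) ≤ power 2ℚ (3 ℕ.* i ℕ.+ 6)
    second-denominator = exponent-bound {½ * g} {½ * ½} (3 ℕ.* i ℕ.+ 6) (*-nonneg (ℚ.<⇒≤ 0<½) 0≤g) (*-monoˡ (ℚ.<⇒≤ 0<½) g≤½) (scaled (½ * ½) 3 6 refl refl)

    -- 7/3 of `W` is 14.49, which is rounded up to the integer 15.
    U≤ : - fromℕ 15 ≤ (ℤ.+ 7 / 3) * logSum n LL
    U≤ = ℚ.≤-trans (diff⁻ (ℚ.nonNegative⁻¹ ((ℤ.+ 7 / 3) * - W - - fromℕ 15))) (*-monoˡ (ℚ.nonNegative⁻¹ (ℤ.+ 7 / 3)) (logSum-bounded-below n ζ≤LL))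

  module Assembly (em : ExcludedMiddle 0ℓ) (γ : ℝ) (γ>0 : fromℚ 0ℚ <ℝ γ) (γ<½ : γ <ℝ fromℚ ½)
    (c₂ : ℚ) (0<c₂ : 0ℚ < c₂) (N₂ : ℕ) (below : ∀ n → N₂ ℕ.≤ n → ∀ y → - fromℕ 15 ≤ y → c₂ ≤ expSum n y) where

    open Indicator em

    const : ℚ
    const = ι (pw 21) * (inv (k₁ c₂) + inv k₂)

    0<k₁ : 0ℚ < k₁ c₂
    0<k₁ = *-pos (*-pos (ℚ.positive⁻¹ ⅛) 0<c₂) (rc-pos (pw>0 4))

    0<k₂ : 0ℚ < k₂
    0<k₂ = *-pos (ℚ.positive⁻¹ (½ * (ζ * ζ))) (rc-pos (pw>0 6))

    module _ (X : ℝ) (X>3 : fromℚ 3ℚ <ℝ X) (q : ℕ) (pq : Prime q) (a : ℤ) (a⊥q : ℤ.Coprime a (ℤ.+ q)) where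

      open Majorant γ X γ>0 γ<½ X>3 using (majorant; logX>1)

      instance
        q≢0 : ℕ.NonZero q
        q≢0 = prime⇒nonZero pq

      1≤q : 1 ℕ.≤ q
      1≤q = ℕ.>-nonZero⁻¹ q

      X≥3 : ∀ n → proj₁ (proj₂ (proj₂ X>3)) ℕ.≤ n → 3ℚ ≤ seq X n
      X≥3 n le = ℚ.≤-trans (≤-+ʳ (ℚ.<⇒≤ (proj₁ (proj₂ X>3)))) (proj₂ (proj₂ (proj₂ X>3)) n le)

      1≤3 : 1ℚ ≤ 3ℚ
      1≤3 = fromℕ-mono {1} {3} (s≤s z≤n)

      1≤X : fromℚ (fromℕ 1) ≤ℝ X
      1≤X ε 0<ε = proj₁ (proj₂ (proj₂ X>3)) , λ n le → ℚ.≤-trans 1≤3 (ℚ.≤-trans (X≥3 n le) (≤-+ʳ (ℚ.<⇒≤ 0<ε)))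

      module _ (x : ℕ) (isFloor : IsFloor em X x) where

        open Discrepancy em q pq a a⊥q x using (E₀; rφ)
        open Residues q pq a a⊥q using (cong⇒mod; mod⇒cong)

        E≡E₀ : E em X q a ≡ E₀
        E≡E₀ = cong₂ _-_
          (trans (positives-sum em {X} {x} isFloor (≡mod? a q)) (∑-cong (range x) (λ {n} _ → cong (_* 𝟙 (SF n)) (𝟙-cong (mod⇒cong {n}) (cong⇒mod {n})))))
          (trans (/-rc (sumOver (filter (λ n → coprime? n q) (positives≤ em X)) μ²) (φ q) {{φ-nonZero q}})
            (cong (_* rφ) (positives-sum em {X} {x} isFloor (λ n → coprime? n q))))

        module _ (κ i : ℕ) (κ≤ : pw (12 ℕ.* κ) ℕ.≤ x) (κ< : x ℕ.< pw (12 ℕ.* suc κ)) (i≤ : pw (6 ℕ.* i) ℕ.≤ suc κ) (i< : suc κ ℕ.< pw (6 ℕ.* suc i)) where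

          t₁ t₂ : ℚ
          t₁ = ι (pw (4 ℕ.* κ)) * rc (pw (2 ℕ.* i))
          t₂ = ι x * rc (q ℕ.* pw (3 ℕ.* i))

          arithmetic : ∣ E em X q a ∣ ≤ ι (pw 21) * (t₁ + t₂)
          arithmetic = subst (λ z → ∣ z ∣ ≤ ι (pw 21) * (t₁ + t₂)) (sym E≡E₀)
            (Core.core em q pq a a⊥q x κ i κ≤ (subst (λ z → x ℕ.< pw z) (trans (ℕ.*-suc 12 κ) (ℕ.+-comm 12 (12 ℕ.* κ))) κ<) i≤)

          analytic : (∃ λ ε → 0ℚ < ε × ∃ λ n₀ → ∀ n → n₀ ℕ.≤ n → ∀ x → 1ℚ ≤ x → power 2ℚ (12 ℕ.* κ) ≤ x + ε → ⅛ * power 2ℚ (4 ℕ.* κ) ≤ expSum n (⅓ * logSum n x))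
            → (∃ λ N → ∀ n → N ℕ.≤ n → seq X n ≤ fromℕ (suc x))
            → ∃ λ N → ∀ n → N ℕ.≤ n → t₁ + t₂ ≤ (inv (k₁ c₂) + inv k₂) * seq (majorant q) n
          analytic (ε , 0<ε , n₀ , cube) (M , X<) = N , λ n N≤n → step n (split n N≤n)
            where
            from = proj₂ (proj₂ isFloor) {x} ℕ.≤-refl
            N₃ = proj₁ (proj₂ (proj₂ X>3))
            Nε = proj₁ (from ε 0<ε)
            N₁ = proj₁ (from 1ℚ 0<1)
            G₀ = proj₁ (proj₂ (proj₂ γ>0))
            G₁ = proj₁ (proj₂ (proj₂ γ<½))
            -- `N₃ + 2` is the threshold inside `logX>1`: from there on two terms of the artanh
            -- series at ½ are present, and 2(½ + 1/24) = 13/12 bounds log X from below.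
            N = N₃ ℕ.+ 2 ℕ.+ (Nε ℕ.+ (N₁ ℕ.+ (G₀ ℕ.+ (G₁ ℕ.+ (n₀ ℕ.+ (M ℕ.+ N₂))))))
            Facts : ℕ → Set
            Facts n = N₃ ℕ.+ 2 ℕ.≤ n × Nε ℕ.≤ n × N₁ ℕ.≤ n × G₀ ℕ.≤ n × G₁ ℕ.≤ n × n₀ ℕ.≤ n × M ℕ.≤ n × N₂ ℕ.≤ n
            split : ∀ n → N ℕ.≤ n → Facts n
            split n h₀ = ℕ.m+n≤o⇒m≤o (N₃ ℕ.+ 2) h₀ , ℕ.m+n≤o⇒m≤o Nε h₁ , ℕ.m+n≤o⇒m≤o N₁ h₂ , ℕ.m+n≤o⇒m≤o G₀ h₃ , ℕ.m+n≤o⇒m≤o G₁ h₄ , ℕ.m+n≤o⇒m≤o n₀ h₅ , ℕ.m+n≤o⇒m≤o M h₆ , ℕ.m+n≤o⇒n≤o M h₆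
              where
              h₁ = ℕ.m+n≤o⇒n≤o (N₃ ℕ.+ 2) h₀
              h₂ = ℕ.m+n≤o⇒n≤o Nε h₁
              h₃ = ℕ.m+n≤o⇒n≤o N₁ h₂
              h₄ = ℕ.m+n≤o⇒n≤o G₀ h₃
              h₅ = ℕ.m+n≤o⇒n≤o G₁ h₄
              h₆ = ℕ.m+n≤o⇒n≤o n₀ h₅
            step : ∀ n → Facts n → t₁ + t₂ ≤ (inv (k₁ c₂) + inv k₂) * seq (majorant q) n
            step n (a₃ , aε , a₁ , b₀ , b₁ , a₀ , aM , a₂) = weigh 0<k₁ 0<k₂ (ℚ.≤-trans (*-nonneg (ℚ.<⇒≤ 0<k₁) 0≤t₁) first) (ℚ.≤-trans (*-nonneg (ℚ.<⇒≤ 0<k₂) 0≤t₂) second) first second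
              where
              Xn = seq X n
              g = seq γ n
              3≤Xn : 3ℚ ≤ Xn
              3≤Xn = X≥3 n (ℕ.m+n≤o⇒m≤o N₃ a₃)
              1≤n : 1 ℕ.≤ n
              1≤n = ℕ.≤-trans (s≤s z≤n) (ℕ.m+n≤o⇒n≤o N₃ a₃)
              1≤Xn : 1ℚ ≤ Xn
              1≤Xn = ℚ.≤-trans 1≤3 3≤Xn
              0≤g : 0ℚ ≤ g
              0≤g = ℚ.≤-trans (≤-+ʳ {0ℚ} (ℚ.<⇒≤ (proj₁ (proj₂ γ>0)))) (proj₂ (proj₂ (proj₂ γ>0)) n b₀)
              g≤½ : g ≤ ½
              g≤½ = ℚ.≤-trans (≤-+ʳ (ℚ.<⇒≤ (proj₁ (proj₂ γ<½)))) (proj₂ (proj₂ (proj₂ γ<½)) n b₁)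
              Xn≤ : Xn ≤ power 2ℚ (12 ℕ.* suc κ)
              Xn≤ = ℚ.≤-trans (X< n aM) (subst₂ _≤_ (ι≡fromℕ (suc x)) (sym (power-two (12 ℕ.* suc κ))) (ι-mono κ<))
              module P = Pointwise n κ i 1≤n 0≤g g≤½ 1≤Xn Xn≤ i< (proj₂ (proj₂ (proj₂ logX>1)) n a₃)
              0≤t₁ : 0ℚ ≤ t₁
              0≤t₁ = *-nonneg (0≤ι (pw (4 ℕ.* κ))) (0≤rc (pw (2 ℕ.* i)))
              0≤t₂ : 0ℚ ≤ t₂
              0≤t₂ = *-nonneg (0≤ι x) (0≤rc (q ℕ.* pw (3 ℕ.* i)))
              big : power 2ℚ (12 ℕ.* κ) ≤ Xn + ε
              big = ℚ.≤-trans (subst₂ _≤_ (sym (power-two (12 ℕ.* κ))) (ι≡fromℕ x) (ι-mono κ≤)) (proj₂ (from ε 0<ε) n aε)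
              -- At index n the floor satisfies only `x ≤ Xn + 1`, where the slack 1 is at most
              -- `Xn`; hence the factor ½.
              halfX : ½ * ι x ≤ Xn
              halfX = ℚ.≤-trans (*-monoˡ (ℚ.<⇒≤ 0<½) (ℚ.≤-trans (ℚ.≤-reflexive (ι≡fromℕ x)) (ℚ.≤-trans (proj₂ (from 1ℚ 0<1) n a₁) (ℚ.+-monoʳ-≤ Xn 1≤Xn))))
                (ℚ.≤-reflexive (solve 1 (λ z → con ½ :* (z :+ z) := z) refl Xn))
              first : k₁ c₂ * t₁ ≤ expSum n (⅓ * logSum n Xn) * expSum n ((ℤ.+ 7 / 3) * logSum n P.LL) * inv (expSum n ((⅙ - ⅓ * g) * P.LL))
              first = first-lower κ i (ℚ.<⇒≤ 0<c₂) (cube n a₀ Xn 1≤Xn big) (below n a₂ _ P.U≤) (proj₁ P.first-denominator) (proj₂ P.first-denominator)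
              second : k₂ * t₂ ≤ Xn * (P.LL * P.LL) * inv (fromℕ q * expSum n (½ * g * P.LL))
              second = second-lower i q x 1≤q halfX P.ζ≤LL (proj₁ P.second-denominator) (proj₂ P.second-denominator)

          conclude : (∃ λ N → ∀ n → N ℕ.≤ n → t₁ + t₂ ≤ (inv (k₁ c₂) + inv k₂) * seq (majorant q) n) → fromℚ ∣ E em X q a ∣ ≤ℝ fromℚ const *ℝ majorant q
          conclude (N , h) ε 0<ε = N , λ n N≤n → begin
            ∣ E em X q a ∣ ≤⟨ arithmetic ⟩
            ι (pw 21) * (t₁ + t₂) ≤⟨ *-monoˡ (0≤ι (pw 21)) (h n N≤n) ⟩
            ι (pw 21) * ((inv (k₁ c₂) + inv k₂) * seq (majorant q) n) ≡⟨ sym (ℚ.*-assoc (ι (pw 21)) (inv (k₁ c₂) + inv k₂) (seq (majorant q) n)) ⟩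
            const * seq (majorant q) n ≤⟨ ≤-+ʳ (ℚ.<⇒≤ 0<ε) ⟩
            const * seq (majorant q) n + ε ∎
            where open ℚ.≤-Reasoning

      bound : fromℚ ∣ E em X q a ∣ ≤ℝ fromℚ const *ℝ majorant q
      bound = with-floor (floor em X 1≤X)
        where
        with-floor : ∃ (IsFloor em X) → fromℚ ∣ E em X q a ∣ ≤ℝ fromℚ const *ℝ majorant q
        with-floor (x , isFloor) = with-κ (binary-log 12 x (s≤s z≤n) (proj₁ (proj₂ isFloor) (s≤s z≤n) 1≤X))
          where
          not-suc : ¬ fromℚ (fromℕ (suc x)) ≤ℝ X
          not-suc h = ℕ.<⇒≱ (ℕ.n<1+n x) (proj₁ (proj₂ isFloor) (s≤s z≤n) h)
          with-κ : (∃ λ κ → pw (12 ℕ.* κ) ℕ.≤ x × x ℕ.< pw (12 ℕ.* suc κ)) → fromℚ ∣ E em X q a ∣ ≤ℝ fromℚ const *ℝ majorant q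
          with-κ (κ , κ≤ , κ<) = with-i (binary-log 6 (suc κ) (s≤s z≤n) (s≤s z≤n))
            where
            with-i : (∃ λ i → pw (6 ℕ.* i) ℕ.≤ suc κ × suc κ ℕ.< pw (6 ℕ.* suc i)) → fromℚ ∣ E em X q a ∣ ≤ℝ fromℚ const *ℝ majorant q
            with-i (i , i≤ , i<) = conclude x isFloor κ i κ≤ κ< i≤ i<
              (analytic x isFloor κ i κ≤ κ< i≤ i< (cube-root-lower κ) (reals-total em X (fromℕ (suc x)) not-suc))

  main : (em : ExcludedMiddle 0ℓ) (γ : ℝ) (γ>0 : fromℚ 0ℚ <ℝ γ) (γ<½ : γ <ℝ fromℚ ½)
    → ∃ λ (C : ℝ) → (X : ℝ) (X>3 : fromℚ 3ℚ <ℝ X) (q : ℕ) (pq : Prime q) (a : ℤ) → ℤ.Coprime a (ℤ.+ q)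
      → fromℚ ∣ E em X q {{prime⇒nonZero pq}} a ∣ ≤ℝ C *ℝ Majorant.majorant γ X γ>0 γ<½ X>3 q {{prime⇒nonZero pq}}
  -- The argument 14 is the predecessor of the bound 15 in `U≤`. The resulting constant is fixed
  -- before X, q and a.
  main em γ γ>0 γ<½ = assemble (expSum-bounded-below 14)
    where
    assemble : (∃ λ c → 0ℚ < c × ∃ λ N → ∀ n → N ℕ.≤ n → ∀ y → - fromℕ 15 ≤ y → c ≤ expSum n y) → _
    assemble (c₂ , 0<c₂ , N₂ , below) = fromℚ (Assembly.const em γ γ>0 γ<½ c₂ 0<c₂ N₂ below) , Assembly.bound em γ γ>0 γ<½ c₂ 0<c₂ N₂ below

open import Defs
open import Data.Integer using (ℤ; +_)
open import Data.Integer.Coprimality using (Coprime)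
open import Data.Nat using (ℕ)
open import Data.Nat.Primality using (Prime; prime⇒nonZero)
open import Data.Product using (∃)
open import Data.Rational using (0ℚ; ½; ∣_∣)

theorem4 : (em : ExcludedMiddle 0ℓ) →
    (γ : ℝ) (γ>0 : fromℚ 0ℚ < γ) (γ<½ : γ < fromℚ ½) →
    ∃ λ (C : ℝ) →
    (X : ℝ) (X>3 : fromℚ 3ℚ < X) (q : ℕ) (q-prime : Prime q) (a : ℤ) →
    Coprime a (+ q) →
    fromℚ ∣ E em X q {{prime⇒nonZero q-prime}} a ∣
    ≤ C * Majorant.majorant γ X γ>0 γ<½ X>3 q {{prime⇒nonZero q-prime}}
theorem4 = Conclusion.main
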